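{- For each of the problems Strongly Connected Spanning Subgraph (SCSpS), Minimum Equivalent Graph (MEG), and $2$-Edge Connected Spanning Subgraph ($2$-ECSS), there is a Monte Carlo algorithm that, given an instance of the problem together with a tree decomposition of width $\mathrm{tw}$ of the underlying undirected graph of the input graph (the input graph itself in the case of $2$-ECSS), solves the instance in $O^*(17^{\mathrm{tw}})$ time.
   Context: SCSpS: the input is a directed graph $D=(V,A)$ and an integer $t$; the question is whether there is a set $X\subseteq A$ with $|X|\le t$ such that $(V,X)$ is strongly connected. MEG: the input is a directed graph $D=(V,E)$ and an integer $t$; the question is whether there is a set $X\subseteq E$ with $|X|\le t$ such that for all $u,v\in V$, if there is a directed path from $u$ to $v$ in $D$, then there is a directed path from $u$ to $v$ in $(V,X)$. $2$-ECSS: the input is an undirected graph $G=(V,E)$ and an integer $t$; the question is whether there is a set $X\subseteq E$ with $|X|\le t$ such that $(V,X)$ is $2$-edge connected (connected, and still connected after the deletion of any single edge). The underlying undirected graph of a directed graph is obtained by omitting the directions of the arcs. A tree decomposition of a graph is a tree in which each node $x$ is assigned a bag $\beta(x)$ of vertices, such that the bags cover all vertices, both endpoints of every edge lie together in some bag, and for every vertex the nodes whose bags contain it form a subtree; its width is the maximum bag size minus one. The notation $O^*(\cdot)$ hides factors polynomial in the input size. A Monte Carlo algorithm is a randomized algorithm with a deterministic running time bound which, on each input, outputs the correct answer with probability at least a fixed constant greater than $1/2$ (e.g. $2/3$). -}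

module Defs where

open import Data.Bool.Base using (Bool; true; false; T; not; _∧_; _∨_; if_then_else_)
open import Data.Bool.Properties using (T?; ∨-comm; ∧-zeroʳ)
open import Data.Fin.Base using (Fin; zero; suc; inject₁; fromℕ) renaming (_<_ to _<ᶠ_)
open import Data.Fin.Properties using (_≟_) renaming (_<?_ to _<ᶠ?_)
open import Data.Fin.Subset using (Subset; _∈_; ∣_∣)
open import Data.Integer.Base as ℤ using (ℤ; +_; -[1+_])
open import Data.List.Base using (List; []; _∷_; length; filter; allFin; cartesianProduct)
open import Data.Nat.Base as ℕ using (ℕ; zero; suc; _+_; _*_; _^_; _∸_; _⊔_)
open import Data.Nat.Properties using (m^n≢0)
open import Data.Nat.Binary.Base using (ℕᵇ; 2[1+_]; 1+[2_]) renaming (zero to 0ᵇ; fromℕ to toBinary)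
open import Data.Product.Base using (Σ; ∃; ∃-syntax; _×_; _,_; uncurry)
open import Data.Rational.Base as ℚ using (ℚ; ½; _/_)
open import Data.Sum.Base using (_⊎_)
open import Data.Vec.Base as Vec using (Vec; []; _∷_; lookup; replicate; _[_]≔_)
open import Data.Vec.Functional using (foldr)
open import Function.Base using (_∘_)
open import Function.Definitions using (Injective)
open import Level using (0ℓ)
open import Relation.Binary.Core using (Rel)
open import Relation.Binary.Construct.Closure.ReflexiveTransitive using (Star)
open import Relation.Binary.PropositionalEquality.Core using (_≡_; refl; cong; cong₂; trans)
open import Relation.Nullary.Decidable using (⌊_⌋; yes; no; _×-dec_)
open import Relation.Nullary.Negation using (¬_; contradiction)

------------------------------------------------------------------------
-- Graphs on the vertex set Fin n

Digraph : ℕ → Set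
Digraph n = Fin n → Fin n → Bool

Arc : ∀ {n} → Digraph n → Rel (Fin n) 0ℓ
Arc D u v = T (D u v)

arcs : ∀ {n} → Digraph n → List (Fin n × Fin n)
arcs {n} D = filter (T? ∘ uncurry D) (cartesianProduct (allFin n) (allFin n))

record Graph (n : ℕ) : Set where
  field
    adj       : Fin n → Fin n → Bool
    symmetric : ∀ u v → adj u v ≡ adj v u
    loopless  : ∀ v → adj v v ≡ false

open Graph public

Adj : ∀ {n} → Graph n → Rel (Fin n) 0ℓ
Adj G u v = T (adj G u v)

-- Every edge {u , v} is listed once, as the pair with u < v.
edges : ∀ {n} → Graph n → List (Fin n × Fin n)
edges {n} G =
  filter (λ (u , v) → (u <ᶠ? v) ×-dec T? (adj G u v))
         (cartesianProduct (allFin n) (allFin n))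

distinct : ∀ {n} → Fin n → Fin n → Bool
distinct u v = not ⌊ u ≟ v ⌋

distinct-sym : ∀ {n} (u v : Fin n) → distinct u v ≡ distinct v u
distinct-sym u v with u ≟ v | v ≟ u
... | yes _    | yes _   = refl
... | no _     | no _    = refl
... | yes refl | no v≢v  = contradiction refl v≢v
... | no u≢u   | yes refl = contradiction refl u≢u

distinct-irrefl : ∀ {n} (v : Fin n) → distinct v v ≡ false
distinct-irrefl v with v ≟ v
... | yes _  = refl
... | no v≢v = contradiction refl v≢v

-- Digraphs may contain loops; these leave no trace in the underlying
-- simple graph.
underlying : ∀ {n} → Digraph n → Graph n
underlying D = record
  { adj       = λ u v → (D u v ∨ D v u) ∧ distinct u v
  ; symmetric = λ u v → cong₂ _∧_ (∨-comm (D u v) (D v u)) (distinct-sym u v)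
  ; loopless  = λ v → trans (cong ((D v v ∨ D v v) ∧_) (distinct-irrefl v))
                            (∧-zeroʳ (D v v ∨ D v v))
  }

-- For a symmetric relation this is connectedness, for the arc relation of
-- a digraph it is strong connectedness.  Walks and paths give the same
-- notion of reachability.
Connected : ∀ {n} → Rel (Fin n) 0ℓ → Set
Connected R = ∀ u v → Star R u v

StronglyConnected : ∀ {n} → Digraph n → Set
StronglyConnected D = Connected (Arc D)

AdjWithout : ∀ {n} → Graph n → Fin n → Fin n → Rel (Fin n) 0ℓ
AdjWithout G a b u v =
  Adj G u v × ¬ ((u ≡ a × v ≡ b) ⊎ (u ≡ b × v ≡ a))

TwoEdgeConnected : ∀ {n} → Graph n → Set
TwoEdgeConnected G =
  Connected (Adj G) × (∀ a b → Adj G a b → Connected (AdjWithout G a b))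

------------------------------------------------------------------------
-- Tree decompositions

record Cycle {n} (G : Graph n) : Set where
  field
    extra     : ℕ
    vertex    : Fin (3 + extra) → Fin n
    injective : Injective _≡_ _≡_ vertex
    adjacent  : ∀ (i : Fin (2 + extra)) → Adj G (vertex (inject₁ i)) (vertex (suc i))
    closed    : Adj G (vertex (fromℕ (2 + extra))) (vertex zero)

record IsTree {n} (G : Graph n) : Set where
  field
    nonempty  : 0 ℕ.< n
    connected : Connected (Adj G)
    acyclic   : ¬ Cycle G

record TreeDecomposition {n} (G : Graph n) : Set where
  field
    nodes       : ℕ
    tree        : Graph nodes
    isTree      : IsTree tree
    bag         : Fin nodes → Subset n
    coverVertex : ∀ v → ∃[ x ] v ∈ bag x
    coverEdge   : ∀ u v → Adj G u v → ∃[ x ] (u ∈ bag x × v ∈ bag x)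
    -- The nodes whose bags contain v induce a connected subgraph of the tree.
    subtree     : ∀ v x y → v ∈ bag x → v ∈ bag y →
                  Star (λ a b → Adj tree a b × v ∈ bag a × v ∈ bag b) x y

  -- Truncated subtraction matters only if n = 0.
  width : ℕ
  width = foldr _⊔_ 0 (λ x → ∣ bag x ∣) ∸ 1

------------------------------------------------------------------------
-- The problems

record DirectedInput : Set where
  field
    order         : ℕ
    digraph       : Digraph order
    budget        : ℤ
    decomposition : TreeDecomposition (underlying digraph)

record UndirectedInput : Set where
  field
    order         : ℕ
    graph         : Graph order
    budget        : ℤ
    decomposition : TreeDecomposition graph

SCSpS : DirectedInput → Set
SCSpS I = Σ (Digraph order) λ X →
    (∀ u v → Arc X u v → Arc digraph u v)
  × + length (arcs X) ℤ.≤ budget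
  × StronglyConnected X
  where open DirectedInput I

MEG : DirectedInput → Set
MEG I = Σ (Digraph order) λ X →
    (∀ u v → Arc X u v → Arc digraph u v)
  × + length (arcs X) ℤ.≤ budget
  × (∀ u v → Star (Arc digraph) u v → Star (Arc X) u v)
  where open DirectedInput I

2-ECSS : UndirectedInput → Set
2-ECSS I = Σ (Graph order) λ X →
    (∀ u v → Adj X u v → Adj graph u v)
  × + length (edges X) ℤ.≤ budget
  × TwoEdgeConnected X
  where open UndirectedInput I

directedWidth : DirectedInput → ℕ
directedWidth I = TreeDecomposition.width (DirectedInput.decomposition I)

undirectedWidth : UndirectedInput → ℕ
undirectedWidth I = TreeDecomposition.width (UndirectedInput.decomposition I)

------------------------------------------------------------------------
-- Machine model: Jones's WHILE language over binary trees, with fair coins.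
--
-- Every step costs one unit.  A step copies, builds or inspects a number of
-- pointers bounded in terms of the program only, so T steps are simulated by
-- O(T) steps of a RAM with words of O(log (T + input size)) bits; conversely
-- T steps of such a RAM are simulated with a factor polylogarithmic in
-- T + input size (memory as a balanced tree, words as lists of bits).  For
-- T = 17 ^ w times a polynomial, with w below the input size, this factor is
-- polynomial in the input size, so O*(17 ^ w) time is the same notion in both
-- models.

infixr 5 _∙_

data 𝔻 : Set where
  nil : 𝔻
  _∙_ : 𝔻 → 𝔻 → 𝔻

size : 𝔻 → ℕ
size nil     = 1
size (d ∙ e) = suc (size d + size e)

first second : 𝔻 → 𝔻
first nil      = nil
first (d ∙ _)  = d
second nil     = nil
second (_ ∙ e) = e

bit : Bool → 𝔻
bit false = nil
bit true  = nil ∙ nil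

isTrue : 𝔻 → Bool
isTrue nil     = false
isTrue (_ ∙ _) = true

data Expr (k : ℕ) : Set where
  var  : Fin k → Expr k
  nil  : Expr k
  cons : Expr k → Expr k → Expr k
  hd   : Expr k → Expr k
  tl   : Expr k → Expr k

infix  6 _:=_
infixr 5 _⨾_

data Command (k : ℕ) : Set where
  _:=_  : Fin k → Expr k → Command k
  toss  : Fin k → Command k
  _⨾_   : Command k → Command k → Command k
  cond  : Expr k → Command k → Command k → Command k
  while : Expr k → Command k → Command k

Store : ℕ → Set
Store k = Vec 𝔻 k

⟦_⟧ : ∀ {k} → Expr k → Store k → 𝔻
⟦ var x ⟧    σ = lookup σ x
⟦ nil ⟧      σ = nil
⟦ cons e f ⟧ σ = ⟦ e ⟧ σ ∙ ⟦ f ⟧ σ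
⟦ hd e ⟧     σ = first (⟦ e ⟧ σ)
⟦ tl e ⟧     σ = second (⟦ e ⟧ σ)

-- The commands still to be executed, and the store.
Config : ℕ → Set
Config k = List (Command k) × Store k

-- As for probabilistic Turing machines, one coin is supplied at each step;
-- only toss looks at it.
step : ∀ {k} → Bool → Config k → Config k
step b ([]              , σ) = [] , σ
step b (x := e     ∷ cs , σ) = cs , σ [ x ]≔ ⟦ e ⟧ σ
step b (toss x     ∷ cs , σ) = cs , σ [ x ]≔ bit b
step b ((c ⨾ d)    ∷ cs , σ) = c ∷ d ∷ cs , σ
step b (cond e c d ∷ cs , σ) = (if isTrue (⟦ e ⟧ σ) then c else d) ∷ cs , σ
step b (while e c  ∷ cs , σ) =
  (if isTrue (⟦ e ⟧ σ) then c ∷ while e c ∷ cs else cs) , σ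

steps : ∀ {k m} → Vec Bool m → Config k → Config k
steps []       γ = γ
steps (b ∷ bs) γ = steps bs (step b γ)

-- Variable zero holds the input at the start and the answer at the end.
record Program : Set where
  field
    auxiliaries : ℕ
    body        : Command (suc auxiliaries)

initial : (P : Program) → 𝔻 → Config (suc (Program.auxiliaries P))
initial P d = body ∷ [] , d ∷ replicate auxiliaries nil
  where open Program P

run : (P : Program) → 𝔻 → ∀ {m} → Vec Bool m → Config (suc (Program.auxiliaries P))
run P d coins = steps coins (initial P d)

Halted : ∀ {k} → Config k → Set
Halted (cs , _) = cs ≡ []

answer : ∀ {k} → Config (suc k) → Bool
answer (_ , σ) = isTrue (lookup σ zero)

------------------------------------------------------------------------
-- Monte Carlo algorithms

count : ∀ m → (Vec Bool m → Bool) → ℕ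
count zero    f = if f [] then 1 else 0
count (suc m) f = count m (f ∘ (false ∷_)) + count m (f ∘ (true ∷_))

-- Probability of an event under m independent fair coins.
Pr : ∀ m → (Vec Bool m → Bool) → ℚ
Pr m f = _/_ (+ count m f) (2 ^ m) {{m^n≢0 2 m}}

-- P, on the encoded instances, decides Yes with a two-sided error probability
-- bounded away from ½ and always halts within the given number of steps.
record IsMonteCarlo {I : Set} (Yes : I → Set) (encode : I → 𝔻)
                    (P : Program) (time : I → ℕ) : Set where
  field
    halts       : ∀ i (coins : Vec Bool (time i)) → Halted (run P (encode i) coins)
    success     : ℚ
    success>½   : success ℚ.> ½
    correct-yes : ∀ i → Yes i →
                  success ℚ.≤ Pr (time i) (λ coins → answer (run P (encode i) coins))
    correct-no  : ∀ i → ¬ Yes i →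
                  success ℚ.≤ Pr (time i) (λ coins → not (answer (run P (encode i) coins)))

-- Since sizes are positive, a monomial with a constant factor bounds any
-- polynomial in the size.
_∈O*_ : {I : Set} → (I → ℕ) → (I → ℕ) → (I → ℕ) → Set
(time ∈O* f) sz = ∃[ C ] ∃[ c ] (∀ i → time i ℕ.≤ C * sz i ^ c * f i)

MonteCarloSolvable : {I : Set} → (I → Set) → (I → 𝔻) → (I → ℕ) → Set
MonteCarloSolvable Yes encode f =
  ∃[ P ] ∃[ time ] (IsMonteCarlo Yes encode P time × (time ∈O* f) (size ∘ encode))

------------------------------------------------------------------------
-- Encoding of the inputs: graphs as adjacency matrices, bags as
-- characteristic vectors, numbers in (bijective) binary.

encodeList : {A : Set} → (A → 𝔻) → List A → 𝔻
encodeList enc []       = nil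
encodeList enc (x ∷ xs) = enc x ∙ encodeList enc xs

encodeMatrix : ∀ {n} → (Fin n → Fin n → Bool) → 𝔻
encodeMatrix {n} M = encodeList (λ u → encodeList (λ v → bit (M u v)) (allFin n)) (allFin n)

encodeSubset : ∀ {n} → Subset n → 𝔻
encodeSubset s = encodeList bit (Vec.toList s)

encodeℕᵇ : ℕᵇ → 𝔻
encodeℕᵇ 0ᵇ       = nil
encodeℕᵇ 2[1+ x ] = bit false ∙ encodeℕᵇ x
encodeℕᵇ 1+[2 x ] = bit true ∙ encodeℕᵇ x

encodeℤ : ℤ → 𝔻
encodeℤ (+ n)    = bit false ∙ encodeℕᵇ (toBinary n)
encodeℤ -[1+ n ] = bit true ∙ encodeℕᵇ (toBinary n)

encodeDecomposition : ∀ {n} {G : Graph n} → TreeDecomposition G → 𝔻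
encodeDecomposition D =
  encodeMatrix (adj tree) ∙ encodeList (λ x → encodeSubset (bag x)) (allFin nodes)
  where open TreeDecomposition D

encodeDirected : DirectedInput → 𝔻
encodeDirected I = encodeMatrix digraph ∙ encodeℤ budget ∙ encodeDecomposition decomposition
  where open DirectedInput I

encodeUndirected : UndirectedInput → 𝔻
encodeUndirected I = encodeMatrix (adj graph) ∙ encodeℤ budget ∙ encodeDecomposition decomposition
  where open UndirectedInput I

{-# OPTIONS --safe #-}

-- Cut & Count with 16 states per vertex.  Choose roots, and sets Y₀ and Y₁ of
-- r arcs each, where r is the number of nonroots.  Give every nonroot a side of
-- a cut and a mark, once for Y₀ and once for Y₁, such that no arc of Y₀ crosses
-- the first cut or enters a marked vertex, and no arc of Y₁ crosses the second
-- cut or leaves a marked vertex.  These states form a vector space over the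
-- field with two elements, so that their number is odd exactly if only the zero
-- state exists, that is, if Y₀ is a forest directed away from the roots and Y₁
-- is one directed towards them.  Random weights make the lightest solution
-- unique with probability at least 3/4 (isolation lemma); it then shows up in
-- the partition function, a truncated polynomial with coefficients modulo two,
-- which is computed by eliminating the nodes of the decomposition.
--
-- SCSpS is the case of a single root.  For MEG the roots are the least vertices
-- of the strong components, and in addition one arc is needed between any two
-- consecutive components.  A graph is 2-edge connected exactly if it has a
-- strong orientation (Robbins), which reduces 2-ECSS to SCSpS with the
-- condition that no edge is used in both directions.
--
-- The algorithm is written in a small typed language with a compiler to WHILE.
-- In its polynomial fragment every term has a polynomially bounded running
-- time; the steps that enumerate states are accounted for by hand.

module Submission where

open import Defs
open import Algebra.Bundles using (CommutativeSemiring)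
open import Algebra.Structures.Biased using (isCommutativeSemiringˡ)
open import Data.Bool.Base using (Bool; true; false; T; not; _∧_; _∨_; _xor_; if_then_else_)
open import Data.Bool.Properties as Boolₚ using (T?)
open import Data.Empty using (⊥; ⊥-elim)
open import Data.Fin.Base as Fin using (Fin; zero; suc; toℕ)
open import Data.Fin.Properties as Finₚ using (_≟_; toℕ<n; toℕ-injective)
open import Data.Fin.Subset using (Subset; ∣_∣) renaming (_∈_ to _∈ˢ_)
open import Data.Integer.Base as ℤ using (ℤ; -[1+_])
import Data.Integer.Properties as ℤₚ
open import Data.List.Base as List using (List; []; _∷_; _++_; allFin; length; foldr; foldl; reverse; replicate; _ʳ++_)
open import Data.List.Membership.Propositional using (_∈_)
open import Data.List.Membership.Propositional.Properties using (∈-allFin; ∈-++⁺ˡ; ∈-++⁺ʳ)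
open import Data.List.Properties as Listₚ using (reverse-involutive; reverse-foldr; length-++; length-replicate)
open import Data.List.Relation.Unary.All as All using (All; []; _∷_)
open import Data.List.Relation.Unary.AllPairs using ([]; _∷_)
open import Data.List.Relation.Unary.Any as Any using (here; there)
open import Data.List.Relation.Unary.Unique.Propositional using (Unique)
open import Data.List.Relation.Unary.Unique.Propositional.Properties using (allFin⁺)
open import Data.Nat.Base as ℕ using (ℕ; zero; suc; _+_; _*_; _^_; _∸_; _⊔_; _⊓_; _≤_; _<_; z≤n; s≤s; _<ᵇ_; _≡ᵇ_; NonZero)
open import Data.Nat.Binary.Base using (ℕᵇ; 2[1+_]; 1+[2_]) renaming (zero to 0ᵇ; toℕ to fromBinary; fromℕ to toBinary)
open import Data.Nat.Binary.Properties using () renaming (toℕ-fromℕ to fromBinary-toBinary)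
open import Data.Nat.Properties as ℕₚ hiding (_≟_)
open import Data.Nat.Solver using (module +-*-Solver)
open import Data.Product.Base using (∃-syntax; _×_; _,_; proj₁; proj₂)
open import Data.Rational.Base as ℚ using (_/_)
import Data.Rational.Properties as ℚₚ
import Data.Rational.Unnormalised.Base as ℚᵘ
import Data.Rational.Unnormalised.Properties as ℚᵘₚ
open import Data.Sum.Base using (_⊎_; inj₁; inj₂)
open import Data.Unit.Base using (⊤; tt)
open import Data.Vec.Base as Vec using (Vec; []; _∷_; lookup; _[_]≔_)
import Data.Vec.Functional as Vecᶠ
open import Data.Vec.Properties using ([]=⇒lookup; lookup⇒[]=)
open import Function.Base using (_∘_; id; flip)
open import Level using (0ℓ)
open import Relation.Binary.Construct.Closure.ReflexiveTransitive as Star using (Star; ε; _◅_; _◅◅_)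
open import Relation.Binary.Definitions using (tri<; tri≈; tri>)
open import Relation.Binary.PropositionalEquality.Core using (_≡_; _≢_; refl; sym; trans; cong; cong₂; subst; subst₂)
import Relation.Binary.Reasoning.Setoid as SetoidReasoning
open import Relation.Binary.Structures using (IsEquivalence)
open import Relation.Nullary.Decidable using (Dec; yes; no; ⌊_⌋; _×-dec_)
open import Relation.Nullary.Negation using (¬_; contradiction)
open import Relation.Unary using (Decidable)
open +-*-Solver using (solve; _:+_; _:*_) renaming (_:=_ to _:≡_; con to lit)

-- An odd number of states has two consequences. If no arc of `Y₀` entered some nonroot, the mark of
-- that vertex alone would be a nonzero state; so every nonroot is entered, and r arcs in all means
-- entered exactly once. Then no chosen arc joins a reached vertex to an unreached one, and the set
-- of vertices not reached from the roots, put on one side of the cut, would be a nonzero state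
-- unless it is empty. The same holds for `Y₁` with all arcs reversed. The numbers of arcs are not
-- imposed but priced. One more arc in a forest costs at least the whole allowance of the union, and
-- one more arc in the union costs more than all random parts together. Truncating the partition
-- function at the permitted price therefore keeps only choices with r arcs in each forest and a
-- small union; the two forests may share arcs. A bag has up to one vertex more than the width, and
-- each of its vertices has four bits. Each bit is either kept for the parent or summed out, so a
-- node costs at most 16 to the power of its bag size, up to polynomial factors, and 16 may be
-- relaxed to 17.

≡≤ : ∀ {a b c} → a ≡ b → b ≤ c → a ≤ c
≡≤ refl le = le

≤≡ : ∀ {a b c} → a ≤ b → b ≡ c → a ≤ c
≤≡ le refl = le

-- Deterministic execution, whatever the coins

infix 4 _⟶[_]_
infixr 5 _▷_

data _⟶[_]_ {k} : Config k → ℕ → Config k → Set where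
  done : ∀ {γ} → γ ⟶[ 0 ] γ
  next : ∀ {γ γ′ γ″ n} → (∀ b → step b γ ≡ γ′) → γ′ ⟶[ n ] γ″ → γ ⟶[ suc n ] γ″

_▷_ : ∀ {k m n} {γ γ′ γ″ : Config k} → γ ⟶[ m ] γ′ → γ′ ⟶[ n ] γ″ → γ ⟶[ m + n ] γ″
done ▷ q = q
next e p ▷ q = next e (p ▷ q)

-- For every command except `toss` the two coins give the same configuration by computation, and the
-- instance argument is found as `refl`. A deterministic run is thus spelled with one `go` per
-- machine step.
go : ∀ {k n} {γ γ″ : Config k} {{_ : step true γ ≡ step false γ}} →
     step false γ ⟶[ n ] γ″ → γ ⟶[ suc n ] γ″
go {{e}} p = next (λ { false → refl ; true → e }) p

-- A typed functional language

infixr 6 _⊗_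

data Ty : Set where
  bool nat : Ty
  list tree : Ty → Ty
  _⊗_ : Ty → Ty → Ty

data Tree (A : Set) : Set where
  leaf : A → Tree A
  node : Tree A → Tree A → Tree A

El : Ty → Set
El bool = Bool
El nat = ℕ
El (list A) = List (El A)
El (tree A) = Tree (El A)
El (A ⊗ B) = El A × El B

-- Unary, because the size measure below counts a number by its value, and because a number can then
-- drive a loop as the list of its ticks.
unary : ℕ → 𝔻
unary zero = nil
unary (suc n) = nil ∙ unary n

encTree : ∀ {A : Set} → (A → 𝔻) → Tree A → 𝔻
encTree f (leaf a) = nil ∙ f a
encTree f (node l r) = bit true ∙ encTree f l ∙ encTree f r

enc : ∀ A → El A → 𝔻
enc bool = bit
enc nat = unary
enc (list A) = encodeList (enc A)
enc (tree A) = encTree (enc A)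
enc (A ⊗ B) (a , b) = enc A a ∙ enc B b

Env : List Ty → Set
Env [] = ⊤
Env (A ∷ Γ) = El A × Env Γ

encEnv : ∀ Γ → Env Γ → 𝔻
encEnv [] _ = nil
encEnv (A ∷ Γ) (a , ρ) = enc A a ∙ encEnv Γ ρ

-- The size measure: every list in the value has length at most s.  The depth
-- of a tree is not measured, since no loop runs over a tree.
AllTree : ∀ {A : Set} → (A → Set) → Tree A → Set
AllTree P (leaf a) = P a
AllTree P (node l r) = AllTree P l × AllTree P r

W : ℕ → ∀ A → El A → Set
W s bool _ = ⊤
W s nat n = n ≤ s
W s (list A) xs = length xs ≤ s × All (W s A) xs
W s (tree A) t = AllTree (W s A) t
W s (A ⊗ B) (a , b) = W s A a × W s B b

WE : ℕ → ∀ Γ → Env Γ → Set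
WE s [] _ = ⊤
WE s (A ∷ Γ) (a , ρ) = W s A a × WE s Γ ρ

infix 4 _∋_
data _∋_ : List Ty → Ty → Set where
  ze : ∀ {Γ A} → (A ∷ Γ) ∋ A
  su : ∀ {Γ A B} → Γ ∋ A → (B ∷ Γ) ∋ A

look : ∀ {Γ A} → Γ ∋ A → Env Γ → El A
look ze (a , _) = a
look (su x) (_ , ρ) = look x ρ

-- Terms in `poly` mode obtain a polynomial time bound by induction on their structure. The `free`
-- mode adds `fold!`, a loop without such a bound, for the enumeration of states.
data Mode : Set where
  poly free : Mode

data _⊑_ : Mode → Mode → Set where
  poly⊑ : ∀ {m} → poly ⊑ m
  free⊑ : free ⊑ free

-- `grow` allows one extra unit of size per operation, enough for a successor or a longer list; the
-- bound for a composite term needs to know nothing else about its operations.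
record Op₁ (A B : Ty) : Set where
  constructor op₁
  field
    expr : ∀ {k} → Expr k → Expr k
    fun : El A → El B
    ok : ∀ {k} (σ : Store k) x a → ⟦ x ⟧ σ ≡ enc A a → ⟦ expr x ⟧ σ ≡ enc B (fun a)
    grow : ∀ s a → W s A a → W (suc s) B (fun a)

record Op₂ (A B C : Ty) : Set where
  constructor op₂
  field
    expr : ∀ {k} → Expr k → Expr k → Expr k
    fun : El A → El B → El C
    ok : ∀ {k} (σ : Store k) x y a b → ⟦ x ⟧ σ ≡ enc A a → ⟦ y ⟧ σ ≡ enc B b →
           ⟦ expr x y ⟧ σ ≡ enc C (fun a b)
    grow : ∀ s a b → W s A a → W s B b → W (suc s) C (fun a b)

record Op₀ (A : Ty) : Set where
  constructor op₀
  field
    expr : ∀ {k} → Expr k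
    val : El A
    ok : ∀ {k} (σ : Store k) → ⟦ expr ⟧ σ ≡ enc A val
    grow : ∀ s → W (suc s) A val

mutual
  -- In polynomial mode every loop carries a proof that its result is
  -- polynomially bounded in terms of the environment and the list.
  data Tm : Mode → List Ty → Ty → Set where
    var : ∀ {m Γ A} → Γ ∋ A → Tm m Γ A
    ap₀ : ∀ {m Γ A} → Op₀ A → Tm m Γ A
    ap₁ : ∀ {m Γ A B} → Op₁ A B → Tm m Γ A → Tm m Γ B
    ap₂ : ∀ {m Γ A B C} → Op₂ A B C → Tm m Γ A → Tm m Γ B → Tm m Γ C
    ite : ∀ {m Γ A} → Tm m Γ bool → Tm m Γ A → Tm m Γ A → Tm m Γ A
    caseList : ∀ {m Γ A B} → Tm m Γ (list A) → Tm m Γ B → Tm m (A ∷ list A ∷ Γ) B → Tm m Γ B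
    caseTree : ∀ {m Γ A B} → Tm m Γ (tree A) → Tm m (A ∷ Γ) B → Tm m (tree A ∷ tree A ∷ Γ) B →
               Tm m Γ B
    fold : ∀ {m Γ A B} (l : Tm m Γ (list A)) (z : Tm m Γ B) (b : Tm m (A ∷ B ∷ Γ) B) →
               FoldBound z b → Tm m Γ B
    fold! : ∀ {Γ A B} → Tm free Γ (list A) → Tm free Γ B → Tm free (A ∷ B ∷ Γ) B → Tm free Γ B
    letin : ∀ {m Γ A B} → Tm m Γ A → Tm m (A ∷ Γ) B → Tm m Γ B
    skip : ∀ {m Γ A B C} → Tm m (A ∷ Γ) B → Tm m (A ∷ C ∷ Γ) B
    -- A call means the given function `g`, not the meaning of `f`, so that semantic goals mention
    -- readable functions instead of unfolded terms.
    call : ∀ {m m′ Γ Δ A} → m′ ⊑ m → (f : Tm m′ Δ A) (g : Env Δ → El A) →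
               (∀ ρ → ⟦ f ⟧ᵗ ρ ≡ g ρ) → Args m Γ Δ → Tm m Γ A

  data Args : Mode → List Ty → List Ty → Set where
    [] : ∀ {m Γ} → Args m Γ []
    _∷_ : ∀ {m Γ Δ A} → Tm m Γ A → Args m Γ Δ → Args m Γ (A ∷ Δ)

  ⟦_⟧ᵗ : ∀ {m Γ A} → Tm m Γ A → Env Γ → El A
  ⟦ var x ⟧ᵗ ρ = look x ρ
  ⟦ ap₀ o ⟧ᵗ ρ = Op₀.val o
  ⟦ ap₁ o t ⟧ᵗ ρ = Op₁.fun o (⟦ t ⟧ᵗ ρ)
  ⟦ ap₂ o t u ⟧ᵗ ρ = Op₂.fun o (⟦ t ⟧ᵗ ρ) (⟦ u ⟧ᵗ ρ)
  ⟦ ite c t u ⟧ᵗ ρ = if ⟦ c ⟧ᵗ ρ then ⟦ t ⟧ᵗ ρ else ⟦ u ⟧ᵗ ρ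
  ⟦ caseList t u v ⟧ᵗ ρ = elimList (⟦ u ⟧ᵗ ρ) (λ x xs → ⟦ v ⟧ᵗ (x , xs , ρ)) (⟦ t ⟧ᵗ ρ)
  ⟦ caseTree t u v ⟧ᵗ ρ = elimTree (λ a → ⟦ u ⟧ᵗ (a , ρ)) (λ l r → ⟦ v ⟧ᵗ (l , r , ρ)) (⟦ t ⟧ᵗ ρ)
  ⟦ fold l z b _ ⟧ᵗ ρ = foldr (λ x a → ⟦ b ⟧ᵗ (x , a , ρ)) (⟦ z ⟧ᵗ ρ) (⟦ l ⟧ᵗ ρ)
  ⟦ fold! l z b ⟧ᵗ ρ = foldr (λ x a → ⟦ b ⟧ᵗ (x , a , ρ)) (⟦ z ⟧ᵗ ρ) (⟦ l ⟧ᵗ ρ)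
  ⟦ letin t u ⟧ᵗ ρ = ⟦ u ⟧ᵗ (⟦ t ⟧ᵗ ρ , ρ)
  ⟦ skip t ⟧ᵗ (a , _ , ρ) = ⟦ t ⟧ᵗ (a , ρ)
  ⟦ call _ f g _ ts ⟧ᵗ ρ = g (⟦ ts ⟧ᵃ ρ)

  ⟦_⟧ᵃ : ∀ {m Γ Δ} → Args m Γ Δ → Env Γ → Env Δ
  ⟦ [] ⟧ᵃ ρ = tt
  ⟦ t ∷ ts ⟧ᵃ ρ = ⟦ t ⟧ᵗ ρ , ⟦ ts ⟧ᵃ ρ

  -- A bound for one pass through the body would not suffice: a body that squares the size exceeds
  -- every polynomial when iterated. The bound concerns the accumulator after an arbitrary list,
  -- which covers all intermediate stages of the loop.
  record FoldBound {m Γ A B} (z : Tm m Γ B) (b : Tm m (A ∷ B ∷ Γ) B) : Set where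
    inductive
    constructor foldBound
    field
      degree : ℕ
      bound : ∀ s ρ xs → 2 ≤ s → WE s Γ ρ → W s (list A) xs →
               W (s ^ degree) B (foldr (λ x a → ⟦ b ⟧ᵗ (x , a , ρ)) (⟦ z ⟧ᵗ ρ) xs)

  elimList : ∀ {A B : Set} → B → (A → List A → B) → List A → B
  elimList u v [] = u
  elimList u v (x ∷ xs) = v x xs

  elimTree : ∀ {A B : Set} → (A → B) → (Tree A → Tree A → B) → Tree A → B
  elimTree u v (leaf a) = u a
  elimTree u v (node l r) = v l r

-- Compilation.  Variables: result, environment, stack.

module _ {q : ℕ} where

  pattern res = zero
  pattern env = suc zero
  pattern stk = suc (suc zero)

  private
    C : Set
    C = Command (3 + q)
    X : Set
    X = Expr (3 + q)

  infix 7 $_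
  pattern $_ x = var x

  place : ∀ {Γ A} → Γ ∋ A → X → X
  place ze e = hd e
  place (su x) e = place x (tl e)

  drop2E : C
  drop2E = env := tl (tl ($ env))

  -- Moves a list from the top of the stack onto the list below it. `foldr` combines from the back,
  -- whereas a loop consumes from the front, so each fold first reverses its list.
  loopRev : C
  loopRev = while (hd ($ stk))
    (stk := cons (tl (hd ($ stk))) (cons (cons (hd (hd ($ stk))) (hd (tl ($ stk)))) (tl (tl ($ stk)))))

  mutual
    comp : ∀ {m Γ A} → Tm m Γ A → C
    comp (var x) = res := place x ($ env)
    comp (ap₀ o) = res := Op₀.expr o
    comp (ap₁ o t) = comp t ⨾ res := Op₁.expr o ($ res)
    comp (ap₂ o t u) = comp t ⨾ stk := cons ($ res) ($ stk) ⨾ comp u ⨾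
                            res := Op₂.expr o (hd ($ stk)) ($ res) ⨾ stk := tl ($ stk)
    comp (ite c t u) = comp c ⨾ cond ($ res) (comp t) (comp u)
    comp (caseList t u v) = comp t ⨾ cond ($ res)
      (env := cons (hd ($ res)) (cons (tl ($ res)) ($ env)) ⨾ comp v ⨾ drop2E) (comp u)
    comp (caseTree t u v) = comp t ⨾ cond (hd ($ res))
      (env := cons (hd (tl ($ res))) (cons (tl (tl ($ res))) ($ env)) ⨾ comp v ⨾ drop2E)
      (env := cons (tl ($ res)) ($ env) ⨾ comp u ⨾ env := tl ($ env))
    comp (fold l z b _) = compFold l z b
    comp (fold! l z b) = compFold l z b
    comp (letin t u) = comp t ⨾ env := cons ($ res) ($ env) ⨾ comp u ⨾ env := tl ($ env)
    comp (skip t) = stk := cons (hd (tl ($ env))) ($ stk) ⨾ env := cons (hd ($ env)) (tl (tl ($ env))) ⨾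
      comp t ⨾ env := cons (hd ($ env)) (cons (hd ($ stk)) (tl ($ env))) ⨾ stk := tl ($ stk)
    comp (call _ f _ _ ts) = stk := cons nil ($ stk) ⨾ compArgs ts ⨾ res := hd ($ stk) ⨾
      stk := cons ($ env) (tl ($ stk)) ⨾ env := $ res ⨾ comp f ⨾ env := hd ($ stk) ⨾ stk := tl ($ stk)

    compFold : ∀ {m Γ A B} → Tm m Γ (list A) → Tm m Γ B → Tm m (A ∷ B ∷ Γ) B → C
    compFold l z b = comp l ⨾ stk := cons ($ res) (cons nil ($ stk)) ⨾ loopRev ⨾ stk := tl ($ stk) ⨾
      comp z ⨾ loopFold b ⨾ stk := tl ($ stk)

    loopFold : ∀ {m Γ A B} → Tm m (A ∷ B ∷ Γ) B → C
    loopFold b = while (hd ($ stk))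
      (env := cons (hd (hd ($ stk))) (cons ($ res) ($ env)) ⨾ comp b ⨾ drop2E ⨾
       stk := cons (tl (hd ($ stk))) (tl ($ stk)))

    compArgs : ∀ {m Γ Δ} → Args m Γ Δ → C
    compArgs [] = res := $ res
    compArgs (t ∷ ts) = compArgs ts ⨾ comp t ⨾ stk := cons (cons ($ res) (hd ($ stk))) (tl ($ stk))

revCost : ∀ {A : Set} → List A → ℕ
revCost [] = 1
revCost (_ ∷ xs) = 2 + revCost xs

-- The loop sees the elements in reverse: ws is what is left of the reversed
-- list, zs what has been processed.
loopCost : ∀ {A B : Set} → (A → B → ℕ) → (A → B → B) → B → List A → List A → ℕ
loopCost c f z [] zs = 1
loopCost c f z (w ∷ ws) zs =
  3 + (suc (c w (foldr f z zs) + (3 + loopCost c f z ws (w ∷ zs))))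

mutual
  cost : ∀ {m Γ A} → Tm m Γ A → Env Γ → ℕ
  cost (var x) ρ = 1
  cost (ap₀ o) ρ = 1
  cost (ap₁ o t) ρ = suc (cost t ρ + 1)
  cost (ap₂ o t u) ρ = suc (cost t ρ + (3 + (cost u ρ + 3)))
  cost (ite c t u) ρ = suc (cost c ρ + suc (if ⟦ c ⟧ᵗ ρ then cost t ρ else cost u ρ))
  cost (caseList t u v) ρ = suc (cost t ρ + suc
    (elimList (cost u ρ) (λ x xs → 3 + (cost v (x , xs , ρ) + 1)) (⟦ t ⟧ᵗ ρ)))
  cost (caseTree t u v) ρ = suc (cost t ρ + suc
    (elimTree (λ a → 3 + (cost u (a , ρ) + 1)) (λ l r → 3 + (cost v (l , r , ρ) + 1)) (⟦ t ⟧ᵗ ρ)))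
  cost (fold l z b _) ρ = costFold l z b ρ
  cost (fold! l z b) ρ = costFold l z b ρ
  cost (letin t u) ρ = suc (cost t ρ + (3 + (cost u (⟦ t ⟧ᵗ ρ , ρ) + 1)))
  cost (skip t) (a , _ , ρ) = 5 + (cost t (a , ρ) + 3)
  cost (call _ f g _ ts) ρ = 3 + (costArgs ts ρ + (7 + (cost f (⟦ ts ⟧ᵃ ρ) + 3)))

  costFold : ∀ {m Γ A B} → Tm m Γ (list A) → Tm m Γ B → Tm m (A ∷ B ∷ Γ) B → Env Γ → ℕ
  costFold l z b ρ = suc (cost l ρ + (3 + (revCost (⟦ l ⟧ᵗ ρ) + (3 + (cost z ρ + suc
    (loopCost (λ x a → cost b (x , a , ρ)) (λ x a → ⟦ b ⟧ᵗ (x , a , ρ)) (⟦ z ⟧ᵗ ρ)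
              (reverse (⟦ l ⟧ᵗ ρ)) [] + 1))))))

  costArgs : ∀ {m Γ Δ} → Args m Γ Δ → Env Γ → ℕ
  costArgs [] ρ = 1
  costArgs (t ∷ ts) ρ = suc (costArgs ts ρ + suc (cost t ρ + 1))

module _ {q : ℕ} where

  store : 𝔻 → 𝔻 → 𝔻 → Vec 𝔻 q → Store (3 + q)
  store r e s σ = r ∷ e ∷ s ∷ σ

  place-ok : ∀ {Γ A} (x : Γ ∋ A) (ρ : Env Γ) (σ : Store (3 + q)) e →
             ⟦ e ⟧ σ ≡ encEnv Γ ρ → ⟦ place x e ⟧ σ ≡ enc A (look x ρ)
  place-ok ze ρ σ e eq = cong first eq
  place-ok (su x) (_ , ρ) σ e eq = place-ok x ρ σ (tl e) (cong second eq)

  private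
    R≔ : ∀ {x : Expr (3 + q)} {d r e s σ cs} → ⟦ x ⟧ (store r e s σ) ≡ d →
         (res := x ∷ cs , store r e s σ) ⟶[ 1 ] (cs , store d e s σ)
    R≔ eq = next (λ _ → cong (λ d → _ , store d _ _ _) eq) done

    branch : ∀ b {c d : Command (3 + q)} {e s σ cs m n} {A : Set} (f : A → 𝔻) {x y : A} →
             (c ∷ cs , store (bit b) e s σ) ⟶[ m ] (cs , store (f x) e s σ) →
             (d ∷ cs , store (bit b) e s σ) ⟶[ n ] (cs , store (f y) e s σ) →
             (cond ($ res) c d ∷ cs , store (bit b) e s σ)
               ⟶[ suc (if b then m else n) ] (cs , store (f (if b then x else y)) e s σ)
    branch false f p q = go q
    branch true f p q = go p

  loopRev-ok : ∀ {A} (xs zs : List (El A)) {r e s σ cs} →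
    (loopRev {q} ∷ cs , store r e (enc (list A) xs ∙ enc (list A) zs ∙ s) σ)
      ⟶[ revCost xs ] (cs , store r e (nil ∙ enc (list A) (xs ʳ++ zs) ∙ s) σ)
  loopRev-ok [] zs = go done
  loopRev-ok {A} (x ∷ xs) zs = go (go (loopRev-ok {A} xs (x ∷ zs)))

  lastArg : ∀ {m Γ Δ} → Args m Γ Δ → Env Γ → 𝔻 → 𝔻
  lastArg [] ρ r = r
  lastArg (_∷_ {A = A} t _) ρ r = enc A (⟦ t ⟧ᵗ ρ)

  mutual
    -- `cost` is the exact number of steps, which reduces every later statement about running time
    -- to arithmetic on `cost`. Environment and stack are restored, as the induction requires.
    comp-ok : ∀ {m Γ A} (t : Tm m Γ A) (ρ : Env Γ) {r s σ cs} →
      (comp {q} t ∷ cs , store r (encEnv Γ ρ) s σ)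
        ⟶[ cost t ρ ] (cs , store (enc A (⟦ t ⟧ᵗ ρ)) (encEnv Γ ρ) s σ)
    comp-ok (var x) ρ = R≔ (place-ok x ρ _ ($ env) refl)
    comp-ok (ap₀ o) ρ = R≔ (Op₀.ok o _)
    comp-ok (ap₁ o t) ρ = go (comp-ok t ρ ▷ R≔ (Op₁.ok o _ ($ res) _ refl))
    comp-ok (ap₂ o t u) ρ = go (comp-ok t ρ ▷ go (go (go (comp-ok u ρ ▷
      go (R≔ (Op₂.ok o _ (hd ($ stk)) ($ res) _ _ refl refl) ▷ go done)))))
    comp-ok {A = A} (ite c t u) ρ = go (comp-ok c ρ ▷
      branch (⟦ c ⟧ᵗ ρ) (enc A) (comp-ok t ρ) (comp-ok u ρ))
    comp-ok (caseList t u v) ρ = go (comp-ok t ρ ▷ caseList-ok u v ρ (⟦ t ⟧ᵗ ρ))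
    comp-ok (caseTree t u v) ρ = go (comp-ok t ρ ▷ caseTree-ok u v ρ (⟦ t ⟧ᵗ ρ))
    comp-ok (fold l z b _) ρ = compFold-ok l z b ρ
    comp-ok (fold! l z b) ρ = compFold-ok l z b ρ
    comp-ok (letin t u) ρ = go (comp-ok t ρ ▷ go (go (go (comp-ok u (⟦ t ⟧ᵗ ρ , ρ) ▷ go done))))
    comp-ok (skip t) (a , c , ρ) = go (go (go (go (go (comp-ok t (a , ρ) ▷ go (go (go done)))))))
    comp-ok {A = A} (call _ f g ok ts) ρ = go (go (go (compArgs-ok ts ρ ▷
      go (go (go (go (go (go (go (comp-ok f (⟦ ts ⟧ᵃ ρ) ▷
      go (go (next (λ _ → cong (λ a → _ , store (enc A a) _ _ _) (ok (⟦ ts ⟧ᵃ ρ))) done))))))))))))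

    caseList-ok : ∀ {m Γ A B} (u : Tm m Γ B) (v : Tm m (A ∷ list A ∷ Γ) B) ρ xs {s σ cs} →
      (cond ($ res) (env := cons (hd ($ res)) (cons (tl ($ res)) ($ env)) ⨾ comp {q} v ⨾ drop2E) (comp u) ∷ cs
        , store (enc (list A) xs) (encEnv Γ ρ) s σ)
      ⟶[ suc (elimList (cost u ρ) (λ x xs → 3 + (cost v (x , xs , ρ) + 1)) xs) ]
      (cs , store (enc B (elimList (⟦ u ⟧ᵗ ρ) (λ x xs → ⟦ v ⟧ᵗ (x , xs , ρ)) xs)) (encEnv Γ ρ) s σ)
    caseList-ok u v ρ [] = go (comp-ok u ρ)
    caseList-ok u v ρ (x ∷ xs) = go (go (go (go (comp-ok v (x , xs , ρ) ▷ go done))))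

    caseTree-ok : ∀ {m Γ A B} (u : Tm m (A ∷ Γ) B) (v : Tm m (tree A ∷ tree A ∷ Γ) B) ρ t {s σ cs} →
      (cond (hd ($ res)) (env := cons (hd (tl ($ res))) (cons (tl (tl ($ res))) ($ env)) ⨾ comp {q} v ⨾ drop2E)
        (env := cons (tl ($ res)) ($ env) ⨾ comp u ⨾ env := tl ($ env)) ∷ cs
        , store (enc (tree A) t) (encEnv Γ ρ) s σ)
      ⟶[ suc (elimTree (λ a → 3 + (cost u (a , ρ) + 1)) (λ l r → 3 + (cost v (l , r , ρ) + 1)) t) ]
      (cs , store (enc B (elimTree (λ a → ⟦ u ⟧ᵗ (a , ρ)) (λ l r → ⟦ v ⟧ᵗ (l , r , ρ)) t)) (encEnv Γ ρ) s σ)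
    caseTree-ok u v ρ (leaf a) = go (go (go (go (comp-ok u (a , ρ) ▷ go done))))
    caseTree-ok u v ρ (node l r) = go (go (go (go (comp-ok v (l , r , ρ) ▷ go done))))

    compFold-ok : ∀ {m Γ A B} (l : Tm m Γ (list A)) (z : Tm m Γ B) (b : Tm m (A ∷ B ∷ Γ) B) ρ {r s σ cs} →
      (compFold {q} l z b ∷ cs , store r (encEnv Γ ρ) s σ)
        ⟶[ costFold l z b ρ ]
      (cs , store (enc B (foldr (λ x a → ⟦ b ⟧ᵗ (x , a , ρ)) (⟦ z ⟧ᵗ ρ) (⟦ l ⟧ᵗ ρ))) (encEnv Γ ρ) s σ)
    compFold-ok {A = A} {B} l z b ρ = go (comp-ok l ρ ▷ go (go (go (loopRev-ok {A} (⟦ l ⟧ᵗ ρ) [] ▷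
      go (go (go (comp-ok z ρ ▷ go (
      loopFold-all b (⟦ z ⟧ᵗ ρ) (reverse (⟦ l ⟧ᵗ ρ)) ρ (reverse-involutive (⟦ l ⟧ᵗ ρ)) ▷ go done))))))))

    loopFold-all : ∀ {m Γ A B} (b : Tm m (A ∷ B ∷ Γ) B) z ws {xs} ρ {s σ cs} → ws ʳ++ [] ≡ xs →
      let f = λ x a → ⟦ b ⟧ᵗ (x , a , ρ) in
      (loopFold {q} b ∷ cs , store (enc B z) (encEnv Γ ρ) (enc (list A) ws ∙ s) σ)
        ⟶[ loopCost (λ x a → cost b (x , a , ρ)) f z ws [] ]
      (cs , store (enc B (foldr f z xs)) (encEnv Γ ρ) (nil ∙ s) σ)
    loopFold-all b z ws ρ refl = loopFold-ok b z ws [] ρ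

    loopFold-ok : ∀ {m Γ A B} (b : Tm m (A ∷ B ∷ Γ) B) z ws zs ρ {s σ cs} →
      let f = λ x a → ⟦ b ⟧ᵗ (x , a , ρ) in
      (loopFold {q} b ∷ cs , store (enc B (foldr f z zs)) (encEnv Γ ρ) (enc (list A) ws ∙ s) σ)
        ⟶[ loopCost (λ x a → cost b (x , a , ρ)) f z ws zs ]
      (cs , store (enc B (foldr f z (ws ʳ++ zs))) (encEnv Γ ρ) (nil ∙ s) σ)
    loopFold-ok b z [] zs ρ = go done
    loopFold-ok b z (w ∷ ws) zs ρ = go (go (go (go (comp-ok b (w , foldr _ z zs , ρ) ▷
      go (go (go (loopFold-ok b z ws (w ∷ zs) ρ)))))))

    compArgs-ok : ∀ {m Γ Δ} (ts : Args m Γ Δ) (ρ : Env Γ) {r s σ cs} →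
      (compArgs {q} ts ∷ cs , store r (encEnv Γ ρ) (nil ∙ s) σ)
        ⟶[ costArgs ts ρ ] (cs , store (lastArg ts ρ r) (encEnv Γ ρ) (encEnv Δ (⟦ ts ⟧ᵃ ρ) ∙ s) σ)
    compArgs-ok [] ρ = go done
    compArgs-ok (t ∷ ts) ρ = go (compArgs-ok ts ρ ▷ go (comp-ok t ρ ▷ go done))

-- Polynomial bounds

W-mono : ∀ {s s′} → s ≤ s′ → ∀ A {a} → W s A a → W s′ A a
W-monos : ∀ {s s′} → s ≤ s′ → ∀ A {xs} → All (W s A) xs → All (W s′ A) xs
W-monot : ∀ {s s′} → s ≤ s′ → ∀ A t → AllTree (W s A) t → AllTree (W s′ A) t
W-mono le bool _ = tt
W-mono le nat w = ≤-trans w le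
W-mono le (list A) (l , w) = ≤-trans l le , W-monos le A w
W-mono le (tree A) {t} w = W-monot le A t w
W-mono le (A ⊗ B) (v , w) = W-mono le A v , W-mono le B w
W-monos le A [] = []
W-monos le A (w ∷ ws) = W-mono le A w ∷ W-monos le A ws
W-monot le A (leaf _) w = W-mono le A w
W-monot le A (node l r) (v , w) = W-monot le A l v , W-monot le A r w

WE-mono : ∀ {s s′} → s ≤ s′ → ∀ Γ {ρ} → WE s Γ ρ → WE s′ Γ ρ
WE-mono le [] _ = tt
WE-mono le (A ∷ Γ) (w , v) = W-mono le A w , WE-mono le Γ v

-- A record, so that the degree can be inferred.
record Deg (s c a : ℕ) : Set where
  constructor deg
  field un : a ≤ s ^ c
open Deg

module _ {s : ℕ} (h : 2 ≤ s) where

  pow-mono : ∀ {i j} → i ≤ j → s ^ i ≤ s ^ j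
  pow-mono = ^-monoʳ-≤ s {{ℕ.>-nonZero (≤-trans (s≤s z≤n) h)}}

  2≤pow : ∀ i → 2 ≤ s ^ suc i
  2≤pow i = ≤-trans h (≡≤ (sym (*-identityʳ s)) (pow-mono {1} {suc i} (s≤s z≤n)))

  n≤2^n : ∀ n → n ≤ 2 ^ n
  n≤2^n zero = z≤n
  n≤2^n (suc n) = ≤≡ (+-mono-≤ (m^n>0 2 n) (n≤2^n n)) (cong (2 ^ n +_) (sym (+-identityʳ (2 ^ n))))

  con : ∀ n → Deg s n n
  con n = deg (≤-trans (n≤2^n n) (^-monoˡ-≤ n h))

  infixr 6 _⊕_
  infixr 7 _⊛_

  -- Both summands are at most `s ^ (i + j)`, and the resulting factor two is absorbed by one
  -- further factor `s`, because `2 ≤ s`.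
  _⊕_ : ∀ {i j a b} → Deg s i a → Deg s j b → Deg s (suc (i + j)) (a + b)
  _⊕_ {i} {j} (deg p) (deg q) = deg (≤-trans
    (+-mono-≤ (≤-trans p (pow-mono (m≤m+n i j)))
              (≤-trans q (≤≡ (pow-mono (m≤n+m j i)) (sym (+-identityʳ _)))))
    (*-monoˡ-≤ (s ^ (i + j)) h))

  plus : ∀ n {j b} → Deg s j b → Deg s (suc (n + j)) (n + b)
  plus n = con n ⊕_

  _⊛_ : ∀ {i j a b} → Deg s i a → Deg s j b → Deg s (i + j) (a * b)
  _⊛_ {i} {j} (deg p) (deg q) = deg (≤≡ (*-mono-≤ p q) (sym (^-distribˡ-+-* s i j)))

  sub : ∀ {i a b} → b ≤ a → Deg s i a → Deg s i b
  sub le (deg p) = deg (≤-trans le p)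

  pow-pow : ∀ {i j a} → Deg (s ^ i) j a → Deg s (i * j) a
  pow-pow {i} {j} (deg p) = deg (≤≡ p (^-*-assoc s i j))

-- The two degrees come before the size and the environment: they depend on the term only, and this
-- uniformity is what makes the bounds polynomial.
record Bounded {Γ A} (t : Tm poly Γ A) : Set where
  constructor bounded
  field
    {costDeg valDeg} : ℕ
    costB : ∀ s ρ → 2 ≤ s → WE s Γ ρ → Deg s costDeg (cost t ρ)
    valB : ∀ s ρ → 2 ≤ s → WE s Γ ρ → W (s ^ valDeg) A (⟦ t ⟧ᵗ ρ)

open Bounded

record BoundedA {Γ Δ} (ts : Args poly Γ Δ) : Set where
  constructor boundedA
  field
    {costDegA valDegA} : ℕ
    costBA : ∀ s ρ → 2 ≤ s → WE s Γ ρ → Deg s costDegA (costArgs ts ρ)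
    valBA : ∀ s ρ → 2 ≤ s → WE s Γ ρ → WE (s ^ valDegA) Δ (⟦ ts ⟧ᵃ ρ)

open BoundedA

loopCost-bound : ∀ {A B : Set} (Q : A → Set) {c : A → B → ℕ} {f z b n} →
  (∀ x zs → suc (length zs) ≤ n → Q x → All Q zs → c x (foldr f z zs) ≤ b) →
  ∀ ws zs → length ws + length zs ≤ n → All Q ws → All Q zs →
  loopCost c f z ws zs ≤ 1 + length ws * (7 + b)
loopCost-bound Q h [] zs l _ _ = ≤-refl
loopCost-bound Q {c} {f} {z} {b} {n} h (w ∷ ws) zs l (q ∷ qs) rs =
  ≤≡ (+-monoʳ-≤ 4 (+-mono-≤ (h w zs (m+n≤o⇒n≤o (length ws) l′) q rs)
            (+-monoʳ-≤ 3 (loopCost-bound Q h ws (w ∷ zs) l′ qs (q ∷ rs)))))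
          eq
  where
  l′ : length ws + suc (length zs) ≤ n
  l′ = subst (_≤ n) (sym (+-suc (length ws) (length zs))) l
  eq : 4 + (b + (3 + (1 + length ws * (7 + b)))) ≡ 1 + (7 + b + length ws * (7 + b))
  eq = cong (4 +_) (trans (cong (b +_) (+-comm 4 (length ws * (7 + b))))
         (trans (sym (+-assoc b _ 4)) (+-comm _ 4)))

revCost≤ : ∀ {A : Set} (xs : List A) → revCost xs ≤ 1 + length xs * 2
revCost≤ [] = ≤-refl
revCost≤ (x ∷ xs) = +-monoʳ-≤ 2 (revCost≤ xs)

All-reverse : ∀ {A : Set} {P : A → Set} {xs ys} → All P xs → All P ys → All P (xs ʳ++ ys)
All-reverse [] qs = qs
All-reverse (p ∷ ps) qs = All-reverse ps (p ∷ qs)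

module _ {s : ℕ} (h : 2 ≤ s) where

  ≤pow : ∀ i → s ≤ s ^ suc i
  ≤pow i = ≡≤ (sym (*-identityʳ s)) (pow-mono h {1} {suc i} (s≤s z≤n))

  up : ∀ Γ {ρ} i → WE s Γ ρ → WE (s ^ suc i) Γ ρ
  up Γ i = WE-mono (≤pow i) Γ

  widen : ∀ A {a i j} → i ≤ j → W (s ^ i) A a → W (s ^ j) A a
  widen A le = W-mono (pow-mono h le) A

  grown : ∀ A {a} i → W (suc (s ^ i)) A a → W (s ^ suc i) A a
  grown A i = W-mono (≤-trans (+-monoˡ-≤ (s ^ i) (m^n>0 s {{ℕ.>-nonZero (≤-trans (s≤s z≤n) h)}} i))
    (≡≤ ((cong (s ^ i +_) (sym (+-identityʳ (s ^ i))))) (*-monoˡ-≤ (s ^ i) h))) A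

look-W : ∀ {Γ A s ρ} (x : Γ ∋ A) → WE s Γ ρ → W s A (look x ρ)
look-W ze (w , _) = w
look-W (su x) (_ , w) = look-W x w

if≤ : ∀ b m n → (if b then m else n) ≤ m + n
if≤ false m n = m≤n+m n m
if≤ true m n = m≤m+n m n

if-elim : ∀ {A : Set} b (P : A → Set) {x y} → P x → P y → P (if b then x else y)
if-elim false P p q = q
if-elim true P p q = p

pw : ∀ s i → Deg s i (s ^ i)
pw s i = deg ≤-refl

flat : ∀ A s i j {a} → W ((s ^ i) ^ j) A a → W (s ^ (i * j)) A a
flat A s i j = subst (λ e → W e A _) (^-*-assoc s i j)

mutual
  -- Where a subterm runs in an environment extended by a computed value of measure `s ^ d`, its
  -- bound is applied at the size `s ^ suc d`, so degrees multiply; elsewhere they add.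
  bound : ∀ {Γ A} (t : Tm poly Γ A) → Bounded t
  bound {A = A} (var x) = bounded {valDeg = 1} (λ s ρ h w → con h 1)
    (λ s ρ h w → W-mono (≤pow h 0) A (look-W x w))
  bound {A = A} (ap₀ o) = bounded {valDeg = 1} (λ s ρ h w → con h 1) λ where
    (suc s) ρ h w → W-mono (≤pow h 0) A (Op₀.grow o s)
  bound {A = A} (ap₁ o t) = bounded {valDeg = suc (valDeg (bound t))}
    (λ s ρ h w → plus h 1 (_⊕_ h (costB (bound t) s ρ h w) (con h 1)))
    (λ s ρ h w → grown h A (valDeg (bound t)) (Op₁.grow o _ _ (valB (bound t) s ρ h w)))
  bound {A = A} (ap₂ {A = B} {C} o t u) = bounded {valDeg = suc (valDeg (bound t) + valDeg (bound u))}
    (λ s ρ h w → plus h 1 (_⊕_ h (costB (bound t) s ρ h w)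
      (plus h 3 (_⊕_ h (costB (bound u) s ρ h w) (con h 3)))))
    (λ s ρ h w → grown h A (valDeg (bound t) + valDeg (bound u)) (Op₂.grow o _ _ _
      (widen h B (m≤m+n (valDeg (bound t)) (valDeg (bound u))) (valB (bound t) s ρ h w))
      (widen h C (m≤n+m (valDeg (bound u)) (valDeg (bound t))) (valB (bound u) s ρ h w))))
  bound {A = A} (ite c t u) = bounded {valDeg = valDeg (bound t) + valDeg (bound u)}
    (λ s ρ h w → plus h 1 (_⊕_ h (costB (bound c) s ρ h w)
      (plus h 1 (sub h (if≤ (⟦ c ⟧ᵗ ρ) _ _)
        (_⊕_ h (costB (bound t) s ρ h w) (costB (bound u) s ρ h w))))))
    (λ s ρ h w → if-elim (⟦ c ⟧ᵗ ρ) (W (s ^ (valDeg (bound t) + valDeg (bound u))) A)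
      (widen h A (m≤m+n (valDeg (bound t)) (valDeg (bound u))) (valB (bound t) s ρ h w))
      (widen h A (m≤n+m (valDeg (bound u)) (valDeg (bound t))) (valB (bound u) s ρ h w)))
  bound {Γ} {B} (caseList {A = A} t u v) = bounded
    {valDeg = valDeg (bound u) + suc (valDeg (bound t)) * valDeg (bound v)}
    (λ s ρ h w → plus h 1 (_⊕_ h (costB (bound t) s ρ h w)
      (plus h 1 (sub h (elimList-cost s ρ h w (⟦ t ⟧ᵗ ρ) (valB (bound t) s ρ h w))
        (_⊕_ h (pw s (costDeg (bound u))) (_⊕_ h (con h 3)
          (_⊕_ h (pw s (suc d * costDeg (bound v))) (con h 1))))))))
    (λ s ρ h w → elimList-val s ρ h w (⟦ t ⟧ᵗ ρ) (valB (bound t) s ρ h w))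
    where
    d = valDeg (bound t)
    inner : ∀ {s} ρ → 2 ≤ s → WE s Γ ρ → ∀ {x xs} → W (s ^ d) (list A) (x ∷ xs) →
            WE (s ^ suc d) (A ∷ list A ∷ Γ) (x , xs , ρ)
    inner ρ h w (l , p ∷ ps) = widen h A (n≤1+n d) p ,
      widen h (list A) (n≤1+n d) (≤-trans (n≤1+n _) l , ps) , up h Γ d w
    elimList-cost : ∀ s ρ → (h : 2 ≤ s) → WE s Γ ρ → ∀ xs → W (s ^ d) (list A) xs →
      elimList (cost u ρ) (λ x xs → 3 + (cost v (x , xs , ρ) + 1)) xs
        ≤ s ^ costDeg (bound u) + (3 + (s ^ (suc d * costDeg (bound v)) + 1))
    elimList-cost s ρ h w [] p = ≤-trans (un (costB (bound u) s ρ h w)) (m≤m+n _ _)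
    elimList-cost s ρ h w (x ∷ xs) p = ≤-trans (+-monoʳ-≤ 3 (+-monoˡ-≤ 1 (un (pow-pow h {suc d}
      (costB (bound v) _ _ (2≤pow h d) (inner ρ h w p)))))) (m≤n+m _ _)
    elimList-val : ∀ s ρ → 2 ≤ s → WE s Γ ρ → ∀ xs → W (s ^ d) (list A) xs →
      W (s ^ (valDeg (bound u) + suc d * valDeg (bound v))) B
        (elimList (⟦ u ⟧ᵗ ρ) (λ x xs → ⟦ v ⟧ᵗ (x , xs , ρ)) xs)
    elimList-val s ρ h w [] p = widen h B (m≤m+n (valDeg (bound u)) (suc d * valDeg (bound v))) (valB (bound u) s ρ h w)
    elimList-val s ρ h w (x ∷ xs) p = widen h B (m≤n+m (suc d * valDeg (bound v)) (valDeg (bound u)))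
      (flat B s (suc d) (valDeg (bound v)) (valB (bound v) _ _ (2≤pow h d) (inner ρ h w p)))
  bound {Γ} {B} (caseTree {A = A} t u v) = bounded
    {valDeg = suc (valDeg (bound t)) * valDeg (bound u) + suc (valDeg (bound t)) * valDeg (bound v)}
    (λ s ρ h w → plus h 1 (_⊕_ h (costB (bound t) s ρ h w)
      (plus h 1 (sub h (elim-cost s ρ h w (⟦ t ⟧ᵗ ρ) (valB (bound t) s ρ h w))
        (_⊕_ h (plus h 3 (_⊕_ h (pw s (suc d * costDeg (bound u))) (con h 1)))
          (plus h 3 (_⊕_ h (pw s (suc d * costDeg (bound v))) (con h 1))))))))
    (λ s ρ h w → elim-val s ρ h w (⟦ t ⟧ᵗ ρ) (valB (bound t) s ρ h w))
    where
    d = valDeg (bound t)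
    innerˡ : ∀ {s} ρ → 2 ≤ s → WE s Γ ρ → ∀ {a} → W (s ^ d) A a → WE (s ^ suc d) (A ∷ Γ) (a , ρ)
    innerˡ ρ h w p = widen h A (n≤1+n d) p , up h Γ d w
    innerⁿ : ∀ {s} ρ → 2 ≤ s → WE s Γ ρ → ∀ {l r} → W (s ^ d) (tree A) (node l r) →
             WE (s ^ suc d) (tree A ∷ tree A ∷ Γ) (l , r , ρ)
    innerⁿ ρ h w {l} {r} (p , q) = widen h (tree A) {l} (n≤1+n d) p ,
      widen h (tree A) {r} (n≤1+n d) q , up h Γ d w
    elim-cost : ∀ s ρ → (h : 2 ≤ s) → WE s Γ ρ → ∀ t → W (s ^ d) (tree A) t →
      elimTree (λ a → 3 + (cost u (a , ρ) + 1)) (λ l r → 3 + (cost v (l , r , ρ) + 1)) t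
        ≤ (3 + (s ^ (suc d * costDeg (bound u)) + 1)) + (3 + (s ^ (suc d * costDeg (bound v)) + 1))
    elim-cost s ρ h w (leaf a) p = ≤-trans (+-monoʳ-≤ 3 (+-monoˡ-≤ 1 (un (pow-pow h {suc d}
      (costB (bound u) _ _ (2≤pow h d) (innerˡ ρ h w p)))))) (m≤m+n _ _)
    elim-cost s ρ h w (node l r) p = ≤-trans (+-monoʳ-≤ 3 (+-monoˡ-≤ 1 (un (pow-pow h {suc d}
      (costB (bound v) _ _ (2≤pow h d) (innerⁿ ρ h w {l} {r} p))))))
      (m≤n+m _ (3 + (s ^ (suc d * costDeg (bound u)) + 1)))
    elim-val : ∀ s ρ → (h : 2 ≤ s) → WE s Γ ρ → ∀ t → W (s ^ d) (tree A) t →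
      W (s ^ (suc d * valDeg (bound u) + suc d * valDeg (bound v))) B
        (elimTree (λ a → ⟦ u ⟧ᵗ (a , ρ)) (λ l r → ⟦ v ⟧ᵗ (l , r , ρ)) t)
    elim-val s ρ h w (leaf a) p = widen h B (m≤m+n (suc d * valDeg (bound u)) (suc d * valDeg (bound v)))
      (flat B s (suc d) (valDeg (bound u)) (valB (bound u) _ _ (2≤pow h d) (innerˡ ρ h w p)))
    elim-val s ρ h w (node l r) p = widen h B (m≤n+m (suc d * valDeg (bound v)) (suc d * valDeg (bound u)))
      (flat B s (suc d) (valDeg (bound v))
        (valB (bound v) _ _ (2≤pow h d) (innerⁿ ρ h w {l} {r} p)))
  bound {Γ} {B} (fold {A = A} l z b (foldBound k fb)) = bounded {valDeg = suc (valDeg (bound l)) * k}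
    (λ s ρ h w → plus h 1 (_⊕_ h (costB (bound l) s ρ h w)
      (plus h 3 (_⊕_ h
        (sub h (revCost≤ (⟦ l ⟧ᵗ ρ)) (plus h 1 (_⊛_ h (len s ρ h w) (con h 2))))
        (plus h 3 (_⊕_ h (costB (bound z) s ρ h w)
          (plus h 1 (_⊕_ h
            (sub h (loop s ρ h w) (plus h 1 (_⊛_ h (len s ρ h w)
              (plus h 7 (pw s (e * costDeg (bound b)))))))
            (con h 1)))))))))
    (λ s ρ h w → flat B s (suc d) k
      (fb (s ^ suc d) ρ _ (2≤pow h d) (up h Γ d w) (list′ s ρ h w)))
    where
    d = valDeg (bound l)
    -- Element and environment of the loop body have measure at most `s ^ suc d`, and the
    -- accumulator at most the `k`-th power of that. The `suc k`-th power covers all three and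
    -- equals `s ^ e`.
    e = suc d * suc k
    len : ∀ s ρ → 2 ≤ s → WE s Γ ρ → Deg s d (length (⟦ l ⟧ᵗ ρ))
    len s ρ h w = deg (proj₁ (valB (bound l) s ρ h w))
    list′ : ∀ s ρ → 2 ≤ s → WE s Γ ρ → W (s ^ suc d) (list A) (⟦ l ⟧ᵗ ρ)
    list′ s ρ h w = widen h (list A) (n≤1+n d) (valB (bound l) s ρ h w)
    loop : ∀ s ρ → (h : 2 ≤ s) → WE s Γ ρ →
      loopCost (λ x a → cost b (x , a , ρ)) (λ x a → ⟦ b ⟧ᵗ (x , a , ρ)) (⟦ z ⟧ᵗ ρ) (reverse (⟦ l ⟧ᵗ ρ)) []
        ≤ 1 + length (⟦ l ⟧ᵗ ρ) * (7 + s ^ (e * costDeg (bound b)))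
    loop s ρ h w = ≤-trans
      (loopCost-bound (W (s ^ suc d) A) {n = s ^ suc d} body (reverse (⟦ l ⟧ᵗ ρ)) []
        (subst (_≤ s ^ suc d) (sym (trans (+-identityʳ _) (Listₚ.length-reverse (⟦ l ⟧ᵗ ρ)))) (proj₁ (list′ s ρ h w)))
        (All-reverse (proj₂ (list′ s ρ h w)) []) [])
      (≤-reflexive (cong (λ n → 1 + n * (7 + s ^ (e * costDeg (bound b)))) (Listₚ.length-reverse (⟦ l ⟧ᵗ ρ))))
      where
      2≤t = 2≤pow h d
      body : ∀ x zs → suc (length zs) ≤ s ^ suc d → W (s ^ suc d) A x → All (W (s ^ suc d) A) zs → _
      body x zs l p ps = un (pow-pow h {e} (subst (λ n → Deg n (costDeg (bound b)) (cost b (x , foldr (λ x a → ⟦ b ⟧ᵗ (x , a , ρ)) (⟦ z ⟧ᵗ ρ) zs , ρ))) (^-*-assoc s (suc d) (suc k))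
        (costB (bound b) _ _ (2≤pow 2≤t k)
          ( W-mono (≤pow 2≤t k) A p
          , widen 2≤t B (n≤1+n k) (fb _ ρ zs 2≤t (up h Γ d w) (≤-trans (n≤1+n _) l , ps))
          , up 2≤t Γ k (up h Γ d w)))))
  bound {Γ} {B} (letin {A = A} t u) = bounded {valDeg = suc (valDeg (bound t)) * valDeg (bound u)}
    (λ s ρ h w → plus h 1 (_⊕_ h (costB (bound t) s ρ h w)
      (plus h 3 (_⊕_ h
        (pow-pow h {suc d} (costB (bound u) _ _ (2≤pow h d) (inner ρ h w))) (con h 1)))))
    (λ s ρ h w → flat B s (suc d) (valDeg (bound u))
      (valB (bound u) _ _ (2≤pow h d) (inner ρ h w)))
    where
    d = valDeg (bound t)
    inner : ∀ {s} ρ → 2 ≤ s → WE s Γ ρ → WE (s ^ suc d) (A ∷ Γ) (⟦ t ⟧ᵗ ρ , ρ)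
    inner ρ h w = widen h A (n≤1+n d) (valB (bound t) _ ρ h w) , up h Γ d w
  bound (skip t) = bounded {valDeg = valDeg (bound t)}
    (λ { s (a , _ , ρ) h (v , _ , w) → plus h 5 (_⊕_ h (costB (bound t) s (a , ρ) h (v , w)) (con h 3)) })
    (λ { s (a , _ , ρ) h (v , _ , w) → valB (bound t) s (a , ρ) h (v , w) })
  bound {A = A} (call poly⊑ f g ok ts) = bounded {valDeg = suc (valDegA (boundA ts)) * valDeg (bound f)}
    (λ s ρ h w → plus h 3 (_⊕_ h (costBA (boundA ts) s ρ h w)
      (plus h 7 (_⊕_ h (pow-pow h {suc (valDegA (boundA ts))}
        (costB (bound f) _ _ (2≤pow h (valDegA (boundA ts))) (args s ρ h w))) (con h 3)))))
    (λ s ρ h w → flat A s (suc (valDegA (boundA ts))) (valDeg (bound f))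
      (subst (W _ A) (ok _) (valB (bound f) _ _ (2≤pow h (valDegA (boundA ts))) (args s ρ h w))))
    where
    args : ∀ s ρ → 2 ≤ s → WE s _ ρ → WE (s ^ suc (valDegA (boundA ts))) _ (⟦ ts ⟧ᵃ ρ)
    args s ρ h w = WE-mono (pow-mono h (n≤1+n (valDegA (boundA ts)))) _ (valBA (boundA ts) s ρ h w)

  boundA : ∀ {Γ Δ} (ts : Args poly Γ Δ) → BoundedA ts
  boundA [] = boundedA {valDegA = 0} (λ s ρ h w → con h 1) (λ s ρ h w → tt)
  boundA (_∷_ {A = A} t ts) = boundedA {valDegA = valDeg (bound t) + valDegA (boundA ts)}
    (λ s ρ h w → plus h 1 (_⊕_ h (costBA (boundA ts) s ρ h w)
      (plus h 1 (_⊕_ h (costB (bound t) s ρ h w) (con h 1)))))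
    (λ s ρ h w → widen h A (m≤m+n (valDeg (bound t)) (valDegA (boundA ts))) (valB (bound t) s ρ h w) ,
      WE-mono (pow-mono h (m≤n+m (valDegA (boundA ts)) (valDeg (bound t)))) _ (valBA (boundA ts) s ρ h w))

module _ {Γ A B} {z : Tm poly Γ B} {b : Tm poly (A ∷ B ∷ Γ) B} where

  keepBound : ∀ c →
    (∀ s ρ → 2 ≤ s → WE s Γ ρ → W (s ^ c) B (⟦ z ⟧ᵗ ρ)) →
    (∀ s ρ x a → 2 ≤ s → WE s Γ ρ → W s A x → W (s ^ c) B a → W (s ^ c) B (⟦ b ⟧ᵗ (x , a , ρ))) →
    FoldBound z b
  keepBound c base step = foldBound c loop
    where
    loop : ∀ s ρ xs → 2 ≤ s → WE s Γ ρ → W s (list A) xs → _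
    loop s ρ [] h w _ = base s ρ h w
    loop s ρ (x ∷ xs) h w (l , p ∷ ps) =
      step s ρ x _ h w p (loop s ρ xs h w (≤-trans (n≤1+n _) l , ps))

boolBound : ∀ {Γ A} {z : Tm poly Γ bool} {b : Tm poly (A ∷ bool ∷ Γ) bool} → FoldBound z b
boolBound = foldBound 0 (λ _ _ _ _ _ _ → tt)

-- For loops that add at most `s ^ c` in each of at most `s` rounds: since `2 ≤ s`, the factor
-- `suc n` is at most `s * s`.
steps-bound : ∀ {s n c l} → 2 ≤ s → n ≤ s → l ≤ suc n * s ^ c → l ≤ s ^ (2 + c)
steps-bound {s} {n} {c} h n≤s l≤ = ≤-trans l≤ (≤-trans
  (*-monoˡ-≤ (s ^ c) {suc n} {s * s} (≤-trans (s≤s n≤s) (≤-trans (+-monoˡ-≤ s (≤-trans (s≤s z≤n) h))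
    (≡≤ ((cong (s +_) (sym (+-identityʳ s)))) (*-monoˡ-≤ s h)))))
  (≤-reflexive (*-assoc s s (s ^ c))))

natBound : ∀ {Γ A} {z : Tm poly Γ nat} {b : Tm poly (A ∷ nat ∷ Γ) nat} c →
  (∀ s ρ → 2 ≤ s → WE s Γ ρ → ⟦ z ⟧ᵗ ρ ≤ s ^ c) →
  (∀ s ρ x a → 2 ≤ s → WE s Γ ρ → W s A x → ⟦ b ⟧ᵗ (x , a , ρ) ≤ s ^ c + a) →
  FoldBound z b
natBound {Γ} {A} {z} {b} c base step = foldBound (2 + c)
  (λ s ρ xs h w ws → steps-bound {n = length xs} {c} h (proj₁ ws) (loop s ρ xs h w (proj₂ ws)))
  where
  loop : ∀ s ρ xs → 2 ≤ s → WE s Γ ρ → All (W s A) xs →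
         foldr (λ x a → ⟦ b ⟧ᵗ (x , a , ρ)) (⟦ z ⟧ᵗ ρ) xs ≤ suc (length xs) * s ^ c
  loop s ρ [] h w _ = ≤≡ (base s ρ h w) (sym (*-identityˡ _))
  loop s ρ (x ∷ xs) h w (p ∷ ps) = ≤-trans (step s ρ x _ h w p) (+-monoʳ-≤ (s ^ c) (loop s ρ xs h w ps))

listBound : ∀ {Γ A C} {z : Tm poly Γ (list C)} {b : Tm poly (A ∷ list C ∷ Γ) (list C)} c →
  (∀ s ρ → 2 ≤ s → WE s Γ ρ → W (s ^ c) (list C) (⟦ z ⟧ᵗ ρ)) →
  (∀ s ρ x a → 2 ≤ s → WE s Γ ρ → W s A x → All (W (s ^ c) C) a →
    length (⟦ b ⟧ᵗ (x , a , ρ)) ≤ s ^ c + length a × All (W (s ^ c) C) (⟦ b ⟧ᵗ (x , a , ρ))) →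
  FoldBound z b
listBound {Γ} {A} {C} {z} {b} c base step = foldBound (2 + c)
  (λ s ρ xs h w ws → let (l , p) = loop s ρ xs h w (proj₂ ws) in
    steps-bound {n = length xs} {c} h (proj₁ ws) l , W-monos (pow-mono h (m≤n+m c 2)) C p)
  where
  loop : ∀ s ρ xs → 2 ≤ s → WE s Γ ρ → All (W s A) xs →
         let ys = foldr (λ x a → ⟦ b ⟧ᵗ (x , a , ρ)) (⟦ z ⟧ᵗ ρ) xs in
         length ys ≤ suc (length xs) * s ^ c × All (W (s ^ c) C) ys
  loop s ρ [] h w _ =
    ≤≡ (proj₁ (base s ρ h w)) (sym (*-identityˡ _)) , proj₂ (base s ρ h w)
  loop s ρ (x ∷ xs) h w (p ∷ ps) = let (l , q) = loop s ρ xs h w ps ; (l′ , q′) = step s ρ x _ h w p q in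
    ≤-trans l′ (+-monoʳ-≤ (s ^ c) l) , q′

-- Functions on lists, numbers, trees and polynomials with polynomial running time

pattern v0 = var ze
pattern v1 = var (su ze)
pattern v2 = var (su (su ze))
pattern v3 = var (su (su (su ze)))
pattern v4 = var (su (su (su (su ze))))
pattern su⁵ x = su (su (su (su (su x))))
pattern v5 = var (su⁵ ze)
pattern v6 = var (su⁵ (su ze))
pattern v7 = var (su⁵ (su (su ze)))
pattern v8 = var (su⁵ (su (su (su ze))))
pattern v9 = var (su⁵ (su (su (su (su ze)))))
pattern v10 = var (su⁵ (su⁵ ze))
pattern v11 = var (su⁵ (su⁵ (su ze)))

module _ {m : Mode} {Γ : List Ty} where

  ff tt′ : Tm m Γ bool
  ff = ap₀ (op₀ nil false (λ _ → refl) (λ _ → tt))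
  tt′ = ap₀ (op₀ (cons nil nil) true (λ _ → refl) (λ _ → tt))

  zer : Tm m Γ nat
  zer = ap₀ (op₀ nil 0 (λ _ → refl) (λ _ → z≤n))

  suk : Tm m Γ nat → Tm m Γ nat
  suk = ap₁ (op₁ (cons nil) suc (λ σ x a eq → cong (nil ∙_) eq) (λ s a w → s≤s w))

  pre : Tm m Γ nat → Tm m Γ nat
  pre = ap₁ (op₁ tl ℕ.pred (λ { σ x zero eq → cong second eq ; σ x (suc a) eq → cong second eq })
                 (λ s a w → ≤-trans pred[n]≤n (≤-trans w (n≤1+n s))))

  -- `false` is coded by `nil`, so a number and the list of its ticks have the same code, and the
  -- conversion is the identity expression.
  ticks : Tm m Γ nat → Tm m Γ (list bool)
  ticks = ap₁ (op₁ (λ x → x) (λ n → replicate n false) (λ σ x a eq → trans eq (same a))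
                 (λ s a w → ≡≤ (length-replicate a) (≤-trans w (n≤1+n s)) , trivial (suc s) (replicate a false)))
    where
    same : ∀ n → unary n ≡ encodeList bit (replicate n false)
    same zero = refl
    same (suc n) = cong (nil ∙_) (same n)
    trivial : ∀ s xs → All (W s bool) xs
    trivial s [] = []
    trivial s (x ∷ xs) = tt ∷ trivial s xs

  module _ {A : Ty} where

    emp : Tm m Γ (list A)
    emp = ap₀ (op₀ nil [] (λ _ → refl) (λ _ → z≤n , []))

    infixr 5 _◂_
    _◂_ : Tm m Γ A → Tm m Γ (list A) → Tm m Γ (list A)
    _◂_ = ap₂ (op₂ cons _∷_ (λ σ x y a b p q → cong₂ _∙_ p q)
                   (λ s a b w (l , v) → s≤s l , W-mono (n≤1+n s) A w ∷ W-monos (n≤1+n s) A v))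

    lf : Tm m Γ A → Tm m Γ (tree A)
    lf = ap₁ (op₁ (cons nil) leaf (λ σ x a eq → cong (nil ∙_) eq) (λ s a → W-mono (n≤1+n s) A))

    nd : Tm m Γ (tree A) → Tm m Γ (tree A) → Tm m Γ (tree A)
    nd = ap₂ (op₂ (λ x y → cons (cons nil nil) (cons x y)) node
                  (λ σ x y a b p q → cong (bit true ∙_) (cong₂ _∙_ p q))
                  (λ s a b w v → W-monot (n≤1+n s) A a w , W-monot (n≤1+n s) A b v))

  module _ {A B : Ty} where

    infixr 6 _،_
    _،_ : Tm m Γ A → Tm m Γ B → Tm m Γ (A ⊗ B)
    _،_ = ap₂ (op₂ cons _,_ (λ σ x y a b p q → cong₂ _∙_ p q)
                   (λ s a b w v → W-mono (n≤1+n s) A w , W-mono (n≤1+n s) B v))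

    π₁ : Tm m Γ (A ⊗ B) → Tm m Γ A
    π₁ = ap₁ (op₁ hd proj₁ (λ σ x a eq → cong first eq) (λ s a (w , _) → W-mono (n≤1+n s) A w))

    π₂ : Tm m Γ (A ⊗ B) → Tm m Γ B
    π₂ = ap₁ (op₁ tl proj₂ (λ σ x a eq → cong second eq) (λ s a (_ , w) → W-mono (n≤1+n s) B w))

record Fn (Δ : List Ty) (A : Ty) : Set where
  constructor fn
  field
    term : Tm poly Δ A
    sem : Env Δ → El A
    correct : ∀ ρ → ⟦ term ⟧ᵗ ρ ≡ sem ρ

-- Opaque, so that the cost of a call is not unfolded by the type checker.
opaque
  sealed : ∀ {Δ A} → Tm poly Δ A → Tm poly Δ A
  sealed t = t

  sealed-sem : ∀ {Δ A} (t : Tm poly Δ A) ρ → ⟦ sealed t ⟧ᵗ ρ ≡ ⟦ t ⟧ᵗ ρ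
  sealed-sem t ρ = refl

infix 8 _$$_
_$$_ : ∀ {m Γ Δ A} → Fn Δ A → Args m Γ Δ → Tm m Γ A
fn t g ok $$ ts = call poly⊑ (sealed t) g (λ ρ → trans (sealed-sem t ρ) (ok ρ)) ts

pattern ⟪_⟫ a = a ∷ []
pattern ⟪_⨟_⟫ a b = a ∷ b ∷ []
pattern ⟪_⨟_⨟_⟫ a b c = a ∷ b ∷ c ∷ []
pattern ⟪_⨟_⨟_⨟_⟫ a b c d = a ∷ b ∷ c ∷ d ∷ []

mapL : ∀ {A B : Set} → (A → B) → List A → List B
mapL g = foldr (λ x a → g x ∷ a) []

anyL allL xorL : ∀ {A : Set} → (A → Bool) → List A → Bool
anyL g = foldr (λ x a → g x ∨ a) false
allL g = foldr (λ x a → g x ∧ a) true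
xorL g = foldr (λ x a → g x xor a) false

tailL : ∀ {A : Set} → List A → List A
tailL = elimList [] (λ _ xs → xs)

nth : ∀ {A : Set} → A → ℕ → List A → A
nth d _ [] = d
nth d zero (x ∷ _) = x
nth d (suc i) (_ ∷ xs) = nth d i xs

at : List (List Bool) → ℕ → ℕ → Bool
at M u v = nth false v (nth [] u M)

range : ℕ → List ℕ
range zero = []
range (suc n) = 0 ∷ mapL suc (range n)

child : ∀ {A : Set} → Bool → Tree A → Tree A
child k = elimTree leaf (λ l r → if k then r else l)

-- The last bit of the key decides at the root of the tree and the first one just above the leaves;
-- the tables are built from the leaves in the matching order.
descend : ∀ {A : Set} → Tree A → List Bool → Tree A
descend t key = foldr child t key

content : ∀ {A : Set} → Tree (List A) → List A
content = elimTree id (λ _ _ → [])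

andF orF xorF : Fn (bool ∷ bool ∷ []) bool
andF = fn (ite v0 v1 ff) (λ (a , b , _) → a ∧ b) (λ { (false , _) → refl ; (true , _) → refl })
orF = fn (ite v0 tt′ v1) (λ (a , b , _) → a ∨ b) (λ { (false , _) → refl ; (true , _) → refl })
xorF = fn (ite v0 (ite v1 ff tt′) v1) (λ (a , b , _) → a xor b)
  (λ { (false , _) → refl ; (true , false , _) → refl ; (true , true , _) → refl })

notF : Fn (bool ∷ []) bool
notF = fn (ite v0 ff tt′) (λ (a , _) → not a) (λ { (false , _) → refl ; (true , _) → refl })

infixr 6 _∧′_ _xor′_
infixr 5 _∨′_
_∧′_ _∨′_ _xor′_ : ∀ {m Γ} → Tm m Γ bool → Tm m Γ bool → Tm m Γ bool
a ∧′ b = andF $$ ⟪ a ⨟ b ⟫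
a ∨′ b = orF $$ ⟪ a ⨟ b ⟫
a xor′ b = xorF $$ ⟪ a ⨟ b ⟫

¬′ : ∀ {m Γ} → Tm m Γ bool → Tm m Γ bool
¬′ a = notF $$ ⟪ a ⟫

-- The body of these loops sees the element, but not the accumulator.
module _ {Γ A} (l : Tm poly Γ (list A)) where

  mapT : ∀ {B} → Tm poly (A ∷ Γ) B → Tm poly Γ (list B)
  mapT {B} b = fold l emp (skip b ◂ v1) (listBound (valDeg (bound b)) (λ s ρ h w → z≤n , [])
    (λ s ρ x a h w p ps → +-monoˡ-≤ (length a) (m^n>0 s {{ℕ.>-nonZero (≤-trans (s≤s z≤n) h)}} (valDeg (bound b))) ,
      valB (bound b) s (x , ρ) h (p , w) ∷ ps))

  anyT xorT : Tm poly (A ∷ Γ) bool → Tm poly Γ bool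
  anyT b = fold l ff (skip b ∨′ v1) boolBound
  xorT b = fold l ff (skip b xor′ v1) boolBound

tailF : ∀ {A} → Fn (list A ∷ []) (list A)
tailF = fn (caseList v0 emp v1) (λ (xs , _) → tailL xs) (λ _ → refl)

tailL-W : ∀ {s A} xs → W s (list A) xs → W s (list A) (tailL xs)
tailL-W [] w = w
tailL-W (x ∷ xs) (l , p ∷ ps) = ≤-trans (n≤1+n _) l , ps

loose : ∀ A {s a} → 2 ≤ s → W s A a → W (s ^ 1) A a
loose A h = W-mono (≤pow h 0) A

dropF : ∀ {A} → Fn (nat ∷ list A ∷ []) (list A)
dropF {A} = fn
  (fold (ticks v0) v1 (tailF $$ ⟪ v1 ⟫)
    (keepBound 1 (λ s ρ h (_ , w , _) → loose (list A) h w) (λ s ρ x a h w p q → tailL-W a q)))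
  (λ (i , xs , _) → List.drop i xs) (λ (i , xs , _) → eq i xs)
  where
  eq : ∀ i xs → foldr (λ _ → tailL) xs (replicate i false) ≡ List.drop i xs
  eq zero xs = refl
  eq (suc i) xs = trans (cong tailL (eq i xs)) (tail-drop i xs)
    where
    tail-drop : ∀ {B : Set} i (xs : List B) → tailL (List.drop i xs) ≡ List.drop (suc i) xs
    tail-drop zero [] = refl
    tail-drop zero (_ ∷ _) = refl
    tail-drop (suc i) [] = refl
    tail-drop (suc i) (_ ∷ xs) = tail-drop i xs

nthF : ∀ {A} → Fn (A ∷ nat ∷ list A ∷ []) A
nthF = fn (caseList (dropF $$ ⟪ v1 ⨟ v2 ⟫) v0 v0) (λ (d , i , xs , _) → nth d i xs) (λ (d , i , xs , _) → eq d i xs)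
  where
  eq : ∀ {A : Set} d i (xs : List A) → elimList d (λ x _ → x) (List.drop i xs) ≡ nth d i xs
  eq d zero [] = refl
  eq d zero (_ ∷ _) = refl
  eq d (suc i) [] = refl
  eq d (suc i) (_ ∷ xs) = eq d i xs

nthB′ : ∀ {m Γ} → Tm m Γ nat → Tm m Γ (list bool) → Tm m Γ bool
nthB′ i xs = nthF $$ ⟪ ff ⨟ i ⨟ xs ⟫

atF : Fn (list (list bool) ∷ nat ∷ nat ∷ []) bool
atF = fn (nthB′ v2 (nthF $$ ⟪ emp ⨟ v1 ⨟ v0 ⟫)) (λ (M , u , v , _) → at M u v) (λ _ → refl)

monusF : Fn (nat ∷ nat ∷ []) nat
monusF = fn
  (fold (ticks v1) v0 (pre v1)
    (keepBound 1 (λ s ρ h (w , _) → loose nat h w) (λ s ρ x a h w p q → ≤-trans pred[n]≤n q)))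
  (λ (i , j , _) → i ∸ j) (λ (i , j , _) → eq i j)
  where
  eq : ∀ i j → foldr (λ _ → ℕ.pred) i (replicate j false) ≡ i ∸ j
  eq i zero = refl
  eq i (suc j) = trans (cong ℕ.pred (eq i j)) (pred[m∸n]≡m∸[1+n] i j)

ltF : Fn (nat ∷ nat ∷ []) bool
ltF = fn (fold (ticks (monusF $$ ⟪ v1 ⨟ v0 ⟫)) ff tt′ boolBound) (λ (i , j , _) → i <ᵇ j) (λ (i , j , _) → eq i j)
  where
  eq : ∀ i j → foldr (λ _ _ → true) false (replicate (j ∸ i) false) ≡ (i <ᵇ j)
  eq zero zero = refl
  eq zero (suc j) = refl
  eq (suc i) zero = refl
  eq (suc i) (suc j) = eq i j

eqF : Fn (nat ∷ nat ∷ []) bool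
eqF = fn (ite (ltF $$ ⟪ v0 ⨟ v1 ⟫) ff (¬′ (ltF $$ ⟪ v1 ⨟ v0 ⟫))) (λ (i , j , _) → i ≡ᵇ j) (λ (i , j , _) → eq i j)
  where
  eq : ∀ i j → (if i <ᵇ j then false else not (j <ᵇ i)) ≡ (i ≡ᵇ j)
  eq zero zero = refl
  eq zero (suc j) = refl
  eq (suc i) zero = refl
  eq (suc i) (suc j) = eq i j

addF : Fn (nat ∷ nat ∷ []) nat
addF = fn
  (fold (ticks v0) v1 (suk v1)
    (natBound 1 (λ s ρ h (_ , w , _) → loose nat h w)
      (λ s ρ x a h w p → +-monoˡ-≤ a (≤-trans (≤-trans (s≤s z≤n) h) (≤pow h 0)))))
  (λ (i , j , _) → i + j) (λ (i , j , _) → eq i j)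
  where
  eq : ∀ i j → foldr (λ _ → suc) j (replicate i false) ≡ i + j
  eq zero j = refl
  eq (suc i) j = cong suc (eq i j)

mulF : Fn (nat ∷ nat ∷ []) nat
mulF = fn
  (fold (ticks v0) zer (addF $$ ⟪ v3 ⨟ v1 ⟫)
    (natBound 1 (λ s ρ h _ → z≤n) (λ s ρ x a h (_ , w , _) p → +-monoˡ-≤ a (loose nat h w))))
  (λ (i , j , _) → i * j) (λ (i , j , _) → eq i j)
  where
  eq : ∀ i j → foldr (λ _ → j +_) 0 (replicate i false) ≡ i * j
  eq zero j = refl
  eq (suc i) j = cong (j +_) (eq i j)

infixl 6 _+′_
infixl 7 _*′_
_+′_ _*′_ : ∀ {m Γ} → Tm m Γ nat → Tm m Γ nat → Tm m Γ nat
a +′ b = addF $$ ⟪ a ⨟ b ⟫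
a *′ b = mulF $$ ⟪ a ⨟ b ⟫

minF : Fn (nat ∷ nat ∷ []) nat
minF = fn (monusF $$ ⟪ v0 ⨟ monusF $$ ⟪ v0 ⨟ v1 ⟫ ⟫) (λ (i , j , _) → i ⊓ j) (λ (i , j , _) → eq i j)
  where
  eq : ∀ i j → i ∸ (i ∸ j) ≡ i ⊓ j
  eq i j with ≤-total i j
  ... | inj₁ i≤j = trans (cong (i ∸_) (m≤n⇒m∸n≡0 i≤j)) (sym (m≤n⇒m⊓n≡m i≤j))
  ... | inj₂ j≤i = trans (m∸[m∸n]≡n j≤i) (sym (m≥n⇒m⊓n≡n j≤i))

lenF : ∀ {A} → Fn (list A ∷ []) nat
lenF = fn
  (fold v0 zer (suk v1)
    (natBound 0 (λ s ρ h _ → z≤n) (λ s ρ x a h w p → ≤-refl)))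
  (λ (xs , _) → length xs) (λ (xs , _) → eq xs)
  where
  eq : ∀ {A : Set} (xs : List A) → foldr (λ _ → suc) 0 xs ≡ length xs
  eq [] = refl
  eq (_ ∷ xs) = cong suc (eq xs)

rangeF : Fn (nat ∷ []) (list nat)
rangeF = fn
  (fold (ticks v0) emp (zer ◂ mapT v1 (suk v0)) (foldBound 1 bnd))
  (λ (n , _) → range n) (λ (n , _) → eq n)
  where
  f : Bool → List ℕ → List ℕ
  f _ a = 0 ∷ mapL suc a
  eq : ∀ n → foldr f [] (replicate n false) ≡ range n
  eq zero = refl
  eq (suc n) = cong (λ a → 0 ∷ mapL suc a) (eq n)
  lens : ∀ (xs : List ℕ) → length (mapL suc xs) ≡ length xs
  lens [] = refl
  lens (x ∷ xs) = cong suc (lens xs)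
  sucs : ∀ {n xs} → All (_≤ n) xs → All (_≤ suc n) (mapL suc xs)
  sucs [] = []
  sucs (p ∷ ps) = s≤s p ∷ sucs ps
  go′ : ∀ xs → length (foldr f [] xs) ≤ length xs × All (_≤ length xs) (foldr f [] xs)
  go′ [] = z≤n , []
  go′ (x ∷ xs) = s≤s (≡≤ (lens (foldr f [] xs)) (proj₁ (go′ xs))) , z≤n ∷ sucs (proj₂ (go′ xs))
  bnd : ∀ s ρ xs → 2 ≤ s → WE s (nat ∷ []) ρ → W s (list bool) xs → W (s ^ 1) (list nat) (foldr f [] xs)
  bnd s ρ xs h w (l , _) = loose (list nat) h
    (≤-trans (proj₁ (go′ xs)) l , W-monos l nat (proj₂ (go′ xs)))

appendF : ∀ {A} → Fn (list A ∷ list A ∷ []) (list A)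
appendF {A} = fn
  (fold v0 v1 (v0 ◂ v1)
    (listBound 1 (λ s ρ h (_ , w , _) → loose (list A) h w)
      (λ s ρ x a h w p ps → +-monoˡ-≤ (length a) (≤-trans (≤-trans (s≤s z≤n) h) (≤pow h 0)) , loose A h p ∷ ps)))
  (λ (xs , ys , _) → xs ++ ys) (λ (xs , ys , _) → eq xs ys)
  where
  eq : ∀ {A : Set} (xs ys : List A) → foldr _∷_ ys xs ≡ xs ++ ys
  eq [] ys = refl
  eq (x ∷ xs) ys = cong (x ∷_) (eq xs ys)

infixr 5 _++′_
_++′_ : ∀ {m Γ A} → Tm m Γ (list A) → Tm m Γ (list A) → Tm m Γ (list A)
a ++′ b = appendF $$ ⟪ a ⨟ b ⟫

reverseF : ∀ {A} → Fn (list A ∷ []) (list A)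
reverseF {A} = fn
  (fold v0 emp (v1 ++′ v0 ◂ emp)
    (listBound 1 (λ s ρ h w → z≤n , [])
      (λ s ρ x a h w p ps →
        ≡≤ ((trans (length-++ a) (+-comm (length a) 1)))
          (+-monoˡ-≤ (length a) (≤-trans (≤-trans (s≤s z≤n) h) (≤pow h 0))) ,
        snoc ps (loose A h p))))
  (λ (xs , _) → reverse xs) (λ (xs , _) → eq xs)
  where
  snoc : ∀ {A : Set} {P : A → Set} {xs x} → All P xs → P x → All P (xs ++ x ∷ [])
  snoc [] q = q ∷ []
  snoc (p ∷ ps) q = p ∷ snoc ps q
  eq : ∀ {A : Set} (xs : List A) → foldr (λ x a → a ++ x ∷ []) [] xs ≡ reverse xs
  eq [] = refl
  eq (x ∷ xs) = trans (cong (_++ x ∷ []) (eq xs)) (sym (Listₚ.unfold-reverse x xs))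

descendF : ∀ {A} → Fn (tree A ∷ list bool ∷ []) (tree A)
descendF {A} = fn
  (fold v1 v0 (caseTree v1 (lf v0) (ite v2 v1 v0))
    (keepBound 1 (λ s (t , _) h (w , _) → loose (tree A) {a = t} h w) (λ s ρ k t h w p q → childW k t q)))
  (λ (t , key , _) → descend t key) (λ (t , key , _) → Listₚ.foldr-cong {f = λ k t → elimTree leaf (λ l r → if k then r else l) t} (λ k t → refl) refl key)
  where
  childW : ∀ {s} k t → W s (tree A) t → W s (tree A) (child k t)
  childW k (leaf _) w = w
  childW false (node _ _) (w , _) = w
  childW true (node _ _) (_ , w) = w

contentF : ∀ {A} → Fn (tree (list A) ∷ []) (list A)
contentF = fn (caseTree v0 v0 emp) (λ (t , _) → content t) (λ _ → refl)

padd pmul : List ℕ → List Bool → List Bool → List Bool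
padd ks p q = mapL (λ e → nth false e p xor nth false e q) ks
pmul ks p q = mapL (λ e → xorL (λ i → xorL (λ j →
  (i + j ≡ᵇ e) ∧ (nth false i p ∧ nth false j q)) ks) ks) ks

mono : List ℕ → ℕ → List Bool
mono ks e = mapL (λ d → d ≡ᵇ e) ks

psum : ∀ {A : Set} → List ℕ → (A → List Bool) → List A → List Bool
psum ks g = foldr (λ x a → padd ks (g x) a) []

paddF pmulF : Fn (list nat ∷ list bool ∷ list bool ∷ []) (list bool)
paddF = fn (mapT v0 (nthB′ v0 v2 xor′ nthB′ v0 v3)) (λ (ks , p , q , _) → padd ks p q) (λ _ → refl)
pmulF = fn (mapT v0 (xorT v1 (xorT v2 ((eqF $$ ⟪ v1 +′ v0 ⨟ v2 ⟫) ∧′ (nthB′ v1 v4 ∧′ nthB′ v0 v5)))))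
  (λ (ks , p , q , _) → pmul ks p q) (λ _ → refl)

monoF : Fn (list nat ∷ nat ∷ []) (list bool)
monoF = fn (mapT v0 (eqF $$ ⟪ v0 ⨟ v2 ⟫)) (λ (ks , e , _) → mono ks e) (λ _ → refl)

length-mapL : ∀ {A B : Set} (g : A → B) xs → length (mapL g xs) ≡ length xs
length-mapL g [] = refl
length-mapL g (x ∷ xs) = cong suc (length-mapL g xs)

bools-W : ∀ s xs → All (W s bool) xs
bools-W s [] = []
bools-W s (x ∷ xs) = tt ∷ bools-W s xs

mapL-W : ∀ {s} {A : Set} (ks : List A) {g : A → Bool} → 2 ≤ s → length ks ≤ s → W (s ^ 1) (list bool) (mapL g ks)
mapL-W {s} ks {g} h l = loose (list bool) h (≡≤ (length-mapL g ks) l , bools-W s (mapL g ks))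

sumT : ∀ {Γ A} → Γ ∋ list nat → Tm poly Γ (list A) → Tm poly (A ∷ Γ) (list bool) → Tm poly Γ (list bool)
sumT {Γ} x l b = fold l emp (paddF $$ ⟪ var (su (su x)) ⨟ skip b ⨟ v1 ⟫)
  (keepBound 1 (λ s ρ h w → z≤n , [])
    (λ s ρ y a h w p q → mapL-W (look x ρ) h (proj₁ (look-W {Γ} {ρ = ρ} x w))))

mat rec par : Ty
mat = list (list bool)
rec = (nat ⊗ nat) ⊗ (list bool ⊗ list bool ⊗ list bool ⊗ list bool)
-- number of vertices, digraph, bags, the three units of weight, pairs
par = nat ⊗ mat ⊗ mat ⊗ (nat ⊗ nat ⊗ nat) ⊗ list rec

-- Binary value with the least significant bit first. Without the cap at `c` in each round a unary
-- result could be exponentially long; for the random weights `c` is large enough for the cap not to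
-- change the value.
value : ℕ → List Bool → ℕ
value c = foldr (λ b a → c ⊓ (a + a + (if b then 1 else 0))) 0

valueF : Fn (nat ∷ list bool ∷ []) nat
valueF = fn
  (fold v1 zer (minF $$ ⟪ v2 ⨟ v1 +′ v1 +′ ite v0 (suk zer) zer ⟫)
    (keepBound 1 (λ s ρ h w → z≤n) (λ s (c , _) x a h (w , _) p q → ≤-trans (m⊓n≤m c _) (loose nat h w))))
  (λ (c , bs , _) → value c bs) (λ _ → refl)

infix 4 _⇒ᵇ_
infix 7 _≡?_
_⇒ᵇ_ _≡?_ : Bool → Bool → Bool
a ⇒ᵇ b = not a ∨ b
a ≡? b = not (a xor b)

infix 4 _⇒′_
infix 7 _≡′_
_⇒′_ _≡′_ : ∀ {m Γ} → Tm m Γ bool → Tm m Γ bool → Tm m Γ bool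
a ⇒′ b = ¬′ a ∨′ b
a ≡′ b = ¬′ (a xor′ b)

-- The four bits of vertex v in a state: the side of the cut and the mark
-- "no arc may be chosen here" for the out-forest, then for the in-forest.
side₀ mark₀ side₁ mark₁ : ℕ → List Bool → ℕ → Bool
side₀ n σ v = nth false v σ
mark₀ n σ v = nth false (n + v) σ
side₁ n σ v = nth false (n + (n + v)) σ
mark₁ n σ v = nth false (n + (n + (n + v))) σ

-- The choice at the pair u < v: which of the arcs u → v (a) and v → u (b) are
-- in the out-forest (₀) and in the in-forest (₁).
admissible : Bool → List (List Bool) → ℕ → ℕ → Bool → Bool → Bool → Bool → Bool
admissible flag D u v a₀ a₁ b₀ b₁ =
  (a₀ ∨ a₁ ⇒ᵇ at D u v) ∧ (b₀ ∨ b₁ ⇒ᵇ at D v u) ∧ (flag ⇒ᵇ not ((a₀ ∨ a₁) ∧ (b₀ ∨ b₁)))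

-- For a fixed choice these are homogeneous linear equations in the bits of the state. `mark₀` is
-- read at the head of an arc of the out-forest, `mark₁` at the tail of an arc of the in-forest.
consistent : ℕ → List Bool → ℕ → ℕ → Bool → Bool → Bool → Bool → Bool
consistent n σ u v a₀ a₁ b₀ b₁ =
  ((a₀ ∨ b₀ ⇒ᵇ side₀ n σ u ≡? side₀ n σ v) ∧ (a₁ ∨ b₁ ⇒ᵇ side₁ n σ u ≡? side₁ n σ v)) ∧
  ((a₀ ⇒ᵇ not (mark₀ n σ v)) ∧ (b₀ ⇒ᵇ not (mark₀ n σ u))) ∧
  ((a₁ ⇒ᵇ not (mark₁ n σ u)) ∧ (b₁ ⇒ᵇ not (mark₁ n σ v)))

weigh : ℕ → Bool → ℕ
weigh w b = if b then w else 0

weight : ℕ × ℕ × ℕ → List Bool × List Bool × List Bool × List Bool → Bool → Bool → Bool → Bool → ℕ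
weight (M₁ , M₂ , c) (w₀ , w₁ , w₂ , w₃) a₀ a₁ b₀ b₁ =
  (weigh (M₁ + value c w₀) a₀ + weigh (M₁ + value c w₁) a₁) +
  (weigh (M₁ + value c w₂) b₀ + weigh (M₁ + value c w₃) b₁) +
  (weigh M₂ (a₀ ∨ a₁) + weigh M₂ (b₀ ∨ b₁))

bits2 : List Bool
bits2 = false ∷ true ∷ []

term : Bool → List ℕ → El par → El rec → List Bool → Bool → Bool → Bool → Bool → List Bool
term flag ks (n , D , bags , Ms , _) ((u , v) , ws) σ a₀ a₁ b₀ b₁ =
  if admissible flag D u v a₀ a₁ b₀ b₁ ∧ consistent n σ u v a₀ a₁ b₀ b₁
  then mono ks (weight Ms ws a₀ a₁ b₀ b₁) else []

factor : Bool → List ℕ → El par → El rec → List Bool → List Bool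
factor flag ks P r σ = psum ks (λ a₀ → psum ks (λ a₁ → psum ks (λ b₀ → psum ks (λ b₁ →
  term flag ks P r σ a₀ a₁ b₀ b₁) bits2) bits2) bits2) bits2

litF : Bool → Fn [] bool
litF false = fn ff (λ _ → false) (λ _ → refl)
litF true = fn tt′ (λ _ → true) (λ _ → refl)

litF-sem : ∀ b → Fn.sem (litF b) tt ≡ b
litF-sem false = refl
litF-sem true = refl

admissibleF : Bool → Fn (mat ∷ nat ∷ nat ∷ bool ∷ bool ∷ bool ∷ bool ∷ []) bool
admissibleF flag = fn
  ((v3 ∨′ v4 ⇒′ atF $$ ⟪ v0 ⨟ v1 ⨟ v2 ⟫) ∧′ (v5 ∨′ v6 ⇒′ atF $$ ⟪ v0 ⨟ v2 ⨟ v1 ⟫) ∧′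
   (litF flag $$ [] ⇒′ ¬′ ((v3 ∨′ v4) ∧′ (v5 ∨′ v6))))
  (λ (D , u , v , a₀ , a₁ , b₀ , b₁ , _) → admissible flag D u v a₀ a₁ b₀ b₁)
  (λ (D , u , v , a₀ , a₁ , b₀ , b₁ , _) → cong (λ f → (a₀ ∨ a₁ ⇒ᵇ at D u v) ∧ (b₀ ∨ b₁ ⇒ᵇ at D v u) ∧
    (f ⇒ᵇ not ((a₀ ∨ a₁) ∧ (b₀ ∨ b₁)))) (litF-sem flag))

consistentF : Fn (nat ∷ list bool ∷ nat ∷ nat ∷ bool ∷ bool ∷ bool ∷ bool ∷ []) bool
consistentF = fn
  (((v4 ∨′ v6 ⇒′ S₀ v2 ≡′ S₀ v3) ∧′ (v5 ∨′ v7 ⇒′ S₁ v2 ≡′ S₁ v3)) ∧′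
   ((v4 ⇒′ ¬′ (F₀ v3)) ∧′ (v6 ⇒′ ¬′ (F₀ v2))) ∧′
   ((v5 ⇒′ ¬′ (F₁ v2)) ∧′ (v7 ⇒′ ¬′ (F₁ v3))))
  (λ (n , σ , u , v , a₀ , a₁ , b₀ , b₁ , _) → consistent n σ u v a₀ a₁ b₀ b₁) (λ _ → refl)
  where
  S₀ F₀ S₁ F₁ : ∀ {Γ} → Tm poly (nat ∷ list bool ∷ Γ) nat → Tm poly (nat ∷ list bool ∷ Γ) bool
  S₀ v = nthB′ v v1
  F₀ v = nthB′ (v0 +′ v) v1
  S₁ v = nthB′ (v0 +′ (v0 +′ v)) v1
  F₁ v = nthB′ (v0 +′ (v0 +′ (v0 +′ v))) v1

weighF : Fn (nat ∷ bool ∷ []) nat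
weighF = fn (ite v1 v0 zer) (λ (w , b , _) → weigh w b) (λ _ → refl)

weightF : Fn ((nat ⊗ nat ⊗ nat) ∷ (list bool ⊗ list bool ⊗ list bool ⊗ list bool) ∷
              bool ∷ bool ∷ bool ∷ bool ∷ []) nat
weightF = fn
  ((u (π₁ v1) v2 +′ u (π₁ (π₂ v1)) v3) +′
   (u (π₁ (π₂ (π₂ v1))) v4 +′ u (π₂ (π₂ (π₂ v1))) v5) +′
   (weighF $$ ⟪ π₁ (π₂ v0) ⨟ v2 ∨′ v3 ⟫ +′ weighF $$ ⟪ π₁ (π₂ v0) ⨟ v4 ∨′ v5 ⟫))
  (λ (Ms , ws , a₀ , a₁ , b₀ , b₁ , _) → weight Ms ws a₀ a₁ b₀ b₁) (λ _ → refl)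
  where
  u : ∀ {Γ} → Tm poly ((nat ⊗ nat ⊗ nat) ∷ Γ) (list bool) → Tm poly ((nat ⊗ nat ⊗ nat) ∷ Γ) bool →
      Tm poly ((nat ⊗ nat ⊗ nat) ∷ Γ) nat
  u w b = weighF $$ ⟪ π₁ v0 +′ valueF $$ ⟪ π₂ (π₂ v0) ⨟ w ⟫ ⨟ b ⟫

termF : Bool → Fn (list nat ∷ par ∷ rec ∷ list bool ∷ bool ∷ bool ∷ bool ∷ bool ∷ []) (list bool)
termF flag = fn
  (ite ((admissibleF flag $$ (π₁ (π₂ v1) ∷ u ∷ v ∷ v4 ∷ v5 ∷ v6 ∷ v7 ∷ [])) ∧′
        (consistentF $$ (π₁ v1 ∷ v3 ∷ u ∷ v ∷ v4 ∷ v5 ∷ v6 ∷ v7 ∷ [])))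
    (monoF $$ ⟪ v0 ⨟ weightF $$ (π₁ (π₂ (π₂ (π₂ v1))) ∷ π₂ v2 ∷ v4 ∷ v5 ∷ v6 ∷ v7 ∷ []) ⟫) emp)
  (λ (ks , P , r , σ , a₀ , a₁ , b₀ , b₁ , _) → term flag ks P r σ a₀ a₁ b₀ b₁) (λ _ → refl)
  where
  u v : ∀ {Γ A B} → Tm poly (A ∷ B ∷ rec ∷ Γ) nat
  u = π₁ (π₁ v2)
  v = π₂ (π₁ v2)

factorF : Bool → Fn (list nat ∷ par ∷ rec ∷ list bool ∷ []) (list bool)
factorF flag = fn
  (sumT ze bs (sumT (su ze) bs (sumT (su (su ze)) bs (sumT (su (su (su ze))) bs
    (termF flag $$ (v4 ∷ v5 ∷ v6 ∷ v7 ∷ v3 ∷ v2 ∷ v1 ∷ v0 ∷ []))))))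
  (λ (ks , P , r , σ , _) → factor flag ks P r σ) (λ _ → refl)
  where
  bs : ∀ {Γ} → Tm poly Γ (list bool)
  bs = ff ◂ tt′ ◂ emp

-- Messages: the node a message is sent to, and its table

msg : Ty
msg = nat ⊗ tree (list bool)

prodMsgs : List ℕ → ℕ → List (El msg) → List Bool → List Bool
prodMsgs ks x ms σ = foldr
  (λ m a → if proj₁ m ≡ᵇ x then pmul ks (content (descend (proj₂ m) σ)) a else a) (mono ks 0) ms

-- The nodes whose bags contain both ends form a subtree. The pair is charged to the node of this
-- subtree nearest to the root, so that its factor enters the product exactly once.
settled : List (List Bool) → ℕ → ℕ → El rec → Bool
settled bags x p ((u , v) , _) = (at bags x u ∧ at bags x v) ∧ not (at bags p u ∧ at bags p v)

prodRecs : Bool → List ℕ → El par → ℕ → ℕ → List Bool → List Bool → List Bool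
prodRecs flag ks P x p σ z = foldr
  (λ r a → if settled (proj₁ (proj₂ (proj₂ P))) x p r then pmul ks (factor flag ks P r σ) a else a) z
  (proj₂ (proj₂ (proj₂ (proj₂ P))))

local : Bool → List ℕ → El par → ℕ → ℕ → List (El msg) → List Bool → List Bool
local flag ks P x p ms σ = prodRecs flag ks P x p σ (prodMsgs ks x ms σ)

prodMsgsF : Fn (list nat ∷ nat ∷ list msg ∷ list bool ∷ []) (list bool)
prodMsgsF = fn
  (fold v2 (monoF $$ ⟪ v0 ⨟ zer ⟫)
    (ite (eqF $$ ⟪ π₁ v0 ⨟ v3 ⟫) (pmulF $$ ⟪ v2 ⨟ contentF $$ ⟪ descendF $$ ⟪ π₂ v0 ⨟ v5 ⟫ ⟫ ⨟ v1 ⟫) v1)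
    (keepBound 1 (λ s ρ h (w , _) → mapL-W (proj₁ ρ) h (proj₁ w))
      (λ s ρ x a h (w , _) p q → if-elim (proj₁ x ≡ᵇ proj₁ (proj₂ ρ)) (W (s ^ 1) (list bool)) (mapL-W (proj₁ ρ) h (proj₁ w)) q)))
  (λ (ks , x , ms , σ , _) → prodMsgs ks x ms σ) (λ _ → refl)

settledF : Fn (mat ∷ nat ∷ nat ∷ rec ∷ []) bool
settledF = fn
  (((atF $$ ⟪ v0 ⨟ v1 ⨟ π₁ (π₁ v3) ⟫) ∧′ (atF $$ ⟪ v0 ⨟ v1 ⨟ π₂ (π₁ v3) ⟫)) ∧′
   ¬′ ((atF $$ ⟪ v0 ⨟ v2 ⨟ π₁ (π₁ v3) ⟫) ∧′ (atF $$ ⟪ v0 ⨟ v2 ⨟ π₂ (π₁ v3) ⟫)))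
  (λ (bags , x , p , r , _) → settled bags x p r) (λ _ → refl)

localF : Bool → Fn (list nat ∷ par ∷ nat ∷ nat ∷ list msg ∷ list bool ∷ []) (list bool)
localF flag = fn
  (fold (π₂ (π₂ (π₂ (π₂ v1)))) (prodMsgsF $$ ⟪ v0 ⨟ v2 ⨟ v4 ⨟ v5 ⟫)
    (ite (settledF $$ ⟪ π₁ (π₂ (π₂ v3)) ⨟ v4 ⨟ v5 ⨟ v0 ⟫)
      (pmulF $$ ⟪ v2 ⨟ factorF flag $$ ⟪ v2 ⨟ v3 ⨟ v0 ⨟ v7 ⟫ ⨟ v1 ⟫) v1)
    (keepBound 1
      (λ s (ks , _ , x , _ , ms , σ , _) h (w , _) → msgs-W {s} {ks} {x} {ms} {σ} h (proj₁ w))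
      (λ s (ks , P , x , p , _) r a h (w , _) _ q →
        if-elim (settled (proj₁ (proj₂ (proj₂ P))) x p r) (W (s ^ 1) (list bool)) (mapL-W ks h (proj₁ w)) q)))
  (λ (ks , P , x , p , ms , σ , _) → local flag ks P x p ms σ) (λ _ → refl)
  where
  msgs-W : ∀ {s ks x ms σ} → 2 ≤ s → length ks ≤ s → W (s ^ 1) (list bool) (prodMsgs ks x ms σ)
  msgs-W {ks = ks} {ms = []} h l = mapL-W ks h l
  msgs-W {s} {ks} {x} {m ∷ ms} {σ} h l = if-elim (proj₁ m ≡ᵇ x) (W (s ^ 1) (list bool))
    (mapL-W ks h l) (msgs-W {s} {ks} {x} {ms} {σ} h l)

-- Only nonroots carry free bits. The bits of the roots stay zero, so that the roots all lie on one
-- side of each cut and are unmarked.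
kept summed : List ℕ → List Bool → List (List Bool) → ℕ → ℕ → List Bool
kept vs ν bags x p = mapL (λ v → nth false v ν ∧ (at bags x v ∧ at bags p v)) vs
summed vs ν bags x p = mapL (λ v → nth false v ν ∧ (at bags x v ∧ not (at bags p v))) vs

keptF summedF : Fn (list nat ∷ list bool ∷ mat ∷ nat ∷ nat ∷ []) (list bool)
keptF = fn (mapT v0 (nthB′ v0 v2 ∧′ ((atF $$ ⟪ v3 ⨟ v4 ⨟ v0 ⟫) ∧′ (atF $$ ⟪ v3 ⨟ v5 ⨟ v0 ⟫))))
  (λ (vs , ν , bags , x , p , _) → kept vs ν bags x p) (λ _ → refl)
summedF = fn (mapT v0 (nthB′ v0 v2 ∧′ ((atF $$ ⟪ v3 ⨟ v4 ⨟ v0 ⟫) ∧′ ¬′ (atF $$ ⟪ v3 ⨟ v5 ⨟ v0 ⟫))))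
  (λ (vs , ν , bags , x , p , _) → summed vs ν bags x p) (λ _ → refl)

merge : List ℕ → List Bool → List Bool → List Bool
merge is τ ρ = mapL (λ i → nth false i τ ∨ nth false i ρ) is

mergeF : Fn (list nat ∷ list bool ∷ list bool ∷ []) (list bool)
mergeF = fn (mapT v0 (nthB′ v0 v2 ∨′ nthB′ v0 v3)) (λ (is , τ , ρ , _) → merge is τ ρ) (λ _ → refl)

enumX : Tm free (list bool ∷ []) (list (list bool))
enumX = fold! v0 (emp ◂ emp) (fold! v1 emp (ite v2 ((ff ◂ v0) ◂ (tt′ ◂ v0) ◂ v1) ((ff ◂ v0) ◂ v1)))

-- One more level of a lookup table. Neighbouring tables, which differ in the bit of this level, are
-- joined; for a bit outside the mask each table is joined with itself.
pairX dupX : Tm free (list (tree (list bool)) ∷ []) (list (tree (list bool)))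
pairX = π₂ (fold! v0 (emp ، emp)
  (caseList (π₁ v1) ((v0 ◂ emp) ، π₂ v1) (emp ، (nd v2 v0 ◂ π₂ v3))))
dupX = fold! v0 emp (nd v0 v0 ◂ v1)

opaque
  sealed! : ∀ {Δ A} → Tm free Δ A → Tm free Δ A
  sealed! t = t

  sealed!-sem : ∀ {Δ A} (t : Tm free Δ A) ρ → ⟦ sealed! t ⟧ᵗ ρ ≡ ⟦ t ⟧ᵗ ρ
  sealed!-sem t ρ = refl

  sealed!-cost : ∀ {Δ A} (t : Tm free Δ A) ρ → cost (sealed! t) ρ ≡ cost t ρ
  sealed!-cost t ρ = refl

call! : ∀ {Γ Δ A} → Tm free Δ A → Args free Γ Δ → Tm free Γ A
call! f ts = call free⊑ (sealed! f) ⟦ f ⟧ᵗ (sealed!-sem f) ts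

buildX : Tm free (list bool ∷ list (tree (list bool)) ∷ []) (list (tree (list bool)))
buildX = fold! v0 v1 (ite v0 (call! pairX ⟪ v1 ⟫) (call! dupX ⟪ v1 ⟫))

-- Further arguments of a message: exponents, parameters, bit positions, node,
-- parent, messages received
msgCtx : List Ty
msgCtx = list nat ∷ par ∷ list nat ∷ nat ∷ nat ∷ list msg ∷ []

module _ (flag : Bool) where

  summandF : Fn (list bool ∷ list bool ∷ list bool ∷ msgCtx) (list bool)
  summandF = fn
    (paddF $$ ⟪ v3 ⨟ localF flag $$ (v3 ∷ v4 ∷ v6 ∷ v7 ∷ v8 ∷ (mergeF $$ ⟪ v5 ⨟ v2 ⨟ v0 ⟫) ∷ []) ⨟ v1 ⟫)
    (λ (ρ , acc , τ , ks , P , is , x , p , ms , _) → padd ks (local flag ks P x p ms (merge is τ ρ)) acc) (λ _ → refl)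

  innerX : Tm free (list (list bool) ∷ list bool ∷ msgCtx) (list bool)
  innerX = fold! v0 emp (summandF $$ (v0 ∷ v1 ∷ v3 ∷ v4 ∷ v5 ∷ v6 ∷ v7 ∷ v8 ∷ v9 ∷ []))

  outerX : Tm free (list (list bool) ∷ list (list bool) ∷ msgCtx) (list (tree (list bool)))
  outerX = fold! v0 emp
    (lf (call! innerX (v3 ∷ v0 ∷ v4 ∷ v5 ∷ v6 ∷ v7 ∷ v8 ∷ v9 ∷ [])) ◂ v1)

  messageX : Tm free (list nat ∷ list bool ∷ msgCtx) (tree (list bool))
  messageX = letin (keptF $$ (v0 ∷ v1 ∷ π₁ (π₂ (π₂ v3)) ∷ v5 ∷ v6 ∷ []))
    (letin (summedF $$ (v1 ∷ v2 ∷ π₁ (π₂ (π₂ v4)) ∷ v6 ∷ v7 ∷ []))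
      (caseList (call! buildX ⟪ reverseF $$ ⟪ v1 ⟫ ⨟
          call! outerX (call! enumX ⟪ v1 ⟫ ∷ call! enumX ⟪ v0 ⟫ ∷ v4 ∷ v5 ∷ v6 ∷ v7 ∷ v8 ∷ v9 ∷ []) ⟫)
        (lf emp) v0))

  -- Arguments: elimination order with parents, root first; bits; nonroots;
  -- exponents; parameters; bit positions
  messagesX : Tm free (list (nat ⊗ nat) ∷ list nat ∷ list bool ∷ list nat ∷ par ∷ list nat ∷ []) (list msg)
  messagesX = fold! v0 emp
    ((π₂ v0 ، call! messageX (v3 ∷ v4 ∷ v5 ∷ v6 ∷ v7 ∷ π₁ v0 ∷ π₂ v0 ∷ v1 ∷ [])) ◂ v1)

-- Sums over states, in a commutative semiring

zipOr zipAnd : List Bool → List Bool → List Bool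
zipOr = List.zipWith _∨_
zipAnd = List.zipWith _∧_

-- State bits are attached to the vertices listed in vs.
data Sub (b : ℕ → Bool) : List ℕ → List Bool → Set where
  [] : Sub b [] []
  _∷_ : ∀ {v vs t τ} → (T t → T (b v)) → Sub b vs τ → Sub b (v ∷ vs) (t ∷ τ)

data Agree (b : ℕ → Bool) : List ℕ → List Bool → List Bool → Set where
  [] : Agree b [] [] []
  _∷_ : ∀ {v vs s t σ τ} → (T (b v) → s ≡ t) → Agree b vs σ τ → Agree b (v ∷ vs) (s ∷ σ) (t ∷ τ)

Agree-length : ∀ {b vs σ τ} → Agree b vs σ τ → length σ ≡ length vs × length τ ≡ length vs
Agree-length [] = refl , refl
Agree-length (_ ∷ ps) = cong suc (proj₁ (Agree-length ps)) , cong suc (proj₂ (Agree-length ps))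

Sub-length : ∀ {b vs τ} → Sub b vs τ → length τ ≡ length vs
Sub-length [] = refl
Sub-length (_ ∷ ps) = cong suc (Sub-length ps)

¬T→false : ∀ {b} → ¬ T b → b ≡ false
¬T→false {false} _ = refl
¬T→false {true} f = contradiction tt f

T→true : ∀ {b} → T b → b ≡ true
T→true {true} _ = refl

true→T : ∀ {b} → b ≡ true → T b
true→T refl = tt

∨-false : ∀ {t r : Bool} → ¬ T r → t ∨ r ≡ t
∨-false {false} f = ¬T→false f
∨-false {true} f = refl

T∧ : ∀ {a b} → T a → T b → T (a ∧ b)
T∧ {true} {true} _ _ = tt

T∧₁ : ∀ {a b} → T (a ∧ b) → T a
T∧₁ {true} _ = tt

T∧₂ : ∀ {a b} → T (a ∧ b) → T b
T∧₂ {true} q = q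

T∨₁ : ∀ {a b} → T a → T (a ∨ b)
T∨₁ {true} _ = tt

T∨₂ : ∀ {a b} → T b → T (a ∨ b)
T∨₂ {false} q = q
T∨₂ {true} _ = tt

T∨-elim : ∀ {a b} {C : Set} → T (a ∨ b) → (T a → C) → (T b → C) → C
T∨-elim {false} q f g = g q
T∨-elim {true} q f g = f q

T-not : ∀ {b} → ¬ T b → T (not b)
T-not {false} _ = tt
T-not {true} f = f tt

not-T : ∀ {b} → T (not b) → ¬ T b
not-T {false} _ ()

T-ext : ∀ {a b} → (T a → T b) → (T b → T a) → a ≡ b
T-ext {false} {false} f g = refl
T-ext {false} {true} f g = ⊥-elim (g tt)
T-ext {true} {false} f g = ⊥-elim (f tt)
T-ext {true} {true} f g = refl

anyL-∃ : ∀ {A : Set} (g : A → Bool) xs → T (anyL g xs) → ∃[ x ] T (g x)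
anyL-∃ g (x ∷ xs) q = T∨-elim {g x} q (x ,_) (anyL-∃ g xs)

≡ᵇ-refl : ∀ n → T (n ≡ᵇ n)
≡ᵇ-refl n = ≡⇒≡ᵇ n n refl

_∈ᵇ_ : ℕ → List ℕ → Bool
x ∈ᵇ xs = anyL (x ≡ᵇ_) xs

anyL-∈ : ∀ (g : ℕ → Bool) {x} xs → T (x ∈ᵇ xs) → T (g x) → T (anyL g xs)
anyL-∈ g {x} (y ∷ xs) m p = T∨-elim {x ≡ᵇ y} m
  (λ e → T∨₁ (subst (T ∘ g) (≡ᵇ⇒≡ x y e) p)) (λ m′ → T∨₂ {g y} (anyL-∈ g xs m′ p))

-- Orders of elimination: each node comes with its parent, and the bags of
-- earlier nodes meet its bag only inside the bag of the parent.
module Order (bag : ℕ → ℕ → Bool) where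

  data Good (A : List ℕ) : List (ℕ × ℕ) → Set where
    [] : Good A []
    more : ∀ {x p O} → ¬ T (x ∈ᵇ A) → T (p ∈ᵇ A) →
          (∀ v → T (bag x v) → T (anyL (λ z → bag z v) A) → T (bag p v)) →
          Good (x ∷ A) O → Good A ((x , p) ∷ O)

  final : List ℕ → List (ℕ × ℕ) → List ℕ
  final A [] = A
  final A ((x , _) ∷ O) = final (x ∷ A) O

module Sums (R : CommutativeSemiring 0ℓ 0ℓ) where

  open CommutativeSemiring R using (Carrier; _≈_; 0#; 1#) renaming (_+_ to infixl 6 _⊞_; _*_ to infixl 7 _⊠_)
  private module R = CommutativeSemiring R
  open SetoidReasoning R.setoid

  S : (ℕ → Bool) → List ℕ → (List Bool → Carrier) → Carrier
  S b [] f = f []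
  S b (v ∷ vs) f = if b v then S b vs (f ∘ (false ∷_)) ⊞ S b vs (f ∘ (true ∷_)) else S b vs (f ∘ (false ∷_))

  Π : ∀ {A : Set} → (A → Bool) → (A → Carrier) → List A → Carrier
  Π P f = foldr (λ x a → if P x then f x ⊠ a else a) 1#

  S-cong : ∀ b vs {f g} → (∀ τ → Sub b vs τ → f τ ≈ g τ) → S b vs f ≈ S b vs g
  S-cong b [] h = h [] []
  S-cong b (v ∷ vs) h with b v in eq
  ... | true = R.+-cong (S-cong b vs (λ τ p → h _ ((λ ()) ∷ p)))
                         (S-cong b vs (λ τ p → h _ ((λ _ → true→T eq) ∷ p)))
  ... | false = S-cong b vs (λ τ p → h _ ((λ ()) ∷ p))

  S-mask : ∀ {b c} vs f → (∀ v → b v ≡ c v) → S b vs f ≈ S c vs f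
  S-mask {b} {c} [] f h = R.refl
  S-mask {b} {c} (v ∷ vs) f h rewrite h v with c v
  ... | true = R.+-cong (S-mask vs _ h) (S-mask vs _ h)
  ... | false = S-mask vs _ h

  S-add : ∀ b vs f g → S b vs (λ σ → f σ ⊞ g σ) ≈ S b vs f ⊞ S b vs g
  S-add b [] f g = R.refl
  S-add b (v ∷ vs) f g with b v
  ... | false = S-add b vs _ _
  ... | true = begin
    S b vs (λ σ → f (false ∷ σ) ⊞ g (false ∷ σ)) ⊞ S b vs (λ σ → f (true ∷ σ) ⊞ g (true ∷ σ))
      ≈⟨ R.+-cong (S-add b vs _ _) (S-add b vs _ _) ⟩
    (f₀ ⊞ g₀) ⊞ (f₁ ⊞ g₁) ≈⟨ R.+-assoc _ _ _ ⟩
    f₀ ⊞ (g₀ ⊞ (f₁ ⊞ g₁)) ≈⟨ R.+-congˡ (R.sym (R.+-assoc _ _ _)) ⟩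
    f₀ ⊞ ((g₀ ⊞ f₁) ⊞ g₁) ≈⟨ R.+-congˡ (R.+-congʳ (R.+-comm _ _)) ⟩
    f₀ ⊞ ((f₁ ⊞ g₀) ⊞ g₁) ≈⟨ R.+-congˡ (R.+-assoc _ _ _) ⟩
    f₀ ⊞ (f₁ ⊞ (g₀ ⊞ g₁)) ≈⟨ R.sym (R.+-assoc _ _ _) ⟩
    (f₀ ⊞ f₁) ⊞ (g₀ ⊞ g₁) ∎
    where
    f₀ = S b vs (f ∘ (false ∷_))
    f₁ = S b vs (f ∘ (true ∷_))
    g₀ = S b vs (g ∘ (false ∷_))
    g₁ = S b vs (g ∘ (true ∷_))

  S-scale : ∀ b vs c f → S b vs (λ σ → c ⊠ f σ) ≈ c ⊠ S b vs f
  S-scale b [] c f = R.refl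
  S-scale b (v ∷ vs) c f with b v
  ... | true = R.trans (R.+-cong (S-scale b vs c _) (S-scale b vs c _)) (R.sym (R.distribˡ c _ _))
  ... | false = S-scale b vs c _

  S-split : ∀ {b c d} vs f → (∀ v → d v ≡ b v ∨ c v) → (∀ v → T (b v) → ¬ T (c v)) →
            S d vs f ≈ S b vs (λ τ → S c vs (λ ρ → f (zipOr τ ρ)))
  S-split [] f h k = R.refl
  S-split {b} {c} {d} (v ∷ vs) f h k rewrite h v with b v in eqb | c v in eqc
  ... | true | true = ⊥-elim (k v (true→T eqb) (true→T eqc))
  ... | true | false = R.+-cong (S-split vs _ h k) (S-split vs _ h k)
  ... | false | false = S-split vs _ h k
  ... | false | true = begin
    S d vs (f ∘ (false ∷_)) ⊞ S d vs (f ∘ (true ∷_)) ≈⟨ R.+-cong (S-split vs _ h k) (S-split vs _ h k) ⟩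
    S b vs (λ τ → S c vs (λ ρ → f (false ∷ zipOr τ ρ))) ⊞ S b vs (λ τ → S c vs (λ ρ → f (true ∷ zipOr τ ρ)))
      ≈⟨ R.sym (S-add b vs _ _) ⟩
    S b vs (λ τ → S c vs (λ ρ → f (false ∷ zipOr τ ρ)) ⊞ S c vs (λ ρ → f (true ∷ zipOr τ ρ))) ∎

  S-none : ∀ {b} vs f → (∀ v → b v ≡ false) → S b vs f ≈ f (List.map (λ _ → false) vs)
  S-none [] f h = R.refl
  S-none (v ∷ vs) f h rewrite h v = S-none vs _ h

  module _ {A : Set} where

    Π-cong : ∀ P {f g : A → Carrier} xs → (∀ x → T (P x) → f x ≈ g x) → Π P f xs ≈ Π P g xs
    Π-cong P [] h = R.refl
    Π-cong P (x ∷ xs) h with P x in eq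
    ... | true = R.*-cong (h x (true→T eq)) (Π-cong P xs h)
    ... | false = Π-cong P xs h

    Π-split : ∀ {P Q O : A → Bool} f xs → (∀ x → O x ≡ P x ∨ Q x) → (∀ x → T (P x) → ¬ T (Q x)) →
              Π O f xs ≈ Π P f xs ⊠ Π Q f xs
    Π-split f [] h k = R.sym (R.*-identityˡ 1#)
    Π-split {P} {Q} f (x ∷ xs) h k rewrite h x with P x in eqp | Q x in eqq
    ... | true | true = ⊥-elim (k x (true→T eqp) (true→T eqq))
    ... | true | false = R.trans (R.*-congˡ (Π-split f xs h k)) (R.sym (R.*-assoc _ _ _))
    ... | false | false = Π-split f xs h k
    ... | false | true = begin
      f x ⊠ Π _ f xs ≈⟨ R.*-congˡ (Π-split f xs h k) ⟩
      f x ⊠ (Π P f xs ⊠ Π Q f xs) ≈⟨ R.sym (R.*-assoc _ _ _) ⟩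
      (f x ⊠ Π P f xs) ⊠ Π Q f xs ≈⟨ R.*-congʳ (R.*-comm _ _) ⟩
      (Π P f xs ⊠ f x) ⊠ Π Q f xs ≈⟨ R.*-assoc _ _ _ ⟩
      Π P f xs ⊠ (f x ⊠ Π Q f xs) ∎

    Π-none : ∀ P (f : A → Carrier) xs → (∀ x → P x ≡ false) → Π P f xs ≈ 1#
    Π-none P f [] h = R.refl
    Π-none P f (x ∷ xs) h rewrite h x = Π-none P f xs h

    Π-all : ∀ P (f : A → Carrier) xs → (∀ x → P x ≡ false → f x ≈ 1#) → Π P f xs ≈ Π (λ _ → true) f xs
    Π-all P f [] h = R.refl
    Π-all P f (x ∷ xs) h with P x in eq
    ... | true = R.*-congˡ (Π-all P f xs h)
    ... | false = R.trans (Π-all P f xs h) (R.trans (R.sym (R.*-identityˡ _)) (R.*-congʳ (R.sym (h x eq))))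

  -- Elimination along a tree decomposition

  Message : Set
  Message = ℕ × (List Bool → Carrier)

  module Elimination (vs : List ℕ) (ν : ℕ → Bool) (bag : ℕ → ℕ → Bool)
                     {Pair : Set} (ends : Pair → ℕ × ℕ) (F : Pair → List Bool → Carrier) (ps : List Pair) where

    both : ℕ → Pair → Bool
    both x r = bag x (proj₁ (ends r)) ∧ bag x (proj₂ (ends r))

    -- `A` holds the nodes not yet eliminated, and the bits of their vertices are those over which
    -- the sum still runs.
    live : List ℕ → ℕ → Bool
    live A v = ν v ∧ anyL (λ x → bag x v) A

    livePair : List ℕ → Pair → Bool
    livePair A r = anyL (λ x → both x r) A

    keep drop : ℕ → ℕ → ℕ → Bool
    keep x p v = ν v ∧ (bag x v ∧ bag p v)
    drop x p v = ν v ∧ (bag x v ∧ not (bag p v))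

    settles : ℕ → ℕ → Pair → Bool
    settles x p r = both x r ∧ not (both p r)

    G : ℕ → ℕ → List Message → List Bool → Carrier
    G x p ms σ = Π (λ m → proj₁ m ≡ᵇ x) (λ m → proj₂ m σ) ms ⊠ Π (settles x p) (λ r → F r σ) ps

    data Computed : List (ℕ × ℕ) → List Message → Set where
      [] : Computed [] []
      _∷_ : ∀ {x p M O ms} →
            (∀ σ → length σ ≡ length vs →
              M σ ≈ S (drop x p) vs (λ ρ → G x p ms (zipOr (zipAnd σ (List.map (keep x p) vs)) ρ))) →
            Computed O ms → Computed ((x , p) ∷ O) ((p , M) ∷ ms)

    open Order bag public

    module _ (F-local : ∀ r x {b σ τ} → T (both x r) → T (b (proj₁ (ends r))) → T (b (proj₂ (ends r))) →
                        Agree b vs σ τ → F r σ ≈ F r τ) where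

      Local : Message → Set
      Local (p , M) = ∀ {σ τ} → Agree (bag p) vs σ τ → M σ ≈ M τ

      zipAnd-agree : ∀ {b c vs′ σ τ} → (∀ v → T (b v) → T (c v)) → Agree c vs′ σ τ →
                     zipAnd σ (List.map b vs′) ≡ zipAnd τ (List.map b vs′)
      zipAnd-agree h [] = refl
      zipAnd-agree {b} h (_∷_ {v = v} {s = s} {t} p ps) = cong₂ _∷_ (eq (b v) (h v)) (zipAnd-agree h ps)
        where
        eq : ∀ x → (T x → T _) → s ∧ x ≡ t ∧ x
        eq true h = cong (_∧ true) (p (h tt))
        eq false h = trans (Boolₚ.∧-zeroʳ s) (sym (Boolₚ.∧-zeroʳ t))

      local-messages : ∀ {O ms} → Computed O ms → All Local ms
      local-messages [] = []
      local-messages (_∷_ {x} {p} {ms = ms} h c) = (λ {σ} {τ} ag → let (l , l′) = Agree-length ag in R.trans (h σ l)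
        (R.trans (R.reflexive (cong (λ z → S (drop x p) vs (λ ρ → G x p ms (zipOr z ρ)))
          (zipAnd-agree (λ v q → T∧₂ {bag x v} (T∧₂ {ν v} q)) ag))) (R.sym (h τ l′)))) ∷ local-messages c

      Π-local : ∀ (P : ℕ → Bool) {σ τ ms} → All Local ms →
                (∀ p → T (P p) → Agree (bag p) vs σ τ) →
                Π (λ m → P (proj₁ m)) (λ m → proj₂ m σ) ms ≈ Π (λ m → P (proj₁ m)) (λ m → proj₂ m τ) ms
      Π-local P [] h = R.refl
      Π-local P {ms = (p , M) ∷ ms} (l ∷ ls) h with P p in eq
      ... | true = R.*-cong (l (h p (true→T eq))) (Π-local P ls h)
      ... | false = Π-local P ls h

      F-agree : ∀ (P : Pair → Bool) {σ τ} → (∀ r → T (P r) → ∃[ b ] ∃[ x ] (T (both x r) ×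
                  T (b (proj₁ (ends r))) × T (b (proj₂ (ends r))) × Agree b vs σ τ)) →
                Π P (λ r → F r σ) ps ≈ Π P (λ r → F r τ) ps
      F-agree P h = Π-cong P ps (λ r p → let (b , x , bx , bu , bv , ag) = h r p in F-local r x {b} bx bu bv ag)

      module Step {A : List ℕ} {x p : ℕ} (x∉A : ¬ T (x ∈ᵇ A)) (p∈A : T (p ∈ᵇ A))
                  (tree : ∀ v → T (bag x v) → T (anyL (λ z → bag z v) A) → T (bag p v)) where

        live-split : ∀ v → live (x ∷ A) v ≡ live A v ∨ drop x p v
        live-split v = T-ext fwd bwd
          where
          fwd : T (live (x ∷ A) v) → T (live A v ∨ drop x p v)
          fwd q with bag p v in eq
          ... | true = T∨₁ {live A v} (T∧ (T∧₁ {ν v} q) (anyL-∈ (λ z → bag z v) A p∈A (true→T eq)))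
          ... | false = T∨-elim {bag x v} (T∧₂ {ν v} q)
            (λ bx → T∨₂ {live A v} (T∧ (T∧₁ {ν v} q) (T∧ bx tt)))
            (λ ba → T∨₁ {live A v} (T∧ (T∧₁ {ν v} q) ba))
          bwd : T (live A v ∨ drop x p v) → T (live (x ∷ A) v)
          bwd q = T∨-elim {live A v} q
            (λ l → T∧ (T∧₁ {ν v} l) (T∨₂ {bag x v} (T∧₂ {ν v} l)))
            (λ d → T∧ (T∧₁ {ν v} d) (T∨₁ (T∧₁ {bag x v} (T∧₂ {ν v} d))))

        notDropped : ∀ {v} → T (anyL (λ z → bag z v) A) → ¬ T (drop x p v)
        notDropped {v} a d = not-T (T∧₂ {bag x v} (T∧₂ {ν v} d)) (tree v (T∧₁ {bag x v} (T∧₂ {ν v} d)) a)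

        live-disjoint : ∀ v → T (live A v) → ¬ T (drop x p v)
        live-disjoint v l = notDropped (T∧₂ {ν v} l)

        livePair-split : ∀ r → livePair (x ∷ A) r ≡ livePair A r ∨ settles x p r
        livePair-split r = T-ext fwd bwd
          where
          fwd : T (livePair (x ∷ A) r) → T (livePair A r ∨ settles x p r)
          fwd q with both p r in eq
          ... | true = T∨₁ {livePair A r} (anyL-∈ (λ z → both z r) A p∈A (true→T eq))
          ... | false = T∨-elim {both x r} q
            (λ bx → T∨₂ {livePair A r} (T∧ bx tt)) (λ ba → T∨₁ {livePair A r} ba)
          bwd : T (livePair A r ∨ settles x p r) → T (livePair (x ∷ A) r)
          bwd q = T∨-elim {livePair A r} q (T∨₂ {both x r}) (λ s → T∨₁ (T∧₁ {both x r} s))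

        any-mono : ∀ {f g : ℕ → Bool} B → (∀ z → T (f z) → T (g z)) → T (anyL f B) → T (anyL g B)
        any-mono {f} {g} (z ∷ B) h q = T∨-elim {f z} q (λ fz → T∨₁ (h z fz)) (λ r → T∨₂ {g z} (any-mono B h r))

        livePair-disjoint : ∀ r → T (livePair A r) → ¬ T (settles x p r)
        livePair-disjoint r l s = not-T (T∧₂ {both x r} s) (T∧
          (tree u (T∧₁ (T∧₁ {both x r} s)) (any-mono A (λ z → T∧₁) l))
          (tree v (T∧₂ {bag x u} (T∧₁ {both x r} s)) (any-mono A (λ z → T∧₂ {bag z u}) l)))
          where
          u = proj₁ (ends r)
          v = proj₂ (ends r)

        tag-split : ∀ (m : Message) → proj₁ m ∈ᵇ (x ∷ A) ≡ proj₁ m ∈ᵇ A ∨ (proj₁ m ≡ᵇ x)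
        tag-split m = Boolₚ.∨-comm (proj₁ m ≡ᵇ x) _

        tag-disjoint : ∀ (m : Message) → T (proj₁ m ∈ᵇ A) → ¬ T (proj₁ m ≡ᵇ x)
        tag-disjoint m a e = x∉A (subst (λ y → T (y ∈ᵇ A)) (≡ᵇ⇒≡ (proj₁ m) x e) a)

        outside : ∀ {b vs′ τ ρ} → (∀ v → T (b v) → T (anyL (λ z → bag z v) A)) →
                  Sub (live A) vs′ τ → Sub (drop x p) vs′ ρ → Agree b vs′ (zipOr τ ρ) τ
        outside h [] [] = []
        outside h (_ ∷ ss) (r ∷ rs) = (λ b → ∨-false (λ t → notDropped (h _ b) (r t))) ∷ outside h ss rs

        inside : ∀ {vs′ τ ρ} → Sub (live A) vs′ τ → Sub (drop x p) vs′ ρ →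
                 Agree (bag x) vs′ (zipOr τ ρ) (zipOr (zipAnd τ (List.map (keep x p) vs′)) ρ)
        inside [] [] = []
        inside (_∷_ {v} {t = t} s ss) (_∷_ {t = r} _ rs) = (λ bx → cong (_∨ r) (T-ext
          (λ q → T∧ q (T∧ (T∧₁ {ν v} (s q)) (T∧ bx (tree v bx (T∧₂ {ν v} (s q)))))) T∧₁)) ∷ inside ss rs

        -- The bits dropped at `x` occur in no other bag of `A`, by the condition on the parent.
        -- Hence the messages to the nodes of `A` and the pairs live there do not depend on these
        -- bits and leave the inner sum by distributivity; what remains inside is the message from
        -- `x` to `p`. Conversely, the factors settled at `x` see only the bag of `x`, so replacing
        -- the outer state by its restriction to the kept bits does not change them.
        eliminate₁ : ∀ {M ms} → All Local ms →
          (∀ σ → length σ ≡ length vs →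
            M σ ≈ S (drop x p) vs (λ ρ → G x p ms (zipOr (zipAnd σ (List.map (keep x p) vs)) ρ))) →
          S (live (x ∷ A)) vs (λ σ → Π (λ m → proj₁ m ∈ᵇ (x ∷ A)) (λ m → proj₂ m σ) ms ⊠ Π (livePair (x ∷ A)) (λ r → F r σ) ps)
            ≈ S (live A) vs (λ σ → Π (λ m → proj₁ m ∈ᵇ A) (λ m → proj₂ m σ) ((p , M) ∷ ms) ⊠ Π (livePair A) (λ r → F r σ) ps)
        eliminate₁ {M} {ms} loc comp = begin
          S (live (x ∷ A)) vs _ ≈⟨ S-split vs _ live-split live-disjoint ⟩
          S (live A) vs (λ τ → S (drop x p) vs (λ ρ → H′ (zipOr τ ρ))) ≈⟨ S-cong (live A) vs each ⟩
          S (live A) vs (λ σ → Π (λ m → proj₁ m ∈ᵇ A) (λ m → proj₂ m σ) ((p , M) ∷ ms) ⊠ Q σ) ∎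
          where
          P Px Q Qx H′ : List Bool → Carrier
          P σ = Π (λ m → proj₁ m ∈ᵇ A) (λ m → proj₂ m σ) ms
          Px σ = Π (λ m → proj₁ m ≡ᵇ x) (λ m → proj₂ m σ) ms
          Q σ = Π (livePair A) (λ r → F r σ) ps
          Qx σ = Π (settles x p) (λ r → F r σ) ps
          H′ σ = Π (λ m → proj₁ m ∈ᵇ (x ∷ A)) (λ m → proj₂ m σ) ms ⊠ Π (livePair (x ∷ A)) (λ r → F r σ) ps

          swap : ∀ a b c d → (a ⊠ b) ⊠ (c ⊠ d) ≈ (a ⊠ c) ⊠ (b ⊠ d)
          swap a b c d = begin
            (a ⊠ b) ⊠ (c ⊠ d) ≈⟨ R.*-assoc _ _ _ ⟩
            a ⊠ (b ⊠ (c ⊠ d)) ≈⟨ R.*-congˡ (R.sym (R.*-assoc _ _ _)) ⟩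
            a ⊠ ((b ⊠ c) ⊠ d) ≈⟨ R.*-congˡ (R.*-congʳ (R.*-comm _ _)) ⟩
            a ⊠ ((c ⊠ b) ⊠ d) ≈⟨ R.*-congˡ (R.*-assoc _ _ _) ⟩
            a ⊠ (c ⊠ (b ⊠ d)) ≈⟨ R.sym (R.*-assoc _ _ _) ⟩
            (a ⊠ c) ⊠ (b ⊠ d) ∎

          P-out : ∀ {τ ρ} → Sub (live A) vs τ → Sub (drop x p) vs ρ → P (zipOr τ ρ) ≈ P τ
          P-out s t = Π-local (_∈ᵇ A) loc (λ q q∈A → outside (λ v b → anyL-∈ (λ z → bag z v) A q∈A b) s t)

          Q-out : ∀ {τ ρ} → Sub (live A) vs τ → Sub (drop x p) vs ρ → Q (zipOr τ ρ) ≈ Q τ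
          Q-out s t = F-agree (livePair A) (λ r l → (λ v → anyL (λ z → bag z v) A) ,
            proj₁ (anyL-∃ (λ z → both z r) A l) , proj₂ (anyL-∃ (λ z → both z r) A l) , any-mono A (λ z → T∧₁) l , any-mono A (λ z → T∧₂ {bag z (proj₁ (ends r))}) l , outside (λ v b → b) s t)

          G-in : ∀ {τ ρ} → Sub (live A) vs τ → Sub (drop x p) vs ρ →
                 Px (zipOr τ ρ) ⊠ Qx (zipOr τ ρ) ≈ G x p ms (zipOr (zipAnd τ (List.map (keep x p) vs)) ρ)
          G-in s t = R.*-cong
            (Π-local (_≡ᵇ x) loc (λ q e → subst (λ y → Agree (bag y) vs _ _) (sym (≡ᵇ⇒≡ q x e)) (inside s t)))
            (F-agree (settles x p) (λ r l → bag x , x , T∧₁ {both x r} l , T∧₁ (T∧₁ {both x r} l) ,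
              T∧₂ {bag x (proj₁ (ends r))} (T∧₁ {both x r} l) , inside s t))

          each : ∀ τ → Sub (live A) vs τ → S (drop x p) vs (λ ρ → H′ (zipOr τ ρ))
                   ≈ Π (λ m → proj₁ m ∈ᵇ A) (λ m → proj₂ m τ) ((p , M) ∷ ms) ⊠ Q τ
          each τ s = begin
            S (drop x p) vs (λ ρ → H′ (zipOr τ ρ)) ≈⟨ S-cong (drop x p) vs (λ ρ t → begin
              H′ (zipOr τ ρ) ≈⟨ R.*-cong (Π-split _ ms tag-split tag-disjoint) (Π-split _ ps livePair-split livePair-disjoint) ⟩
              (P (zipOr τ ρ) ⊠ Px (zipOr τ ρ)) ⊠ (Q (zipOr τ ρ) ⊠ Qx (zipOr τ ρ)) ≈⟨ swap _ _ _ _ ⟩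
              (P (zipOr τ ρ) ⊠ Q (zipOr τ ρ)) ⊠ (Px (zipOr τ ρ) ⊠ Qx (zipOr τ ρ))
                ≈⟨ R.*-cong (R.*-cong (P-out s t) (Q-out s t)) (G-in s t) ⟩
              (P τ ⊠ Q τ) ⊠ G x p ms (zipOr (zipAnd τ (List.map (keep x p) vs)) ρ) ∎) ⟩
            S (drop x p) vs (λ ρ → (P τ ⊠ Q τ) ⊠ G x p ms (zipOr (zipAnd τ (List.map (keep x p) vs)) ρ))
              ≈⟨ S-scale (drop x p) vs _ _ ⟩
            (P τ ⊠ Q τ) ⊠ S (drop x p) vs (λ ρ → G x p ms (zipOr (zipAnd τ (List.map (keep x p) vs)) ρ))
              ≈⟨ R.*-congˡ (R.sym (comp τ (Sub-length s))) ⟩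
            (P τ ⊠ Q τ) ⊠ M τ ≈⟨ R.*-comm _ _ ⟩
            M τ ⊠ (P τ ⊠ Q τ) ≈⟨ R.sym (R.*-assoc _ _ _) ⟩
            (M τ ⊠ P τ) ⊠ Q τ ≈⟨ R.*-congʳ (R.reflexive (cong (λ b → if b then M τ ⊠ P τ else P τ) (sym (T→true p∈A)))) ⟩
            Π (λ m → proj₁ m ∈ᵇ A) (λ m → proj₂ m τ) ((p , M) ∷ ms) ⊠ Q τ ∎

      eliminate : ∀ A {O ms} → Good A O → Computed O ms →
        S (live (final A O)) vs (λ σ → Π (livePair (final A O)) (λ r → F r σ) ps)
          ≈ S (live A) vs (λ σ → Π (λ m → proj₁ m ∈ᵇ A) (λ m → proj₂ m σ) ms ⊠ Π (livePair A) (λ r → F r σ) ps)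
      eliminate A [] [] = S-cong (live A) vs (λ τ _ → R.sym (R.*-identityˡ _))
      eliminate A (more {x} {p} x∉ p∈ tr g) (_∷_ {M = M} {ms = ms} h c) = R.trans (eliminate (x ∷ A) g c)
        (Step.eliminate₁ {A} {x} {p} x∉ p∈ tr {M} {ms} (local-messages c) h)

xorL-cong : ∀ {A : Set} {g h : A → Bool} xs → (∀ x → g x ≡ h x) → xorL g xs ≡ xorL h xs
xorL-cong [] e = refl
xorL-cong (x ∷ xs) e = cong₂ _xor_ (e x) (xorL-cong xs e)

xor-swap : ∀ a b c d → (a xor b) xor (c xor d) ≡ (a xor c) xor (b xor d)
xor-swap false b false d = refl
xor-swap false b true d = sym (Boolₚ.not-distribʳ-xor b d)
xor-swap true b false d = sym (Boolₚ.not-distribˡ-xor b d)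
xor-swap true b true d = trans (sym (Boolₚ.not-distribˡ-xor b (not d)))
  (trans (cong not (sym (Boolₚ.not-distribʳ-xor b d))) (Boolₚ.not-involutive _))

xorL-xor : ∀ {A : Set} (g h : A → Bool) xs → xorL (λ x → g x xor h x) xs ≡ xorL g xs xor xorL h xs
xorL-xor g h [] = refl
xorL-xor g h (x ∷ xs) = trans (cong ((g x xor h x) xor_) (xorL-xor g h xs)) (xor-swap (g x) (h x) _ _)

xorL-∧ : ∀ {A : Set} c (g : A → Bool) xs → xorL (λ x → c ∧ g x) xs ≡ c ∧ xorL g xs
xorL-∧ false g [] = refl
xorL-∧ false g (x ∷ xs) = xorL-∧ false g xs
xorL-∧ true g xs = refl

xorL-false : ∀ {A : Set} (xs : List A) → xorL (λ _ → false) xs ≡ false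
xorL-false xs = xorL-∧ false (λ _ → false) xs

xorL-swap : ∀ {A B : Set} (g : A → B → Bool) xs ys →
            xorL (λ x → xorL (g x) ys) xs ≡ xorL (λ y → xorL (λ x → g x y) xs) ys
xorL-swap g [] ys = sym (xorL-false ys)
xorL-swap g (x ∷ xs) ys = trans (cong (xorL (g x) ys xor_) (xorL-swap g xs ys)) (sym (xorL-xor (g x) _ ys))

xorL-mapL : ∀ {A B : Set} (g : B → Bool) (f : A → B) xs → xorL g (mapL f xs) ≡ xorL (g ∘ f) xs
xorL-mapL g f [] = refl
xorL-mapL g f (x ∷ xs) = cong (g (f x) xor_) (xorL-mapL g f xs)

xorL-range-cong : ∀ n {g h : ℕ → Bool} → (∀ i → i < n → g i ≡ h i) → xorL g (range n) ≡ xorL h (range n)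
xorL-range-cong zero e = refl
xorL-range-cong (suc n) {g} {h} e = cong₂ _xor_ (e 0 (s≤s z≤n))
  (trans (xorL-mapL g suc (range n)) (trans (xorL-range-cong n (λ i l → e (suc i) (s≤s l))) (sym (xorL-mapL h suc (range n)))))

xorL-point : ∀ n m (g : ℕ → Bool) → xorL (λ i → (m ≡ᵇ i) ∧ g i) (range n) ≡ (m <ᵇ n) ∧ g m
xorL-point zero m g = refl
xorL-point (suc n) zero g = trans (cong (g 0 xor_) (trans (xorL-mapL (λ i → (0 ≡ᵇ i) ∧ g i) suc (range n)) (xorL-false (range n)))) (Boolₚ.xor-identityʳ _)
xorL-point (suc n) (suc m) g = trans (xorL-mapL (λ i → (suc m ≡ᵇ i) ∧ g i) suc (range n)) (xorL-point n m (g ∘ suc))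

≡ᵇ-sym : ∀ m n → (m ≡ᵇ n) ≡ (n ≡ᵇ m)
≡ᵇ-sym zero zero = refl
≡ᵇ-sym zero (suc n) = refl
≡ᵇ-sym (suc m) zero = refl
≡ᵇ-sym (suc m) (suc n) = ≡ᵇ-sym m n

<ᵇ-true : ∀ {m n} → m < n → (m <ᵇ n) ≡ true
<ᵇ-true l = T→true (<⇒<ᵇ l)

nth-mapL : ∀ {A B : Set} d d′ (f : A → B) e xs → e < length xs → nth d e (mapL f xs) ≡ f (nth d′ e xs)
nth-mapL d d′ f zero (x ∷ xs) l = refl
nth-mapL d d′ f (suc e) (x ∷ xs) (s≤s l) = nth-mapL d d′ f e xs l

length-range : ∀ n → length (range n) ≡ n
length-range zero = refl
length-range (suc n) = cong suc (trans (length-mapL suc (range n)) (length-range n))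

nth-range : ∀ e n → e < n → nth 0 e (range n) ≡ e
nth-range zero (suc n) l = refl
nth-range (suc e) (suc n) (s≤s l) = trans (nth-mapL 0 0 suc e (range n) (subst (e <_) (sym (length-range n)) l))
  (cong suc (nth-range e n l))

nth-tab : ∀ {B : Set} d (f : ℕ → B) e n → e < n → nth d e (mapL f (range n)) ≡ f e
nth-tab d f e n l = trans (nth-mapL d 0 f e (range n) (subst (e <_) (sym (length-range n)) l)) (cong f (nth-range e n l))

-- Polynomials truncated at degree K, as coefficient functions

module Poly (K : ℕ) where

  ks : List ℕ
  ks = range K

  infix 4 _≈_
  record _≈_ (f g : ℕ → Bool) : Set where
    constructor upto
    field coeff : ∀ e → e < K → f e ≡ g e
  open _≈_ public

  one : ℕ → Bool
  one e = e ≡ᵇ 0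

  coef : List Bool → ℕ → Bool
  coef p e = nth false e p

  opaque
    add mul : (ℕ → Bool) → (ℕ → Bool) → ℕ → Bool
    add f g e = f e xor g e
    mul f g e = xorL (λ i → xorL (λ j → (i + j ≡ᵇ e) ∧ (f i ∧ g j)) ks) ks

    X : (ℕ → Bool) → Bool
    X g = xorL g ks

    X-cong : ∀ {g h} → (∀ i → g i ≡ h i) → X g ≡ X h
    X-cong = xorL-cong ks

    ∧-swap : ∀ a b c → a ∧ (b ∧ c) ≡ b ∧ (a ∧ c)
    ∧-swap a b c = trans (sym (Boolₚ.∧-assoc a b c)) (trans (cong (_∧ c) (Boolₚ.∧-comm a b)) (Boolₚ.∧-assoc b a c))

    -- Truncation is compatible with products since coefficients below `K` involve exponents below
    -- `K` only: whenever the summand is nonzero, the test `m <ᵇ K` succeeds by itself.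
    within : ∀ {m e} → e < K → ∀ {b} → (T b → m ≤ e) → (m <ᵇ K) ∧ b ≡ b
    within {m} e<K {false} h = Boolₚ.∧-zeroʳ (m <ᵇ K)
    within {m} e<K {true} h = trans (Boolₚ.∧-identityʳ _) (<ᵇ-true (≤-trans (s≤s (h tt)) e<K))

    triple : (ℕ → Bool) → (ℕ → Bool) → (ℕ → Bool) → ℕ → Bool
    triple f g h e = X λ i → X λ j → X λ l → (i + (j + l) ≡ᵇ e) ∧ (f i ∧ (g j ∧ h l))

    -- Both bracketings are compared with the symmetric triple sum. The sums are interchanged until
    -- the exponent of the inner product is summed innermost, where a single term survives.
    mul-right : ∀ f g h e → e < K → mul f (mul g h) e ≡ triple f g h e
    mul-right f g h e e<K = X-cong λ i → trans (X-cong λ k → expand i k)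
      (trans (xorL-swap (λ k j → X λ l → Ψ i k j l) ks ks) (X-cong λ j →
        trans (xorL-swap (λ k l → Ψ i k j l) ks ks) (X-cong λ l → point i j l)))
      where
      Ψ : ℕ → ℕ → ℕ → ℕ → Bool
      Ψ i k j l = (i + k ≡ᵇ e) ∧ (f i ∧ ((j + l ≡ᵇ k) ∧ (g j ∧ h l)))
      expand : ∀ i k → (i + k ≡ᵇ e) ∧ (f i ∧ mul g h k) ≡
        X λ j → X λ l → (i + k ≡ᵇ e) ∧ (f i ∧ ((j + l ≡ᵇ k) ∧ (g j ∧ h l)))
      expand i k = sym (trans (X-cong λ j → trans (xorL-∧ (i + k ≡ᵇ e) _ ks) (cong ((i + k ≡ᵇ e) ∧_) (xorL-∧ (f i) _ ks)))
        (trans (xorL-∧ (i + k ≡ᵇ e) _ ks) (cong ((i + k ≡ᵇ e) ∧_) (xorL-∧ (f i) _ ks))))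
      point : ∀ i j l → X (λ k → (i + k ≡ᵇ e) ∧ (f i ∧ ((j + l ≡ᵇ k) ∧ (g j ∧ h l)))) ≡
        (i + (j + l) ≡ᵇ e) ∧ (f i ∧ (g j ∧ h l))
      point i j l = trans (X-cong λ k → trans (cong ((i + k ≡ᵇ e) ∧_) (∧-swap (f i) (j + l ≡ᵇ k) (g j ∧ h l))) (∧-swap (i + k ≡ᵇ e) (j + l ≡ᵇ k) _))
        (trans (xorL-point K (j + l) (λ k → (i + k ≡ᵇ e) ∧ (f i ∧ (g j ∧ h l))))
          (within e<K (λ t → ≤≡ (m≤n+m (j + l) i) (≡ᵇ⇒≡ _ e (T∧₁ t)))))

    mul-left : ∀ f g h e → e < K → mul (mul f g) h e ≡ triple f g h e
    mul-left f g h e e<K = trans (X-cong λ k → X-cong λ l → expand k l)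
      (trans (X-cong λ k → trans (xorL-swap (λ l i → X λ j → Φ k l i j) ks ks)
                                 (X-cong λ i → xorL-swap (λ l j → Φ k l i j) ks ks))
        (trans (xorL-swap (λ k i → X λ j → X λ l → Φ k l i j) ks ks) (X-cong λ i →
          trans (xorL-swap (λ k j → X λ l → Φ k l i j) ks ks) (X-cong λ j →
            trans (xorL-swap (λ k l → Φ k l i j) ks ks) (X-cong λ l → point i j l)))))
      where
      Φ : ℕ → ℕ → ℕ → ℕ → Bool
      Φ k l i j = (i + j ≡ᵇ k) ∧ ((k + l ≡ᵇ e) ∧ (f i ∧ (g j ∧ h l)))
      expand : ∀ k l → (k + l ≡ᵇ e) ∧ (mul f g k ∧ h l) ≡
        X λ i → X λ j → (i + j ≡ᵇ k) ∧ ((k + l ≡ᵇ e) ∧ (f i ∧ (g j ∧ h l)))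
      expand k l = sym (trans (X-cong λ i → trans (X-cong λ j → re i j)
        (xorL-∧ ((k + l ≡ᵇ e) ∧ h l) _ ks)) (trans (xorL-∧ ((k + l ≡ᵇ e) ∧ h l) _ ks)
          (trans (Boolₚ.∧-assoc (k + l ≡ᵇ e) (h l) _) (cong ((k + l ≡ᵇ e) ∧_) (Boolₚ.∧-comm (h l) _)))))
        where
        re : ∀ i j → (i + j ≡ᵇ k) ∧ ((k + l ≡ᵇ e) ∧ (f i ∧ (g j ∧ h l))) ≡
                     ((k + l ≡ᵇ e) ∧ h l) ∧ ((i + j ≡ᵇ k) ∧ (f i ∧ g j))
        re i j = trans (∧-swap (i + j ≡ᵇ k) (k + l ≡ᵇ e) _) (trans (cong ((k + l ≡ᵇ e) ∧_)
          (trans (cong ((i + j ≡ᵇ k) ∧_) (trans (sym (Boolₚ.∧-assoc (f i) (g j) (h l))) (Boolₚ.∧-comm _ (h l))))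
            (∧-swap (i + j ≡ᵇ k) (h l) _))) (sym (Boolₚ.∧-assoc (k + l ≡ᵇ e) (h l) _)))
      point : ∀ i j l → X (λ k → (i + j ≡ᵇ k) ∧ ((k + l ≡ᵇ e) ∧ (f i ∧ (g j ∧ h l)))) ≡
        (i + (j + l) ≡ᵇ e) ∧ (f i ∧ (g j ∧ h l))
      point i j l = trans (xorL-point K (i + j) (λ k → (k + l ≡ᵇ e) ∧ (f i ∧ (g j ∧ h l))))
        (trans (within e<K (λ t → ≤≡ (m≤m+n (i + j) l) (≡ᵇ⇒≡ _ e (T∧₁ t))))
          (cong (λ s → (s ≡ᵇ e) ∧ (f i ∧ (g j ∧ h l))) (+-assoc i j l)))

    mul-point : ∀ a g e → mul (λ i → i ≡ᵇ a) g e ≡ (a <ᵇ K) ∧ X (λ j → (a + j ≡ᵇ e) ∧ g j)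
    mul-point a g e = trans (X-cong λ i → trans (X-cong λ j → trans (∧-swap (i + j ≡ᵇ e) (i ≡ᵇ a) (g j))
        (cong (_∧ ((i + j ≡ᵇ e) ∧ g j)) (≡ᵇ-sym i a))) (xorL-∧ (a ≡ᵇ i) _ ks))
      (xorL-point K a (λ i → X (λ j → (i + j ≡ᵇ e) ∧ g j)))

    mul-comm : ∀ f g e → mul f g e ≡ mul g f e
    mul-comm f g e = trans (xorL-swap (λ i j → (i + j ≡ᵇ e) ∧ (f i ∧ g j)) ks ks) (X-cong λ j → X-cong λ i →
      cong₂ _∧_ (cong (_≡ᵇ e) (+-comm i j)) (Boolₚ.∧-comm (f i) (g j)))

    one-mul : ∀ g e → e < K → mul one g e ≡ g e
    one-mul g e e<K = trans (mul-point 0 g e) (trans (cong (_∧ X (λ j → (j ≡ᵇ e) ∧ g j)) (<ᵇ-true (≤-trans (s≤s z≤n) e<K)))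
      (trans (X-cong λ j → cong (_∧ g j) (≡ᵇ-sym j e)) (trans (xorL-point K e g) (cong (_∧ g e) (<ᵇ-true e<K)))))

    mono-mul : ∀ a b e → e < K → mul (λ i → i ≡ᵇ a) (λ i → i ≡ᵇ b) e ≡ (e ≡ᵇ a + b)
    mono-mul a b e e<K = trans (mul-point a _ e) (trans (cong ((a <ᵇ K) ∧_)
        (trans (X-cong λ j → trans (Boolₚ.∧-comm (a + j ≡ᵇ e) _) (cong (_∧ (a + j ≡ᵇ e)) (≡ᵇ-sym j b)))
          (trans (xorL-point K b (λ j → a + j ≡ᵇ e))
            (within e<K (λ t → ≤≡ (m≤n+m b a) (≡ᵇ⇒≡ _ e t))))))
      (trans (within e<K (λ t → ≤≡ (m≤m+n a b) (≡ᵇ⇒≡ _ e t))) (≡ᵇ-sym (a + b) e)))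

    mul-cong : ∀ {f f′ g g′} → f ≈ f′ → g ≈ g′ → ∀ e → mul f g e ≡ mul f′ g′ e
    mul-cong p q e = xorL-range-cong K λ i i<K → xorL-range-cong K λ j j<K →
      cong ((i + j ≡ᵇ e) ∧_) (cong₂ _∧_ (coeff p i i<K) (coeff q j j<K))

    mul-distribʳ : ∀ f g h e → mul (add g h) f e ≡ add (mul g f) (mul h f) e
    mul-distribʳ f g h e = trans (X-cong λ i → trans (X-cong λ j →
        trans (cong ((i + j ≡ᵇ e) ∧_) (trans (Boolₚ.∧-comm _ (f j)) (trans (Boolₚ.∧-distribˡ-xor (f j) (g i) (h i))
          (cong₂ _xor_ (Boolₚ.∧-comm (f j) (g i)) (Boolₚ.∧-comm (f j) (h i))))))
        (Boolₚ.∧-distribˡ-xor (i + j ≡ᵇ e) (g i ∧ f j) (h i ∧ f j)))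
        (xorL-xor (λ j → (i + j ≡ᵇ e) ∧ (g i ∧ f j)) (λ j → (i + j ≡ᵇ e) ∧ (h i ∧ f j)) ks))
      (xorL-xor (λ i → X λ j → (i + j ≡ᵇ e) ∧ (g i ∧ f j)) (λ i → X λ j → (i + j ≡ᵇ e) ∧ (h i ∧ f j)) ks)

    mul-zeroˡ : ∀ f e → mul (λ _ → false) f e ≡ false
    mul-zeroˡ f e = trans (X-cong λ i → trans (X-cong λ j → Boolₚ.∧-zeroʳ (i + j ≡ᵇ e)) (xorL-false ks)) (xorL-false ks)

    add-def : ∀ f g e → add f g e ≡ f e xor g e
    add-def f g e = refl

    add-cong : ∀ {f f′ g g′} → f ≈ f′ → g ≈ g′ → add f g ≈ add f′ g′
    add-cong p q = upto λ e l → cong₂ _xor_ (coeff p e l) (coeff q e l)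

    add-assoc : ∀ f g h → add (add f g) h ≈ add f (add g h)
    add-assoc f g h = upto λ e _ → Boolₚ.xor-assoc (f e) (g e) (h e)

    add-zeroˡ : ∀ f → add (λ _ → false) f ≈ f
    add-zeroˡ f = upto λ e _ → refl

    add-zeroʳ : ∀ f → add f (λ _ → false) ≈ f
    add-zeroʳ f = upto λ e _ → Boolₚ.xor-identityʳ (f e)

    add-comm : ∀ f g → add f g ≈ add g f
    add-comm f g = upto λ e _ → Boolₚ.xor-comm (f e) (g e)

    coef-padd : ∀ p q → coef (padd ks p q) ≈ add (coef p) (coef q)
    coef-padd p q = upto λ e l → nth-tab false _ e K l

    coef-pmul : ∀ p q → coef (pmul ks p q) ≈ mul (coef p) (coef q)
    coef-pmul p q = upto λ e l → nth-tab false _ e K l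

  ring : CommutativeSemiring 0ℓ 0ℓ
  ring = record
    { Carrier = ℕ → Bool
    ; _≈_ = _≈_
    ; _+_ = add
    ; _*_ = mul
    ; 0# = λ _ → false
    ; 1# = one
    ; isCommutativeSemiring = isCommutativeSemiringˡ (record
      { +-isCommutativeMonoid = record
        { isMonoid = record
          { isSemigroup = record
            { isMagma = record { isEquivalence = equiv ; ∙-cong = add-cong }
            ; assoc = add-assoc }
          ; identity = add-zeroˡ , add-zeroʳ }
        ; comm = add-comm }
      ; *-isCommutativeMonoid = record
        { isMonoid = record
          { isSemigroup = record
            { isMagma = record { isEquivalence = equiv ; ∙-cong = λ p q → upto λ e _ → mul-cong p q e }
            ; assoc = λ f g h → upto λ e l → trans (mul-left f g h e l) (sym (mul-right f g h e l)) }
          ; identity = (λ f → upto λ e l → one-mul f e l) , (λ f → upto λ e l → trans (mul-comm f one e) (one-mul f e l)) }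
        ; comm = λ f g → upto λ e _ → mul-comm f g e }
      ; distribʳ = λ f g h → upto λ e _ → mul-distribʳ f g h e
      ; zeroˡ = λ f → upto λ e _ → mul-zeroˡ f e
      })
    }
    where
    equiv : IsEquivalence _≈_
    equiv = record { refl = upto λ _ _ → refl ; sym = λ p → upto λ e l → sym (coeff p e l)
                   ; trans = λ p q → upto λ e l → trans (coeff p e l) (coeff q e l) }

  coef-mono : ∀ a → coef (mono ks a) ≈ (λ e → e ≡ᵇ a)
  coef-mono a = upto λ e l → nth-tab false _ e K l

-- Enumeration of states and lookup tables

mapL≡map : ∀ {A B : Set} (g : A → B) xs → mapL g xs ≡ List.map g xs
mapL≡map g [] = refl
mapL≡map g (x ∷ xs) = cong (g x ∷_) (mapL≡map g xs)

mapL-∘ : ∀ {A B C : Set} (g : B → C) (f : A → B) xs → mapL g (mapL f xs) ≡ mapL (g ∘ f) xs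
mapL-∘ g f [] = refl
mapL-∘ g f (x ∷ xs) = cong (g (f x) ∷_) (mapL-∘ g f xs)

grow : Bool → List (List Bool) → List (List Bool)
grow b = foldr (λ τ out → if b then (false ∷ τ) ∷ (true ∷ τ) ∷ out else (false ∷ τ) ∷ out) []

enumL : List Bool → List (List Bool)
enumL = foldr grow ([] ∷ [])

pairStep : ∀ {A : Set} → Tree A → List (Tree A) × List (Tree A) → List (Tree A) × List (Tree A)
pairStep x acc = elimList (x ∷ [] , proj₂ acc) (λ y _ → [] , node x y ∷ proj₂ acc) (proj₁ acc)

pairing : ∀ {A : Set} → List (Tree A) → List (Tree A) × List (Tree A)
pairing = foldr pairStep ([] , [])

pairUp dup : ∀ {A : Set} → List (Tree A) → List (Tree A)
pairUp = proj₂ ∘ pairing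
dup = mapL (λ t → node t t)

layer : ∀ {A : Set} → Bool → List (Tree A) → List (Tree A)
layer b ts = if b then pairUp ts else dup ts

build : ∀ {A : Set} → List Bool → List (Tree A) → List (Tree A)
build mask ts = foldr layer ts mask

-- `grow true` places the two extensions of a state next to each other, so joining neighbours joins
-- exactly the entries that differ in the new bit.
layer-grow : ∀ {A : Set} b (h : List Bool → Tree A) τs →
  layer b (mapL h (grow b τs)) ≡ mapL (λ τ → node (h (false ∷ τ)) (h (b ∷ τ))) τs
layer-grow false h [] = refl
layer-grow false h (τ ∷ τs) = cong (_ ∷_) (layer-grow false h τs)
layer-grow {A} true h τs = cong proj₂ (both τs)
  where
  both : ∀ τs → pairing (mapL h (grow true τs)) ≡ ([] , mapL (λ τ → node (h (false ∷ τ)) (h (true ∷ τ))) τs)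
  both [] = refl
  both (τ ∷ τs) rewrite both τs = refl

child-node : ∀ {A : Set} k b (h : Bool → Tree A) → child k (node (h false) (h b)) ≡ h (k ∧ b)
child-node false b h = refl
child-node true b h = refl

-- At a position outside the mask both subtrees are equal, so the lookup ignores that bit of the
-- key. A full state can therefore be used as key to a table indexed by masked states.
build-spec : ∀ {A : Set} mask (h : List Bool → Tree A) →
  ∃[ t ] (build (reverse mask) (mapL h (enumL mask)) ≡ t ∷ [] ×
          (∀ σ → length σ ≡ length mask → descend t σ ≡ h (zipAnd σ mask)))
build-spec mask h = let (t , eq , d) = spec mask h in t , trans (reverse-foldr layer _ mask) eq , d
  where
  spec : ∀ {A : Set} mask (h : List Bool → Tree A) →
    ∃[ t ] (foldl (λ ts b → layer b ts) (mapL h (enumL mask)) mask ≡ t ∷ [] ×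
            (∀ σ → length σ ≡ length mask → descend t σ ≡ h (zipAnd σ mask)))
  spec [] h = h [] , refl , λ { [] _ → refl }
  spec (b ∷ mask) h with spec mask (λ τ → node (h (false ∷ τ)) (h (b ∷ τ)))
  ... | t , eq , d = t , trans (cong (λ ts → foldl (λ ts b → layer b ts) ts mask) (layer-grow b h (enumL mask))) eq ,
    λ { (k ∷ σ) l → trans (cong (child k) (d σ (suc-injective l))) (child-node k b (λ x → h (x ∷ zipAnd σ mask))) }

merge-zipOr : ∀ n τ ρ → length τ ≡ n → length ρ ≡ n → merge (range n) τ ρ ≡ zipOr τ ρ
merge-zipOr zero [] [] _ _ = refl
merge-zipOr (suc n) (t ∷ τ) (r ∷ ρ) p q = cong ((t ∨ r) ∷_)
  (trans (mapL-∘ _ suc (range n)) (merge-zipOr n τ ρ (suc-injective p) (suc-injective q)))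

length-zipAnd : ∀ xs ys → length xs ≡ length ys → length (zipAnd xs ys) ≡ length ys
length-zipAnd [] [] _ = refl
length-zipAnd (x ∷ xs) (y ∷ ys) e = cong suc (length-zipAnd xs ys (suc-injective e))

Agree-nth : ∀ {b vs σ τ} → Agree b vs σ τ → ∀ i → i < length vs → T (b (nth 0 i vs)) → nth false i σ ≡ nth false i τ
Agree-nth (p ∷ ps) zero l q = p q
Agree-nth (p ∷ ps) (suc i) (s≤s l) q = Agree-nth ps i l q

nth-++ʳ : ∀ {A : Set} (d : A) xs ys i → nth d (length xs + i) (xs ++ ys) ≡ nth d i ys
nth-++ʳ d [] ys i = refl
nth-++ʳ d (x ∷ xs) ys i = nth-++ʳ d xs ys i

nth-++ˡ : ∀ {A : Set} (d : A) xs ys {i} → i < length xs → nth d i (xs ++ ys) ≡ nth d i xs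
nth-++ˡ d (x ∷ xs) ys {zero} l = refl
nth-++ˡ d (x ∷ xs) ys {suc i} (s≤s l) = nth-++ˡ d xs ys l

-- The vertices to which the four blocks of bits belong
vertices4 : ℕ → List ℕ
vertices4 n = range n ++ range n ++ range n ++ range n

module _ (n : ℕ) where

  private
    r = range n

    shift : ∀ {A : Set} (d : A) xs ys i → length xs ≡ n → nth d (n + i) (xs ++ ys) ≡ nth d i ys
    shift d xs ys i refl = nth-++ʳ d xs ys i

    start : ∀ ys {v} → v < n → nth 0 v (r ++ ys) ≡ v
    start ys {v} l = trans (nth-++ˡ 0 r ys (subst (v <_) (sym (length-range n)) l)) (nth-range v n l)

  length-vertices4 : length (vertices4 n) ≡ n + (n + (n + n))
  length-vertices4 rewrite length-++ r {r ++ r ++ r} | length-++ r {r ++ r} | length-++ r {r} | length-range n = refl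

  vertices4-nth : ∀ v → v < n →
    nth 0 v (vertices4 n) ≡ v × nth 0 (n + v) (vertices4 n) ≡ v ×
    nth 0 (n + (n + v)) (vertices4 n) ≡ v × nth 0 (n + (n + (n + v))) (vertices4 n) ≡ v
  vertices4-nth v l = start _ l , trans (shift 0 r _ v lr) (start _ l) ,
    trans (shift 0 r _ (n + v) lr) (trans (shift 0 r _ v lr) (start _ l)) ,
    trans (shift 0 r _ (n + (n + v)) lr) (trans (shift 0 r _ (n + v) lr) (trans (shift 0 r _ v lr) (nth-range v n l)))
    where lr = length-range n

  vertices4-< : ∀ v → v < n → v < length (vertices4 n) × n + v < length (vertices4 n) ×
    n + (n + v) < length (vertices4 n) × n + (n + (n + v)) < length (vertices4 n)
  vertices4-< v l rewrite length-vertices4 =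
    ≤-trans l (m≤m+n n _) , +-monoʳ-< n (≤-trans l (m≤m+n n _)) ,
    +-monoʳ-< n (+-monoʳ-< n (≤-trans l (m≤m+n n _))) , +-monoʳ-< n (+-monoʳ-< n (+-monoʳ-< n l))

  agree-bits : ∀ {b σ τ v} → Agree b (vertices4 n) σ τ → v < n → T (b v) →
    side₀ n σ v ≡ side₀ n τ v × mark₀ n σ v ≡ mark₀ n τ v × side₁ n σ v ≡ side₁ n τ v × mark₁ n σ v ≡ mark₁ n τ v
  agree-bits {b} {σ} {τ} {v} ag l bv = let (e₀ , e₁ , e₂ , e₃) = vertices4-nth v l ; (l₀ , l₁ , l₂ , l₃) = vertices4-< v l in
    bitAt e₀ l₀ , bitAt e₁ l₁ , bitAt e₂ l₂ , bitAt e₃ l₃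
    where
    bitAt : ∀ {i} → nth 0 i (vertices4 n) ≡ v → i < length (vertices4 n) → nth false i σ ≡ nth false i τ
    bitAt {i} e l = Agree-nth ag i l (subst (T ∘ b) (sym e) bv)

  consistent-agree : ∀ {b σ τ u v} a₀ a₁ b₀ b₁ → Agree b (vertices4 n) σ τ → u < n → v < n → T (b u) → T (b v) →
    consistent n σ u v a₀ a₁ b₀ b₁ ≡ consistent n τ u v a₀ a₁ b₀ b₁
  consistent-agree {u = u} {v} a₀ a₁ b₀ b₁ ag lu lv bu bv
    with agree-bits ag lu bu | agree-bits ag lv bv
  ... | p₀ , p₁ , p₂ , p₃ | q₀ , q₁ , q₂ , q₃ rewrite p₀ | p₁ | p₂ | p₃ | q₀ | q₁ | q₂ | q₃ = refl

psum-cong : ∀ {A : Set} ks {g h : A → List Bool} xs → (∀ x → g x ≡ h x) → psum ks g xs ≡ psum ks h xs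
psum-cong ks [] e = refl
psum-cong ks (x ∷ xs) e = cong₂ (padd ks) (e x) (psum-cong ks xs e)

module Tables (flag : Bool) (K : ℕ) (P : El par) (ν : List Bool) where

  open Poly K
  open Sums ring
  private module R = CommutativeSemiring ring

  n : ℕ
  n = proj₁ P

  bags : List (List Bool)
  bags = proj₁ (proj₂ (proj₂ P))

  recs : List (El rec)
  recs = proj₂ (proj₂ (proj₂ (proj₂ P)))

  vs is : List ℕ
  vs = vertices4 n
  is = range (length vs)

  F : El rec → List Bool → ℕ → Bool
  F r σ = coef (factor flag ks P r σ)

  open Elimination vs (λ v → nth false v ν) (at bags) proj₁ F recs public

  inner : ℕ → ℕ → List (El msg) → List Bool → List Bool
  inner x p ms τ = psum ks (λ ρ → local flag ks P x p ms (merge is τ ρ)) (enumL (summed vs ν bags x p))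

  tableOf : List (List Bool) → List Bool → ℕ → ℕ → List (El msg) → Tree (List Bool)
  tableOf τs κ x p ms = elimList (leaf []) (λ t _ → t) (build (reverse κ) (mapL (λ τ → leaf (inner x p ms τ)) τs))

  messages : List (ℕ × ℕ) → List (El msg)
  messages = foldr (λ (x , p) ms → (p , tableOf (enumL (kept vs ν bags x p)) (kept vs ν bags x p) x p ms) ∷ ms) []

  interpret : List (El msg) → List Message
  interpret = mapL (λ (p , t) → p , λ σ → coef (content (descend t σ)))

  S-enum : ∀ b us (g : List Bool → List Bool) → coef (psum ks g (enumL (mapL b us))) ≈ S b us (coef ∘ g)
  S-enum b [] g = R.trans (coef-padd (g []) []) (R.+-identityʳ _)
  S-enum b (v ∷ us) g with b v
  ... | false = R.trans (R.reflexive (cong coef (ungrow (enumL (mapL b us))))) (S-enum b us (g ∘ (false ∷_)))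
    where
    ungrow : ∀ τs → psum ks g (grow false τs) ≡ psum ks (g ∘ (false ∷_)) τs
    ungrow [] = refl
    ungrow (τ ∷ τs) = cong (padd ks (g (false ∷ τ))) (ungrow τs)
  ... | true = R.trans (regroup (enumL (mapL b us)))
      (R.+-cong (S-enum b us (g ∘ (false ∷_))) (S-enum b us (g ∘ (true ∷_))))
    where
    regroup : ∀ τs → coef (psum ks g (grow true τs)) ≈
      add (coef (psum ks (g ∘ (false ∷_)) τs)) (coef (psum ks (g ∘ (true ∷_)) τs))
    regroup [] = R.sym (R.+-identityˡ _)
    regroup (τ ∷ τs) = R.trans (coef-padd (g (false ∷ τ)) (padd ks (g (true ∷ τ)) (psum ks g (grow true τs)))) (R.trans
      (R.+-congˡ (R.trans (coef-padd (g (true ∷ τ)) (psum ks g (grow true τs))) (R.+-congˡ (regroup τs))))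
      (R.trans (lem _ _ _ _) (R.sym (R.+-cong (coef-padd (g (false ∷ τ)) (psum ks (g ∘ (false ∷_)) τs))
                                              (coef-padd (g (true ∷ τ)) (psum ks (g ∘ (true ∷_)) τs))))))
      where
      lem : ∀ a b c d → add a (add b (add c d)) ≈ add (add a c) (add b d)
      lem a b c d = R.trans (R.+-congˡ (R.trans (R.sym (R.+-assoc b c d)) (R.trans (R.+-congʳ (R.+-comm b c)) (R.+-assoc c b d))))
        (R.sym (R.+-assoc a c _))

  coef-msgs : ∀ x ms σ → coef (prodMsgs ks x ms σ) ≈ Π (λ m → proj₁ m ≡ᵇ x) (λ m → proj₂ m σ) (interpret ms)
  coef-msgs x [] σ = coef-mono 0
  coef-msgs x ((p , t) ∷ ms) σ with p ≡ᵇ x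
  ... | true = R.trans (coef-pmul (content (descend t σ)) (prodMsgs ks x ms σ)) (R.*-congˡ (coef-msgs x ms σ))
  ... | false = coef-msgs x ms σ

  coef-local : ∀ x p ms σ → coef (local flag ks P x p ms σ) ≈ G x p (interpret ms) σ
  coef-local x p ms σ = R.trans (recsPart recs) (R.trans (R.*-congˡ (coef-msgs x ms σ)) (R.*-comm _ _))
    where
    prodR : List (El rec) → List Bool
    prodR = foldr (λ r a → if settled bags x p r then pmul ks (factor flag ks P r σ) a else a) (prodMsgs ks x ms σ)
    recsPart : ∀ rs → coef (prodR rs) ≈
      R._*_ (Π (settles x p) (λ r → F r σ) rs) (coef (prodMsgs ks x ms σ))
    recsPart [] = R.sym (R.*-identityˡ _)
    recsPart (r ∷ rs) with settles x p r
    ... | true = R.trans (coef-pmul (factor flag ks P r σ) (prodR rs)) (R.trans (R.*-congˡ (recsPart rs)) (R.sym (R.*-assoc _ _ _)))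
    ... | false = recsPart rs

  computed : ∀ O → Computed O (interpret (messages O))
  computed [] = []
  computed ((x , p) ∷ O) = spec ∷ computed O
    where
    κ = kept vs ν bags x p
    ms = messages O
    lκ : length κ ≡ length vs
    lκ = length-mapL _ vs
    spec : ∀ σ → length σ ≡ length vs → coef (content (descend (tableOf (enumL κ) κ x p ms) σ)) ≈
      S (drop x p) vs (λ ρ → G x p (interpret ms) (zipOr (zipAnd σ (List.map (keep x p) vs)) ρ))
    spec σ l with build-spec κ (λ τ → leaf (inner x p ms τ))
    ... | t , eq , d = R.trans (R.reflexive (cong coef (trans
        (cong (λ ts → content (descend (elimList (leaf []) (λ t _ → t) ts) σ)) eq)
        (cong content (d σ (trans l (sym lκ)))))))
      (R.trans (S-enum (drop x p) vs (λ ρ → local flag ks P x p ms (merge is (zipAnd σ κ) ρ)))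
        (S-cong (drop x p) vs (λ ρ s → R.trans (R.reflexive (cong (λ z → coef (local flag ks P x p ms z))
            (merge-zipOr (length vs) (zipAnd σ κ) ρ (trans (length-zipAnd σ κ (trans l (sym lκ))) lκ) (Sub-length s))))
          (R.trans (coef-local x p ms (zipOr (zipAnd σ κ) ρ))
            (R.reflexive (cong (λ z → G x p (interpret ms) (zipOr (zipAnd σ z) ρ)) (mapL≡map (keep x p) vs)))))))

  F-local : (∀ x u → T (at bags x u) → u < n) → ∀ r x {b σ τ} → T (both x r) →
            T (b (proj₁ (proj₁ r))) → T (b (proj₂ (proj₁ r))) → Agree b vs σ τ → F r σ ≈ F r τ
  F-local small ((u , v) , ws) x {b} {σ} {τ} bx bu bv ag = R.reflexive (cong coef
    (psum-cong ks bits2 λ a₀ → psum-cong ks bits2 λ a₁ → psum-cong ks bits2 λ b₀ → psum-cong ks bits2 λ b₁ →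
      cong (λ c → if admissible flag (proj₁ (proj₂ P)) u v a₀ a₁ b₀ b₁ ∧ c then mono ks (weight (proj₁ (proj₂ (proj₂ (proj₂ P)))) ws a₀ a₁ b₀ b₁) else [])
        (consistent-agree n a₀ a₁ b₀ b₁ ag (small x u (T∧₁ bx)) (small x v (T∧₂ {at bags x u} bx)) bu bv)))

  zeros : List Bool
  zeros = mapL (λ _ → false) vs

  -- The root is eliminated into a virtual node N with an empty bag.
  result : ℕ → List (ℕ × ℕ) → List Bool
  result N O = prodMsgs ks N (messages O) zeros

  -- The bag of `N` is empty, hence after the last elimination only the zero state is left and the
  -- messages to `N` carry the whole sum. Every nonroot lies in some bag, so no bit is missing;
  -- pairs contained in no bag have factor one.
  result-spec : ∀ N O → (∀ x u → T (at bags x u) → u < n) → (∀ v → at bags N v ≡ false) → Good (N ∷ []) O →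
    (∀ v → T (nth false v ν) → T (anyL (λ x → at bags x v) (final (N ∷ []) O))) →
    (∀ r → livePair (final (N ∷ []) O) r ≡ false → ∀ σ → F r σ ≈ R.1#) →
    coef (result N O) ≈ S (λ v → nth false v ν) vs (λ σ → Π (λ _ → true) (λ r → F r σ) recs)
  result-spec N O small empty good cover trivial = R.sym (R.trans
    (R.trans (S-mask {c = live A} vs _ (λ v → T-ext (λ q → T∧ q (cover v q)) T∧₁))
      (S-cong (live A) vs (λ σ _ → R.sym (Π-all (livePair A) _ recs (λ r e → trivial r e σ)))))
    (R.trans (eliminate (F-local small) (N ∷ []) good (computed O))
      (R.trans (S-none {live (N ∷ [])} vs _ (λ v → trans (cong (λ b → nth false v ν ∧ (b ∨ false)) (empty v)) (Boolₚ.∧-zeroʳ (nth false v ν))))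
        (R.trans (R.*-cong (Π-tag (interpret (messages O))) (Π-none (livePair (N ∷ [])) _ recs (λ r → cong (λ b → (b ∧ at bags N (proj₂ (proj₁ r))) ∨ false) (empty _))))
          (R.trans (R.*-identityʳ _) (R.trans (R.reflexive (cong (λ z → Π (λ m → proj₁ m ≡ᵇ N) (λ m → proj₂ m z) (interpret (messages O))) (sym (mapL≡map (λ _ → false) vs))))
            (R.sym (coef-msgs N (messages O) zeros))))))))
    where
    A = final (N ∷ []) O
    Π-tag : ∀ ms {σ} → Π (λ m → proj₁ m ∈ᵇ (N ∷ [])) (λ m → proj₂ m σ) ms ≈ Π (λ m → proj₁ m ≡ᵇ N) (λ m → proj₂ m σ) ms
    Π-tag [] = R.refl
    Π-tag (m ∷ ms) with proj₁ m ≡ᵇ N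
    ... | true = R.*-congˡ (Π-tag ms)
    ... | false = Π-tag ms

-- Expansion of the partition function

zipXor : List Bool → List Bool → List Bool
zipXor = List.zipWith _xor_

XS : (ℕ → Bool) → List ℕ → (List Bool → Bool) → Bool
XS b [] f = f []
XS b (v ∷ vs) f = if b v then XS b vs (f ∘ (false ∷_)) xor XS b vs (f ∘ (true ∷_)) else XS b vs (f ∘ (false ∷_))

allX : ∀ m → (Vec Bool m → Bool) → Bool
allX zero f = f []
allX (suc m) f = allX m (f ∘ (false ∷_)) xor allX m (f ∘ (true ∷_))

allX-cong : ∀ m {f g} → (∀ c → f c ≡ g c) → allX m f ≡ allX m g
allX-cong zero h = h []
allX-cong (suc m) h = cong₂ _xor_ (allX-cong m (λ c → h _)) (allX-cong m (λ c → h _))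

xor-true : ∀ {a b} → a xor b ≡ true → T a ⊎ T b
xor-true {true} eq = inj₁ tt
xor-true {false} {true} eq = inj₂ tt

XS-∃ : ∀ b vs f → XS b vs f ≡ true → ∃[ σ ] (Sub b vs σ × T (f σ))
XS-∃ b [] f eq = [] , [] , true→T eq
XS-∃ b (v ∷ vs) f eq with b v in bv
... | false = let (σ , s , t) = XS-∃ b vs _ eq in false ∷ σ , (λ ()) ∷ s , t
... | true with xor-true eq
... | inj₁ t = let (σ , s , u) = XS-∃ b vs _ (T→true t) in false ∷ σ , (λ ()) ∷ s , u
... | inj₂ t = let (σ , s , u) = XS-∃ b vs _ (T→true t) in true ∷ σ , (λ _ → true→T bv) ∷ s , u

XS-cong : ∀ b vs {f g} → (∀ σ → Sub b vs σ → f σ ≡ g σ) → XS b vs f ≡ XS b vs g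
XS-cong b [] h = h [] []
XS-cong b (v ∷ vs) h with b v in bv
... | false = XS-cong b vs (λ σ s → h _ ((λ ()) ∷ s))
... | true = cong₂ _xor_ (XS-cong b vs (λ σ s → h _ ((λ ()) ∷ s))) (XS-cong b vs (λ σ s → h _ ((λ _ → true→T bv) ∷ s)))

XS-shift : ∀ b vs t f → Sub b vs t → XS b vs (λ σ → f (zipXor σ t)) ≡ XS b vs f
XS-shift b [] [] f [] = refl
XS-shift b (v ∷ vs) (false ∷ t) f (_ ∷ s) with b v
... | true = cong₂ _xor_ (XS-shift b vs t _ s) (XS-shift b vs t _ s)
... | false = XS-shift b vs t _ s
XS-shift b (v ∷ vs) (true ∷ t) f (q ∷ s) rewrite T→true (q tt) =
  trans (cong₂ _xor_ (XS-shift b vs t (f ∘ (true ∷_)) s) (XS-shift b vs t (f ∘ (false ∷_)) s))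
        (Boolₚ.xor-comm (XS b vs (f ∘ (true ∷_))) (XS b vs (f ∘ (false ∷_))))

-- Invariance under a nonzero translation pairs up the states.
XS-even : ∀ b vs t f → Sub b vs t → T (anyL id t) → (∀ σ → Sub b vs σ → f (zipXor σ t) ≡ f σ) → XS b vs f ≡ false
XS-even b (v ∷ vs) (false ∷ t) f (_ ∷ s) nz h with b v in bv
... | false = XS-even b vs t _ s nz (λ σ p → h _ ((λ ()) ∷ p))
... | true = cong₂ _xor_ (XS-even b vs t _ s nz (λ σ p → h _ ((λ ()) ∷ p))) (XS-even b vs t _ s nz (λ σ p → h _ ((λ _ → true→T bv) ∷ p)))
XS-even b (v ∷ vs) (true ∷ t) f (q ∷ s) nz h rewrite T→true (q tt) =
  trans (cong (XS b vs (f ∘ (false ∷_)) xor_) (trans (sym (XS-shift b vs t (f ∘ (true ∷_)) s)) (XS-cong b vs (λ σ p → h (false ∷ σ) ((λ ()) ∷ p)))))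
    (Boolₚ.xor-same (XS b vs (f ∘ (false ∷_))))

XS-unique : ∀ b vs f → (∀ σ → Sub b vs σ → T (f σ) → T (allL not σ)) → T (f (List.map (λ _ → false) vs)) → XS b vs f ≡ true
XS-unique b [] f h z = T→true z
XS-unique b (v ∷ vs) f h z with b v in bv
... | false = XS-unique b vs _ (λ σ p t → h (false ∷ σ) ((λ ()) ∷ p) t) z
... | true = trans (cong₂ _xor_ (XS-unique b vs _ (λ σ p t → h (false ∷ σ) ((λ ()) ∷ p) t) z)
    (trans (XS-cong b vs {g = λ _ → false} (λ σ p → ¬T→false (λ t → h (true ∷ σ) ((λ _ → true→T bv) ∷ p) t))) (none vs))) refl
  where
  none : ∀ vs → XS b vs (λ _ → false) ≡ false
  none [] = refl
  none (v ∷ vs) with b v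
  ... | true = cong₂ _xor_ (none vs) (none vs)
  ... | false = none vs

module Expansion (flag : Bool) (D : El mat) {n : ℕ} where

  Pairs : Set
  Pairs = List (Fin n × Fin n)

  module _ where

    recsOf : ∀ (ps : Pairs) → Vec (List Bool) (length ps * 4) → List (El rec)
    recsOf [] [] = []
    recsOf ((u , v) ∷ ps) (w₀ ∷ w₁ ∷ w₂ ∷ w₃ ∷ ω) =
      ((toℕ u , toℕ v) , w₀ , w₁ , w₂ , w₃) ∷ recsOf ps ω

    weightOf : ℕ × ℕ × ℕ → (ps : Pairs) → Vec (List Bool) (length ps * 4) → Vec Bool (length ps * 4) → ℕ
    weightOf Ms [] [] [] = 0
    weightOf Ms (_ ∷ ps) (w₀ ∷ w₁ ∷ w₂ ∷ w₃ ∷ ω) (a₀ ∷ a₁ ∷ b₀ ∷ b₁ ∷ c) =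
      weight Ms (w₀ , w₁ , w₂ , w₃) a₀ a₁ b₀ b₁ + weightOf Ms ps ω c

  fits : (ps : Pairs) → Vec Bool (length ps * 4) → List Bool → Bool
  fits [] [] σ = true
  fits ((u , v) ∷ ps) (a₀ ∷ a₁ ∷ b₀ ∷ b₁ ∷ c) σ =
    (admissible flag D (toℕ u) (toℕ v) a₀ a₁ b₀ b₁ ∧ consistent n σ (toℕ u) (toℕ v) a₀ a₁ b₀ b₁) ∧ fits ps c σ

  parity : List ℕ → (ℕ → Bool) → (ps : Pairs) → Vec Bool (length ps * 4) → Bool
  parity vs ν ps c = XS ν vs (fits ps c)

  module _ (K : ℕ) where

    open Poly K
    open Sums ring
    private module R = CommutativeSemiring ring

    allR : ∀ m → (Vec Bool m → ℕ → Bool) → ℕ → Bool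
    allR zero f = f []
    allR (suc m) f = add (allR m (f ∘ (false ∷_))) (allR m (f ∘ (true ∷_)))

    allR-cong : ∀ m {f g} → (∀ c → f c ≈ g c) → allR m f ≈ allR m g
    allR-cong zero h = h []
    allR-cong (suc m) h = R.+-cong (allR-cong m (λ c → h _)) (allR-cong m (λ c → h _))

    allR-scale : ∀ m x f → mul x (allR m f) ≈ allR m (λ c → mul x (f c))
    allR-scale zero x f = R.refl
    allR-scale (suc m) x f = R.trans (R.distribˡ x _ _) (R.+-cong (allR-scale m x _) (allR-scale m x _))

    allR-allX : ∀ m f e → allR m f e ≡ allX m (λ c → f c e)
    allR-allX zero f e = refl
    allR-allX (suc m) f e = trans (add-def _ _ e) (cong₂ _xor_ (allR-allX m _ e) (allR-allX m _ e))

    S-allR : ∀ m b vs (f : List Bool → Vec Bool m → ℕ → Bool) →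
             S b vs (λ σ → allR m (f σ)) ≈ allR m (λ c → S b vs (λ σ → f σ c))
    S-allR zero b vs f = R.refl
    S-allR (suc m) b vs f = R.trans (S-add b vs _ _) (R.+-cong (S-allR m b vs _) (S-allR m b vs _))

    S-XS : ∀ b vs (f : List Bool → Bool) (g : ℕ → Bool) e → S b vs (λ σ e → f σ ∧ g e) e ≡ XS b vs f ∧ g e
    S-XS b [] f g e = refl
    S-XS b (v ∷ vs) f g e with b v
    ... | false = S-XS b vs _ g e
    ... | true = trans (add-def _ _ e) (trans (cong₂ _xor_ (S-XS b vs _ g e) (S-XS b vs _ g e))
      (trans (cong₂ _xor_ (Boolₚ.∧-comm x (g e)) (Boolₚ.∧-comm y (g e))) (trans (sym (Boolₚ.∧-distribˡ-xor (g e) x y)) (Boolₚ.∧-comm (g e) (x xor y)))))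
      where
      x = XS b vs (f ∘ (false ∷_))
      y = XS b vs (f ∘ (true ∷_))

    both : (Bool → ℕ → Bool) → ℕ → Bool
    both f = add (f false) (f true)

    psum-both : ∀ g → coef (psum ks g bits2) ≈ both (coef ∘ g)
    psum-both g = R.trans (coef-padd (g false) (padd ks (g true) [])) (R.+-congˡ
      (R.trans (coef-padd (g true) []) (R.+-identityʳ _)))

    both-cong : ∀ {f g} → (∀ b → f b ≈ g b) → both f ≈ both g
    both-cong h = R.+-cong (h false) (h true)

    both-mul : ∀ f x → mul (both f) x ≈ both (λ b → mul (f b) x)
    both-mul f x = R.distribʳ x (f false) (f true)

    coef-if : ∀ b w → coef (if b then mono ks w else []) ≈ (λ e → b ∧ (e ≡ᵇ w))
    coef-if true w = coef-mono w
    coef-if false w = R.refl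

    mono-times : ∀ x y a b → mul (λ e → x ∧ (e ≡ᵇ a)) (λ e → y ∧ (e ≡ᵇ b)) ≈ (λ e → (x ∧ y) ∧ (e ≡ᵇ a + b))
    mono-times true true a b = upto λ e l → mono-mul a b e l
    mono-times true false a b = R.zeroʳ _
    mono-times false y a b = R.zeroˡ _

    module _ (bags : El mat) (Ms : ℕ × ℕ × ℕ) where

      product : ∀ rs (ps : Pairs) (ω : Vec (List Bool) (length ps * 4)) σ →
        Π (λ _ → true) (λ r → coef (factor flag ks (n , D , bags , Ms , rs) r σ)) (recsOf ps ω)
          ≈ allR (length ps * 4) (λ c e → fits ps c σ ∧ (e ≡ᵇ weightOf Ms ps ω c))
      product rs [] [] σ = R.refl
      product rs ((u , v) ∷ ps) (w₀ ∷ w₁ ∷ w₂ ∷ w₃ ∷ ω) σ =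
        R.trans (R.*-cong expand (product rs ps ω σ))
          (push λ a₀ → push λ a₁ → push λ b₀ → push λ b₁ →
            R.trans (allR-scale (length ps * 4) _ _) (allR-cong (length ps * 4) (λ c →
              mono-times (good a₀ a₁ b₀ b₁) (fits ps c σ) (weight Ms ws a₀ a₁ b₀ b₁) (weightOf Ms ps ω c))))
        where
        ws = w₀ , w₁ , w₂ , w₃
        good : Bool → Bool → Bool → Bool → Bool
        good a₀ a₁ b₀ b₁ = admissible flag D (toℕ u) (toℕ v) a₀ a₁ b₀ b₁ ∧ consistent n σ (toℕ u) (toℕ v) a₀ a₁ b₀ b₁
        expand : coef (factor flag ks (n , D , bags , Ms , rs) ((toℕ u , toℕ v) , ws) σ) ≈
          both λ a₀ → both λ a₁ → both λ b₀ → both λ b₁ e → good a₀ a₁ b₀ b₁ ∧ (e ≡ᵇ weight Ms ws a₀ a₁ b₀ b₁)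
        expand = R.trans (psum-both λ a₀ → psum ks (λ a₁ → psum ks (λ b₀ → psum ks (t a₀ a₁ b₀) bits2) bits2) bits2)
          (both-cong λ a₀ → R.trans (psum-both λ a₁ → psum ks (λ b₀ → psum ks (t a₀ a₁ b₀) bits2) bits2)
          (both-cong λ a₁ → R.trans (psum-both λ b₀ → psum ks (t a₀ a₁ b₀) bits2)
          (both-cong λ b₀ → R.trans (psum-both (t a₀ a₁ b₀))
          (both-cong λ b₁ → coef-if (good a₀ a₁ b₀ b₁) (weight Ms ws a₀ a₁ b₀ b₁)))))
          where
          t : Bool → Bool → Bool → Bool → List Bool
          t = term flag ks (n , D , bags , Ms , rs) ((toℕ u , toℕ v) , ws) σ
        push : ∀ {f g : Bool → ℕ → Bool} {x} → (∀ b → mul (f b) x ≈ g b) → mul (both f) x ≈ both g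
        push {f} h = R.trans (both-mul f _) (both-cong h)

      -- Multiplying out the product over the pairs gives one monomial per choice of arcs.
      -- Exchanging this sum with the one over the states leaves, at exponent `e`, the parity of the
      -- number of choices of weight `e` that admit an odd number of states.
      expansion : ∀ rs ν vs ps (ω : Vec (List Bool) (length ps * 4)) e → e < K →
        S ν vs (λ σ → Π (λ _ → true) (λ r → coef (factor flag ks (n , D , bags , Ms , rs) r σ)) (recsOf ps ω)) e
          ≡ allX (length ps * 4) (λ c → parity vs ν ps c ∧ (e ≡ᵇ weightOf Ms ps ω c))
      expansion rs ν vs ps ω e l = trans (coeff (R.trans (S-cong ν vs (λ σ _ → product rs ps ω σ)) (S-allR (length ps * 4) ν vs _)) e l)
        (trans (allR-allX (length ps * 4) _ e) (allX-cong (length ps * 4) (λ c → S-XS ν vs (fits ps c) (λ e → e ≡ᵇ weightOf Ms ps ω c) e)))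

-- Finite sums and numbers of arcs

⌜_⌝ : Bool → ℕ
⌜ b ⌝ = if b then 1 else 0

sumF : ∀ {n} → (Fin n → ℕ) → ℕ
sumF {zero} g = 0
sumF {suc n} g = g zero + sumF (g ∘ suc)

sumL : ∀ {A : Set} → (A → ℕ) → List A → ℕ
sumL g = foldr (λ x a → g x + a) 0

sumF-cong : ∀ {n} {g h : Fin n → ℕ} → (∀ v → g v ≡ h v) → sumF g ≡ sumF h
sumF-cong {zero} e = refl
sumF-cong {suc n} e = cong₂ _+_ (e zero) (sumF-cong (e ∘ suc))

sumF-mono : ∀ {n} {g h : Fin n → ℕ} → (∀ v → g v ≤ h v) → sumF g ≤ sumF h
sumF-mono {zero} e = z≤n
sumF-mono {suc n} e = +-mono-≤ (e zero) (sumF-mono (e ∘ suc))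

+-exchange : ∀ a b c d → (a + b) + (c + d) ≡ (a + c) + (b + d)
+-exchange a b c d = trans (+-assoc a b (c + d)) (trans (cong (a +_)
  (trans (sym (+-assoc b c d)) (trans (cong (_+ d) (+-comm b c)) (+-assoc c b d)))) (sym (+-assoc a c (b + d))))

sumF-+ : ∀ {n} (g h : Fin n → ℕ) → sumF (λ v → g v + h v) ≡ sumF g + sumF h
sumF-+ {zero} g h = refl
sumF-+ {suc n} g h = trans (cong (g zero + h zero +_) (sumF-+ (g ∘ suc) (h ∘ suc))) (+-exchange (g zero) (h zero) _ _)

sumF-0 : ∀ {n} → sumF {n} (λ _ → 0) ≡ 0
sumF-0 {zero} = refl
sumF-0 {suc n} = sumF-0 {n}

sumF-swap : ∀ {m n} (g : Fin m → Fin n → ℕ) → sumF (λ u → sumF (g u)) ≡ sumF (λ v → sumF (λ u → g u v))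
sumF-swap {zero} {n} g = sym (sumF-0 {n})
sumF-swap {suc m} g = trans (cong (sumF (g zero) +_) (sumF-swap (g ∘ suc))) (sym (sumF-+ (g zero) _))

sumF-term : ∀ {n} (g : Fin n → ℕ) v → g v ≤ sumF g
sumF-term g zero = m≤m+n _ _
sumF-term g (suc v) = ≤-trans (sumF-term (g ∘ suc) v) (m≤n+m _ (g zero))

sumF-tight : ∀ {n} {g h : Fin n → ℕ} → (∀ v → g v ≤ h v) → sumF h ≤ sumF g → ∀ v → g v ≡ h v
sumF-tight {suc n} {g} {h} le tot zero = ≤-antisym (le zero) (+-cancelʳ-≤ (sumF (g ∘ suc)) (h zero) (g zero)
  (≤-trans (+-monoʳ-≤ (h zero) (sumF-mono (le ∘ suc))) tot))
sumF-tight {suc n} {g} {h} le tot (suc v) = sumF-tight (le ∘ suc)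
  (+-cancelˡ-≤ (h zero) _ _ (≤-trans tot (+-monoˡ-≤ (sumF (g ∘ suc)) (le zero)))) v

_==_ : ∀ {n} → Digraph n
u == v = ⌊ u ≟ v ⌋

==-refl : ∀ {n} (u : Fin n) → (u == u) ≡ true
==-refl u with u ≟ u
... | yes _ = refl
... | no ne = contradiction refl ne

==-true : ∀ {n} {u v : Fin n} → T (u == v) → u ≡ v
==-true {u = u} {v} t with u ≟ v
... | yes eq = eq

==-suc : ∀ {n} (u v : Fin n) → (suc u == suc v) ≡ (u == v)
==-suc u v with u ≟ v
... | yes _ = refl
... | no _ = refl

sumF-point : ∀ {n} (u : Fin n) → sumF (λ v → ⌜ u == v ⌝) ≡ 1
sumF-point {suc n} zero = cong suc (sumF-0 {n})
sumF-point {suc n} (suc u) = trans (sumF-cong (λ v → cong ⌜_⌝ (==-suc u v))) (sumF-point u)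

sumF-const : ∀ n c → sumF {n} (λ _ → c) ≡ n * c
sumF-const zero c = refl
sumF-const (suc n) c = cong (c +_) (sumF-const n c)

⌜⌝≤1 : ∀ b → ⌜ b ⌝ ≤ 1
⌜⌝≤1 false = z≤n
⌜⌝≤1 true = ≤-refl

⌜⌝-mono : ∀ {a b} → (T a → T b) → ⌜ a ⌝ ≤ ⌜ b ⌝
⌜⌝-mono {false} h = z≤n
⌜⌝-mono {true} {true} h = ≤-refl
⌜⌝-mono {true} {false} h = ⊥-elim (h tt)

⌜∨⌝-≤ : ∀ a b → ⌜ a ∨ b ⌝ ≤ ⌜ a ⌝ + ⌜ b ⌝
⌜∨⌝-≤ false b = ≤-refl
⌜∨⌝-≤ true b = s≤s z≤n

arcCount : ∀ {n} → Digraph n → ℕ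
arcCount X = sumF (λ u → sumF (λ v → ⌜ X u v ⌝))

sumL-++ : ∀ {A : Set} (g : A → ℕ) xs ys → sumL g (xs ++ ys) ≡ sumL g xs + sumL g ys
sumL-++ g [] ys = refl
sumL-++ g (x ∷ xs) ys = trans (cong (g x +_) (sumL-++ g xs ys)) (sym (+-assoc (g x) _ _))

sumF-sumL : ∀ {A : Set} {n} (g : Fin n → A → ℕ) xs → sumF (λ v → sumL (g v) xs) ≡ sumL (λ x → sumF (λ v → g v x)) xs
sumF-sumL {n = n} g [] = sumF-0 {n}
sumF-sumL g (x ∷ xs) = trans (sumF-+ (λ v → g v x) (λ v → sumL (g v) xs)) (cong (sumF (λ v → g v x) +_) (sumF-sumL g xs))

sumL-cong : ∀ {A : Set} {g h : A → ℕ} xs → (∀ x → g x ≡ h x) → sumL g xs ≡ sumL h xs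
sumL-cong [] e = refl
sumL-cong (x ∷ xs) e = cong₂ _+_ (e x) (sumL-cong xs e)

sumL-1 : ∀ {A : Set} (xs : List A) → sumL (λ _ → 1) xs ≡ length xs
sumL-1 [] = refl
sumL-1 (x ∷ xs) = cong suc (sumL-1 xs)

-- Reachability, decided by Warshall's algorithm

module _ {n : ℕ} where

  round : Fin n → Digraph n → Digraph n
  round w ρ u v = ρ u v ∨ (ρ u w ∧ ρ w v)

  closure : Digraph n → Digraph n
  closure e = foldr round (λ u v → e u v ∨ (u == v)) (allFin n)

  module _ (e : Digraph n) where

    private
      Path : Fin n → Fin n → Set
      Path = Star (λ u v → T (e u v))
      C : List (Fin n) → Digraph n
      C = foldr round (λ u v → e u v ∨ (u == v))

      sound : ∀ ws u v → T (C ws u v) → Path u v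
      sound [] u v t = T∨-elim {e u v} t (λ p → p ◅ ε) (λ q → subst (Path u) (==-true q) ε)
      sound (w ∷ ws) u v t = T∨-elim {C ws u v} t (sound ws u v)
        (λ p → sound ws u w (T∧₁ p) ◅◅ sound ws w v (T∧₂ {C ws u w} p))

      base : ∀ ws u v → T (e u v ∨ (u == v)) → T (C ws u v)
      base [] u v t = t
      base (w ∷ ws) u v t = T∨₁ (base ws u v t)

      -- For an older `w`, each of the two connections is either old or passes through the newest
      -- vertex `x`. Old pieces that meet in `w` are joined by induction; if both connections pass
      -- through `x`, the part between the two visits is cut out.
      through : ∀ ws w → w ∈ ws → ∀ u v → T (C ws u w) → T (C ws w v) → T (C ws u v)
      through (w ∷ ws) .w (here refl) u v p q = T∨₂ {C ws u v} (T∧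
        (T∨-elim {C ws u w} p id T∧₁) (T∨-elim {C ws w v} q id (T∧₂ {C ws w w})))
      through (x ∷ ws) w (there m) u v p q = T∨-elim {C ws u w} p
        (λ p → T∨-elim {C ws w v} q
          (λ q → T∨₁ (tr u v p q))
          (λ q → T∨₂ {C ws u v} (T∧ (tr u x p (T∧₁ q)) (T∧₂ {C ws w x} q))))
        (λ p → T∨-elim {C ws w v} q
          (λ q → T∨₂ {C ws u v} (T∧ (T∧₁ p) (tr x v (T∧₂ {C ws u x} p) q)))
          (λ q → T∨₂ {C ws u v} (T∧ (T∧₁ p) (T∧₂ {C ws w x} q))))
        where
        tr : ∀ u v → T (C ws u w) → T (C ws w v) → T (C ws u v)
        tr = through ws w m

    closure-sound : ∀ u v → T (closure e u v) → Path u v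
    closure-sound = sound (allFin n)

    closure-refl : ∀ u → T (closure e u u)
    closure-refl u = base (allFin n) u u (T∨₂ {e u u} (true→T (==-refl u)))

    closure-trans : ∀ u w v → T (closure e u w) → T (closure e w v) → T (closure e u v)
    closure-trans u w v = through (allFin n) w (∈-allFin w) u v

    closure-complete : ∀ {u v} → Path u v → T (closure e u v)
    closure-complete ε = closure-refl _
    closure-complete (p ◅ q) = closure-trans _ _ _ (base (allFin n) _ _ (T∨₁ p)) (closure-complete q)

-- Branchings

anyL-intro : ∀ {A : Set} (g : A → Bool) xs {x} → x ∈ xs → T (g x) → T (anyL g xs)
anyL-intro g (x ∷ xs) (here refl) t = T∨₁ t
anyL-intro g (x ∷ xs) (there m) t = T∨₂ {g x} (anyL-intro g xs m t)

joins : ∀ {n} → Fin n → Fin n → Fin n × Fin n → Bool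
joins u v (x , y) = (x == u) ∧ (y == v)

listed : ∀ {n} → List (Fin n × Fin n) → Digraph n
listed as u v = anyL (joins u v) as

listed-elim : ∀ {n} (as : List (Fin n × Fin n)) {u v} → T (listed as u v) → (u , v) ∈ as
listed-elim ((x , y) ∷ as) {u} {v} t = T∨-elim {(x == u) ∧ (y == v)} t
  (λ q → here (cong₂ _,_ (sym (==-true (T∧₁ q))) (sym (==-true (T∧₂ {x == u} q))))) (λ q → there (listed-elim as q))

listed-intro : ∀ {n} (as : List (Fin n × Fin n)) {u v} → (u , v) ∈ as → T (listed as u v)
listed-intro (_ ∷ as) {u} {v} (here refl) rewrite ==-refl u | ==-refl v = tt
listed-intro (b ∷ as) (there m) = T∨₂ {joins _ _ b} (listed-intro as m)

module Branching {n : ℕ} (ν : Fin n → Bool) (as : List (Fin n × Fin n)) where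

  indegree : Fin n → ℕ
  indegree v = sumL (λ a → ⌜ proj₂ a == v ⌝) as

  total : sumF indegree ≡ length as
  total = trans (sumF-sumL (λ v a → ⌜ proj₂ a == v ⌝) as) (trans (sumL-cong as (λ a → sumF-point (proj₂ a))) (sumL-1 as))

  Chosen : Fin n → Fin n → Set
  Chosen u v = (u , v) ∈ as

  indegree≥1 : ∀ (bs : List (Fin n × Fin n)) {u v} → (u , v) ∈ bs → 1 ≤ sumL (λ a → ⌜ proj₂ a == v ⌝) bs
  indegree≥1 (_ ∷ bs) {v = v} (here refl) rewrite ==-refl v = s≤s z≤n
  indegree≥1 (b ∷ bs) (there m) = ≤-trans (indegree≥1 bs m) (m≤n+m _ _)

  unique : ∀ (bs : List (Fin n × Fin n)) {u w v} → sumL (λ a → ⌜ proj₂ a == v ⌝) bs ≤ 1 → (u , v) ∈ bs → (w , v) ∈ bs → u ≡ w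
  unique (_ ∷ bs) l (here refl) (here refl) = refl
  unique (_ ∷ bs) {v = v} l (here refl) (there q) rewrite ==-refl v =
    contradiction (≤-trans (s≤s (indegree≥1 bs q)) l) (λ { (s≤s ()) })
  unique (_ ∷ bs) {v = v} l (there p) (here refl) rewrite ==-refl v =
    contradiction (≤-trans (s≤s (indegree≥1 bs p)) l) (λ { (s≤s ()) })
  unique (b ∷ bs) l (there p) (there q) = unique bs (≤-trans (m≤n+m _ _) l) p q

  private
    e : Digraph n
    e = listed as

    rootReach : Fin n → Bool
    rootReach v = anyL (λ r → not (ν r) ∧ closure e r v) (allFin n)

    reached : ∀ {r v} → ¬ T (ν r) → T (closure e r v) → T (rootReach v)
    reached {r} nr c = anyL-intro _ (allFin n) (∈-allFin r) (T∧ (T-not nr) c)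

    last : ∀ {r v} → Star (λ u v → T (e u v)) r v → r ≡ v ⊎ ∃[ w ] (Star (λ u v → T (e u v)) r w × T (e w v))
    last ε = inj₁ refl
    last (p ◅ q) with last q
    ... | inj₁ refl = inj₂ (_ , ε , p)
    ... | inj₂ (w , s , t) = inj₂ (w , p ◅ s , t)

  -- The total indegree is the number of arcs, so the two bounds are tight: nonroots have indegree
  -- one and roots indegree zero. Then an arc never joins a reached vertex to an unreached one in
  -- either direction, the indicator of the unreached vertices is constant along arcs, and rigidity
  -- makes it vanish.
  reachable : (∀ v → T (ν v) → 1 ≤ indegree v) → length as ≤ sumF (λ v → ⌜ ν v ⌝) →
    (∀ (χ : Fin n → Bool) → (∀ v → T (χ v) → T (ν v)) → (∀ u v → Chosen u v → χ u ≡ χ v) → ∀ v → ¬ T (χ v)) →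
    ∀ v → ∃[ r ] (¬ T (ν r) × Star Chosen r v)
  reachable low few rigid v with rootReach v in eq
  ... | false = contradiction (T-not (λ t → subst T eq t)) (rigid (not ∘ rootReach) isNonroot constant v)
    where
    indeg-ν : ∀ v → ⌜ ν v ⌝ ≡ indegree v
    indeg-ν = sumF-tight le (≡≤ (total) few)
      where
      le : ∀ v → ⌜ ν v ⌝ ≤ indegree v
      le v with ν v in eqv
      ... | true = low v (true→T eqv)
      ... | false = z≤n
    isNonroot : ∀ v → T (not (rootReach v)) → T (ν v)
    isNonroot v t with ν v in eqv
    ... | true = tt
    ... | false = not-T t (reached (λ q → subst T eqv q) (closure-refl e v))
    nonroot : ∀ {u v} → Chosen u v → T (ν v)
    nonroot {u} {v} c with ν v | indeg-ν v
    ... | true | _ = tt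
    ... | false | z = contradiction (subst (1 ≤_) (sym z) (indegree≥1 as c)) (λ ())
    indeg≤1 : ∀ v → indegree v ≤ 1
    indeg≤1 v rewrite sym (indeg-ν v) with ν v
    ... | true = ≤-refl
    ... | false = z≤n
    constant : ∀ u v → Chosen u v → not (rootReach u) ≡ not (rootReach v)
    constant u v c = cong not (T-ext fwd bwd)
      where
      fwd : T (rootReach u) → T (rootReach v)
      fwd t = let (r , q) = anyL-∃ _ (allFin n) t in
        reached (not-T (T∧₁ q)) (closure-trans e r u v (T∧₂ {not (ν r)} q) (closure-complete e (listed-intro as c ◅ ε)))
      bwd : T (rootReach v) → T (rootReach u)
      bwd t = let (r , q) = anyL-∃ _ (allFin n) t in
        pred-reached r (not-T (T∧₁ q)) (last (closure-sound e r v (T∧₂ {not (ν r)} q)))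
        where
        pred-reached : ∀ r → ¬ T (ν r) → r ≡ v ⊎ ∃[ w ] (Star (λ u v → T (e u v)) r w × T (e w v)) → T (rootReach u)
        pred-reached r nr (inj₁ eq) = contradiction (nonroot c) (subst (λ z → ¬ T (ν z)) eq nr)
        -- `v` is entered only once, so the last arc of the path from the root is the arc from `u`,
        -- and the path visits `u` before.
        pred-reached r nr (inj₂ (w , s , p)) = subst (T ∘ rootReach) (sym (unique as (indeg≤1 v) c (listed-elim as p)))
          (reached {r} nr (closure-complete e s))
  ... | true = let (r , q) = anyL-∃ _ (allFin n) (true→T eq) in
    r , not-T (T∧₁ q) , Star.map (listed-elim as) (closure-sound e r v (T∧₂ {not (ν r)} q))

-- The arcs chosen in the two forests and their weights

opt : ∀ {A : Set} → Bool → A → List A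
opt b x = if b then x ∷ [] else []

length-opt : ∀ {A : Set} b {x : A} → length (opt b x) ≡ ⌜ b ⌝
length-opt false = refl
length-opt true = refl

opt-All : ∀ {A : Set} {P : A → Set} b {x xs} → All P (opt b x ++ xs) → (T b → P x) × All P xs
opt-All false ps = (λ ()) , ps
opt-All true (p ∷ ps) = (λ _ → p) , ps

opt-∈ : ∀ {A : Set} b {x y : A} {xs} → y ∈ opt b x ++ xs → (T b × y ≡ x) ⊎ y ∈ xs
opt-∈ false m = inj₂ m
opt-∈ true (here eq) = inj₁ (tt , eq)
opt-∈ true (there m) = inj₂ m

Selector : Set
Selector = Bool → Bool → Bool → Bool → Bool × Bool

-- `in⁻` lists the arcs of the in-forest reversed, as arcs of an out-forest, so that one argument
-- about indegrees serves both forests.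
out in⁻ any : Selector
out a₀ a₁ b₀ b₁ = a₀ , b₀
in⁻ a₀ a₁ b₀ b₁ = b₁ , a₁
any a₀ a₁ b₀ b₁ = a₀ ∨ a₁ , b₀ ∨ b₁

module _ {n : ℕ} where

  Pairing : Set
  Pairing = List (Fin n × Fin n)

  chosen : Selector → (ps : Pairing) → Vec Bool (length ps * 4) → List (Fin n × Fin n)
  chosen sel [] [] = []
  chosen sel ((u , v) ∷ ps) (a₀ ∷ a₁ ∷ b₀ ∷ b₁ ∷ c) =
    opt (proj₁ (sel a₀ a₁ b₀ b₁)) (u , v) ++ opt (proj₂ (sel a₀ a₁ b₀ b₁)) (v , u) ++ chosen sel ps c

  length-chosen : ∀ sel u v (ps : Pairing) a₀ a₁ b₀ b₁ c →
    length (chosen sel ((u , v) ∷ ps) (a₀ ∷ a₁ ∷ b₀ ∷ b₁ ∷ c)) ≡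
    (⌜ proj₁ (sel a₀ a₁ b₀ b₁) ⌝ + ⌜ proj₂ (sel a₀ a₁ b₀ b₁) ⌝) + length (chosen sel ps c)
  length-chosen sel u v ps a₀ a₁ b₀ b₁ c = trans (length-++ (opt x (u , v)))
    (trans (cong₂ _+_ (length-opt x) (trans (length-++ (opt y (v , u))) (cong (_+ length (chosen sel ps c)) (length-opt y))))
      (sym (+-assoc ⌜ x ⌝ ⌜ y ⌝ _)))
    where
    x = proj₁ (sel a₀ a₁ b₀ b₁)
    y = proj₂ (sel a₀ a₁ b₀ b₁)

  weigh≡ : ∀ w b → weigh w b ≡ w * ⌜ b ⌝
  weigh≡ w false = sym (*-zeroʳ w)
  weigh≡ w true = sym (*-identityʳ w)

  weigh-≥ : ∀ M w b → M * ⌜ b ⌝ ≤ weigh (M + w) b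
  weigh-≥ M w b = ≤≡ (*-monoˡ-≤ ⌜ b ⌝ (m≤m+n M w)) (sym (weigh≡ (M + w) b))

  weigh-≤ : ∀ M {w c} b → w ≤ c → weigh (M + w) b ≤ M * ⌜ b ⌝ + c
  weigh-≤ M {w} {c} false le = z≤n
  weigh-≤ M {w} {c} true le = +-mono-≤ (≤-reflexive (sym (*-identityʳ M))) le

  value-≤ : ∀ c bs → value c bs ≤ c
  value-≤ c [] = z≤n
  value-≤ c (b ∷ bs) = m⊓n≤m c _

  module _ (M₁ M₂ c : ℕ) where

    private
      Ms = M₁ , M₂ , c

    -- The weight of the choice at one pair without the random parts; there are four of these, each
    -- at most `c`.
    units : Bool → Bool → Bool → Bool → ℕ
    units a₀ a₁ b₀ b₁ = M₁ * ((⌜ a₀ ⌝ + ⌜ b₀ ⌝) + (⌜ b₁ ⌝ + ⌜ a₁ ⌝)) + M₂ * (⌜ a₀ ∨ a₁ ⌝ + ⌜ b₀ ∨ b₁ ⌝)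

    private
      four : ∀ x y z w → M₁ * ((x + z) + (w + y)) ≡ (M₁ * x + M₁ * y) + (M₁ * z + M₁ * w)
      four x y z w = trans (cong (M₁ *_) (trans (cong (x + z +_) (+-comm w y)) (+-exchange x z y w)))
        (trans (*-distribˡ-+ M₁ (x + y) (z + w)) (cong₂ _+_ (*-distribˡ-+ M₁ x y) (*-distribˡ-+ M₁ z w)))

      units≡ : ∀ a₀ a₁ b₀ b₁ → units a₀ a₁ b₀ b₁ ≡
        (M₁ * ⌜ a₀ ⌝ + M₁ * ⌜ a₁ ⌝) + (M₁ * ⌜ b₀ ⌝ + M₁ * ⌜ b₁ ⌝) + (weigh M₂ (a₀ ∨ a₁) + weigh M₂ (b₀ ∨ b₁))
      units≡ a₀ a₁ b₀ b₁ = cong₂ _+_ (four ⌜ a₀ ⌝ ⌜ a₁ ⌝ ⌜ b₀ ⌝ ⌜ b₁ ⌝)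
        (trans (*-distribˡ-+ M₂ ⌜ a₀ ∨ a₁ ⌝ _) (sym (cong₂ _+_ (weigh≡ M₂ (a₀ ∨ a₁)) (weigh≡ M₂ (b₀ ∨ b₁)))))

    weight-≥ : ∀ w₀ w₁ w₂ w₃ a₀ a₁ b₀ b₁ → units a₀ a₁ b₀ b₁ ≤ weight Ms (w₀ , w₁ , w₂ , w₃) a₀ a₁ b₀ b₁
    weight-≥ w₀ w₁ w₂ w₃ a₀ a₁ b₀ b₁ = ≡≤ (units≡ a₀ a₁ b₀ b₁) (+-monoˡ-≤ _
      (+-mono-≤ (+-mono-≤ (weigh-≥ M₁ (value c w₀) a₀) (weigh-≥ M₁ (value c w₁) a₁))
                (+-mono-≤ (weigh-≥ M₁ (value c w₂) b₀) (weigh-≥ M₁ (value c w₃) b₁))))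

    weight-≤ : ∀ w₀ w₁ w₂ w₃ a₀ a₁ b₀ b₁ → weight Ms (w₀ , w₁ , w₂ , w₃) a₀ a₁ b₀ b₁ ≤ units a₀ a₁ b₀ b₁ + ((c + c) + (c + c))
    weight-≤ w₀ w₁ w₂ w₃ a₀ a₁ b₀ b₁ = ≤≡ (+-monoˡ-≤ _
      (+-mono-≤ (+-mono-≤ (weigh-≤ M₁ a₀ (value-≤ c w₀)) (weigh-≤ M₁ a₁ (value-≤ c w₁)))
                (+-mono-≤ (weigh-≤ M₁ b₀ (value-≤ c w₂)) (weigh-≤ M₁ b₁ (value-≤ c w₃)))))
      (trans (cong (_+ U) (trans (cong₂ _+_ (+-exchange (m a₀) c (m a₁) c) (+-exchange (m b₀) c (m b₁) c))
          (+-exchange (m a₀ + m a₁) (c + c) (m b₀ + m b₁) (c + c))))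
        (trans (+-assoc ((m a₀ + m a₁) + (m b₀ + m b₁)) ((c + c) + (c + c)) U) (trans (cong ((m a₀ + m a₁) + (m b₀ + m b₁) +_) (+-comm ((c + c) + (c + c)) U))
          (trans (sym (+-assoc ((m a₀ + m a₁) + (m b₀ + m b₁)) U _)) (cong (_+ ((c + c) + (c + c))) (sym (units≡ a₀ a₁ b₀ b₁)))))))
      where
      m : Bool → ℕ
      m b = M₁ * ⌜ b ⌝
      U = weigh M₂ (a₀ ∨ a₁) + weigh M₂ (b₀ ∨ b₁)

    unitsOf : (ps : Pairing) → Vec Bool (length ps * 4) → ℕ
    unitsOf ps x = M₁ * (length (chosen out ps x) + length (chosen in⁻ ps x)) + M₂ * length (chosen any ps x)

    unitsOf-∷ : ∀ u v ps a₀ a₁ b₀ b₁ x →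
      unitsOf ((u , v) ∷ ps) (a₀ ∷ a₁ ∷ b₀ ∷ b₁ ∷ x) ≡ units a₀ a₁ b₀ b₁ + unitsOf ps x
    unitsOf-∷ u v ps a₀ a₁ b₀ b₁ x rewrite
      length-chosen out u v ps a₀ a₁ b₀ b₁ x | length-chosen in⁻ u v ps a₀ a₁ b₀ b₁ x | length-chosen any u v ps a₀ a₁ b₀ b₁ x =
      trans (cong₂ _+_ (trans (cong (M₁ *_) (+-exchange p o q i)) (*-distribˡ-+ M₁ (p + q) (o + i))) (*-distribˡ-+ M₂ r a))
        (+-exchange (M₁ * (p + q)) (M₁ * (o + i)) (M₂ * r) (M₂ * a))
      where
      p = ⌜ a₀ ⌝ + ⌜ b₀ ⌝
      q = ⌜ b₁ ⌝ + ⌜ a₁ ⌝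
      r = ⌜ a₀ ∨ a₁ ⌝ + ⌜ b₀ ∨ b₁ ⌝
      o = length (chosen out ps x)
      i = length (chosen in⁻ ps x)
      a = length (chosen any ps x)

    module _ (flag : Bool) (D : El mat) where

      open Expansion flag D {n}

      weightOf-≥ : ∀ ps (ω : Vec (List Bool) (length ps * 4)) x → unitsOf ps x ≤ weightOf Ms ps ω x
      weightOf-≥ [] [] [] = ≤-reflexive (cong₂ _+_ (*-zeroʳ M₁) (*-zeroʳ M₂))
      weightOf-≥ ((u , v) ∷ ps) (w₀ ∷ w₁ ∷ w₂ ∷ w₃ ∷ ω) (a₀ ∷ a₁ ∷ b₀ ∷ b₁ ∷ x) =
        ≡≤ (unitsOf-∷ u v ps a₀ a₁ b₀ b₁ x)
          (+-mono-≤ (weight-≥ w₀ w₁ w₂ w₃ a₀ a₁ b₀ b₁) (weightOf-≥ ps ω x))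

      weightOf-≤ : ∀ ps (ω : Vec (List Bool) (length ps * 4)) x →
        weightOf Ms ps ω x ≤ unitsOf ps x + length ps * ((c + c) + (c + c))
      weightOf-≤ [] [] [] = z≤n
      weightOf-≤ ((u , v) ∷ ps) (w₀ ∷ w₁ ∷ w₂ ∷ w₃ ∷ ω) (a₀ ∷ a₁ ∷ b₀ ∷ b₁ ∷ x) =
        ≤≡ (+-mono-≤ (weight-≤ w₀ w₁ w₂ w₃ a₀ a₁ b₀ b₁) (weightOf-≤ ps ω x))
          (trans (+-exchange (units a₀ a₁ b₀ b₁) ((c + c) + (c + c)) (unitsOf ps x) _)
            (cong (_+ ((c + c) + (c + c) + length ps * ((c + c) + (c + c)))) (sym (unitsOf-∷ u v ps a₀ a₁ b₀ b₁ x))))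

-- State vectors given by four sets of vertices, and translations by them

tab : ∀ {n} → (Fin n → Bool) → List Bool
tab = List.tabulate

nth-tabulate : ∀ {A : Set} {n} (d : A) (g : Fin n → A) v → nth d (toℕ v) (List.tabulate g) ≡ g v
nth-tabulate d g zero = refl
nth-tabulate d g (suc v) = nth-tabulate d (g ∘ suc) v

nth-zipXor : ∀ σ τ i → length σ ≡ length τ → nth false i (zipXor σ τ) ≡ nth false i σ xor nth false i τ
nth-zipXor [] [] i _ = refl
nth-zipXor (s ∷ σ) (t ∷ τ) zero e = refl
nth-zipXor (s ∷ σ) (t ∷ τ) (suc i) e = nth-zipXor σ τ i (suc-injective e)

Sub-++ : ∀ {b vs ws σ τ} → Sub b vs σ → Sub b ws τ → Sub b (vs ++ ws) (σ ++ τ)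
Sub-++ [] q = q
Sub-++ (p ∷ ps) q = p ∷ Sub-++ ps q

Sub-tab : ∀ n {b : ℕ → Bool} (g : Fin n → Bool) → (∀ v → T (g v) → T (b (toℕ v))) → Sub b (range n) (tab g)
Sub-tab zero g h = []
Sub-tab (suc n) g h = h zero ∷ shiftSub (range n) (Sub-tab n (g ∘ suc) (h ∘ suc))
  where
  shiftSub : ∀ {b} vs {σ} → Sub (b ∘ suc) vs σ → Sub b (mapL suc vs) σ
  shiftSub [] [] = []
  shiftSub (v ∷ vs) (p ∷ ps) = p ∷ shiftSub vs ps

Sub-nth : ∀ {b vs σ} → Sub b vs σ → ∀ i → T (nth false i σ) → T (b (nth 0 i vs))
Sub-nth (p ∷ ps) zero t = p t
Sub-nth (p ∷ ps) (suc i) t = Sub-nth ps i t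

anyL-nth : ∀ σ i → T (nth false i σ) → T (anyL id σ)
anyL-nth (s ∷ σ) zero t = T∨₁ t
anyL-nth (s ∷ σ) (suc i) t = T∨₂ {s} (anyL-nth σ i t)

allL-nth : ∀ σ → (∀ i → i < length σ → nth false i σ ≡ false) → T (allL not σ)
allL-nth [] h = tt
allL-nth (s ∷ σ) h = T∧ (T-not (λ t → subst T (h 0 (s≤s z≤n)) t)) (allL-nth σ (λ i l → h (suc i) (s≤s l)))

nth-map-false : ∀ {A : Set} i (vs : List A) → nth false i (List.map (λ _ → false) vs) ≡ false
nth-map-false i [] = refl
nth-map-false zero (v ∷ vs) = refl
nth-map-false (suc i) (v ∷ vs) = nth-map-false i vs

module _ {n : ℕ} where

  block : (g₀ g₁ g₂ g₃ : Fin n → Bool) → List Bool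
  block g₀ g₁ g₂ g₃ = tab g₀ ++ tab g₁ ++ tab g₂ ++ tab g₃

  private
    shift : ∀ (g : Fin n → Bool) ys i → nth false (n + i) (tab g ++ ys) ≡ nth false i ys
    shift g ys i = trans (cong (λ m → nth false (m + i) (tab g ++ ys)) (sym (Listₚ.length-tabulate g))) (nth-++ʳ false (tab g) ys i)

    start : ∀ (g : Fin n → Bool) ys v → nth false (toℕ v) (tab g ++ ys) ≡ g v
    start g ys v = trans (nth-++ˡ false (tab g) ys (subst (toℕ v <_) (sym (Listₚ.length-tabulate g)) (toℕ<n v))) (nth-tabulate false g v)

  block-bits : ∀ g₀ g₁ g₂ g₃ (v : Fin n) → let t = block g₀ g₁ g₂ g₃ in
    side₀ n t (toℕ v) ≡ g₀ v × mark₀ n t (toℕ v) ≡ g₁ v × side₁ n t (toℕ v) ≡ g₂ v × mark₁ n t (toℕ v) ≡ g₃ v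
  block-bits g₀ g₁ g₂ g₃ v = start g₀ _ v , trans (shift g₀ _ _) (start g₁ _ v) ,
    trans (shift g₀ _ _) (trans (shift g₁ _ _) (start g₂ _ v)) ,
    trans (shift g₀ _ _) (trans (shift g₁ _ _) (trans (shift g₂ _ _) (nth-tabulate false g₃ v)))

  Sub-block : ∀ {b : ℕ → Bool} g₀ g₁ g₂ g₃ → (∀ v → T (g₀ v) ⊎ T (g₁ v) ⊎ T (g₂ v) ⊎ T (g₃ v) → T (b (toℕ v))) →
    Sub b (vertices4 n) (block g₀ g₁ g₂ g₃)
  Sub-block g₀ g₁ g₂ g₃ h = Sub-++ (Sub-tab n g₀ (λ v → h v ∘ inj₁)) (Sub-++ (Sub-tab n g₁ (λ v → h v ∘ inj₂ ∘ inj₁))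
    (Sub-++ (Sub-tab n g₂ (λ v → h v ∘ inj₂ ∘ inj₂ ∘ inj₁)) (Sub-tab n g₃ (λ v → h v ∘ inj₂ ∘ inj₂ ∘ inj₂))))

module _ {n : ℕ} (g₀ g₁ g₂ g₃ : Fin n → Bool) where

  Respects : (g h : Fin n → Bool) → Fin n × Fin n → Set
  Respects g h (x , y) = g x ≡ g y × h y ≡ false

  side-shift : ∀ p s t {g h} → (T p → g ≡ h) → (p ⇒ᵇ (s xor g) ≡? (t xor h)) ≡ (p ⇒ᵇ s ≡? t)
  side-shift false s t e = refl
  side-shift true s t {g} {h} e rewrite e tt = cong not (trans (xor-swap s h t h) (trans (cong ((s xor t) xor_) (Boolₚ.xor-same h)) (Boolₚ.xor-identityʳ _)))

  mark-shift : ∀ p m {g} → (T p → g ≡ false) → (p ⇒ᵇ not (m xor g)) ≡ (p ⇒ᵇ not m)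
  mark-shift false m e = refl
  mark-shift true m e rewrite e tt = cong not (Boolₚ.xor-identityʳ m)

  module _ (flag : Bool) (D : El mat) (σ σ′ : List Bool)
    (e₀ : ∀ v → side₀ n σ′ (toℕ v) ≡ side₀ n σ (toℕ v) xor g₀ v)
    (e₁ : ∀ v → mark₀ n σ′ (toℕ v) ≡ mark₀ n σ (toℕ v) xor g₁ v)
    (e₂ : ∀ v → side₁ n σ′ (toℕ v) ≡ side₁ n σ (toℕ v) xor g₂ v)
    (e₃ : ∀ v → mark₁ n σ′ (toℕ v) ≡ mark₁ n σ (toℕ v) xor g₃ v) where

    open Expansion flag D {n}

    -- The equations on the state are homogeneous and linear, so adding a solution of them, given by
    -- `g₀` to `g₃`, preserves which of them hold; admissibility does not involve the state.
    fits-shift : ∀ (ps : Pairing {n}) c → All (Respects g₀ g₁) (chosen out ps c) → All (Respects g₂ g₃) (chosen in⁻ ps c) →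
                 fits ps c σ′ ≡ fits ps c σ
    fits-shift [] [] _ _ = refl
    fits-shift ((u , v) ∷ ps) (a₀ ∷ a₁ ∷ b₀ ∷ b₁ ∷ c) p q =
      cong₂ _∧_ (cong (admissible flag D (toℕ u) (toℕ v) a₀ a₁ b₀ b₁ ∧_) same) (fits-shift ps c ps′ qs′)
      where
      pa = proj₁ (opt-All a₀ p)
      pb = proj₁ (opt-All b₀ (proj₂ (opt-All a₀ p)))
      ps′ = proj₂ (opt-All b₀ (proj₂ (opt-All a₀ p)))
      qb = proj₁ (opt-All b₁ q)
      qa = proj₁ (opt-All a₁ (proj₂ (opt-All b₁ q)))
      qs′ = proj₂ (opt-All a₁ (proj₂ (opt-All b₁ q)))
      same : consistent n σ′ (toℕ u) (toℕ v) a₀ a₁ b₀ b₁ ≡ consistent n σ (toℕ u) (toℕ v) a₀ a₁ b₀ b₁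
      same rewrite e₀ u | e₀ v | e₁ u | e₁ v | e₂ u | e₂ v | e₃ u | e₃ v = cong₂ _∧_
        (cong₂ _∧_ (side-shift (a₀ ∨ b₀) (side₀ n σ (toℕ u)) (side₀ n σ (toℕ v)) (λ t → T∨-elim {a₀} t (proj₁ ∘ pa) (sym ∘ proj₁ ∘ pb)))
                   (side-shift (a₁ ∨ b₁) (side₁ n σ (toℕ u)) (side₁ n σ (toℕ v)) (λ t → T∨-elim {a₁} t (sym ∘ proj₁ ∘ qa) (proj₁ ∘ qb))))
        (cong₂ _∧_ (cong₂ _∧_ (mark-shift a₀ _ (proj₂ ∘ pa)) (mark-shift b₀ _ (proj₂ ∘ pb)))
                   (cong₂ _∧_ (mark-shift a₁ _ (proj₂ ∘ qa)) (mark-shift b₁ _ (proj₂ ∘ qb))))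

⇒ᵇ-elim : ∀ {a b} → T (a ⇒ᵇ b) → T a → T b
⇒ᵇ-elim {true} t _ = t

reverse-star : ∀ {A : Set} {R : A → A → Set} {x y} → Star (λ a b → R b a) x y → Star R y x
reverse-star ε = ε
reverse-star (p ◅ q) = reverse-star q ◅◅ (p ◅ ε)

-- Choices with an odd number of states, and rooted forests

data Simple {n : ℕ} : Pairing {n} → Set where
  [] : Simple []
  _∷_ : ∀ {u v ps} → u ≢ v × ¬ ((u , v) ∈ ps) × ¬ ((v , u) ∈ ps) → Simple ps → Simple ((u , v) ∷ ps)

Symmetric⁻ : ∀ {n} → Digraph n → Set
Symmetric⁻ X = ∀ u v → T (X u v) → ¬ T (X v u)

-- A subgraph with fewer than t arcs in which every vertex is reachable from
-- a root and reaches a root; ν marks the vertices that are not roots.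
record CoreYes {n : ℕ} (flag : Bool) (d : Digraph n) (ν : Fin n → Bool) (t : ℕ) : Set where
  field
    pick : Digraph n
    pick⊆ : ∀ u v → T (pick u v) → T (d u v)
    oriented : T flag → Symmetric⁻ pick
    small : arcCount pick < t
    from-roots : ∀ v → ∃[ r ] (¬ T (ν r) × Star (λ x y → T (pick x y)) r v)
    to-roots : ∀ v → ∃[ r ] (¬ T (ν r) × Star (λ x y → T (pick x y)) v r)

module Core (flag : Bool) (D : El mat) {n : ℕ} (d : Digraph n)
            (at-d : ∀ u v → at D (toℕ u) (toℕ v) ≡ d u v)
            (νᵇ : ℕ → Bool) where

  open Expansion flag D {n}

  ν : Fin n → Bool
  ν v = νᵇ (toℕ v)

  nonroots : ℕ
  nonroots = sumF (λ v → ⌜ ν v ⌝)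

  vs : List ℕ
  vs = vertices4 n

  odd : (ps : Pairing) → Vec Bool (length ps * 4) → Set
  odd ps c = parity vs νᵇ ps c ≡ true

  module Sound (ps : Pairing) (c : Vec Bool (length ps * 4)) (isOdd : odd ps c) where

    outs ins : List (Fin n × Fin n)
    outs = chosen out ps c
    ins = chosen in⁻ ps c

    -- Translation by a nonzero vector of the state space is an involution without fixed points on
    -- the fitting states, so their number would be even.
    impossible : ∀ (g₀ g₁ g₂ g₃ : Fin n → Bool) →
      (∀ v → T (g₀ v) ⊎ T (g₁ v) ⊎ T (g₂ v) ⊎ T (g₃ v) → T (ν v)) →
      All (Respects g₀ g₁ g₂ g₃ g₀ g₁) outs → All (Respects g₀ g₁ g₂ g₃ g₂ g₃) ins →
      ∃[ v ] (T (g₀ v) ⊎ T (g₁ v) ⊎ T (g₂ v) ⊎ T (g₃ v)) → ⊥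
    impossible g₀ g₁ g₂ g₃ h p q (w , nz) = contradiction (trans (sym isOdd)
      (XS-even νᵇ vs t (fits ps c) subt (nonzero nz) invariant)) (λ ())
      where
      t = block g₀ g₁ g₂ g₃
      bits = block-bits g₀ g₁ g₂ g₃
      subt = Sub-block {b = νᵇ} g₀ g₁ g₂ g₃ h
      nonzero : T (g₀ w) ⊎ T (g₁ w) ⊎ T (g₂ w) ⊎ T (g₃ w) → T (anyL id t)
      nonzero (inj₁ x) = anyL-nth t (toℕ w) (subst T (sym (proj₁ (bits w))) x)
      nonzero (inj₂ (inj₁ x)) = anyL-nth t (n + toℕ w) (subst T (sym (proj₁ (proj₂ (bits w)))) x)
      nonzero (inj₂ (inj₂ (inj₁ x))) = anyL-nth t (n + (n + toℕ w)) (subst T (sym (proj₁ (proj₂ (proj₂ (bits w))))) x)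
      nonzero (inj₂ (inj₂ (inj₂ x))) = anyL-nth t (n + (n + (n + toℕ w))) (subst T (sym (proj₂ (proj₂ (proj₂ (bits w))))) x)
      invariant : ∀ σ → Sub νᵇ vs σ → fits ps c (zipXor σ t) ≡ fits ps c σ
      invariant σ s = fits-shift g₀ g₁ g₂ g₃ flag D σ (zipXor σ t)
        (λ v → bitAt _ (proj₁ (bits v)))
        (λ v → bitAt _ (proj₁ (proj₂ (bits v))))
        (λ v → bitAt _ (proj₁ (proj₂ (proj₂ (bits v)))))
        (λ v → bitAt _ (proj₂ (proj₂ (proj₂ (bits v))))) ps c p q
        where
        bitAt : ∀ i {g} → nth false i t ≡ g → nth false i (zipXor σ t) ≡ nth false i σ xor g
        bitAt i e = trans (nth-zipXor σ t i (trans (Sub-length s) (sym (Sub-length subt)))) (cong (nth false i σ xor_) e)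

    ∅ᵇ : Fin n → Bool
    ∅ᵇ _ = false

    tabulateAll : ∀ {A : Set} {P : A → Set} xs → (∀ x → x ∈ xs → P x) → All P xs
    tabulateAll xs h = All.tabulate (λ {x} m → h x m)

    entered : ∀ (as : List (Fin n × Fin n)) v → (∀ {x y} → (x , y) ∈ as → y ≡ v → ⊥) ⊎ 1 ≤ Branching.indegree ν as v
    entered as v with Branching.indegree ν as v in eq
    ... | suc _ = inj₂ (s≤s z≤n)
    ... | zero = inj₁ (λ { {x} {y} m refl → contradiction (subst (1 ≤_) eq (Branching.indegree≥1 ν as as m)) (λ ()) })

    -- If no arc of the out-forest entered `v`, the state that marks only `v` would violate no
    -- equation.
    out-low : ∀ v → T (ν v) → 1 ≤ Branching.indegree ν outs v
    out-low v nv with entered outs v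
    ... | inj₂ le = le
    ... | inj₁ none = ⊥-elim (impossible ∅ᵇ (v ==_) ∅ᵇ ∅ᵇ
      (λ { w (inj₂ (inj₁ t)) → subst (T ∘ ν) (==-true t) nv ; w (inj₁ ()) ; w (inj₂ (inj₂ (inj₁ ()))) ; w (inj₂ (inj₂ (inj₂ ()))) })
      (tabulateAll outs (λ { (x , y) m → refl , ¬T→false (λ t → none m (sym (==-true t))) }))
      (tabulateAll ins (λ { (x , y) m → refl , refl }))
      (v , inj₂ (inj₁ (true→T (==-refl v)))))

    in-low : ∀ v → T (ν v) → 1 ≤ Branching.indegree ν ins v
    in-low v nv with entered ins v
    ... | inj₂ le = le
    ... | inj₁ none = ⊥-elim (impossible ∅ᵇ ∅ᵇ ∅ᵇ (v ==_)
      (λ { w (inj₂ (inj₂ (inj₂ t))) → subst (T ∘ ν) (==-true t) nv ; w (inj₁ ()) ; w (inj₂ (inj₁ ())) ; w (inj₂ (inj₂ (inj₁ ()))) })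
      (tabulateAll outs (λ { (x , y) m → refl , refl }))
      (tabulateAll ins (λ { (x , y) m → refl , ¬T→false (λ t → none m (sym (==-true t))) }))
      (v , inj₂ (inj₂ (inj₂ (true→T (==-refl v))))))

    -- A set of nonroots that no chosen arc enters or leaves is the side of a cut that no arc
    -- crosses, hence a state.
    out-rigid : ∀ (χ : Fin n → Bool) → (∀ v → T (χ v) → T (ν v)) → (∀ u v → (u , v) ∈ outs → χ u ≡ χ v) → ∀ v → ¬ T (χ v)
    out-rigid χ h k v t = impossible χ ∅ᵇ ∅ᵇ ∅ᵇ
      (λ { w (inj₁ x) → h w x ; w (inj₂ (inj₁ ())) ; w (inj₂ (inj₂ (inj₁ ()))) ; w (inj₂ (inj₂ (inj₂ ()))) })
      (tabulateAll outs (λ { (x , y) m → k x y m , refl })) (tabulateAll ins (λ { (x , y) m → refl , refl })) (v , inj₁ t)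

    in-rigid : ∀ (χ : Fin n → Bool) → (∀ v → T (χ v) → T (ν v)) → (∀ u v → (u , v) ∈ ins → χ u ≡ χ v) → ∀ v → ¬ T (χ v)
    in-rigid χ h k v t = impossible ∅ᵇ ∅ᵇ χ ∅ᵇ
      (λ { w (inj₂ (inj₂ (inj₁ x))) → h w x ; w (inj₁ ()) ; w (inj₂ (inj₁ ())) ; w (inj₂ (inj₂ (inj₂ ()))) })
      (tabulateAll outs (λ { (x , y) m → refl , refl })) (tabulateAll ins (λ { (x , y) m → k x y m , refl })) (v , inj₂ (inj₂ (inj₁ t)))

    low : ∀ (as : List (Fin n × Fin n)) → (∀ v → T (ν v) → 1 ≤ Branching.indegree ν as v) → nonroots ≤ length as
    low as h = ≤≡ (sumF-mono le) (Branching.total ν as)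
      where
      le : ∀ v → ⌜ ν v ⌝ ≤ Branching.indegree ν as v
      le v with ν v in eq
      ... | true = h v (true→T eq)
      ... | false = z≤n

    outs-low : nonroots ≤ length outs
    outs-low = low outs out-low

    ins-low : nonroots ≤ length ins
    ins-low = low ins in-low

    X : Digraph n
    X = listed (chosen any ps c)

    opt-⊆ : ∀ {A : Set} b b′ {x : A} {xs ys} → (T b → T b′) → (∀ {y} → y ∈ xs → y ∈ ys) → ∀ {y} → y ∈ opt b x ++ xs → y ∈ opt b′ x ++ ys
    opt-⊆ false false h k m = k m
    opt-⊆ false true h k m = there (k m)
    opt-⊆ true true h k (here e) = here e
    opt-⊆ true true h k (there m) = there (k m)
    opt-⊆ true false h k m = contradiction (h tt) (λ ())

    out⊆any : ∀ (ps : Pairing {n}) c {a} → a ∈ chosen out ps c → a ∈ chosen any ps c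
    out⊆any [] [] ()
    out⊆any ((u , v) ∷ ps) (a₀ ∷ a₁ ∷ b₀ ∷ b₁ ∷ c) =
      opt-⊆ a₀ (a₀ ∨ a₁) T∨₁ (opt-⊆ b₀ (b₀ ∨ b₁) T∨₁ (out⊆any ps c))

    in⊆any : ∀ (ps : Pairing {n}) c {x y} → (x , y) ∈ chosen in⁻ ps c → (y , x) ∈ chosen any ps c
    in⊆any [] [] ()
    in⊆any ((u , v) ∷ ps) (a₀ ∷ a₁ ∷ b₀ ∷ b₁ ∷ c) {x} {y} m with opt-∈ b₁ m
    ... | inj₁ (t , refl) = ∈-++⁺ʳ (opt (a₀ ∨ a₁) (u , v)) (∈-++⁺ˡ (subst (λ b → (v , u) ∈ opt b (v , u)) (sym (T→true (T∨₂ {b₀} t))) (here refl)))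
    ... | inj₂ m′ with opt-∈ a₁ m′
    ... | inj₁ (t , refl) = ∈-++⁺ˡ (subst (λ b → (u , v) ∈ opt b (u , v)) (sym (T→true (T∨₂ {a₀} t))) (here refl))
    ... | inj₂ m″ = ∈-++⁺ʳ (opt (a₀ ∨ a₁) (u , v)) (∈-++⁺ʳ (opt (b₀ ∨ b₁) (v , u)) (in⊆any ps c m″))

    module _ where
      private
        -- An odd number is not zero, so some state fits. It is needed only as evidence that the
        -- choice is admissible at every pair, which does not depend on the state.
        witness = XS-∃ νᵇ vs (fits ps c) isOdd

      fitting : T (fits ps c (proj₁ witness))
      fitting = proj₂ (proj₂ witness)

      any⊆d : ∀ (ps : Pairing {n}) c {σ} → T (fits ps c σ) → ∀ {x y} → (x , y) ∈ chosen any ps c → T (d x y)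
      any⊆d [] [] _ ()
      any⊆d ((u , v) ∷ ps) (a₀ ∷ a₁ ∷ b₀ ∷ b₁ ∷ c) f m with opt-∈ (a₀ ∨ a₁) m
      ... | inj₁ (t , refl) = subst T (at-d u v) (⇒ᵇ-elim (T∧₁ (T∧₁ (T∧₁ f))) t)
      ... | inj₂ m′ with opt-∈ (b₀ ∨ b₁) m′
      ... | inj₁ (t , refl) = subst T (at-d v u) (⇒ᵇ-elim (T∧₁ (T∧₂ {a₀ ∨ a₁ ⇒ᵇ at D (toℕ u) (toℕ v)} (T∧₁ (T∧₁ f)))) t)
      ... | inj₂ m″ = any⊆d ps c (T∧₂ {admissible flag D (toℕ u) (toℕ v) a₀ a₁ b₀ b₁ ∧ _} f) m″

      ends-in : ∀ (ps : Pairing {n}) c {x y} → (x , y) ∈ chosen any ps c → (x , y) ∈ ps ⊎ (y , x) ∈ ps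
      ends-in [] [] ()
      ends-in ((u , v) ∷ ps) (a₀ ∷ a₁ ∷ b₀ ∷ b₁ ∷ c) m with opt-∈ (a₀ ∨ a₁) m
      ... | inj₁ (t , refl) = inj₁ (here refl)
      ... | inj₂ m′ with opt-∈ (b₀ ∨ b₁) m′
      ... | inj₁ (t , refl) = inj₂ (here refl)
      ... | inj₂ m″ with ends-in ps c m″
      ... | inj₁ q = inj₁ (there q)
      ... | inj₂ q = inj₂ (there q)

      any-oriented : ∀ (ps : Pairing {n}) c {σ} → T flag → Simple ps → T (fits ps c σ) →
        ∀ {x y} → (x , y) ∈ chosen any ps c → (y , x) ∈ chosen any ps c → ⊥
      any-oriented [] [] _ _ _ ()
      any-oriented ((u , v) ∷ ps) (a₀ ∷ a₁ ∷ b₀ ∷ b₁ ∷ c) fl ((u≢v , n₁ , n₂) ∷ si) f m m′ = cases (opt-∈ (a₀ ∨ a₁) m) (opt-∈ (a₀ ∨ a₁) m′)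
        where
        a b : Bool
        a = a₀ ∨ a₁
        b = b₀ ∨ b₁
        exclusive : T a → T b → ⊥
        exclusive ta tb = not-T (⇒ᵇ-elim (T∧₂ {b ⇒ᵇ at D (toℕ v) (toℕ u)} (T∧₂ {a ⇒ᵇ at D (toℕ u) (toℕ v)} (T∧₁ (T∧₁ f)))) fl) (T∧ ta tb)
        late : ∀ {x y} → (x , y) ∈ chosen any ps c → (x , y) ≡ (u , v) ⊎ (x , y) ≡ (v , u) → ⊥
        late q (inj₁ refl) with ends-in ps c q
        ... | inj₁ r = n₁ r
        ... | inj₂ r = n₂ r
        late q (inj₂ refl) with ends-in ps c q
        ... | inj₁ r = n₂ r
        ... | inj₂ r = n₁ r
        cases : ∀ {x y} → (T a × (x , y) ≡ (u , v)) ⊎ (x , y) ∈ opt b (v , u) ++ chosen any ps c →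
                (T a × (y , x) ≡ (u , v)) ⊎ (y , x) ∈ opt b (v , u) ++ chosen any ps c → ⊥
        cases (inj₁ (_ , refl)) (inj₁ (_ , e)) = u≢v (sym (cong proj₁ e))
        cases (inj₁ (ta , refl)) (inj₂ q) with opt-∈ b q
        ... | inj₁ (tb , _) = exclusive ta tb
        ... | inj₂ r = late r (inj₂ refl)
        cases (inj₂ p) (inj₁ (ta , refl)) with opt-∈ b p
        ... | inj₁ (tb , _) = exclusive ta tb
        ... | inj₂ r = late r (inj₂ refl)
        cases (inj₂ p) (inj₂ q) with opt-∈ b p | opt-∈ b q
        ... | inj₁ (_ , refl) | inj₁ (_ , e) = u≢v (cong proj₁ e)
        ... | inj₁ (_ , refl) | inj₂ r = late r (inj₁ refl)
        ... | inj₂ r | inj₁ (_ , refl) = late r (inj₁ refl)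
        ... | inj₂ r | inj₂ r′ = any-oriented ps c fl si (T∧₂ {admissible flag D (toℕ u) (toℕ v) a₀ a₁ b₀ b₁ ∧ _} f) r r′

    any-count : ∀ (as : List (Fin n × Fin n)) → arcCount (listed as) ≤ length as
    any-count as = ≤≡ (sumF-mono (λ u → sumF-mono (λ v → any≤sum u v as))) (trans
      (sumF-cong (λ u → sumF-sumL (λ v a → ⌜ joins u v a ⌝) as))
      (trans (sumF-sumL (λ u a → sumF (λ v → ⌜ joins u v a ⌝)) as)
        (trans (sumL-cong as one) (sumL-1 as))))
      where
      any≤sum : ∀ u v (as : List (Fin n × Fin n)) → ⌜ listed as u v ⌝ ≤ sumL (λ a → ⌜ joins u v a ⌝) as
      any≤sum u v [] = z≤n
      any≤sum u v (a ∷ as) with joins u v a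
      ... | true = s≤s z≤n
      ... | false = any≤sum u v as
      row : ∀ (x : Fin n × Fin n) u → sumF (λ v → ⌜ joins u v x ⌝) ≡ ⌜ proj₁ x == u ⌝
      row (x , y) u with x == u
      ... | true = sumF-point y
      ... | false = sumF-0 {n}
      one : ∀ (x : Fin n × Fin n) → sumF (λ u → sumF (λ v → ⌜ joins u v x ⌝)) ≡ 1
      one x = trans (sumF-cong (row x)) (sumF-point (proj₁ x))

    sound : Simple ps → ∀ {t} → length outs + length ins ≤ nonroots + nonroots → length (chosen any ps c) < t → CoreYes flag d ν t
    sound simple {t} few small = record
      { pick = X
      ; pick⊆ = λ u v x → any⊆d ps c fitting (listed-elim _ x)
      ; oriented = λ fl u v x y → any-oriented ps c fl simple fitting (listed-elim _ x) (listed-elim _ y)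
      ; small = ≤-trans (s≤s (any-count (chosen any ps c))) small
      ; from-roots = λ v → let (r , nr , s) = Branching.reachable ν outs out-low out-few out-rigid v in
                       r , nr , Star.map (λ m → listed-intro _ (out⊆any ps c m)) s
      ; to-roots = λ v → let (r , nr , s) = Branching.reachable ν ins in-low in-few in-rigid v in
                       r , nr , reverse-star (Star.map (λ m → listed-intro _ (in⊆any ps c m)) s)
      }
      where
      -- The marks force at least `nonroots` arcs into either list, so the bound on their sum bounds
      -- each of them.
      out-few : length outs ≤ nonroots
      out-few = +-cancelʳ-≤ nonroots _ _ (≤-trans (+-monoʳ-≤ (length outs) ins-low) few)
      in-few : length ins ≤ nonroots
      in-few = +-cancelˡ-≤ nonroots _ _ (≤-trans (+-monoˡ-≤ (length ins) outs-low) few)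

least : ∀ (p : ℕ → Bool) N → T (p N) → ∃[ k ] (T (p k) × (∀ j → T (p j) → k ≤ j))
least p zero t = 0 , t , λ j _ → z≤n
least p (suc N) t with p 0 in eq
... | true = 0 , true→T eq , λ j _ → z≤n
... | false = let (k , tk , min) = least (p ∘ suc) N t in suc k , tk ,
  λ { zero t0 → ⊥-elim (subst T eq t0) ; (suc j) tj → s≤s (min j tj) }

choose : ∀ {A : Set} b → (T b → A) → A → A
choose true f d = f tt
choose false f d = d

choose-true : ∀ {A : Set} b (f : T b → A) d t → choose b f d ≡ f t
choose-true true f d t = refl

-- A breadth-first forest: every nonroot keeps one arc, from a vertex of smaller distance to the
-- roots. The distance excludes loops and is the induction measure by which the sides of a cut are
-- seen to vanish.
module BFS {n : ℕ} (X : Digraph n) (ν : Fin n → Bool)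
           (reach : ∀ v → ∃[ r ] (¬ T (ν r) × Star (λ x y → T (X x y)) r v)) where

  within : ℕ → Fin n → Bool
  within zero v = not (ν v)
  within (suc k) v = within k v ∨ anyL (λ u → within k u ∧ X u v) (allFin n)

  extend : ∀ {r v} k → T (within k r) → Star (λ x y → T (X x y)) r v → ∃[ j ] T (within j v)
  extend k t ε = k , t
  extend k t (_◅_ {j = w} x s) = extend (suc k)
    (T∨₂ {within k w} (anyL-intro (λ u → within k u ∧ X u w) (allFin n) (∈-allFin _) (T∧ t x))) s

  found : ∀ v → ∃[ k ] (T (within k v) × (∀ j → T (within j v) → k ≤ j))
  found v = let (r , nr , s) = reach v ; (j , t) = extend 0 (T-not nr) s in least (λ k → within k v) j t

  rank : Fin n → ℕ
  rank v = proj₁ (found v)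

  parent : ∀ v → T (ν v) → ∃[ u ] (T (X u v) × rank u < rank v)
  parent v nv with found v
  ... | zero , t , _ = contradiction nv (not-T t)
  ... | suc k , t , min = T∨-elim {within k v} t (λ q → contradiction (min k q) (<⇒≱ ≤-refl)) λ q →
    let (u , r) = anyL-∃ (λ u → within k u ∧ X u v) (allFin n) q in
    u , T∧₂ {within k u} r , s≤s (proj₂ (proj₂ (found u)) k (T∧₁ r))

  predecessor : Fin n → Fin n
  predecessor v = choose (ν v) (λ t → proj₁ (parent v t)) v

  predecessor-spec : ∀ v → T (ν v) → T (X (predecessor v) v) × rank (predecessor v) < rank v
  predecessor-spec v nv = subst (λ u → T (X u v) × rank u < rank v) (sym (choose-true (ν v) _ v nv)) (proj₂ (parent v nv))

  arc : Digraph n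
  arc u v = ν v ∧ (predecessor v == u)

  arc-spec : ∀ {u v} → T (arc u v) → T (ν v) × T (X u v) × rank u < rank v
  arc-spec {u} {v} t = T∧₁ t , subst (λ w → T (X w v) × rank w < rank v) (==-true (T∧₂ {ν v} t)) (predecessor-spec v (T∧₁ t))

  arc-predecessor : ∀ v → T (ν v) → T (arc (predecessor v) v)
  arc-predecessor v nv = T∧ nv (true→T (==-refl (predecessor v)))

  arc-irrefl : ∀ u → arc u u ≡ false
  arc-irrefl u = ¬T→false λ t → <-irrefl refl (proj₂ (proj₂ (arc-spec t)))

  arc-count : arcCount arc ≡ sumF (λ v → ⌜ ν v ⌝)
  arc-count = trans (sumF-swap (λ u v → ⌜ arc u v ⌝)) (sumF-cong (λ v → column (ν v) (predecessor v)))
    where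
    column : ∀ b x → sumF (λ u → ⌜ b ∧ (x == u) ⌝) ≡ ⌜ b ⌝
    column true x = sumF-point x
    column false x = sumF-0 {n}

record Complete {n : ℕ} (ps : Pairing {n}) : Set where
  field
    cover : ∀ u v → u ≢ v → (u , v) ∈ ps ⊎ (v , u) ∈ ps
    total : ∀ (F : Digraph n) → (∀ u → F u u ≡ false) →
            sumL (λ p → ⌜ F (proj₁ p) (proj₂ p) ⌝ + ⌜ F (proj₂ p) (proj₁ p) ⌝) ps ≡ arcCount F

module CompleteCore (flag : Bool) (D : El mat) {n : ℕ} (d : Digraph n)
                    (at-d : ∀ u v → at D (toℕ u) (toℕ v) ≡ d u v) (νᵇ : ℕ → Bool) where

  open Expansion flag D {n}
  open Core flag D d at-d νᵇ using (ν; nonroots; vs; odd)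

  module _ {t : ℕ} (yes′ : CoreYes flag d ν t) (ps : Pairing {n}) (complete : Complete ps) where

    open CoreYes yes′
    open Complete complete

    back : ∀ v → ∃[ r ] (¬ T (ν r) × Star (λ x y → T (pick y x)) r v)
    back v = let (r , nr , s) = to-roots v in r , nr , reverse-star s

    module O = BFS pick ν from-roots
    module I = BFS (flip pick) ν back

    f₀ f₁ : Digraph n
    f₀ = O.arc
    f₁ u v = I.arc v u

    choiceOf : (ps : Pairing {n}) → Vec Bool (length ps * 4)
    choiceOf [] = []
    choiceOf ((u , v) ∷ ps) = f₀ u v ∷ f₁ u v ∷ f₀ v u ∷ f₁ v u ∷ choiceOf ps

    c : Vec Bool (length ps * 4)
    c = choiceOf ps

    counts : Selector → Digraph n → Set
    counts sel F = ∀ u v → ⌜ proj₁ (sel (f₀ u v) (f₁ u v) (f₀ v u) (f₁ v u)) ⌝ + ⌜ proj₂ (sel (f₀ u v) (f₁ u v) (f₀ v u) (f₁ v u)) ⌝ ≡ ⌜ F u v ⌝ + ⌜ F v u ⌝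

    lengths : ∀ sel F → counts sel F → ∀ ps → length (chosen sel ps (choiceOf ps)) ≡ sumL (λ p → ⌜ F (proj₁ p) (proj₂ p) ⌝ + ⌜ F (proj₂ p) (proj₁ p) ⌝) ps
    lengths sel F e [] = refl
    lengths sel F e ((u , v) ∷ ps) = trans (length-chosen sel u v ps _ _ _ _ (choiceOf ps)) (cong₂ _+_ (e u v) (lengths sel F e ps))

    outs-count : length (chosen out ps c) ≡ nonroots
    outs-count = trans (lengths out f₀ (λ u v → refl) ps) (trans (total f₀ O.arc-irrefl) O.arc-count)

    ins-count : length (chosen in⁻ ps c) ≡ nonroots
    ins-count = trans (lengths in⁻ I.arc (λ u v → refl) ps) (trans (total I.arc I.arc-irrefl) I.arc-count)

    either : Digraph n
    either u v = f₀ u v ∨ f₁ u v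

    either⊆ : ∀ {u v} → T (either u v) → T (pick u v)
    either⊆ {u} {v} t = T∨-elim {f₀ u v} t (λ q → proj₁ (proj₂ (O.arc-spec q))) (λ q → proj₁ (proj₂ (I.arc-spec q)))

    any-count : length (chosen any ps c) < t
    any-count = ≤-trans (s≤s (≡≤ ((trans (lengths any either (λ u v → refl) ps)
      (total either (λ u → cong₂ _∨_ (O.arc-irrefl u) (I.arc-irrefl u)))))
      (sumF-mono (λ u → sumF-mono (λ v → ⌜⌝-mono (either⊆ {u} {v})))))) small

    consistentAt : List Bool → Digraph n
    consistentAt σ u v = consistent n σ (toℕ u) (toℕ v) (f₀ u v) (f₁ u v) (f₀ v u) (f₁ v u)

    admissibleAt : Digraph n
    admissibleAt u v = admissible flag D (toℕ u) (toℕ v) (f₀ u v) (f₁ u v) (f₀ v u) (f₁ v u)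

    fits-∈ : ∀ ps {σ u v} → T (fits ps (choiceOf ps) σ) → (u , v) ∈ ps → T (consistentAt σ u v)
    fits-∈ ((u , v) ∷ ps) f (here refl) = T∧₂ {admissibleAt u v} (T∧₁ f)
    fits-∈ ((u , v) ∷ ps) {σ} f (there m) = fits-∈ ps (T∧₂ {admissibleAt u v ∧ consistentAt σ u v} f) m

    ≡?-elim : ∀ {a b} → T (a ≡? b) → a ≡ b
    ≡?-elim {false} {false} _ = refl
    ≡?-elim {true} {true} _ = refl

    not-elim : ∀ {a} → T (not a) → a ≡ false
    not-elim {false} _ = refl

    module _ {σ : List Bool} (fit : T (fits ps c σ)) (s : Sub νᵇ vs σ) where

      edge₀ : ∀ x y → T (f₀ x y) → side₀ n σ (toℕ x) ≡ side₀ n σ (toℕ y) × mark₀ n σ (toℕ y) ≡ false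
      edge₀ x y t with cover x y (λ { refl → subst T (O.arc-irrefl x) t })
      ... | inj₁ m = let k = fits-∈ ps fit m in
        ≡?-elim (⇒ᵇ-elim (T∧₁ (T∧₁ k)) (T∨₁ t)) ,
        not-elim (⇒ᵇ-elim (T∧₁ (T∧₁ (T∧₂ {((f₀ x y ∨ f₀ y x ⇒ᵇ _) ∧ (f₁ x y ∨ f₁ y x ⇒ᵇ _))} k))) t)
      ... | inj₂ m = let k = fits-∈ ps fit m in
        sym (≡?-elim (⇒ᵇ-elim (T∧₁ (T∧₁ k)) (T∨₂ {f₀ y x} t))) ,
        not-elim (⇒ᵇ-elim (T∧₂ {f₀ y x ⇒ᵇ _} (T∧₁ (T∧₂ {((f₀ y x ∨ f₀ x y ⇒ᵇ _) ∧ (f₁ y x ∨ f₁ x y ⇒ᵇ _))} k))) t)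

      edge₁ : ∀ x y → T (f₁ x y) → side₁ n σ (toℕ x) ≡ side₁ n σ (toℕ y) × mark₁ n σ (toℕ x) ≡ false
      edge₁ x y t with cover x y (λ { refl → subst T (I.arc-irrefl x) t })
      ... | inj₁ m = let k = fits-∈ ps fit m in
        ≡?-elim (⇒ᵇ-elim (T∧₂ {f₀ x y ∨ f₀ y x ⇒ᵇ _} (T∧₁ k)) (T∨₁ t)) ,
        not-elim (⇒ᵇ-elim (T∧₁ (T∧₂ {(f₀ x y ⇒ᵇ _) ∧ (f₀ y x ⇒ᵇ _)} (T∧₂ {((f₀ x y ∨ f₀ y x ⇒ᵇ _) ∧ (f₁ x y ∨ f₁ y x ⇒ᵇ _))} k))) t)
      ... | inj₂ m = let k = fits-∈ ps fit m in
        sym (≡?-elim (⇒ᵇ-elim (T∧₂ {f₀ y x ∨ f₀ x y ⇒ᵇ _} (T∧₁ k)) (T∨₂ {f₁ y x} t))) ,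
        not-elim (⇒ᵇ-elim (T∧₂ {f₁ y x ⇒ᵇ _} (T∧₂ {(f₀ y x ⇒ᵇ _) ∧ (f₀ x y ⇒ᵇ _)} (T∧₂ {((f₀ y x ∨ f₀ x y ⇒ᵇ _) ∧ (f₁ y x ∨ f₁ x y ⇒ᵇ _))} k))) t)

      bit-root : ∀ {v} i → nth 0 i vs ≡ toℕ v → ¬ T (ν v) → nth false i σ ≡ false
      bit-root i e nv = ¬T→false λ t → nv (subst (T ∘ νᵇ) e (Sub-nth s i t))

      places : ∀ v → nth 0 (toℕ v) vs ≡ toℕ v × nth 0 (n + toℕ v) vs ≡ toℕ v ×
               nth 0 (n + (n + toℕ v)) vs ≡ toℕ v × nth 0 (n + (n + (n + toℕ v))) vs ≡ toℕ v
      places v = vertices4-nth n (toℕ v) (toℕ<n v)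

      split : ∀ v → T (ν v) ⊎ ¬ T (ν v)
      split v with ν v
      ... | true = inj₁ tt
      ... | false = inj₂ λ ()

      -- The side is constant along the arc from the predecessor, whose rank is smaller, and roots
      -- have side zero. The marks vanish at once, since each nonroot is entered by its arc.
      side₀-false : ∀ k v → O.rank v < k → side₀ n σ (toℕ v) ≡ false
      side₀-false (suc k) v (s≤s l) with split v
      ... | inj₂ nv = bit-root (toℕ v) (proj₁ (places v)) nv
      ... | inj₁ nv = trans (sym (proj₁ (edge₀ (O.predecessor v) v (O.arc-predecessor v nv))))
        (side₀-false k (O.predecessor v) (≤-trans (proj₂ (O.predecessor-spec v nv)) l))

      side₁-false : ∀ k v → I.rank v < k → side₁ n σ (toℕ v) ≡ false
      side₁-false (suc k) v (s≤s l) with split v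
      ... | inj₂ nv = bit-root _ (proj₁ (proj₂ (proj₂ (places v)))) nv
      ... | inj₁ nv = trans (proj₁ (edge₁ v (I.predecessor v) (I.arc-predecessor v nv)))
        (side₁-false k (I.predecessor v) (≤-trans (proj₂ (I.predecessor-spec v nv)) l))

      mark₀-false : ∀ v → mark₀ n σ (toℕ v) ≡ false
      mark₀-false v with split v
      ... | inj₂ nv = bit-root _ (proj₁ (proj₂ (places v))) nv
      ... | inj₁ nv = proj₂ (edge₀ (O.predecessor v) v (O.arc-predecessor v nv))

      mark₁-false : ∀ v → mark₁ n σ (toℕ v) ≡ false
      mark₁-false v with split v
      ... | inj₂ nv = bit-root _ (proj₂ (proj₂ (proj₂ (places v)))) nv
      ... | inj₁ nv = proj₂ (edge₁ v (I.predecessor v) (I.arc-predecessor v nv))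

      -- Splits the positions in a state into those of its first block, read as vertices, and the
      -- rest; three applications reach all four blocks.
      first-block : ∀ {P : ℕ → Set} {m} → (∀ v → P (toℕ v)) → (∀ i → i < m → P (n + i)) → ∀ i → i < n + m → P i
      first-block {P} {m} f g i l with i ℕₚ.<? n
      ... | yes i<n = subst P (Finₚ.toℕ-fromℕ< i<n) (f (Fin.fromℕ< i<n))
      ... | no i≮n = subst P (m+[n∸m]≡n (≮⇒≥ i≮n)) (g (i ∸ n)
        (+-cancelˡ-< n (i ∸ n) m (subst (_< n + m) (sym (m+[n∸m]≡n (≮⇒≥ i≮n))) l)))

      last-block : ∀ {P : ℕ → Set} → (∀ v → P (toℕ v)) → ∀ i → i < n → P i
      last-block {P} f i l = subst P (Finₚ.toℕ-fromℕ< l) (f (Fin.fromℕ< l))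

      all-false : T (allL not σ)
      all-false = allL-nth σ λ i l → first-block {λ i → nth false i σ ≡ false}
        (λ v → side₀-false _ v ≤-refl) (first-block {λ i → nth false (n + i) σ ≡ false}
        mark₀-false (first-block {λ i → nth false (n + (n + i)) σ ≡ false}
        (λ v → side₁-false _ v ≤-refl) (last-block {λ i → nth false (n + (n + (n + i))) σ ≡ false} mark₁-false)))
        i (subst (i <_) (trans (Sub-length s) (length-vertices4 n)) l)

    fits-zeros : ∀ ps → T (fits ps (choiceOf ps) (List.map (λ _ → false) vs))
    fits-zeros [] = tt
    fits-zeros ((u , v) ∷ ps) = T∧ (T∧ adm cst) (fits-zeros ps)
      where
      zs = List.map (λ _ → false) vs
      ⇒ᵇ-intro : ∀ {a b} → (T a → T b) → T (a ⇒ᵇ b)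
      ⇒ᵇ-intro {false} h = tt
      ⇒ᵇ-intro {true} h = h tt
      adm : T (admissibleAt u v)
      adm = T∧ (⇒ᵇ-intro {either u v} λ t → subst T (sym (at-d u v)) (pick⊆ u v (either⊆ t)))
        (T∧ (⇒ᵇ-intro {either v u} λ t → subst T (sym (at-d v u)) (pick⊆ v u (either⊆ t)))
          (⇒ᵇ-intro {flag} λ fl → T-not λ t → oriented fl u v (either⊆ (T∧₁ t)) (either⊆ (T∧₂ {either u v} t))))
      same : ∀ a i j → T (a ⇒ᵇ nth false i zs ≡? nth false j zs)
      same a i j rewrite nth-map-false i vs | nth-map-false j vs = ⇒ᵇ-intro {a} (λ _ → tt)
      unmarked : ∀ a i → T (a ⇒ᵇ not (nth false i zs))
      unmarked a i rewrite nth-map-false i vs = ⇒ᵇ-intro {a} (λ _ → tt)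
      cst : T (consistentAt zs u v)
      cst = T∧ (T∧ (same (f₀ u v ∨ f₀ v u) _ _) (same (f₁ u v ∨ f₁ v u) _ _))
        (T∧ (T∧ (unmarked (f₀ u v) _) (unmarked (f₀ v u) _)) (T∧ (unmarked (f₁ u v) _) (unmarked (f₁ v u) _)))

    choice-odd : odd ps c
    choice-odd = XS-unique νᵇ vs (fits ps c) (λ σ s f → all-false f s) (fits-zeros ps)

-- The isolation lemma

sumV : ∀ k → (Vec Bool k → ℕ) → ℕ
sumV zero f = f []
sumV (suc k) f = sumV k (f ∘ (false ∷_)) + sumV k (f ∘ (true ∷_))

sumV-mono : ∀ k {f g} → (∀ v → f v ≤ g v) → sumV k f ≤ sumV k g
sumV-mono zero h = h []
sumV-mono (suc k) h = +-mono-≤ (sumV-mono k (λ v → h _)) (sumV-mono k (λ v → h _))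

sumV-cong : ∀ k {f g} → (∀ v → f v ≡ g v) → sumV k f ≡ sumV k g
sumV-cong zero h = h []
sumV-cong (suc k) h = cong₂ _+_ (sumV-cong k (λ v → h _)) (sumV-cong k (λ v → h _))

sumV-+ : ∀ k f g → sumV k (λ v → f v + g v) ≡ sumV k f + sumV k g
sumV-+ zero f g = refl
sumV-+ (suc k) f g = trans (cong₂ _+_ (sumV-+ k _ _) (sumV-+ k _ _)) (+-exchange (sumV k _) _ _ _)

sumV-const : ∀ k c → sumV k (λ _ → c) ≡ 2 ^ k * c
sumV-const zero c = sym (+-identityʳ c)
sumV-const (suc k) c = trans (cong₂ _+_ (sumV-const k c) (sumV-const k c))
  (trans (sym (*-distribʳ-+ c (2 ^ k) (2 ^ k))) (cong (λ x → (2 ^ k + x) * c) (sym (+-identityʳ (2 ^ k)))))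

sumV-∃ : ∀ k (p : Vec Bool k → Bool) → 1 ≤ sumV k (⌜_⌝ ∘ p) → ∃[ v ] T (p v)
sumV-∃ zero p le with p [] in eq
... | true = [] , true→T eq
sumV-∃ (suc k) p le with sumV k (⌜_⌝ ∘ p ∘ (false ∷_)) in eq
... | suc m = let (v , t) = sumV-∃ k (p ∘ (false ∷_)) (≤≡ (s≤s z≤n) (sym eq)) in false ∷ v , t
... | zero = let (v , t) = sumV-∃ k (p ∘ (true ∷_)) le in true ∷ v , t

sumV-unique : ∀ k (p : Vec Bool k → Bool) → (∀ v w → T (p v) → T (p w) → v ≡ w) → sumV k (⌜_⌝ ∘ p) ≤ 1
sumV-unique zero p h with p []
... | true = ≤-refl
... | false = z≤n
sumV-unique (suc k) p h with sumV k (⌜_⌝ ∘ p ∘ (false ∷_)) in eq₀ | sumV k (⌜_⌝ ∘ p ∘ (true ∷_)) in eq₁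
... | zero | x = subst (_≤ 1) eq₁ (sumV-unique k (p ∘ (true ∷_)) (λ v w a b → cong Vec.tail (h (true ∷ v) (true ∷ w) a b)))
... | suc m | zero = ≡≤ (+-identityʳ (suc m)) (subst (_≤ 1) eq₀
  (sumV-unique k (p ∘ (false ∷_)) (λ v w a b → cong Vec.tail (h (false ∷ v) (false ∷ w) a b))))
... | suc m | suc l with sumV-∃ k (p ∘ (false ∷_)) (≤≡ (s≤s z≤n) (sym eq₀))
                       | sumV-∃ k (p ∘ (true ∷_)) (≤≡ (s≤s z≤n) (sym eq₁))
... | v , a | w , b = contradiction (cong Vec.head (h (false ∷ v) (true ∷ w) a b)) (λ ())

allX-∃ : ∀ m (p : Vec Bool m → Bool) → allX m p ≡ true → ∃[ c ] T (p c)
allX-∃ zero p eq = [] , true→T eq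
allX-∃ (suc m) p eq with xor-true eq
... | inj₁ t = let (c , u) = allX-∃ m _ (T→true t) in false ∷ c , u
... | inj₂ t = let (c , u) = allX-∃ m _ (T→true t) in true ∷ c , u

module Isolation {k : ℕ} where

  Ω : ℕ → Set
  Ω M = Vec (Vec Bool k) M

  sumΩ : ∀ M → (Ω M → ℕ) → ℕ
  sumΩ zero f = f []
  sumΩ (suc M) f = sumV k (λ w → sumΩ M (f ∘ (w ∷_)))

  sumΩ-mono : ∀ M {f g} → (∀ ω → f ω ≤ g ω) → sumΩ M f ≤ sumΩ M g
  sumΩ-mono zero h = h []
  sumΩ-mono (suc M) h = sumV-mono k (λ w → sumΩ-mono M (λ ω → h _))

  sumΩ-+ : ∀ M f g → sumΩ M (λ ω → f ω + g ω) ≡ sumΩ M f + sumΩ M g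
  sumΩ-+ zero f g = refl
  sumΩ-+ (suc M) f g = trans (sumV-cong k (λ w → sumΩ-+ M _ _)) (sumV-+ k _ _)

  sumΩ-const : ∀ M c → sumΩ M (λ _ → c) ≡ (2 ^ k) ^ M * c
  sumΩ-const zero c = sym (+-identityʳ c)
  sumΩ-const (suc M) c = trans (sumV-cong k (λ _ → sumΩ-const M c)) (trans (sumV-const k _) (sym (*-assoc (2 ^ k) ((2 ^ k) ^ M) c)))

  sumΩ-sumF : ∀ M {n} (f : Fin n → Ω M → ℕ) → sumΩ M (λ ω → sumF (λ i → f i ω)) ≡ sumF (λ i → sumΩ M (f i))
  sumΩ-sumF M {zero} f = trans (sumΩ-const M 0) (*-zeroʳ ((2 ^ k) ^ M))
  sumΩ-sumF M {suc n} f = trans (sumΩ-+ M (f zero) _) (cong (sumΩ M (f zero) +_) (sumΩ-sumF M (f ∘ suc)))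

  sumV-sumΩ : ∀ j M (f : Vec Bool j → Ω M → ℕ) → sumV j (λ w → sumΩ M (f w)) ≡ sumΩ M (λ ω → sumV j (λ w → f w ω))
  sumV-sumΩ zero M f = refl
  sumV-sumΩ (suc j) M f = trans (cong₂ _+_ (sumV-sumΩ j M _) (sumV-sumΩ j M _)) (sym (sumΩ-+ M _ _))

  -- With the other coordinates fixed, at most one of the `2 ^ k` values of coordinate `i` belongs
  -- to the event; this is summed over the other coordinates.
  determined : ∀ {M} (i : Fin M) (p : Ω M → Bool) → (∀ ω a b → T (p (ω [ i ]≔ a)) → T (p (ω [ i ]≔ b)) → a ≡ b) →
               2 ^ k * sumΩ M (⌜_⌝ ∘ p) ≤ (2 ^ k) ^ M
  determined {suc M} zero p h = *-monoʳ-≤ (2 ^ k) (≡≤ ((sumV-sumΩ k M (λ w ω → ⌜ p (w ∷ ω) ⌝)))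
    (≤≡ (sumΩ-mono M (λ ω → sumV-unique k (λ w → p (w ∷ ω)) (λ v w a b → h (v ∷ ω) v w a b)))
      (trans (sumΩ-const M 1) (*-identityʳ _))))
  determined {suc M} (suc i) p h = ≡≤ ((scale k (λ w → sumΩ M (λ ω → ⌜ p (w ∷ ω) ⌝))))
    (≤≡ (sumV-mono k (λ w → determined i (p ∘ (w ∷_)) (λ ω a b → h (w ∷ ω) a b))) (sumV-const k _))
    where
    scale : ∀ j (f : Vec Bool j → ℕ) → 2 ^ k * sumV j f ≡ sumV j (λ w → 2 ^ k * f w)
    scale zero f = refl
    scale (suc j) f = trans (*-distribˡ-+ (2 ^ k) (sumV j _) _) (cong₂ _+_ (scale j _) (scale j _))

  module _ (val : Vec Bool k → ℕ) (val-injective : ∀ {a b} → val a ≡ val b → a ≡ b) where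

    dot : ∀ {M} → Ω M → Vec Bool M → ℕ
    dot [] [] = 0
    dot (w ∷ ω) (b ∷ c) = weigh (val w) b + dot ω c

    rest : ∀ {M} → Fin M → Ω M → Vec Bool M → ℕ
    rest zero (_ ∷ ω) (_ ∷ c) = dot ω c
    rest (suc i) (w ∷ ω) (b ∷ c) = weigh (val w) b + rest i ω c

    dot-rest : ∀ {M} (i : Fin M) ω c a → dot (ω [ i ]≔ a) c ≡ rest i ω c + weigh (val a) (lookup c i)
    dot-rest zero (_ ∷ ω) (b ∷ c) a = +-comm (weigh (val a) b) (dot ω c)
    dot-rest (suc i) (w ∷ ω) (b ∷ c) a = trans (cong (weigh (val w) b +_) (dot-rest i ω c a)) (sym (+-assoc (weigh (val w) b) _ _))

    module _ {M : ℕ} (F : Vec Bool M → Bool) (base : Vec Bool M → ℕ) where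

      wt : Ω M → Vec Bool M → ℕ
      wt ω c = base c + dot ω c

      Minimal : Ω M → Vec Bool M → Set
      Minimal ω c = T (F c) × (∀ d → T (F d) → wt ω c ≤ wt ω d)

      Singular : Fin M → Ω M → Set
      Singular i ω = ∃[ c ] ∃[ c′ ] (Minimal ω c × Minimal ω c′ × lookup c i ≡ false × lookup c′ i ≡ true)

      wt-at : ∀ i ω a c b → lookup c i ≡ b → wt (ω [ i ]≔ a) c ≡ (base c + rest i ω c) + weigh (val a) b
      wt-at i ω a c b refl = trans (cong (base c +_) (dot-rest i ω c a)) (sym (+-assoc (base c) _ _))

      -- Fix all weights except that of `i`. The least weight of a solution avoiding `i` is then a
      -- constant, and the least weight of one containing `i` is a constant plus the weight of `i`.
      -- Singularity equates the two, which determines the weight of `i`.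
      singular-unique : ∀ i ω a b → Singular i (ω [ i ]≔ a) → Singular i (ω [ i ]≔ b) → a ≡ b
      singular-unique i ω a b (c , c′ , (fc , mc) , (fc′ , mc′) , ci , ci′) (d , d′ , (fd , md) , (fd′ , md′) , di , di′) =
        val-injective (≤-antisym (lemma a b c c′ ci′ (≤-antisym (mc c′ fc′) (mc′ c fc)) c′≥)
                                 (lemma b a d d′ di′ (≤-antisym (md d′ fd′) (md′ d fd)) d′≥))
        where
        ωa = ω [ i ]≔ a
        ωb = ω [ i ]≔ b
        indep : ∀ x → lookup x i ≡ false → wt ωa x ≡ wt ωb x
        indep x e = trans (wt-at i ω a x false e) (sym (wt-at i ω b x false e))
        same : wt ωa c ≡ wt ωb d
        same = ≤-antisym (≤≡ (mc d fd) (indep d di)) (≤≡ (md c fc) (sym (indep c ci)))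
        c′≥ : wt ωa c ≤ wt ωb c′
        c′≥ = ≡≤ (same) (md c′ fc′)
        d′≥ : wt ωb d ≤ wt ωa d′
        d′≥ = ≡≤ (sym same) (mc d′ fd′)
        lemma : ∀ a b c c′ → lookup c′ i ≡ true → wt (ω [ i ]≔ a) c ≡ wt (ω [ i ]≔ a) c′ →
                wt (ω [ i ]≔ a) c ≤ wt (ω [ i ]≔ b) c′ → val a ≤ val b
        lemma a b c c′ ci′ e le = +-cancelˡ-≤ (base c′ + rest i ω c′) (val a) (val b)
          (≡≤ ((trans (sym (wt-at i ω a c′ true ci′)) (sym e))) (≤≡ le (wt-at i ω b c′ true ci′)))

      minimum : ∀ m (G : Vec Bool m → Bool) (f : Vec Bool m → ℕ) →
        (∀ c → ¬ T (G c)) ⊎ ∃[ c ] (T (G c) × (∀ d → T (G d) → f c ≤ f d))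
      minimum zero G f with G [] in eq
      ... | true = inj₂ ([] , true→T eq , λ { [] _ → ≤-refl })
      ... | false = inj₁ λ { [] t → subst T eq t }
      minimum (suc m) G f with minimum m (G ∘ (false ∷_)) (f ∘ (false ∷_)) | minimum m (G ∘ (true ∷_)) (f ∘ (true ∷_))
      ... | inj₁ p | inj₁ q = inj₁ λ { (false ∷ c) → p c ; (true ∷ c) → q c }
      ... | inj₁ p | inj₂ (c , t , le) = inj₂ (true ∷ c , t , λ { (false ∷ d) u → ⊥-elim (p d u) ; (true ∷ d) → le d })
      ... | inj₂ (c , t , le) | inj₁ q = inj₂ (false ∷ c , t , λ { (false ∷ d) → le d ; (true ∷ d) u → ⊥-elim (q d u) })
      ... | inj₂ (c , t , le) | inj₂ (c′ , t′ , le′) with ≤-total (f (false ∷ c)) (f (true ∷ c′))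
      ... | inj₁ x = inj₂ (false ∷ c , t , λ { (false ∷ d) → le d ; (true ∷ d) u → ≤-trans x (le′ d u) })
      ... | inj₂ x = inj₂ (true ∷ c′ , t′ , λ { (false ∷ d) u → ≤-trans x (le d u) ; (true ∷ d) → le′ d })

      -- If the two halves of the cube contain odd numbers of solutions, the opposite half has one,
      -- which differs in the first coordinate; otherwise the half of `c` has an even number and the
      -- search continues there.
      another : ∀ m (p : Vec Bool m → Bool) → allX m p ≡ false → ∀ c → T (p c) → ∃[ c′ ] ∃[ i ] (T (p c′) × lookup c′ i ≡ not (lookup c i))
      another zero p eq [] t = ⊥-elim (subst T eq t)
      another (suc m) p eq (b ∷ c) t with allX m (p ∘ (false ∷_)) in eq₀ | allX m (p ∘ (true ∷_)) in eq₁
      another (suc m) p eq (false ∷ c) t | true | true = let (d , u) = allX-∃ m (p ∘ (true ∷_)) eq₁ in true ∷ d , zero , u , refl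
      another (suc m) p eq (true ∷ c) t | true | true = let (d , u) = allX-∃ m (p ∘ (false ∷_)) eq₀ in false ∷ d , zero , u , refl
      another (suc m) p eq (false ∷ c) t | false | false = let (d , i , u , e) = another m (p ∘ (false ∷_)) eq₀ c t in false ∷ d , suc i , u , e
      another (suc m) p eq (true ∷ c) t | false | false = let (d , i , u , e) = another m (p ∘ (true ∷_)) eq₁ c t in true ∷ d , suc i , u , e

      module _ (K : ℕ) (bad : Ω M → Bool)
        (bad-spec : ∀ ω → T (bad ω) → ∀ e → e < K → allX M (λ c → F c ∧ (e ≡ᵇ wt ω c)) ≡ false)
        (c₀ : Vec Bool M) (Fc₀ : T (F c₀)) (light : ∀ ω → wt ω c₀ < K) where

        -- The weight of a lightest solution lies below `K`, as it is at most that of `c₀`. If the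
        -- coefficient there vanishes, the number of solutions of this weight is even, so a second
        -- lightest solution exists, and a coordinate where the two differ is singular.
        singular : ∀ ω → T (bad ω) → ∃[ i ] Singular i ω
        singular ω t with minimum M F (wt ω)
        ... | inj₁ none = ⊥-elim (none c₀ Fc₀)
        ... | inj₂ (c , fc , mc) with another M (λ d → F d ∧ (wt ω c ≡ᵇ wt ω d))
                (bad-spec ω t (wt ω c) (≤-trans (s≤s (mc c₀ Fc₀)) (light ω))) c (T∧ fc (≡ᵇ-refl (wt ω c)))
        ... | c′ , i , u , e = i , order (lookup c i) refl
          where
          minimal′ : Minimal ω c′
          minimal′ = T∧₁ u , λ d fd → ≡≤ ((sym (≡ᵇ⇒≡ (wt ω c) (wt ω c′) (T∧₂ {F c′} u)))) (mc d fd)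
          order : ∀ b → lookup c i ≡ b → Singular i ω
          order false eq = c , c′ , (fc , mc) , minimal′ , eq , trans e (cong not eq)
          order true eq = c′ , c , minimal′ , (fc , mc) , trans e (cong not eq) , eq

        at-index : Fin M → Ω M → Bool
        at-index i ω = choose (bad ω) (λ t → proj₁ (singular ω t) == i) false

        at-index-singular : ∀ i ω → T (at-index i ω) → Singular i ω
        at-index-singular i ω = go′ (bad ω) (singular ω)
          where
          go′ : ∀ b (s : T b → ∃[ i ] Singular i ω) → T (choose b (λ t → proj₁ (s t) == i) false) → Singular i ω
          go′ true s t = subst (λ j → Singular j ω) (==-true t) (proj₂ (s tt))

        -- Union bound over the `M` coordinates: each of them is singular with probability at most
        -- one in `2 ^ k`.
        isolation : 2 ^ k * sumΩ M (⌜_⌝ ∘ bad) ≤ M * (2 ^ k) ^ M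
        isolation = ≤-trans (*-monoʳ-≤ (2 ^ k) (≤≡ (sumΩ-mono M (λ ω → indexed (bad ω) (singular ω)))
            (sumΩ-sumF M (λ i ω → ⌜ at-index i ω ⌝))))
          (≡≤ ((scaleF (λ i → sumΩ M (λ ω → ⌜ at-index i ω ⌝))))
            (≤≡ (sumF-mono (λ i → determined i (at-index i) (λ ω a b p q →
                singular-unique i ω a b (at-index-singular i _ p) (at-index-singular i _ q))))
              (sumF-const M ((2 ^ k) ^ M))))
          where
          indexed : ∀ b {S : Fin M → Set} (s : T b → ∃[ i ] S i) → ⌜ b ⌝ ≤ sumF (λ i → ⌜ choose b (λ t → proj₁ (s t) == i) false ⌝)
          indexed false s = z≤n
          indexed true s = ≤-reflexive (sym (sumF-point (proj₁ (s tt))))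
          scaleF : ∀ {n} (f : Fin n → ℕ) → 2 ^ k * sumF f ≡ sumF (λ i → 2 ^ k * f i)
          scaleF {zero} f = *-zeroʳ (2 ^ k)
          scaleF {suc n} f = trans (*-distribˡ-+ (2 ^ k) (f zero) _) (cong (2 ^ k * f zero +_) (scaleF (f ∘ suc)))

-- Simple paths and cycles

data Walk {A : Set} (R : A → A → Set) : A → A → List A → Set where
  here! : ∀ {x} → Walk R x x (x ∷ [])
  _∷_ : ∀ {x y z ys} → R x y → Walk R y z ys → Walk R x z (x ∷ ys)

module _ {A : Set} where

  Distinct : List A → Set
  Distinct [] = ⊤
  Distinct (x ∷ xs) = ¬ (x ∈ xs) × Distinct xs

  lookup-∈ : ∀ (xs : List A) i → List.lookup xs i ∈ xs
  lookup-∈ (x ∷ xs) zero = here refl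
  lookup-∈ (x ∷ xs) (suc i) = there (lookup-∈ xs i)

  distinct-injective : ∀ (xs : List A) → Distinct xs → ∀ {i j} → List.lookup xs i ≡ List.lookup xs j → i ≡ j
  distinct-injective (x ∷ xs) (x∉ , d) {zero} {zero} e = refl
  distinct-injective (x ∷ xs) (x∉ , d) {zero} {suc j} e = contradiction (subst (_∈ xs) (sym e) (lookup-∈ xs j)) x∉
  distinct-injective (x ∷ xs) (x∉ , d) {suc i} {zero} e = contradiction (subst (_∈ xs) e (lookup-∈ xs i)) x∉
  distinct-injective (x ∷ xs) (x∉ , d) {suc i} {suc j} e = cong suc (distinct-injective xs d e)

  module _ {R : A → A → Set} where

    cut : ∀ {x y z ys} → Walk R y z ys → Distinct ys → x ∈ ys → ∃[ zs ] (Walk R x z zs × Distinct zs)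
    cut here! d (here refl) = _ , here! , d
    cut (r ∷ w) d (here refl) = _ , r ∷ w , d
    cut (r ∷ w) (_ , d) (there m) = cut w d m

    simple : (∀ x (ys : List A) → Dec (x ∈ ys)) → ∀ {x z} → Star R x z → ∃[ ys ] (Walk R x z ys × Distinct ys)
    simple dec ε = _ , here! , (λ ()) , tt
    simple dec {x} (r ◅ s) with simple dec s
    ... | ys , w , d with dec x ys
    ... | yes m = cut w d m
    ... | no m = x ∷ ys , r ∷ w , m , d

    walk-adjacent : ∀ {x z y ys} → Walk R x z (y ∷ ys) → ∀ i → R (List.lookup (y ∷ ys) (Fin.inject₁ i)) (List.lookup ys i)
    walk-adjacent (r ∷ here!) zero = r
    walk-adjacent (r ∷ (_ ∷ _)) zero = r
    walk-adjacent (r ∷ w@here!) (suc ())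
    walk-adjacent (r ∷ w@(_ ∷ _)) (suc i) = walk-adjacent w i

    walk-last : ∀ {x z y ys} → Walk R x z (y ∷ ys) → List.lookup (y ∷ ys) (Fin.fromℕ (length ys)) ≡ z
    walk-last here! = refl
    walk-last (r ∷ here!) = refl
    walk-last (r ∷ w@(_ ∷ _)) = walk-last w

    walk-all : ∀ {P : A → Set} → (∀ {x y} → R x y → P x × P y) → ∀ {x z ys} → P x → Walk R x z ys → ∀ {y} → y ∈ ys → P y
    walk-all h px here! (here refl) = px
    walk-all h px (r ∷ w) (here refl) = px
    walk-all h px (r ∷ w) (there m) = walk-all h (proj₂ (h r)) w m

  walk-map : ∀ {R S : A → A → Set} → (∀ {x y} → R x y → S x y) → ∀ {x y ys} → Walk R x y ys → Walk S x y ys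
  walk-map f here! = here!
  walk-map f (r ∷ w) = f r ∷ walk-map f w

_∈?_ : ∀ {n} (x : Fin n) ys → Dec (x ∈ ys)
x ∈? ys = Any.any? (x ≟_) ys

module _ {n : ℕ} (G : Graph n) (acyclic : ¬ Cycle G) where

  Avoiding : Fin n → Fin n → Fin n → Set
  Avoiding x a b = Adj G a b × a ≢ x × b ≢ x

  adj-sym : ∀ {a b} → Adj G a b → Adj G b a
  adj-sym {a} {b} t = subst T (symmetric G a b) t

  adj-irrefl : ∀ {a b} → Adj G a b → a ≢ b
  adj-irrefl {a} t refl = subst T (loopless G a) t

  -- A path between two different neighbours of `x` that avoids `x`, once made simple, closes to a
  -- cycle through `x`.
  no-detour : ∀ x {y p} → Adj G x y → Adj G x p → Star (Avoiding x) y p → y ≡ p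
  no-detour x {y} {p} xy xp s with y ≟ p
  ... | yes e = e
  ... | no ne with simple _∈?_ s
  ... | _ , here! , _ = contradiction refl ne
  ... | _ , w@(r ∷ here!) , d = ⊥-elim (acyclic (cyc w d))
    where
    cyc : ∀ {u rest} → Walk (Avoiding x) y p (y ∷ u ∷ rest) → Distinct (y ∷ u ∷ rest) → Cycle G
    cyc {u} {rest} w d = record
      { extra = length rest
      ; vertex = List.lookup (x ∷ y ∷ u ∷ rest)
      ; injective = λ {i} {j} → distinct-injective (x ∷ y ∷ u ∷ rest) ((λ m → walk-all (λ (_ , a , b) → a , b) (adj-irrefl (adj-sym xy)) w m refl) , d)
      ; adjacent = walk-adjacent (xy ∷ walk-map proj₁ w)
      ; closed = subst (λ v → Adj G v x) (sym (walk-last w)) (adj-sym xp)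
      }
  ... | _ , w@(r ∷ (_ ∷ _)) , d = ⊥-elim (acyclic (cyc w d))
    where
    cyc : ∀ {u rest} → Walk (Avoiding x) y p (y ∷ u ∷ rest) → Distinct (y ∷ u ∷ rest) → Cycle G
    cyc {u} {rest} w d = record
      { extra = length rest
      ; vertex = List.lookup (x ∷ y ∷ u ∷ rest)
      ; injective = λ {i} {j} → distinct-injective (x ∷ y ∷ u ∷ rest) ((λ m → walk-all (λ (_ , a , b) → a , b) (adj-irrefl (adj-sym xy)) w m refl) , d)
      ; adjacent = walk-adjacent (xy ∷ walk-map proj₁ w)
      ; closed = subst (λ v → Adj G v x) (sym (walk-last w)) (adj-sym xp)
      }

  -- The path is cut after its last visit to `x`; `P` records that the next vertex `y` still has the
  -- property that holds along the path.
  last-exit : ∀ {P : Fin n → Set} x {a z} → z ≢ x → Star (λ a b → Adj G a b × P a × P b) a z →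
    Star (Avoiding x) a z × a ≢ x ⊎ ∃[ y ] (Adj G x y × P y × Star (Avoiding x) y z)
  last-exit x z≢x ε = inj₁ (ε , z≢x)
  last-exit x {a} z≢x ((ab , pa , pb) ◅ s) with last-exit x z≢x s
  ... | inj₂ r = inj₂ r
  ... | inj₁ (t , b≢x) with a ≟ x
  ... | yes refl = inj₂ (_ , ab , pb , t)
  ... | no a≢x = inj₁ ((ab , a≢x , b≢x) ◅ t , a≢x)

-- An elimination order for the tree of the decomposition

visited : ℕ → List (ℕ × ℕ) → Bool
visited x O = anyL (λ e → x ≡ᵇ proj₁ e) O

attach : List (List Bool) → List (ℕ × ℕ) → ℕ → List (ℕ × ℕ) → List (ℕ × ℕ)
attach A O x c = foldr (λ e c → if at A x (proj₁ e) then (x , proj₁ e) ∷ [] else c) c O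

candidate : List (List Bool) → List ℕ → List (ℕ × ℕ) → List (ℕ × ℕ)
candidate A xs O = foldr (λ x c → if visited x O then c else attach A O x c) [] xs

-- Node 0 becomes the root, with the virtual parent `N`. As `N` exceeds every index of a node,
-- looking up its bag gives the empty one. The list `xs` of all nodes also serves as a counter of
-- rounds.
order : List (List Bool) → List ℕ → ℕ → List (ℕ × ℕ)
order A xs N = foldr (λ _ O → O ++ candidate A xs O) ((0 , N) ∷ []) xs

candidateF : Fn (mat ∷ list nat ∷ list (nat ⊗ nat) ∷ []) (list (nat ⊗ nat))
candidateF = fn
  (fold v1 emp (ite (anyT v4 (eqF $$ ⟪ v1 ⨟ π₁ v0 ⟫)) v1
    (fold v4 v1 (ite (atF $$ ⟪ v4 ⨟ v2 ⨟ π₁ v0 ⟫) ((v2 ، π₁ v0) ◂ emp) v1) attachBound))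
    (keepBound 1 (λ s ρ h w → z≤n , [])
      (λ s (A , xs , O , _) x c h (_ , _ , (_ , wO) , _) px pc →
        if-elim (visited x O) (W (s ^ 1) (list (nat ⊗ nat))) pc (attach-W {s} A O x c h wO px pc))))
  (λ (A , xs , O , _) → candidate A xs O) (λ _ → refl)
  where
  single : ∀ {s x y} → 2 ≤ s → x ≤ s ^ 1 → y ≤ s ^ 1 → W (s ^ 1) (list (nat ⊗ nat)) ((x , y) ∷ [])
  single h px py = ≤-trans (≤-trans (s≤s z≤n) h) (≤pow h 0) , (px , py) ∷ []
  attach-W : ∀ {s} A O x c → 2 ≤ s → All (W s (nat ⊗ nat)) O → x ≤ s → W (s ^ 1) (list (nat ⊗ nat)) c →
             W (s ^ 1) (list (nat ⊗ nat)) (attach A O x c)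
  attach-W A [] x c h [] px pc = pc
  attach-W {s} A ((y , q) ∷ O) x c h ((py , _) ∷ ps) px pc =
    if-elim (at A x y) (W (s ^ 1) (list (nat ⊗ nat))) (single h (loose nat h px) (loose nat h py)) (attach-W A O x c h ps px pc)
  attachBound : FoldBound {poly} {nat ∷ list (nat ⊗ nat) ∷ mat ∷ list nat ∷ list (nat ⊗ nat) ∷ []}
    v1 (ite (atF $$ ⟪ v4 ⨟ v2 ⨟ π₁ v0 ⟫) ((v2 ، π₁ v0) ◂ emp) v1)
  attachBound = keepBound 1 (λ s ρ h (_ , w , _) → loose (list (nat ⊗ nat)) h w)
    (λ s (x , c , A , _) e c′ h (px , _) pe pc →
      if-elim (at A x (proj₁ e)) (W (s ^ 1) (list (nat ⊗ nat))) (single h (loose nat h px) (loose nat h (proj₁ pe))) pc)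

candidate-All : ∀ {P : ℕ × ℕ → Set} A xs O → (∀ {x y q} → x ∈ xs → (y , q) ∈ O → P (x , y)) → All P (candidate A xs O)
candidate-All {P} A xs O h = outer xs (λ m → m)
  where
  inner : ∀ x c O′ → (∀ {e} → e ∈ O′ → e ∈ O) → x ∈ xs → All P c → All P (attach A O′ x c)
  inner x c [] sub m pc = pc
  inner x c ((y , q) ∷ O′) sub m pc with at A x y
  ... | true = h m (sub (here refl)) ∷ []
  ... | false = inner x c O′ (sub ∘ there) m pc
  outer : ∀ xs′ → (∀ {e} → e ∈ xs′ → e ∈ xs) → All P (foldr (λ x c → if visited x O then c else attach A O x c) [] xs′)
  outer [] sub = []
  outer (x ∷ xs′) sub with visited x O
  ... | true = outer xs′ (sub ∘ there)
  ... | false = inner x _ O (λ m → m) (sub (here refl)) (outer xs′ (sub ∘ there))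

candidate-length : ∀ A xs O → length (candidate A xs O) ≤ 1
candidate-length A [] O = z≤n
candidate-length A (x ∷ xs) O with visited x O
... | true = candidate-length A xs O
... | false = inner O
  where
  inner : ∀ O′ → length (attach A O′ x (candidate A xs O)) ≤ 1
  inner [] = candidate-length A xs O
  inner ((y , _) ∷ O′) with at A x y
  ... | true = ≤-refl
  ... | false = inner O′

orderF : Fn (mat ∷ list nat ∷ nat ∷ []) (list (nat ⊗ nat))
orderF = fn
  (fold v1 ((zer ، v2) ◂ emp) (v1 ++′ candidateF $$ ⟪ v2 ⨟ v3 ⨟ v1 ⟫)
    (listBound 1
      (λ s (A , xs , N , _) h (_ , _ , w , _) → ≤-trans (≤-trans (s≤s z≤n) h) (≤pow h 0) , (z≤n , loose nat h w) ∷ [])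
      (λ s (A , xs , N , _) x O h (_ , (_ , wx) , _) px pO →
        ≡≤ ((trans (length-++ O) (+-comm (length O) _)))
          (+-monoˡ-≤ (length O) (≤-trans (candidate-length A xs O) (≤-trans (≤-trans (s≤s z≤n) h) (≤pow h 0)))) ,
        All-++ pO (candidate-All A xs O (λ mx my → loose nat h (All.lookup wx mx) , proj₁ (All.lookup pO my))))))
  (λ (A , xs , N , _) → order A xs N) (λ _ → refl)
  where
  All-++ : ∀ {A : Set} {P : A → Set} {xs ys} → All P xs → All P ys → All P (xs ++ ys)
  All-++ [] qs = qs
  All-++ (p ∷ ps) qs = p ∷ All-++ ps qs

anyL-∃∈ : ∀ (g : ℕ → Bool) V → T (anyL g V) → ∃[ z ] (T (z ∈ᵇ V) × T (g z))
anyL-∃∈ g (z ∷ V) t = T∨-elim {g z} t (λ p → z , T∨₁ (≡ᵇ-refl z) , p)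
  (λ q → let (y , m , p) = anyL-∃∈ g V q in y , T∨₂ {y ≡ᵇ z} m , p)

visited-∈ : ∀ {y} O → T (visited y O) → ∃[ q ] ((y , q) ∈ O)
visited-∈ {y} ((x , q) ∷ O) t = T∨-elim {y ≡ᵇ x} t (λ e → q , here (cong (_, q) (≡ᵇ⇒≡ y x e)))
  (λ r → let (q , m) = visited-∈ O r in q , there m)

∈-visited : ∀ {y q} O → (y , q) ∈ O → T (visited y O)
∈-visited {y} (_ ∷ O) (here refl) = T∨₁ (≡ᵇ-refl y)
∈-visited {y} (e ∷ O) (there m) = T∨₂ {y ≡ᵇ proj₁ e} (∈-visited O m)

∈-mapL : ∀ {A B : Set} (f : A → B) {x} xs → x ∈ xs → f x ∈ mapL f xs
∈-mapL f (_ ∷ xs) (here refl) = here refl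
∈-mapL f (_ ∷ xs) (there m) = there (∈-mapL f xs m)

∈-mapL⁻ : ∀ {A B : Set} (f : A → B) {y} xs → y ∈ mapL f xs → ∃[ x ] (x ∈ xs × y ≡ f x)
∈-mapL⁻ f (x ∷ xs) (here refl) = x , here refl , refl
∈-mapL⁻ f (x ∷ xs) (there m) = let (x′ , m′ , e) = ∈-mapL⁻ f xs m in x′ , there m′ , e

∈-range : ∀ {i n} → i < n → i ∈ range n
∈-range {zero} {suc n} l = here refl
∈-range {suc i} {suc n} (s≤s l) = there (∈-mapL suc (range n) (∈-range l))

range-< : ∀ {i n} → i ∈ range n → i < n
range-< {n = suc n} (here refl) = s≤s z≤n
range-< {n = suc n} (there m) with ∈-mapL⁻ suc (range n) m
... | i , m′ , refl = s≤s (range-< m′)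

Candidate : List (List Bool) → List ℕ → List (ℕ × ℕ) → List (ℕ × ℕ) → Set
Candidate A xs O c =
  (c ≡ [] × (∀ {x y q} → x ∈ xs → ¬ T (visited x O) → (y , q) ∈ O → ¬ T (at A x y))) ⊎
  ∃[ x ] ∃[ y ] (c ≡ (x , y) ∷ [] × x ∈ xs × ¬ T (visited x O) × T (visited y O) × T (at A x y))

candidate-spec : ∀ A xs O → Candidate A xs O (candidate A xs O)
candidate-spec A [] O = inj₁ (refl , λ ())
candidate-spec A (x ∷ xs) O with visited x O in eq
... | true = later (candidate-spec A xs O)
  where
  later : ∀ {c} → Candidate A xs O c → Candidate A (x ∷ xs) O c
  later (inj₁ (e , h)) = inj₁ (e , λ { (here refl) nv _ _ → nv (true→T eq) ; (there m) → h m })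
  later (inj₂ (x , y , e , m , r)) = inj₂ (x , y , e , there m , r)
... | false = try O (λ m → m) (λ m → inj₁ m)
  where
  unvisited : ¬ T (visited x O)
  unvisited t = subst T eq t
  c : List (ℕ × ℕ)
  c = candidate A xs O
  try : ∀ O′ → (∀ {e} → e ∈ O′ → e ∈ O) → (∀ {y q} → (y , q) ∈ O → (y , q) ∈ O′ ⊎ ¬ T (at A x y)) →
        Candidate A (x ∷ xs) O (attach A O′ x c)
  try [] sub covered with candidate-spec A xs O
  ... | inj₁ (e , h) = inj₁ (e , λ { (here refl) _ m → none (covered m) ; (there m) → h m })
    where
    none : ∀ {y q} → (y , q) ∈ [] ⊎ ¬ T (at A x y) → ¬ T (at A x y)
    none (inj₂ f) = f
  ... | inj₂ (x′ , y , e , m , r) = inj₂ (x′ , y , e , there m , r)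
  try ((y , q) ∷ O′) sub covered with at A x y in ea
  ... | true = inj₂ (x , y , refl , here refl , unvisited , ∈-visited O (sub (here refl)) , true→T ea)
  ... | false = try O′ (sub ∘ there) (λ m → skip-first (covered m))
    where
    skip-first : ∀ {z r} → (z , r) ∈ (y , q) ∷ O′ ⊎ ¬ T (at A x z) → (z , r) ∈ O′ ⊎ ¬ T (at A x z)
    skip-first (inj₁ (here refl)) = inj₂ (λ t → subst T ea t)
    skip-first (inj₁ (there m)) = inj₁ m
    skip-first (inj₂ f) = inj₂ f

module TreeOrder {N : ℕ} (G : Graph N) (tree : IsTree G) (A : El mat)
  (at-A : ∀ x y → at A (toℕ x) (toℕ y) ≡ adj G x y) (at-small : ∀ i j → T (at A i j) → j < N)
  (bag : ℕ → ℕ → Bool) (bag-small : ∀ i v → T (bag i v) → i < N)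
  (subtree : ∀ v (x y : Fin N) → T (bag (toℕ x) v) → T (bag (toℕ y) v) →
    Star (λ a b → Adj G a b × T (bag (toℕ a) v) × T (bag (toℕ b) v)) x y) where

  open Order bag
  open IsTree tree

  root : Fin N
  root = Fin.fromℕ< nonempty

  root-0 : toℕ root ≡ 0
  root-0 = Finₚ.toℕ-fromℕ< nonempty

  V : List (ℕ × ℕ) → List ℕ
  V = final (N ∷ [])

  final-spec : ∀ B O x → x ∈ᵇ final B O ≡ visited x O ∨ (x ∈ᵇ B)
  final-spec B [] x = refl
  final-spec B ((y , q) ∷ O) x = trans (final-spec (y ∷ B) O x)
    (trans (sym (Boolₚ.∨-assoc (visited x O) (x ≡ᵇ y) _)) (trans (cong (_∨ (x ∈ᵇ B)) (Boolₚ.∨-comm (visited x O) (x ≡ᵇ y))) refl))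

  ≢N : ∀ (x : Fin N) → (toℕ x ≡ᵇ N) ≡ false
  ≢N x = ¬T→false λ t → <-irrefl (≡ᵇ⇒≡ (toℕ x) N t) (toℕ<n x)

  V-visited : ∀ O (x : Fin N) → toℕ x ∈ᵇ V O ≡ visited (toℕ x) O
  V-visited O x = trans (final-spec (N ∷ []) O (toℕ x)) (trans (cong (λ b → visited (toℕ x) O ∨ (b ∨ false)) (≢N x)) (Boolₚ.∨-identityʳ _))

  Good-snoc : ∀ {B O x p} → Good B O → ¬ T (x ∈ᵇ final B O) → T (p ∈ᵇ final B O) →
    (∀ v → T (bag x v) → T (anyL (λ z → bag z v) (final B O)) → T (bag p v)) → Good B (O ++ (x , p) ∷ [])
  Good-snoc [] a b c = more a b c []
  Good-snoc (more i j k g) a b c = more i j k (Good-snoc g a b c)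

  Inside : List (ℕ × ℕ) → Fin N → Fin N → Set
  Inside O a b = Adj G a b × T (visited (toℕ a) O) × T (visited (toℕ b) O)

  -- `conn` says that the visited nodes form a connected part of the tree. `len` says that no node
  -- is listed twice, which limits the number of successful rounds.
  record Inv (O : List (ℕ × ℕ)) : Set where
    field
      good : Good (N ∷ []) O
      start : T (visited 0 O)
      conn : ∀ (a : Fin N) → T (visited (toℕ a) O) → Star (Inside O) root a
      len : length O ≡ sumF {N} (λ x → ⌜ visited (toℕ x) O ⌝)

  visited-snoc : ∀ x O e → visited x (O ++ e ∷ []) ≡ visited x O ∨ (x ≡ᵇ proj₁ e)
  visited-snoc x [] e = Boolₚ.∨-identityʳ _
  visited-snoc x (o ∷ O) e = trans (cong ((x ≡ᵇ proj₁ o) ∨_) (visited-snoc x O e)) (sym (Boolₚ.∨-assoc (x ≡ᵇ proj₁ o) _ _))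

  toℕ-≡ᵇ : ∀ (x y : Fin N) → (toℕ y ≡ᵇ toℕ x) ≡ (x == y)
  toℕ-≡ᵇ x y with x ≟ y
  ... | yes refl = T→true (≡ᵇ-refl (toℕ x))
  ... | no ne = ¬T→false λ t → ne (sym (toℕ-injective (≡ᵇ⇒≡ (toℕ y) (toℕ x) t)))

  inv-start : Inv ((0 , N) ∷ [])
  inv-start = record
    { good = more (λ t → subst T (trans (cong (_∨ false) (trans (cong (_≡ᵇ N) (sym root-0)) (≢N root))) refl) t) (T∨₁ (≡ᵇ-refl N))
        (λ v _ t → T∨-elim {bag N v} t id (λ ())) []
    ; start = tt
    ; conn = λ a t → T∨-elim {toℕ a ≡ᵇ 0} t (λ e → subst (Star _ root) (toℕ-injective (trans root-0 (sym (≡ᵇ⇒≡ (toℕ a) 0 e)))) ε) (λ ())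
    ; len = sym (trans (sumF-cong (λ x → cong ⌜_⌝ (trans (Boolₚ.∨-identityʳ _) (trans (cong (toℕ x ≡ᵇ_) (sym root-0)) (toℕ-≡ᵇ root x))))) (sumF-point root))
    }

  extended : ∀ {O} (x p : Fin N) → Inv O → ¬ T (visited (toℕ x) O) → T (visited (toℕ p) O) → Adj G x p →
             Inv (O ++ (toℕ x , toℕ p) ∷ [])
  extended {O} x p inv nx vp xp = record
    { good = Good-snoc good (λ t → nx (subst T (V-visited O x) t)) (subst T (sym (V-visited O p)) vp) parent
    ; start = old 0 start
    ; conn = conn′
    ; len = trans (length-++ O) (trans (+-comm (length O) 1) (trans (cong suc len) (sym (trans (sumF-cong count′)
        (trans (sumF-+ (λ y → ⌜ x == y ⌝) (λ y → ⌜ visited (toℕ y) O ⌝)) (cong (_+ sumF {N} (λ y → ⌜ visited (toℕ y) O ⌝)) (sumF-point x)))))))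
    }
    where
    open Inv inv
    O′ = O ++ (toℕ x , toℕ p) ∷ []
    old : ∀ y → T (visited y O) → T (visited y O′)
    old y t = subst T (sym (visited-snoc y O _)) (T∨₁ t)
    count′ : ∀ (y : Fin N) → ⌜ visited (toℕ y) O′ ⌝ ≡ ⌜ x == y ⌝ + ⌜ visited (toℕ y) O ⌝
    count′ y rewrite visited-snoc (toℕ y) O (toℕ x , toℕ p) | toℕ-≡ᵇ x y with x ≟ y
    ... | yes refl rewrite ¬T→false nx = refl
    ... | no _ = cong ⌜_⌝ (Boolₚ.∨-identityʳ _)
    lift : ∀ {a b} → Inside O a b → Inside O′ a b
    lift {a} {b} (ab , va , vb) = ab , old (toℕ a) va , old (toℕ b) vb
    conn′ : ∀ (a : Fin N) → T (visited (toℕ a) O′) → Star (Inside O′) root a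
    conn′ a t = T∨-elim {visited (toℕ a) O} (subst T (visited-snoc (toℕ a) O _) t)
      (λ v → Star.map lift (conn a v))
      (λ e → subst (Star (Inside O′) root) (sym (toℕ-injective (≡ᵇ⇒≡ (toℕ a) (toℕ x) e)))
        (Star.map lift (conn p vp) ◅◅ ((adj-sym G acyclic xp , old (toℕ p) vp ,
          subst T (sym (visited-snoc (toℕ x) O _)) (T∨₂ {visited (toℕ x) O} (≡ᵇ-refl (toℕ x)))) ◅ ε)))
    outside : ∀ {a : Fin N} → T (visited (toℕ a) O) → a ≢ x
    outside va refl = nx va
    back : ∀ {a b} → Star (Inside O) a b → Star (Avoiding G acyclic x) b a
    back ε = ε
    back ((ab , va , vb) ◅ s) = back s ◅◅ ((adj-sym G acyclic ab , outside vb , outside va) ◅ ε)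
    forth : ∀ {a b} → Star (Inside O) a b → Star (Avoiding G acyclic x) a b
    forth = Star.map (λ (ab , va , vb) → ab , outside va , outside vb)
    -- Let `v` also occur at a visited node `z`. The path from `x` to `z` through bags containing
    -- `v` leaves `x` for the last time towards some neighbour `y`. From `y` one reaches `z` and
    -- then, inside the visited part, `p`, always avoiding `x`. In a tree this forces `y` to be `p`.
    parent : ∀ v → T (bag (toℕ x) v) → T (anyL (λ z → bag z v) (V O)) → T (bag (toℕ p) v)
    parent v bx t with anyL-∃∈ (λ z → bag z v) (V O) t
    ... | z , z∈ , bz = through (Fin.fromℕ< (bag-small z v bz)) (Finₚ.toℕ-fromℕ< (bag-small z v bz))
      where
      through : ∀ (z′ : Fin N) → toℕ z′ ≡ z → T (bag (toℕ p) v)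
      through z′ refl with last-exit G acyclic x (outside vz) (subtree v x z′ bx bz)
        where vz = subst T (V-visited O z′) z∈
      ... | inj₁ (_ , x≢x) = contradiction refl x≢x
      ... | inj₂ (y , xy , by , s) = subst (λ w → T (bag (toℕ w) v))
        (no-detour G acyclic x xy xp (s ◅◅ (back (conn z′ (subst T (V-visited O z′) z∈)) ◅◅ forth (conn p vp)))) by

  AllVisited : List (ℕ × ℕ) → Set
  AllVisited O = ∀ (x : Fin N) → T (visited (toℕ x) O)

  run-order : ∀ xs → let O = foldr (λ (_ : ℕ) O → O ++ candidate A (range N) O) ((0 , N) ∷ []) xs in
              Inv O × (AllVisited O ⊎ length O ≡ suc (length xs))
  run-order [] = inv-start , inj₂ refl
  run-order (_ ∷ xs) with run-order xs
  ... | inv , prog = go′ (candidate-spec A (range N) O)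
    where
    O = foldr (λ (_ : ℕ) O → O ++ candidate A (range N) O) ((0 , N) ∷ []) xs
    go′ : ∀ {c} → Candidate A (range N) O c → Inv (O ++ c) × (AllVisited (O ++ c) ⊎ length (O ++ c) ≡ suc (suc (length xs)))
    go′ (inj₁ (refl , none)) = subst Inv (sym (Listₚ.++-identityʳ O)) inv , inj₁ λ x →
        subst (λ Z → T (visited (toℕ x) Z)) (sym (Listₚ.++-identityʳ O)) (spread (subst (λ i → T (visited i O)) (sym root-0) (Inv.start inv)) (connected root x))
      where
      spread : ∀ {a b : Fin N} → T (visited (toℕ a) O) → Star (Adj G) a b → T (visited (toℕ b) O)
      spread va ε = va
      spread {a} va (_◅_ {j = b} ab s) with visited (toℕ b) O in eb
      ... | true = spread (true→T eb) s
      ... | false = ⊥-elim (none (∈-range (toℕ<n b)) (λ t → subst T eb t) (proj₂ (visited-∈ O va))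
        (subst T (sym (at-A b a)) (adj-sym G acyclic ab)))
    go′ (inj₂ (i , j , refl , i∈ , ni , vj , aij)) = both (Fin.fromℕ< (range-< i∈)) (Fin.fromℕ< (at-small i j aij))
        (Finₚ.toℕ-fromℕ< (range-< i∈)) (Finₚ.toℕ-fromℕ< (at-small i j aij))
      where
      both : ∀ (x p : Fin N) → toℕ x ≡ i → toℕ p ≡ j → Inv (O ++ (i , j) ∷ []) × (AllVisited (O ++ (i , j) ∷ []) ⊎ length (O ++ (i , j) ∷ []) ≡ suc (suc (length xs)))
      both x p refl refl = extended x p inv ni vj (subst T (at-A x p) aij) , longer prog
        where
        longer : AllVisited O ⊎ length O ≡ suc (length xs) → _
        longer (inj₁ all) = ⊥-elim (ni (all x))
        longer (inj₂ e) = inj₂ (trans (length-++ O) (trans (+-comm (length O) 1) (cong suc e)))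

  order-good : Good (N ∷ []) (order A (range N) N)
  order-good = Inv.good (proj₁ (run-order (range N)))

  -- Otherwise each of the `N` rounds added a node, and the order would list `N + 1` nodes without
  -- repetition.
  order-all : ∀ (x : Fin N) → T (toℕ x ∈ᵇ V (order A (range N) N))
  order-all x with run-order (range N)
  ... | inv , inj₁ all = subst T (sym (V-visited (order A (range N) N) x)) (all x)
  ... | inv , inj₂ e = contradiction (≡≤ ((trans (cong suc (sym (length-range N))) (trans (sym e) (Inv.len inv))))
      (≤≡ (sumF-mono {N} (λ y → ⌜⌝≤1 (visited (toℕ y) (order A (range N) N)))) (trans (sumF-const N 1) (*-identityʳ N)))) (<⇒≱ ≤-refl)

-- The decision procedure as a term

input prepared setup : Ty
input = mat ⊗ (bool ⊗ list bool) ⊗ mat ⊗ mat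
-- Digraph, nonroots, strict bound on the number of arcs, bound on the latter
prepared = mat ⊗ list bool ⊗ nat ⊗ nat
-- Order, bits, nonroots, exponents, parameters, bit positions, number of nodes
setup = list (nat ⊗ nat) ⊗ list nat ⊗ list bool ⊗ list nat ⊗ par ⊗ list nat ⊗ nat

lgStep : ℕ → ℕ × ℕ → ℕ × ℕ
lgStep n (p , l) = if p <ᵇ n then (p + p , suc l) else (p , l)

-- A power of two that is at least `n`, with its exponent. Both are needed: the power for the range
-- of the random weights, the exponent for the number of coins per weight.
lg : ℕ → ℕ × ℕ
lg n = foldr (λ _ → lgStep n) (1 , 0) (replicate n false)

lgStep-bound : ∀ n {p l} → l < p → p ≤ suc (n + n) → proj₂ (lgStep n (p , l)) < proj₁ (lgStep n (p , l)) × proj₁ (lgStep n (p , l)) ≤ suc (n + n)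
lgStep-bound n {p} {l} l<p p≤ with p <ᵇ n in eq
... | true = +-mono-≤ (≤-trans (s≤s z≤n) l<p) l<p , ≤-trans (+-mono-≤ p≤n p≤n) (n≤1+n _)
  where
  p≤n : p ≤ n
  p≤n = <⇒≤ (<ᵇ⇒< p n (true→T eq))
... | false = l<p , p≤

lgF : Fn (nat ∷ []) (nat ⊗ nat)
lgF = fn
  (fold (ticks v0) (suk zer ، zer) (ite (ltF $$ ⟪ π₁ v1 ⨟ v2 ⟫) ((π₁ v1 +′ π₁ v1) ، suk (π₂ v1)) (π₁ v1 ، π₂ v1))
    (foldBound 3 λ s (n , _) xs h (w , _) _ → let (a , b) = inv n xs ; c = big s n h w in
      ≤-trans b c , ≤-trans (<⇒≤ a) (≤-trans b c)))
  (λ (n , _) → lg n) (λ _ → refl)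
  where
  inv : ∀ n (xs : List Bool) → let r = foldr (λ _ → lgStep n) (1 , 0) xs in proj₂ r < proj₁ r × proj₁ r ≤ suc (n + n)
  inv n [] = s≤s z≤n , s≤s z≤n
  inv n (_ ∷ xs) = lgStep-bound n (proj₁ (inv n xs)) (proj₂ (inv n xs))
  big : ∀ s n → 2 ≤ s → n ≤ s → suc (n + n) ≤ s ^ 3
  big s n h w = un (_⊕_ h {0} {2} {1} (deg ≤-refl) (sub h (+-mono-≤ w (≤≡ w (sym (+-identityʳ s))))
    (deg (*-mono-≤ h (≤-reflexive (sym (*-identityʳ s)))))))

-- With `p` the power of two from `lg n`, both describe the range of `16 * (p * p)` weights, which
-- is at least sixteen times the number of pairs. Every pair has four random weights, so the
-- isolation lemma fails with probability at most 4/16.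
bitsOf boundOf : ℕ → ℕ
bitsOf n = suc (suc (suc (suc (proj₂ (lg n) + proj₂ (lg n)))))
boundOf n = let p = proj₁ (lg n) in ((p + p) + (p + p)) * ((p + p) + (p + p))

boundOfF : Fn (nat ∷ []) nat
boundOfF = fn
  (letin (π₁ (lgF $$ ⟪ v0 ⟫)) (((v0 +′ v0) +′ (v0 +′ v0)) *′ ((v0 +′ v0) +′ (v0 +′ v0))))
  (λ (n , _) → boundOf n) (λ _ → refl)

pairsFrom : List ℕ → List ℕ → List (ℕ × ℕ)
pairsFrom is us = foldr (λ u a → foldr (λ v b → if u <ᵇ v then (u , v) ∷ b else b) a is) [] us

pairsF : Fn (list nat ∷ []) (list (nat ⊗ nat))
pairsF = fn
  (fold v0 emp (fold v2 v1 (ite (ltF $$ ⟪ v2 ⨟ v0 ⟫) ((v2 ، v0) ◂ v1) v1) innerBound)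
    (listBound 1 (λ s ρ h w → z≤n , [])
      (λ s (is , _) u a h (w , _) pu pa → let (l , q) = inner-W {s} is u a h (proj₂ w) pu pa in
        ≤-trans l (+-monoˡ-≤ (length a) (≤-trans (proj₁ w) (≤pow h 0))) , q)))
  (λ (is , _) → pairsFrom is is) (λ _ → refl)
  where
  inner : List ℕ → ℕ → List (ℕ × ℕ) → List (ℕ × ℕ)
  inner is u a = foldr (λ v b → if u <ᵇ v then (u , v) ∷ b else b) a is
  inner-W : ∀ {s} is u a → 2 ≤ s → All (_≤ s) is → u ≤ s → All (W (s ^ 1) (nat ⊗ nat)) a →
            length (inner is u a) ≤ length is + length a × All (W (s ^ 1) (nat ⊗ nat)) (inner is u a)
  inner-W [] u a h [] pu pa = ≤-refl , pa
  inner-W {s} (v ∷ is) u a h (p ∷ ps) pu pa with u <ᵇ v | inner-W {s} is u a h ps pu pa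
  ... | true | l , q = s≤s l , (loose nat h pu , loose nat h p) ∷ q
  ... | false | l , q = ≤-trans l (n≤1+n _) , q
  innerBound : FoldBound {poly} {nat ∷ list (nat ⊗ nat) ∷ list nat ∷ []}
    v1 (ite (ltF $$ ⟪ v2 ⨟ v0 ⟫) ((v2 ، v0) ◂ v1) v1)
  innerBound = listBound 1 (λ s ρ h (_ , w , _) → loose (list (nat ⊗ nat)) h w)
    (λ s (u , a , _) v b h (pu , _) pv pb → grows (u <ᵇ v) b h (loose nat h pu , loose nat h pv) pb)
    where
    grows : ∀ {s e} c b → 2 ≤ s → W (s ^ 1) (nat ⊗ nat) e → All (W (s ^ 1) (nat ⊗ nat)) b →
      length (if c then e ∷ b else b) ≤ s ^ 1 + length b × All (W (s ^ 1) (nat ⊗ nat)) (if c then e ∷ b else b)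
    grows false b h p pb = m≤n+m (length b) _ , pb
    grows true b h p pb = +-monoˡ-≤ (length b) (≤-trans (≤-trans (s≤s z≤n) h) (≤pow h 0)) , p ∷ pb

-- The pairs are listed in reverse because the tossing loop puts each completed record in front of
-- the earlier ones.
coinsF : Fn (input ∷ []) (list (nat ⊗ nat) ⊗ list bool)
coinsF = fn
  (letin (lenF $$ ⟪ π₁ v0 ⟫)
    (reverseF $$ ⟪ pairsF $$ ⟪ rangeF $$ ⟪ v0 ⟫ ⟫ ⟫ ، ticks (suk (suk (suk (suk (π₂ (lgF $$ ⟪ v0 ⟫) +′ π₂ (lgF $$ ⟪ v0 ⟫))))))))
  (λ (i , _) → let n = length (proj₁ i) in reverse (pairsFrom (range n) (range n)) , replicate (bitsOf n) false) (λ _ → refl)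

trues : List Bool → ℕ
trues = foldr (λ b a → if b then suc a else a) 0

truesF : Fn (list bool ∷ []) nat
truesF = fn
  (fold v0 zer (ite v0 (suk v1) v1)
    (natBound 0 (λ s ρ h w → z≤n) (λ s ρ b a h w p → grows b a)))
  (λ (bs , _) → trues bs) (λ _ → refl)
  where
  grows : ∀ b a → (if b then suc a else a) ≤ suc a
  grows false a = n≤1+n a
  grows true a = ≤-refl

-- The units of weight: an arc of a branching costs M₁, an arc of the union M₂.
unit₂ unit₁ truncation : ℕ → ℕ → ℕ → ℕ → ℕ → ℕ
unit₂ p c cap r t = suc (p * ((c + c) + (c + c)))
unit₁ p c cap r t = unit₂ p c cap r t * cap
truncation p c cap r t = unit₁ p c cap r t * (r + r) + unit₂ p c cap r t * t

parOf : List (List Bool) → List Bool → ℕ → ℕ → List (List Bool) → List (El rec) → El par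
parOf D ν t cap bags rs =
  let n = length ν ; c = boundOf n ; p = length rs ; r = trues ν in
  n , D , bags , (unit₁ p c cap r t , unit₂ p c cap r t , c) , rs

setupOf : El prepared → El input → List (El rec) → El setup
setupOf (D , ν , t , cap) (_ , _ , A , bags) rs =
  let n = length ν ; c = boundOf n ; p = length rs ; r = trues ν ; N = length A in
  order A (range N) N , vertices4 n , ν , range (truncation p c cap r t) ,
  parOf D ν t cap bags rs , range (length (vertices4 n)) , N

setupF : Fn (prepared ∷ input ∷ list rec ∷ []) setup
setupF = fn
  (letin (π₁ (π₂ v0)) (letin (lenF $$ ⟪ v0 ⟫) (letin (boundOfF $$ ⟪ v0 ⟫) (letin (lenF $$ ⟪ v5 ⟫)
   (letin (truesF $$ ⟪ v3 ⟫) (letin (lenF $$ ⟪ π₁ (π₂ (π₂ v6)) ⟫)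
   (letin (suk (v2 *′ ((v3 +′ v3) +′ (v3 +′ v3)))) (letin (v0 *′ π₂ (π₂ (π₂ v7)))
   (letin (vertices v6)
     ((orderF $$ ⟪ π₁ (π₂ (π₂ v10)) ⨟ rangeF $$ ⟪ v3 ⟫ ⨟ v3 ⟫) ، v0 ، v8 ،
      (rangeF $$ ⟪ v1 *′ (v4 +′ v4) +′ v2 *′ π₁ (π₂ (π₂ v9)) ⟫) ،
      (v7 ، π₁ v9 ، π₂ (π₂ (π₂ v10)) ، (v1 ، v2 ، v6) ، v11) ،
      (rangeF $$ ⟪ lenF $$ ⟪ v0 ⟫ ⟫) ، v3))))))))))
  (λ (q , i , rs , _) → setupOf q i rs) (λ _ → refl)
  where
  vertices : ∀ {Γ} → Tm poly Γ nat → Tm poly Γ (list nat)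
  vertices n = letin (rangeF $$ ⟪ n ⟫) (v0 ++′ v0 ++′ v0 ++′ v0)

finishF : Fn (list nat ∷ nat ∷ list msg ∷ list nat ∷ []) bool
finishF = fn (anyT (prodMsgsF $$ ⟪ v0 ⨟ v1 ⨟ v2 ⨟ mapT v3 ff ⟫) v0)
  (λ (ks , N , ms , vs , _) → anyL id (prodMsgs ks N ms (mapL (λ _ → false) vs))) (λ _ → refl)

module _ (flag : Bool) (prepare : Fn (input ∷ []) prepared) where

  solveX : Tm free (input ∷ list rec ∷ []) bool
  solveX = letin (setupF $$ ⟪ prepare $$ ⟪ v0 ⟫ ⨟ v0 ⨟ v1 ⟫)
    (letin (call! (messagesX flag)
      (π₁ v0 ∷ π₁ (π₂ v0) ∷ π₁ (π₂ (π₂ v0)) ∷ π₁ (π₂ (π₂ (π₂ v0))) ∷ π₁ (π₂ (π₂ (π₂ (π₂ v0)))) ∷ π₁ (π₂ (π₂ (π₂ (π₂ (π₂ v0))))) ∷ []))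
      (finishF $$ ⟪ π₁ (π₂ (π₂ (π₂ v1))) ⨟ π₂ (π₂ (π₂ (π₂ (π₂ (π₂ v1))))) ⨟ v0 ⨟ π₁ (π₂ v1) ⟫))

  module Run (q : El prepared) (i : El input) (rs : List (El rec)) where
    private
      D = proj₁ q
      ν = proj₁ (proj₂ q)
      t = proj₁ (proj₂ (proj₂ q))
      cap = proj₂ (proj₂ (proj₂ q))
      A = proj₁ (proj₂ (proj₂ i))
      bags = proj₂ (proj₂ (proj₂ i))

    K : ℕ
    K = truncation (length rs) (boundOf (length ν)) cap (trues ν) t

    open Tables flag K (parOf D ν t cap bags rs) ν using (result) public

    polynomial : List Bool
    polynomial = result (length A) (order A (range (length A)) (length A))

  -- Opaque, so that two verdicts are compared by their arguments.
  opaque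
    verdict : El prepared → El input → List (El rec) → Bool
    verdict q i rs = anyL id (Run.polynomial q i rs)

    verdict-def : ∀ q i rs → verdict q i rs ≡ anyL id (Run.polynomial q i rs)
    verdict-def q i rs = refl

    solveX-sem : ∀ i rs → ⟦ solveX ⟧ᵗ (i , rs , tt) ≡ verdict (Fn.sem prepare (i , tt)) i rs
    solveX-sem i rs = refl

-- Running time of the exponential part

-- The counterpart of `Deg` with a separate factor `E` for the number of states, which is
-- exponential in the width and must not be raised to a power.
record DegE (s d E a : ℕ) : Set where
  constructor degE
  field unE : a ≤ s ^ d * E
open DegE

module _ {s : ℕ} (h : 2 ≤ s) where

  fromDeg : ∀ {d E a} → 1 ≤ E → Deg s d a → DegE s d E a
  fromDeg {d} {E} 1≤E (deg p) = degE (≤-trans p (≡≤ ((sym (*-identityʳ (s ^ d)))) (*-monoʳ-≤ (s ^ d) 1≤E)))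

  atMost : ∀ {d E a} → a ≤ E → DegE s d E a
  atMost {d} {E} le = degE (≤-trans le (≡≤ (sym (*-identityˡ E))
    (*-monoˡ-≤ E (m^n>0 s {{ℕ.>-nonZero (≤-trans (s≤s z≤n) h)}} d))))

  infixr 6 _⊞_
  _⊞_ : ∀ {i j E a b} → DegE s i E a → DegE s j E b → DegE s (suc (i + j)) E (a + b)
  _⊞_ {i} {j} {E} (degE p) (degE q) = degE (≤-trans (+-mono-≤ p q) (≡≤ ((sym (*-distribʳ-+ E (s ^ i) (s ^ j))))
    (*-monoˡ-≤ E (un (_⊕_ h (pw s i) (pw s j))))))

  _⊠_ : ∀ {i j E F a b} → DegE s i E a → DegE s j F b → DegE s (i + j) (E * F) (a * b)
  _⊠_ {i} {j} {E} {F} (degE p) (degE q) = degE (≤-trans (*-mono-≤ p q) (≤-reflexive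
    (trans (*-assoc (s ^ i) E (s ^ j * F)) (trans (cong (s ^ i *_) (trans (sym (*-assoc E (s ^ j) F))
      (trans (cong (_* F) (*-comm E (s ^ j))) (*-assoc (s ^ j) E F))))
      (trans (sym (*-assoc (s ^ i) (s ^ j) (E * F))) (cong (_* (E * F)) (sym (^-distribˡ-+-* s i j))))))))

  relax : ∀ {d E F a} → E ≤ F → DegE s d E a → DegE s d F a
  relax {d} le (degE p) = degE (≤-trans p (*-monoʳ-≤ (s ^ d) le))

  below : ∀ {d E a b} → b ≤ a → DegE s d E a → DegE s d E b
  below le (degE p) = degE (≤-trans le p)

  const≤ : ∀ n {E} → 1 ≤ E → DegE s n E n
  const≤ n 1≤E = fromDeg 1≤E (con h n)

pwE : ∀ s d E → DegE s d E (s ^ d * E)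
pwE s d E = degE ≤-refl

reE : ∀ {s d E F a} → E ≡ F → DegE s d E a → DegE s d F a
reE refl p = p

unsealed : ∀ {s d E Δ A} (t : Tm free Δ A) ρ → DegE s d E (cost t ρ) → DegE s d E (cost (sealed! t) ρ)
unsealed t ρ (degE p) = degE (≡≤ (sealed!-cost t ρ) p)

-- The accumulators met by the loop are the folds over suffixes of its own list, and only for these
-- is a bound on the body demanded. A bound over arbitrary lists would lose the size of the
-- enumerated sets.
loopCost-suffix : ∀ {A B : Set} {c : A → B → ℕ} {f z b xs} →
  (∀ x zs → (∃[ ys ] ys ++ x ∷ zs ≡ xs) → c x (foldr f z zs) ≤ b) →
  ∀ ws zs → ws ʳ++ zs ≡ xs → loopCost c f z ws zs ≤ 1 + length ws * (7 + b)
loopCost-suffix h [] zs e = ≤-refl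
loopCost-suffix {c = c} {f} {z} {b} h (w ∷ ws) zs e = ≤-trans
  (+-monoʳ-≤ 4 (+-mono-≤ (h w zs (reverse ws , trans (sym (Listₚ.ʳ++-defn ws)) e))
    (+-monoʳ-≤ 3 (loopCost-suffix h ws (w ∷ zs) e))))
  (≤-reflexive (cong (4 +_) (trans (cong (b +_) (+-comm 4 (length ws * (7 + b))))
    (trans (sym (+-assoc b _ 4)) (+-comm _ 4)))))

-- The degree that the next bound produces, written out so that it depends visibly on the degrees of
-- the parts alone.
foldDegree : ℕ → ℕ → ℕ → ℕ → ℕ
foldDegree dl dz dn db = suc (1 + suc (dl + suc (3 + suc (suc (1 + (dn + 2)) + suc (3 + suc (dz + suc (1 + suc (suc (1 + (dn + suc (7 + db))) + 1))))))))

module _ {m Γ A B} (l : Tm m Γ (list A)) (z : Tm m Γ B) (b : Tm m (A ∷ B ∷ Γ) B) (ρ : Env Γ) where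

  private
    f : El A → El B → El B
    f x a = ⟦ b ⟧ᵗ (x , a , ρ)
    xs = ⟦ l ⟧ᵗ ρ

  costFold-bound : ∀ {s E F dl dz dn db n} → (h : 2 ≤ s) → 1 ≤ E → 1 ≤ F →
    DegE s dl (E * F) (cost l ρ) → DegE s dz (E * F) (cost z ρ) → length xs ≤ n → DegE s dn E n →
    (∀ x zs → (∃[ ys ] ys ++ x ∷ zs ≡ xs) → DegE s db F (cost b (x , foldr f (⟦ z ⟧ᵗ ρ) zs , ρ))) →
    DegE s (foldDegree dl dz dn db) (E * F) (costFold l z b ρ)
  costFold-bound {s} {E} {F} {db = db} {n} h 1≤E 1≤F cl cz len≤n dlen body =
    _⊞_ h (k 1) (_⊞_ h cl (_⊞_ h (k 3) (_⊞_ h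
      (below h (≤-trans (revCost≤ xs) (+-monoʳ-≤ 1 (*-monoˡ-≤ 2 len≤n))) (_⊞_ h (k 1) (_⊠_ h dlen (const≤ h 2 1≤F))))
      (_⊞_ h (k 3) (_⊞_ h cz (_⊞_ h (k 1) (_⊞_ h
        (below h (≤-trans (loopCost-suffix (λ x zs sf → unE (body x zs sf)) (reverse xs) [] (reverse-involutive xs))
            (+-monoʳ-≤ 1 (*-monoˡ-≤ (7 + s ^ db * F) (≡≤ (Listₚ.length-reverse xs) len≤n))))
          (_⊞_ h (k 1) (_⊠_ h dlen (_⊞_ h (const≤ h 7 1≤F) (pwE s db F)))))
        (k 1))))))))
    where
    1≤EF : 1 ≤ E * F
    1≤EF = *-mono-≤ 1≤E 1≤F
    k : ∀ n → DegE s n (E * F) n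
    k n = const≤ h n 1≤EF

length-grow : ∀ b (τs : List (List Bool)) → length (grow b τs) ≡ (if b then 2 else 1) * length τs
length-grow false [] = refl
length-grow false (τ ∷ τs) = cong suc (length-grow false τs)
length-grow true [] = refl
length-grow true (τ ∷ τs) = trans (cong (λ m → suc (suc m)) (length-grow true τs)) (cong suc (sym (+-suc (length τs) (length τs + 0))))

length-enumL : ∀ mask → length (enumL mask) ≡ 2 ^ trues mask
length-enumL [] = refl
length-enumL (false ∷ mask) = trans (length-grow false (enumL mask)) (trans (+-identityʳ _) (length-enumL mask))
length-enumL (true ∷ mask) = trans (length-grow true (enumL mask)) (cong (λ x → x + (x + 0)) (length-enumL mask))

trues-suffix : ∀ ys {zs xs} → ys ++ zs ≡ xs → trues zs ≤ trues xs
trues-suffix [] refl = ≤-refl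
trues-suffix (false ∷ ys) refl = trues-suffix ys refl
trues-suffix (true ∷ ys) refl = ≤-trans (trues-suffix ys refl) (n≤1+n _)

enumL-lengths : ∀ mask → All (λ τ → length τ ≡ length mask) (enumL mask)
enumL-lengths [] = refl ∷ []
enumL-lengths (b ∷ mask) = grow-lengths b (enumL-lengths mask)
  where
  grow-lengths : ∀ b {m τs} → All (λ τ → length τ ≡ m) τs → All (λ τ → length τ ≡ suc m) (grow b τs)
  grow-lengths b [] = []
  grow-lengths false (p ∷ ps) = cong suc p ∷ grow-lengths false ps
  grow-lengths true (p ∷ ps) = cong suc p ∷ cong suc p ∷ grow-lengths true ps

All-suffix : ∀ {A : Set} {P : A → Set} ys {zs xs} → ys ++ zs ≡ xs → All P xs → All P zs
All-suffix [] refl ps = ps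
All-suffix (y ∷ ys) refl (_ ∷ ps) = All-suffix ys refl ps

length-suffix : ∀ {A : Set} (ys : List A) {zs xs} → ys ++ zs ≡ xs → length zs ≤ length xs
length-suffix [] refl = ≤-refl
length-suffix (y ∷ ys) refl = ≤-trans (length-suffix ys refl) (n≤1+n _)

1≤2^ : ∀ n → 1 ≤ 2 ^ n
1≤2^ n = m^n>0 2 n

enumX-cost : ∃[ d ] ∀ s → 2 ≤ s → ∀ mask → length mask ≤ s → DegE s d (2 ^ trues mask) (cost enumX (mask , tt))
enumX-cost = _ , λ s h mask l → reE (*-identityˡ (2 ^ trues mask))
  (costFold-bound v0 (emp ◂ emp) inner (mask , tt) {dn = 1} h ≤-refl (1≤2^ (trues mask))
    (const≤ h 1 (*-mono-≤ {1} ≤-refl (1≤2^ (trues mask)))) (const≤ h 9 (*-mono-≤ {1} ≤-refl (1≤2^ (trues mask)))) l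
    (degE (≤-reflexive (sym (trans (*-identityʳ (s ^ 1)) (*-identityʳ s)))))
    (λ b zs (ys , e) → reE (*-identityʳ (2 ^ trues mask))
      (costFold-bound v1 emp step₁ (b , enumL zs , mask , tt) {dn = 0} h (1≤2^ (trues mask)) ≤-refl
        (const≤ h 1 (*-mono-≤ (1≤2^ (trues mask)) ≤-refl)) (const≤ h 1 (*-mono-≤ (1≤2^ (trues mask)) ≤-refl))
        -- A suffix of the mask has no more true bits than the mask, so no intermediate enumeration
        -- exceeds the final one.
        (≡≤ (length-enumL zs) (^-monoʳ-≤ 2 (trues-suffix (ys ++ b ∷ []) (trans (Listₚ.++-assoc ys (b ∷ []) zs) e))))
        (atMost h ≤-refl)
        (λ τ σs _ → below h (step-cost b τ (foldr (λ τ a → ⟦ step₁ ⟧ᵗ (τ , a , b , enumL zs , mask , tt)) [] σs) (enumL zs) mask) (const≤ h 40 ≤-refl)))))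
  where
  step₁ : Tm free (list bool ∷ list (list bool) ∷ bool ∷ list (list bool) ∷ list bool ∷ []) (list (list bool))
  step₁ = ite v2 ((ff ◂ v0) ◂ (tt′ ◂ v0) ◂ v1) ((ff ◂ v0) ◂ v1)
  inner : Tm free (bool ∷ list (list bool) ∷ list bool ∷ []) (list (list bool))
  inner = fold! v1 emp step₁
  step-cost : ∀ b τ acc τs mask → cost step₁ (τ , acc , b , τs , mask , tt) ≤ 40
  step-cost false τ acc τs mask = ℕₚ.≤ᵇ⇒≤ _ 40 tt
  step-cost true τ acc τs mask = ℕₚ.≤ᵇ⇒≤ _ 40 tt

table : Ty
table = tree (list bool)

pairUp-length : ∀ {A : Set} (ts : List (Tree A)) → length (pairUp ts) ≤ length ts
pairUp-length ts = ≤-trans (m≤n+m _ _) (both ts)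
  where
  step-length : ∀ {A : Set} (t : Tree A) acc {n} → length (proj₁ acc) + length (proj₂ acc) ≤ n →
    length (proj₁ (pairStep t acc)) + length (proj₂ (pairStep t acc)) ≤ suc n
  step-length t ([] , out) h = s≤s h
  step-length t (_ ∷ p , out) h = s≤s (≤-trans (m≤n+m (length out) (length p)) (≤-trans (n≤1+n _) h))
  both : ∀ {A : Set} (ts : List (Tree A)) → length (proj₁ (pairing ts)) + length (proj₂ (pairing ts)) ≤ length ts
  both [] = z≤n
  both (t ∷ ts) = step-length t (pairing ts) (both ts)

layer-length : ∀ {A : Set} b (ts : List (Tree A)) → length (layer b ts) ≤ length ts
layer-length false ts = ≤-reflexive (length-mapL _ ts)
layer-length true ts = pairUp-length ts

build-length : ∀ {A : Set} mask (ts : List (Tree A)) → length (build mask ts) ≤ length ts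
build-length [] ts = ≤-refl
build-length (b ∷ mask) ts = ≤-trans (layer-length b (build mask ts)) (build-length mask ts)

layer-All : ∀ {A : Set} {P : A → Set} b {ts : List (Tree A)} → All (AllTree P) ts → All (AllTree P) (layer b ts)
layer-All false [] = []
layer-All false (p ∷ ps) = (p , p) ∷ layer-All false ps
layer-All {A} {P} true ps = proj₂ (both ps)
  where
  step-All : ∀ {t} → AllTree P t → ∀ acc → All (AllTree P) (proj₁ acc) × All (AllTree P) (proj₂ acc) →
    All (AllTree P) (proj₁ (pairStep t acc)) × All (AllTree P) (proj₂ (pairStep t acc))
  step-All p ([] , out) (_ , qs) = p ∷ [] , qs
  step-All p (_ ∷ _ , out) (r ∷ _ , qs) = [] , (p , r) ∷ qs
  both : ∀ {ts} → All (AllTree P) ts → All (AllTree P) (proj₁ (pairing ts)) × All (AllTree P) (proj₂ (pairing ts))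
  both [] = [] , []
  both (p ∷ ps) = step-All p _ (both ps)

build-All : ∀ {A : Set} {P : A → Set} mask {ts : List (Tree A)} → All (AllTree P) ts → All (AllTree P) (build mask ts)
build-All [] ps = ps
build-All (b ∷ mask) ps = layer-All b (build-All mask ps)

≤1* : ∀ {n} E → n ≤ E → n ≤ E * 1
≤1* E le = ≤≡ le (sym (*-identityʳ E))

pairX-cost : ∃[ d ] ∀ s → 2 ≤ s → ∀ ts E → length ts ≤ E → 1 ≤ E → DegE s d E (cost pairX (ts , tt))
pairX-cost = _ , λ s h ts E l 1≤E → _⊞_ h (const≤ h 1 1≤E) (_⊞_ h
  (reE (*-identityʳ E) (costFold-bound v0 (emp ، emp) body (ts , tt) {dn = 0} h 1≤E ≤-refl
    (const≤ h 1 (≤1* E 1≤E)) (const≤ h 9 (≤1* E 1≤E)) l (atMost h ≤-refl)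
    (λ x zs _ → below h (body-cost x (pairing {List Bool} zs) ts) (const≤ h 40 ≤-refl))))
  (const≤ h 1 1≤E))
  where
  body : Tm free (table ∷ (list table ⊗ list table) ∷ list table ∷ []) (list table ⊗ list table)
  body = caseList (π₁ v1) ((v0 ◂ emp) ، π₂ v1) (emp ، (nd v2 v0 ◂ π₂ v3))
  body-cost : ∀ x acc ts → cost body (x , acc , ts , tt) ≤ 40
  body-cost x ([] , _) ts = ℕₚ.≤ᵇ⇒≤ _ 40 tt
  body-cost x (_ ∷ _ , _) ts = ℕₚ.≤ᵇ⇒≤ _ 40 tt

dupX-cost : ∃[ d ] ∀ s → 2 ≤ s → ∀ ts E → length ts ≤ E → 1 ≤ E → DegE s d E (cost dupX (ts , tt))
dupX-cost = _ , λ s h ts E l 1≤E → reE (*-identityʳ E) (costFold-bound v0 emp body (ts , tt) {dn = 0} h 1≤E ≤-refl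
    (const≤ h 1 (≤1* E 1≤E)) (const≤ h 1 (≤1* E 1≤E)) l (atMost h ≤-refl)
    (λ x zs _ → const≤ h 17 ≤-refl))
  where
  body : Tm free (table ∷ list table ∷ list table ∷ []) (list table)
  body = nd v0 v0 ◂ v1

buildX-cost : ∃[ d ] ∀ s → 2 ≤ s → ∀ mask ts E → length mask ≤ s → length ts ≤ E → 1 ≤ E →
              DegE s d E (cost buildX (mask , ts , tt))
buildX-cost = _ , λ s h mask ts E lm l 1≤E → reE (*-identityˡ E)
  (costFold-bound v0 v1 body (mask , ts , tt) {dn = 1} h ≤-refl 1≤E
    (const≤ h 1 (*-mono-≤ {1} ≤-refl 1≤E)) (const≤ h 1 (*-mono-≤ {1} ≤-refl 1≤E)) lm
    (degE (≤-reflexive (sym (trans (*-identityʳ (s ^ 1)) (*-identityʳ s)))))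
    (λ b zs _ → layer-cost s h b (build zs ts) mask ts E (≤-trans (build-length zs ts) l) 1≤E))
  where
  body : Tm free (bool ∷ list table ∷ list bool ∷ list table ∷ []) (list table)
  body = ite v0 (call! pairX ⟪ v1 ⟫) (call! dupX ⟪ v1 ⟫)
  layer-cost : ∀ s → (h : 2 ≤ s) → ∀ b acc mask ts E → length acc ≤ E → 1 ≤ E →
    DegE s _ E (cost body (b , acc , mask , ts , tt))
  layer-cost s h b acc mask ts E l 1≤E = _⊞_ h (const≤ h 3 1≤E) (below h (if≤ b _ _)
    (_⊞_ h (_⊞_ h (const≤ h 15 1≤E) (_⊞_ h (unsealed pairX (acc , tt) (proj₂ pairX-cost s h acc E l 1≤E)) (const≤ h 3 1≤E)))
             (_⊞_ h (const≤ h 15 1≤E) (_⊞_ h (unsealed dupX (acc , tt) (proj₂ dupX-cost s h acc E l 1≤E)) (const≤ h 3 1≤E)))))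

module _ {s : ℕ} (h : 2 ≤ s) where

  callBound : ∀ n x {d E a} → 1 ≤ E → a ≡ n + (x + 3) → DegE s d E x → DegE s (suc (n + suc (d + 3))) E a
  callBound n x 1≤E refl p = _⊞_ h (const≤ h n 1≤E) (_⊞_ h p (const≤ h 3 1≤E))

psum-W : ∀ {A : Set} {s} ks (g : A → List Bool) xs → length ks ≤ s → W s (list bool) (psum ks g xs)
psum-W ks g [] l = z≤n , []
psum-W {s = s} ks g (x ∷ xs) l = ≡≤ (length-mapL _ ks) l , bools-W s _

module _ (flag : Bool) where

  summandB : Bounded (sealed (Fn.term (summandF flag)))
  summandB = bound (sealed (Fn.term (summandF flag)))

  innerX-cost : ∃[ d ] ∀ s → 2 ≤ s → ∀ ρs τ (ctx : Env msgCtx) E → All (W s (list bool)) ρs → length ρs ≤ E → 1 ≤ E →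
    W s (list bool) τ → WE s msgCtx ctx → DegE s d E (cost (innerX flag) (ρs , τ , ctx))
  innerX-cost = _ , λ s h ρs τ ctx E wρ l 1≤E wτ wc →
    reE (*-identityʳ E) (costFold-bound v0 emp body (ρs , τ , ctx) {dn = 0} h 1≤E ≤-refl
      (const≤ h 1 (≤1* E 1≤E)) (const≤ h 1 (≤1* E 1≤E)) l (atMost h ≤-refl)
      (λ ρ zs (ys , e) → callBound h 47 (cost (sealed (Fn.term (summandF flag))) (ρ , sum ρs τ ctx zs , τ , ctx)) ≤-refl (body-cost ρ (sum ρs τ ctx zs) ρs τ ctx)
        (fromDeg h ≤-refl (costB summandB s (ρ , sum ρs τ ctx zs , τ , ctx) h
          (All.head (All-suffix ys e wρ) , sum-W ρs τ ctx zs wc , wτ , wc)))))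
    where
    body : Tm free (list bool ∷ list bool ∷ list (list bool) ∷ list bool ∷ msgCtx) (list bool)
    body = summandF flag $$ (v0 ∷ v1 ∷ v3 ∷ v4 ∷ v5 ∷ v6 ∷ v7 ∷ v8 ∷ v9 ∷ [])
    sum : List (List Bool) → List Bool → Env msgCtx → List (List Bool) → List Bool
    sum ρs τ ctx = foldr (λ ρ acc → ⟦ body ⟧ᵗ (ρ , acc , ρs , τ , ctx)) []
    body-cost : ∀ ρ acc ρs τ (ctx : Env msgCtx) → cost body (ρ , acc , ρs , τ , ctx) ≡
      47 + (cost (sealed (Fn.term (summandF flag))) (ρ , acc , τ , ctx) + 3)
    body-cost ρ acc ρs τ ctx = refl
    sum-W : ∀ {s} ρs τ ctx zs → WE s msgCtx ctx → W s (list bool) (sum ρs τ ctx zs)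
    sum-W ρs τ ctx [] w = z≤n , []
    sum-W {s} ρs τ (ks , P , is , x , p , ms , _) (z ∷ zs) ((l , _) , _) =
      ≡≤ (length-mapL _ ks) l , bools-W s _

  outerX-cost : ∃[ d ] ∀ s → 2 ≤ s → ∀ τs ρs (ctx : Env msgCtx) E F → All (W s (list bool)) τs → length τs ≤ E → 1 ≤ E →
    All (W s (list bool)) ρs → length ρs ≤ F → 1 ≤ F → WE s msgCtx ctx → DegE s d (E * F) (cost (outerX flag) (τs , ρs , ctx))
  outerX-cost = _ , λ s h τs ρs ctx E F wτ l 1≤E wρ l′ 1≤F wc →
    costFold-bound v0 emp body (τs , ρs , ctx) {dn = 0} h 1≤E 1≤F
      (const≤ h 1 (*-mono-≤ 1≤E 1≤F)) (const≤ h 1 (*-mono-≤ 1≤E 1≤F)) l (atMost h ≤-refl)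
      (λ τ zs (ys , e) → callBound h 53 (cost (sealed! (innerX flag)) (ρs , τ , ctx)) 1≤F (body-cost τ (leaves τs ρs ctx zs) τs ρs ctx)
        (unsealed (innerX flag) (ρs , τ , ctx) (proj₂ innerX-cost s h ρs τ ctx F wρ l′ 1≤F (All.head (All-suffix ys e wτ)) wc)))
    where
    body : Tm free (list bool ∷ list table ∷ list (list bool) ∷ list (list bool) ∷ msgCtx) (list table)
    body = lf (call! (innerX flag) (v3 ∷ v0 ∷ v4 ∷ v5 ∷ v6 ∷ v7 ∷ v8 ∷ v9 ∷ [])) ◂ v1
    leaves : List (List Bool) → List (List Bool) → Env msgCtx → List (List Bool) → List (El table)
    leaves τs ρs ctx = foldr (λ τ acc → ⟦ body ⟧ᵗ (τ , acc , τs , ρs , ctx)) []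
    shuffle : ∀ n → 45 + (n + 3) + 1 + 7 ≡ 53 + (n + 3)
    shuffle n = trans (+-assoc (45 + (n + 3)) 1 7) (trans (+-assoc 45 (n + 3) 8) (trans (cong (45 +_) (+-comm (n + 3) 8)) refl))
    body-cost : ∀ τ acc τs ρs (ctx : Env msgCtx) → cost body (τ , acc , τs , ρs , ctx) ≡
      53 + (cost (sealed! (innerX flag)) (ρs , τ , ctx) + 3)
    body-cost τ acc τs ρs ctx = shuffle (cost (sealed! (innerX flag)) (ρs , τ , ctx))

module _ {s : ℕ} (h : 2 ≤ s) {E : ℕ} (1≤E : 1 ≤ E) where

  private
    infixr 6 _⊞′_
    _⊞′_ : ∀ {i j a b} → DegE s i E a → DegE s j E b → DegE s (suc (i + j)) E (a + b)
    _⊞′_ = _⊞_ h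
    k : ∀ n → DegE s n E n
    k n = const≤ h n 1≤E

  outerCall : ∀ m n o {di dj dp} → DegE s di E m → DegE s dj E n → DegE s dp E o →
    DegE s (suc (3 + suc (suc (1 + suc (suc (1 + suc (25 + suc (1 + suc (dj + 1)))) + suc (1 + suc (di + 1)))) + suc (7 + suc (dp + 3))))) E
      (3 + (suc (suc (25 + suc (n + 1)) + suc (m + 1)) + (7 + (o + 3))))
  outerCall m n o dm dn dp = k 3 ⊞′ (k 1 ⊞′ ((k 1 ⊞′ (k 25 ⊞′ (k 1 ⊞′ (dn ⊞′ k 1)))) ⊞′ (k 1 ⊞′ (dm ⊞′ k 1)))) ⊞′ (k 7 ⊞′ (dp ⊞′ k 3))

  buildCall : ∀ a r b {da dr db} → DegE s da E a → DegE s dr E r → DegE s db E b →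
    DegE s (suc (3 + suc (suc (1 + suc (suc (1 + suc (1 + suc (1 + suc (da + 1)))) + suc (1 + suc (dr + 1)))) + suc (7 + suc (db + 3))))) E
      (3 + (suc (suc (1 + suc (a + 1)) + suc (r + 1)) + (7 + (b + 3))))
  buildCall a r b da dr db = k 3 ⊞′ (k 1 ⊞′ ((k 1 ⊞′ (k 1 ⊞′ (k 1 ⊞′ (da ⊞′ k 1)))) ⊞′ (k 1 ⊞′ (dr ⊞′ k 1)))) ⊞′ (k 7 ⊞′ (db ⊞′ k 3))

  twoLets : ∀ x y z w {dx dy dz} → DegE s dx E x → DegE s dy E y → DegE s dz E z → w ≤ 5 →
    DegE s (suc (1 + suc (dx + suc (3 + suc (suc (1 + suc (dy + suc (3 + suc (suc (1 + suc (dz + suc (1 + 5))) + 1)))) + 1))))) E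
      (suc (x + (3 + (suc (y + (3 + (suc (z + suc w) + 1))) + 1))))
  twoLets x y z w dx dy dz w≤ = k 1 ⊞′ (dx ⊞′ (k 3 ⊞′ ((k 1 ⊞′ (dy ⊞′ (k 3 ⊞′ ((k 1 ⊞′ (dz ⊞′ (k 1 ⊞′ below h w≤ (k 5)))) ⊞′ k 1)))) ⊞′ k 1)))

elimList≤ : ∀ {A : Set} (l : List A) → elimList 3 (λ _ _ → 5) l ≤ 5
elimList≤ [] = s≤s (s≤s (s≤s z≤n))
elimList≤ (_ ∷ _) = ≤-refl

list-W : ∀ {s} (bs : List Bool) → length bs ≤ s → W s (list bool) bs
list-W {s} bs l = l , bools-W s bs

enums-W : ∀ {s} mask → length mask ≤ s → All (W s (list bool)) (enumL mask)
enums-W mask l = All.map (λ {τ} e → list-W τ (≡≤ (e) l)) (enumL-lengths mask)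

-- The cost of computing one message, with the costs of its calls as variables. The bound becomes a
-- statement about numbers, and its agreement with the term is checked once, by `message-cost`.
messageTotal : (k m r x y o b w : ℕ) → ℕ
messageTotal k m r x y o b w = suc ((37 + (k + 3)) + (3 + (suc ((37 + (m + 3)) + (3 + (suc
  ((3 + (suc (suc (1 + suc ((3 + (suc (suc (25 + suc ((15 + (y + 3)) + 1)) + suc ((15 + (x + 3)) + 1)) + (7 + (o + 3)))) + 1)) + suc ((15 + (r + 3)) + 1)) + (7 + (b + 3))))
    + suc w) + 1))) + 1)))

messageTotal-bound : ∀ dk dm dr dx dy dp db → ∃[ d ] ∀ s E → 2 ≤ s → 1 ≤ E → ∀ k m r x y o b w →
  DegE s dk E k → DegE s dm E m → DegE s dr E r → DegE s dx E x → DegE s dy E y → DegE s dp E o → DegE s db E b → w ≤ 5 →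
  DegE s d E (messageTotal k m r x y o b w)
messageTotal-bound dk dm dr dx dy dp db = _ , λ s E h 1≤E k m r x y o b w pk pm pr px py po pb w≤ →
  twoLets h 1≤E (37 + (k + 3)) (37 + (m + 3)) _ w
    (callBound h 37 k 1≤E refl pk) (callBound h 37 m 1≤E refl pm)
    (buildCall h 1≤E _ (15 + (r + 3)) b
      (outerCall h 1≤E (15 + (x + 3)) (15 + (y + 3)) o (callBound h 15 x 1≤E refl px) (callBound h 15 y 1≤E refl py) po)
      (callBound h 15 r 1≤E refl pr) pb) w≤

module _ (flag : Bool) where

  opaque
    messageDegrees : ∃[ d ] ∀ s E → 2 ≤ s → 1 ≤ E → ∀ k m r x y o b w →
      DegE s (costDeg (bound (sealed (Fn.term keptF)))) E k → DegE s (costDeg (bound (sealed (Fn.term summedF)))) E m →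
      DegE s (costDeg (bound (sealed (Fn.term (reverseF {bool}))))) E r → DegE s (proj₁ enumX-cost) E x → DegE s (proj₁ enumX-cost) E y →
      DegE s (proj₁ (outerX-cost flag)) E o → DegE s (proj₁ buildX-cost) E b → w ≤ 5 → DegE s d E (messageTotal k m r x y o b w)
    messageDegrees = messageTotal-bound (costDeg (bound (sealed (Fn.term keptF)))) (costDeg (bound (sealed (Fn.term summedF))))
      (costDeg (bound (sealed (Fn.term (reverseF {bool}))))) (proj₁ enumX-cost) (proj₁ enumX-cost) (proj₁ (outerX-cost flag)) (proj₁ buildX-cost)

  messageDegree : ℕ
  messageDegree = proj₁ messageDegrees

  messageΓ : List Ty
  messageΓ = list nat ∷ list bool ∷ msgCtx

  module _ (vs : List ℕ) (ν : List Bool) (ks : List ℕ) (P : El par) (is : List ℕ) (x p : ℕ) (ms : List (El msg)) where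

    private
      bags = proj₁ (proj₂ (proj₂ P))
      ctx : Env msgCtx
      ctx = ks , P , is , x , p , ms , tt
      κ = kept vs ν bags x p
      μ = summed vs ν bags x p
      leaves : List (El table)
      leaves = mapL (λ τ → leaf (psum ks (λ ρ → local flag ks P x p ms (merge is τ ρ)) (enumL μ))) (enumL κ)
      EE : ℕ
      EE = 2 ^ trues κ * 2 ^ trues μ
      1≤EE : 1 ≤ EE
      1≤EE = *-mono-≤ (1≤2^ (trues κ)) (1≤2^ (trues μ))
      κ≤EE : 2 ^ trues κ ≤ EE
      κ≤EE = ≡≤ (sym (*-identityʳ _)) (*-monoʳ-≤ (2 ^ trues κ) (1≤2^ (trues μ)))
      μ≤EE : 2 ^ trues μ ≤ EE
      μ≤EE = ≡≤ (sym (*-identityˡ _)) (*-monoˡ-≤ (2 ^ trues μ) (1≤2^ (trues κ)))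

      keptC summedC reverseC outsC buildC enumκ enumμ : ℕ
      keptC = cost (sealed (Fn.term keptF)) (vs , ν , bags , x , p , tt)
      summedC = cost (sealed (Fn.term summedF)) (vs , ν , bags , x , p , tt)
      reverseC = cost (sealed (Fn.term (reverseF {bool}))) (κ , tt)
      outsC = cost (sealed! (outerX flag)) (enumL κ , enumL μ , ctx)
      buildC = cost (sealed! buildX) (reverse κ , leaves , tt)
      enumκ = cost (sealed! enumX) (κ , tt)
      enumμ = cost (sealed! enumX) (μ , tt)

    message-cost : cost (messageX flag) (vs , ν , ctx) ≡
      messageTotal keptC summedC reverseC enumκ enumμ outsC buildC (elimList 3 (λ _ _ → 5) (build (reverse κ) leaves))
    message-cost = refl

    message-bound : ∀ s → 2 ≤ s → WE s messageΓ (vs , ν , ctx) → DegE s messageDegree EE (cost (sealed! (messageX flag)) (vs , ν , ctx))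
    message-bound s h w@((lvs , _) , wν , wks , (wn , wD , wbags , wr) , wis , wx , wp , wms , _) =
      below h (≤-reflexive (trans (sealed!-cost (messageX flag) (vs , ν , ctx)) message-cost)) (proj₂ messageDegrees s EE h 1≤EE
        keptC summedC reverseC enumκ enumμ outsC buildC (elimList 3 (λ _ _ → 5) (build (reverse κ) leaves))
        (fromDeg h 1≤EE (costB (bound (sealed (Fn.term keptF))) s (vs , ν , bags , x , p , tt) h wmask))
        (fromDeg h 1≤EE (costB (bound (sealed (Fn.term summedF))) s (vs , ν , bags , x , p , tt) h wmask))
        (fromDeg h 1≤EE (costB (bound (sealed (Fn.term (reverseF {bool})))) s (κ , tt) h (list-W κ lκ , tt)))
        (unsealed enumX (κ , tt) (relax h κ≤EE (proj₂ enumX-cost s h κ lκ)))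
        (unsealed enumX (μ , tt) (relax h μ≤EE (proj₂ enumX-cost s h μ lμ)))
        (unsealed (outerX flag) (enumL κ , enumL μ , ctx) (proj₂ (outerX-cost flag) s h (enumL κ) (enumL μ) ctx (2 ^ trues κ) (2 ^ trues μ)
          (enums-W κ lκ) (≤-reflexive (length-enumL κ)) (1≤2^ (trues κ))
          (enums-W μ lμ) (≤-reflexive (length-enumL μ)) (1≤2^ (trues μ)) (proj₂ (proj₂ w))))
        (unsealed buildX (reverse κ , leaves , tt) (relax h κ≤EE (proj₂ buildX-cost s h (reverse κ) leaves (2 ^ trues κ) (≡≤ (Listₚ.length-reverse κ) lκ)
            (≡≤ (length-mapL _ (enumL κ)) (≤-reflexive (length-enumL κ))) (1≤2^ (trues κ)))))
        (elimList≤ (build (reverse κ) leaves)))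
      where
      wmask : WE s (list nat ∷ list bool ∷ mat ∷ nat ∷ nat ∷ []) (vs , ν , bags , x , p , tt)
      wmask = proj₁ w , wν , wbags , wx , wp , tt
      lκ : length κ ≤ s
      lκ = ≡≤ (length-mapL _ vs) lvs
      lμ : length μ ≤ s
      lμ = ≡≤ (length-mapL _ vs) lvs

module _ (flag : Bool) where

  messagesΓ : List Ty
  messagesΓ = list nat ∷ list bool ∷ list nat ∷ par ∷ list nat ∷ []

  private
    body : Tm free ((nat ⊗ nat) ∷ list msg ∷ list (nat ⊗ nat) ∷ messagesΓ) (list msg)
    body = (π₂ v0 ، call! (messageX flag) (v3 ∷ v4 ∷ v5 ∷ v6 ∷ v7 ∷ π₁ v0 ∷ π₂ v0 ∷ v1 ∷ [])) ◂ v1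

    bodyTotal : ℕ → ℕ
    bodyTotal m = suc ((suc (3 + (3 + ((47 + (m + 3)) + 3)))) + 7)

    bodyTotal-bound : ∀ dm → ∃[ d ] ∀ s E → 2 ≤ s → 1 ≤ E → ∀ m → DegE s dm E m → DegE s d E (bodyTotal m)
    bodyTotal-bound dm = _ , λ s E h 1≤E m p → let k = λ n → const≤ h n 1≤E in
      _⊞_ h (k 1) (_⊞_ h (_⊞_ h (k 1) (_⊞_ h (k 3) (_⊞_ h (k 3) (_⊞_ h (callBound h 47 m 1≤E refl p) (k 3))))) (k 7))

    body-cost : ∀ x p acc O vs ν ks P is → cost body ((x , p) , acc , O , vs , ν , ks , P , is , tt) ≡
      bodyTotal (cost (sealed! (messageX flag)) (vs , ν , ks , P , is , x , p , acc , tt))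
    body-cost x p acc O vs ν ks P is = refl

  messagesDegree : ℕ
  messagesDegree = foldDegree 1 1 1 (proj₁ (bodyTotal-bound (messageDegree flag)))

  module _ (O : List (ℕ × ℕ)) (vs : List ℕ) (ν : List Bool) (ks : List ℕ) (P : El par) (is : List ℕ) where

    private
      bags = proj₁ (proj₂ (proj₂ P))
      ρ : Env messagesΓ
      ρ = vs , ν , ks , P , is , tt

    partial : List (ℕ × ℕ) → List (El msg)
    partial = foldr (λ e acc → ⟦ body ⟧ᵗ (e , acc , O , ρ)) []

    -- A table has exponentially many leaves, but the measure sees only the polynomials stored
    -- there, each with as many coefficients as there are exponents. So the messages already
    -- received are small inputs for the polynomial fragment, which only descends into them.
    partial-W : ∀ {s} zs → length ks ≤ s → All (W s (nat ⊗ nat)) zs →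
      length (partial zs) ≡ length zs × All (W s msg) (partial zs)
    partial-W [] l [] = refl , []
    partial-W {s} ((x , p) ∷ zs) l ((_ , wp) ∷ ws) = cong suc (proj₁ (partial-W zs l ws)) , (wp , table-W) ∷ proj₂ (partial-W zs l ws)
      where
      ms = partial zs
      κ = kept vs ν bags x p
      μ = summed vs ν bags x p
      row : List Bool → Tree (List Bool)
      row τ = leaf (psum ks (λ ρ → local flag ks P x p ms (merge is τ ρ)) (enumL μ))
      rows-W : ∀ τs → All (AllTree (W s (list bool))) (mapL row τs)
      rows-W [] = []
      rows-W (τ ∷ τs) = psum-W ks (λ ρ → local flag ks P x p ms (merge is τ ρ)) (enumL μ) l ∷ rows-W τs
      head-W : ∀ ts → All (AllTree (W s (list bool))) ts → AllTree (W s (list bool)) (elimList (leaf []) (λ t _ → t) ts)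
      head-W [] _ = z≤n , []
      head-W (t ∷ ts) (q ∷ _) = q
      table-W : AllTree (W s (list bool)) (elimList (leaf []) (λ t _ → t) (build (reverse κ) (mapL row (enumL κ))))
      table-W = head-W _ (build-All (reverse κ) (rows-W (enumL κ)))

    states : ℕ × ℕ → ℕ
    states (x , p) = 2 ^ trues (kept vs ν bags x p) * 2 ^ trues (summed vs ν bags x p)

    step-bound : ∀ s E x p ms → 2 ≤ s → 1 ≤ E → WE s (messageΓ flag) (vs , ν , ks , P , is , x , p , ms , tt) → states (x , p) ≤ E →
      DegE s (proj₁ (bodyTotal-bound (messageDegree flag))) E (cost body ((x , p) , ms , O , ρ))
    step-bound s E x p ms h 1≤E w le = below h (≤-reflexive (body-cost x p ms O vs ν ks P is))
      (proj₂ (bodyTotal-bound (messageDegree flag)) s E h 1≤E (cost (sealed! (messageX flag)) ρ′)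
        (relax h le (message-bound flag vs ν ks P is x p ms s h w)))
      where
      ρ′ : Env (messageΓ flag)
      ρ′ = vs , ν , ks , P , is , x , p , ms , tt

    -- `E` bounds the work at a single node; the number of nodes enters the polynomial factor.
    messages-bound : ∀ s E → 2 ≤ s → 1 ≤ E → W s (list (nat ⊗ nat)) O → WE s messagesΓ ρ → All (λ e → states e ≤ E) O →
      DegE s messagesDegree E (cost (messagesX flag) (O , ρ))
    messages-bound s E h 1≤E (lO , wO) w@(wvs , wν , wks , wP , wis , _) st =
      reE (*-identityˡ E) (costFold-bound v0 emp body (O , ρ) {dn = 1} h ≤-refl 1≤E
        (const≤ h 1 (*-mono-≤ {1} ≤-refl 1≤E)) (const≤ h 1 (*-mono-≤ {1} ≤-refl 1≤E)) lO
        (degE (≤-reflexive (sym (trans (*-identityʳ (s ^ 1)) (*-identityʳ s)))))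
        one)
      where
      one : ∀ e zs → (∃[ ys ] ys ++ e ∷ zs ≡ O) →
        DegE s (proj₁ (bodyTotal-bound (messageDegree flag))) E (cost body (e , partial zs , O , ρ))
      one (x , p) zs (ys , eq) = step-bound s E x p (partial zs) h 1≤E
        (wvs , wν , wks , wP , wis , proj₁ (All.head wzs) , proj₂ (All.head wzs) ,
          (≡≤ (proj₁ ws) (≤-trans (n≤1+n _) (≤-trans (length-suffix ys eq) lO)) , proj₂ ws) , tt)
        (All.head (All-suffix ys eq st))
        where
        wzs = All-suffix ys eq wO
        ws = partial-W zs (proj₁ wks) (All.tail wzs)

module _ (flag : Bool) (prepare : Fn (input ∷ []) prepared) where

  private
    setupT : ∀ {m} → Tm m (input ∷ list rec ∷ []) setup
    setupT = setupF $$ ⟪ prepare $$ ⟪ v0 ⟫ ⨟ v0 ⨟ v1 ⟫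

    finishC : El setup → List (El msg) → ℕ
    finishC (O , vs , ν , ks , P , is , N) ms = cost (sealed (Fn.term finishF)) (ks , N , ms , vs , tt)

    messagesC : El setup → ℕ
    messagesC (O , vs , ν , ks , P , is , N) = cost (sealed! (messagesX flag)) (O , vs , ν , ks , P , is , tt)

    messagesV : El setup → List (El msg)
    messagesV (O , vs , ν , ks , P , is , N) = partial flag O vs ν ks P is O

    solveTotal : ℕ → ℕ → ℕ → ℕ
    solveTotal a m f = suc (a + (3 + (suc ((77 + (m + 3)) + (3 + ((51 + (f + 3)) + 1))) + 1)))

    solve-cost : ∀ i rs → cost (solveX flag prepare) (i , rs , tt) ≡
      (let st = ⟦ setupT {free} ⟧ᵗ (i , rs , tt) in
       solveTotal (cost (setupT {free}) (i , rs , tt)) (messagesC st) (finishC st (messagesV st)))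
    solve-cost i rs = refl

    setup-cost : ∀ ρ → cost (setupT {free}) ρ ≡ cost (setupT {poly}) ρ
    setup-cost ρ = refl

    solveTotal-bound : ∀ da dm df → ∃[ d ] ∀ s E → 2 ≤ s → 1 ≤ E → ∀ a m f →
      DegE s da E a → DegE s dm E m → DegE s df E f → DegE s d E (solveTotal a m f)
    solveTotal-bound da dm df = _ , λ s E h 1≤E a m f pa pm pf → let k = λ n → const≤ h n 1≤E in
      _⊞_ h (k 1) (_⊞_ h pa (_⊞_ h (k 3) (_⊞_ h
        (_⊞_ h (k 1) (_⊞_ h (callBound h 77 m 1≤E refl pm) (_⊞_ h (k 3) (_⊞_ h (callBound h 51 f 1≤E refl pf) (k 1)))))
        (k 1))))

    finishB : Bounded (sealed (Fn.term finishF))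
    finishB = bound (sealed (Fn.term finishF))

    setupB : Bounded (setupT {poly})
    setupB = bound (setupT {poly})

    setupStates : El setup → ℕ × ℕ → ℕ
    setupStates (O , vs , ν , ks , P , is , N) = states flag O vs ν ks P is

    finish-bound : ∀ s E st → 2 ≤ s → 1 ≤ E → W s setup st → DegE s (costDeg finishB) E (finishC st (messagesV st))
    finish-bound s E (O , vs , ν , ks , P , is , N) h 1≤E (wO , wvs , wν , wks , wP , wis , wN) =
      fromDeg h 1≤E (costB finishB s (ks , N , partial flag O vs ν ks P is O , vs , tt) h
        (wks , wN , (≡≤ (proj₁ ws) (proj₁ wO) , proj₂ ws) , wvs , tt))
      where
      ws = partial-W flag O vs ν ks P is O (proj₁ wks) (proj₂ wO)

    setup-messages : ∀ s E st → 2 ≤ s → 1 ≤ E → W s setup st → All (λ e → setupStates st e ≤ E) (proj₁ st) →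
      DegE s (messagesDegree flag) E (messagesC st)
    setup-messages s E (O , vs , ν , ks , P , is , N) h 1≤E (wO , wvs , wν , wks , wP , wis , wN) le =
      unsealed (messagesX flag) (O , vs , ν , ks , P , is , tt) (messages-bound flag O vs ν ks P is s E h 1≤E wO (wvs , wν , wks , wP , wis , tt) le)

    power : ∀ {s E a} k d → DegE (s ^ suc k) d E a → DegE s (suc k * d) E a
    power {s} {E} {a} k d (degE p) = degE (subst (λ x → a ≤ x * E) (^-*-assoc s (suc k) d) p)

    opaque
      setupDegree setupValue solveDegree : ℕ
      setupDegree = costDeg setupB
      setupValue = valDeg setupB
      solveDegree = proj₁ (solveTotal-bound setupDegree (suc setupValue * messagesDegree flag) (suc setupValue * costDeg finishB))

      setup-bound : ∀ s ρ → 2 ≤ s → WE s (input ∷ list rec ∷ []) ρ →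
        Deg s setupDegree (cost (setupT {free}) ρ) × W (s ^ setupValue) setup (⟦ setupT {free} ⟧ᵗ ρ)
      setup-bound s ρ h w = subst (Deg s (costDeg setupB)) (sym (setup-cost ρ)) (costB setupB s ρ h w) , valB setupB s ρ h w

      total-bound : ∀ s E → 2 ≤ s → 1 ≤ E → ∀ a m f → DegE s setupDegree E a →
        DegE s (suc setupValue * messagesDegree flag) E m → DegE s (suc setupValue * costDeg finishB) E f → DegE s solveDegree E (solveTotal a m f)
      total-bound = proj₂ (solveTotal-bound setupDegree (suc setupValue * messagesDegree flag) (suc setupValue * costDeg finishB))

    assembled : ∀ s E a st → 2 ≤ s → 1 ≤ E → Deg s setupDegree a → W (s ^ setupValue) setup st →
      All (λ e → setupStates st e ≤ E) (proj₁ st) → DegE s solveDegree E (solveTotal a (messagesC st) (finishC st (messagesV st)))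
    assembled s E a st h 1≤E da wst le = total-bound s E h 1≤E a (messagesC st) (finishC st (messagesV st))
      (fromDeg h 1≤E da)
      (power setupValue (messagesDegree flag) (setup-messages (s ^ suc setupValue) E st 2≤s′ 1≤E wst′ le))
      (power setupValue (costDeg finishB) (finish-bound (s ^ suc setupValue) E st 2≤s′ 1≤E wst′))
      where
      2≤s′ = 2≤pow h setupValue
      wst′ = widen h setup {j = suc setupValue} (n≤1+n setupValue) wst

  nodeStates : El input → List (El rec) → ℕ × ℕ → ℕ
  nodeStates i rs = setupStates (setupOf (Fn.sem prepare (i , tt)) i rs)

  solveX-cost : ∃[ d ] ∀ s E i rs → 2 ≤ s → 1 ≤ E → W s input i → W s (list rec) rs →
    All (λ e → nodeStates i rs e ≤ E) (proj₁ (setupOf (Fn.sem prepare (i , tt)) i rs)) →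
    DegE s d E (cost (solveX flag prepare) (i , rs , tt))
  solveX-cost = solveDegree , λ s E i rs h 1≤E wi wrs le →
    let b = setup-bound s (i , rs , tt) h (wi , wrs , tt) in
    below h (≤-reflexive (solve-cost i rs)) (assembled s E (cost (setupT {free}) (i , rs , tt)) (⟦ setupT {free} ⟧ᵗ (i , rs , tt)) h 1≤E (proj₁ b) (proj₂ b) le)

-- Matrices of an instance and the list of pairs of vertices

rows : ∀ {m n} → (Fin m → Fin n → Bool) → List (List Bool)
rows M = List.tabulate (λ u → tab (M u))

at-rows : ∀ {m n} (M : Fin m → Fin n → Bool) u v → at (rows M) (toℕ u) (toℕ v) ≡ M u v
at-rows M u v = trans (cong (nth false (toℕ v)) (nth-tabulate [] (λ u → tab (M u)) u)) (nth-tabulate false (M u) v)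

nth-< : ∀ i xs → T (nth false i xs) → i < length xs
nth-< zero (x ∷ xs) t = s≤s z≤n
nth-< (suc i) (x ∷ xs) t = s≤s (nth-< i xs t)

rows-< : ∀ {m n} (M : Fin m → Fin n → Bool) i j → T (at (rows M) i j) → i < m × j < n
rows-< {zero} M i j ()
rows-< {suc m} M zero j t = s≤s z≤n , subst (j <_) (Listₚ.length-tabulate (M zero)) (nth-< j (tab (M zero)) t)
rows-< {suc m} M (suc i) j t = let (p , q) = rows-< (M ∘ suc) i j t in s≤s p , q

fin : ∀ {n i} → i < n → ∃[ v ] (i ≡ toℕ {n} v)
fin l = Fin.fromℕ< l , sym (Finₚ.toℕ-fromℕ< l)

module _ {n : ℕ} where

  _≺_ : Digraph n
  u ≺ v = toℕ u <ᵇ toℕ v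

  inner : List (Fin n) → Fin n → Pairing {n} → Pairing {n}
  inner is u a = foldr (λ v b → if u ≺ v then (u , v) ∷ b else b) a is

  increasing : List (Fin n) → List (Fin n) → Pairing {n}
  increasing is us = foldr (inner is) [] us

  toℕ² : Fin n × Fin n → ℕ × ℕ
  toℕ² (u , v) = toℕ u , toℕ v

  increasing-pairsFrom : ∀ is us → pairsFrom (mapL toℕ is) (mapL toℕ us) ≡ mapL toℕ² (increasing is us)
  increasing-pairsFrom is [] = refl
  increasing-pairsFrom is (u ∷ us) = trans (cong (λ a → foldr _ a (mapL toℕ is)) (increasing-pairsFrom is us)) (row is)
    where
    a = increasing is us
    row : ∀ vs → foldr (λ v b → if toℕ u <ᵇ v then (toℕ u , v) ∷ b else b) (mapL toℕ² a) (mapL toℕ vs) ≡ mapL toℕ² (inner vs u a)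
    row [] = refl
    row (v ∷ vs) with toℕ u <ᵇ toℕ v
    ... | true = cong (_ ∷_) (row vs)
    ... | false = row vs

  inner-∈ : ∀ is {u a x y} → (x , y) ∈ inner is u a → (x ≡ u × y ∈ is × T (x ≺ y)) ⊎ (x , y) ∈ a
  inner-∈ [] m = inj₂ m
  inner-∈ (v ∷ is) {u} m with u ≺ v in eq
  inner-∈ (v ∷ is) {u} (here refl) | true = inj₁ (refl , here refl , true→T eq)
  inner-∈ (v ∷ is) {u} (there m) | true with inner-∈ is m
  ... | inj₁ (e , y∈ , l) = inj₁ (e , there y∈ , l)
  ... | inj₂ m′ = inj₂ m′
  inner-∈ (v ∷ is) {u} m | false with inner-∈ is m
  ... | inj₁ (e , y∈ , l) = inj₁ (e , there y∈ , l)
  ... | inj₂ m′ = inj₂ m′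

  ∈-inner : ∀ is {u a v} → v ∈ is → T (u ≺ v) → (u , v) ∈ inner is u a
  ∈-inner (w ∷ is) {u} (here refl) l rewrite T→true l = here refl
  ∈-inner (w ∷ is) {u} (there m) l with u ≺ w
  ... | true = there (∈-inner is m l)
  ... | false = ∈-inner is m l

  inner-⊇ : ∀ is {u a p} → p ∈ a → p ∈ inner is u a
  inner-⊇ [] m = m
  inner-⊇ (w ∷ is) {u} m with u ≺ w
  ... | true = there (inner-⊇ is m)
  ... | false = inner-⊇ is m

  increasing-∈ : ∀ is us {x y} → (x , y) ∈ increasing is us → x ∈ us × T (x ≺ y)
  increasing-∈ is (u ∷ us) m with inner-∈ is m
  ... | inj₁ (refl , _ , l) = here refl , l
  ... | inj₂ m′ = let (p , q) = increasing-∈ is us m′ in there p , q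

  ∈-increasing : ∀ is us {u v} → u ∈ us → v ∈ is → T (u ≺ v) → (u , v) ∈ increasing is us
  ∈-increasing is (w ∷ us) (here refl) v∈ l = ∈-inner is v∈ l
  ∈-increasing is (w ∷ us) (there u∈) v∈ l = inner-⊇ is (∈-increasing is us u∈ v∈ l)

  ≺-asym : ∀ {u v} → T (u ≺ v) → ¬ T (v ≺ u)
  ≺-asym {u} {v} p q = <-asym (<ᵇ⇒< (toℕ u) (toℕ v) p) (<ᵇ⇒< (toℕ v) (toℕ u) q)

  increasing-simple : ∀ {is us} → Unique is → Unique us → Simple (increasing is us)
  increasing-simple ui [] = []
  increasing-simple {is} {u ∷ us} ui (u∉ ∷ uu) = row ui
    where
    a = increasing is us
    row : ∀ {vs} → Unique vs → Simple (inner vs u a)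
    row [] = increasing-simple ui uu
    row {v ∷ vs} (v∉ ∷ uv) with u ≺ v in eq
    ... | false = row uv
    ... | true = ((λ { refl → ≺-asym {u} {v} l l }) , (λ m → fresh (inner-∈ vs m)) , (λ m → back (inner-∈ vs m))) ∷ row uv
      where
      l = true→T eq
      fresh : (u ≡ u × v ∈ vs × T (u ≺ v)) ⊎ (u , v) ∈ a → ⊥
      fresh (inj₁ (_ , m , _)) = All.lookup v∉ m refl
      fresh (inj₂ m) = All.lookup u∉ (proj₁ (increasing-∈ is us m)) refl
      back : (v ≡ u × u ∈ vs × T (v ≺ u)) ⊎ (v , u) ∈ a → ⊥
      back (inj₁ (refl , _ , _)) = ≺-asym {u} {v} l l
      back (inj₂ m) = ≺-asym {u} {v} l (proj₂ (increasing-∈ is us m))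

  sum-increasing : ∀ (g : Fin n × Fin n → ℕ) is us →
    sumL g (increasing is us) ≡ sumL (λ u → sumL (λ v → if u ≺ v then g (u , v) else 0) is) us
  sum-increasing g is [] = refl
  sum-increasing g is (u ∷ us) = trans (row is) (cong (sumL (λ v → if u ≺ v then g (u , v) else 0) is +_) (sum-increasing g is us))
    where
    row : ∀ vs → sumL g (inner vs u (increasing is us)) ≡ sumL (λ v → if u ≺ v then g (u , v) else 0) vs + sumL g (increasing is us)
    row [] = refl
    row (v ∷ vs) with u ≺ v
    ... | true = trans (cong (g (u , v) +_) (row vs)) (sym (+-assoc (g (u , v)) _ _))
    ... | false = row vs

sumL-map : ∀ {A B : Set} (g : B → ℕ) (f : A → B) xs → sumL g (mapL f xs) ≡ sumL (g ∘ f) xs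
sumL-map g f [] = refl
sumL-map g f (x ∷ xs) = cong (g (f x) +_) (sumL-map g f xs)

sumL-tabulate : ∀ {A : Set} {n} (g : A → ℕ) (f : Fin n → A) → sumL g (List.tabulate f) ≡ sumF (g ∘ f)
sumL-tabulate {n = zero} g f = refl
sumL-tabulate {n = suc n} g f = cong (g (f zero) +_) (sumL-tabulate g (f ∘ suc))

mapL-tabulate : ∀ {A B : Set} {n} (g : A → B) (f : Fin n → A) → mapL g (List.tabulate f) ≡ List.tabulate (g ∘ f)
mapL-tabulate {n = zero} g f = refl
mapL-tabulate {n = suc n} g f = cong (g (f zero) ∷_) (mapL-tabulate g (f ∘ suc))

range-toℕ : ∀ n → range n ≡ mapL toℕ (allFin n)
range-toℕ n = trans (eq n) (sym (mapL-tabulate toℕ id))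
  where
  eq : ∀ n → range n ≡ List.tabulate {n = n} toℕ
  eq zero = refl
  eq (suc n) = cong (0 ∷_) (trans (cong (mapL suc) (eq n)) (mapL-tabulate suc toℕ))

module _ (n : ℕ) where

  allPairs : Pairing {n}
  allPairs = increasing (allFin n) (allFin n)

  pairsFrom-allPairs : pairsFrom (range n) (range n) ≡ mapL toℕ² allPairs
  pairsFrom-allPairs = trans (cong (λ r → pairsFrom r r) (range-toℕ n)) (increasing-pairsFrom (allFin n) (allFin n))

  simple-pairs : Simple allPairs
  simple-pairs = increasing-simple (allFin⁺ n) (allFin⁺ n)

  sum-allPairs : ∀ g → sumL g allPairs ≡ sumF (λ u → sumF (λ v → if u ≺ v then g (u , v) else 0))
  sum-allPairs g = trans (sum-increasing g (allFin n) (allFin n)) (trans (sumL-tabulate {n = n} (λ u → sumL (λ v → if u ≺ v then g (u , v) else 0) (allFin n)) id)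
    (sumF-cong (λ u → sumL-tabulate {n = n} (λ v → if u ≺ v then g (u , v) else 0) id)))

  length-allPairs : length allPairs ≤ n * n
  length-allPairs = ≡≤ ((trans (sym (sumL-1 allPairs)) (sum-allPairs (λ _ → 1))))
    (≤≡ (sumF-mono {n} (λ u → ≤≡ (sumF-mono {n} {h = λ _ → 1} (λ v → ⌜⌝≤1 (u ≺ v))) (sumF-const n 1)))
      (trans (sumF-const n (n * 1)) (cong (n *_) (*-identityʳ n))))

  complete-pairs : Complete allPairs
  complete-pairs = record { cover = cover′ ; total = total′ }
    where
    cover′ : ∀ u v → u ≢ v → (u , v) ∈ allPairs ⊎ (v , u) ∈ allPairs
    cover′ u v u≢v with <-cmp (toℕ u) (toℕ v)
    ... | tri< l _ _ = inj₁ (∈-increasing _ _ (∈-allFin u) (∈-allFin v) (<⇒<ᵇ l))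
    ... | tri≈ _ e _ = contradiction (toℕ-injective e) u≢v
    ... | tri> _ _ l = inj₂ (∈-increasing _ _ (∈-allFin v) (∈-allFin u) (<⇒<ᵇ l))
    module _ (F : Digraph n) (irr : ∀ u → F u u ≡ false) where
      h : Fin n → Fin n → ℕ
      h u v = if u ≺ v then ⌜ F u v ⌝ else 0
      h′ : Fin n → Fin n → ℕ
      h′ u v = if u ≺ v then ⌜ F v u ⌝ else 0
      if-+ : ∀ b {x y} → (if b then x + y else 0) ≡ (if b then x else 0) + (if b then y else 0)
      if-+ false = refl
      if-+ true = refl
      eitherWay : ∀ u v → h u v + h′ v u ≡ ⌜ F u v ⌝
      eitherWay u v with <-cmp (toℕ u) (toℕ v)
      ... | tri< l _ ¬g rewrite T→true (<⇒<ᵇ l) | ¬T→false (λ t → ¬g (<ᵇ⇒< (toℕ v) (toℕ u) t)) = +-identityʳ _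
      ... | tri> ¬l _ g rewrite T→true (<⇒<ᵇ g) | ¬T→false (λ t → ¬l (<ᵇ⇒< (toℕ u) (toℕ v) t)) = refl
      ... | tri≈ ¬l e _ rewrite toℕ-injective e | irr v = trans (cong₂ _+_ (if-0 (v ≺ v)) (if-0 (v ≺ v))) refl
        where
        if-0 : ∀ b → (if b then 0 else 0) ≡ 0
        if-0 false = refl
        if-0 true = refl
      total′ : sumL (λ p → ⌜ F (proj₁ p) (proj₂ p) ⌝ + ⌜ F (proj₂ p) (proj₁ p) ⌝) allPairs ≡ arcCount F
      -- An arc towards a smaller vertex is counted at its reversed pair. Exchanging the two sums in
      -- that part brings it back to its own position, where exactly one of the two parts counts it.
      total′ = trans (sum-allPairs _) (trans (sumF-cong (λ u → trans (sumF-cong (λ v → if-+ (u ≺ v))) (sumF-+ (h u) (h′ u))))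
        (trans (sumF-+ (λ u → sumF (h u)) (λ u → sumF (h′ u))) (trans (cong (sumF (λ u → sumF (h u)) +_) (sumF-swap h′))
          (trans (sym (sumF-+ (λ u → sumF (h u)) (λ v → sumF (λ u → h′ u v))))
            (sumF-cong (λ u → trans (sym (sumF-+ (h u) (λ v → h′ v u))) (sumF-cong (λ v → eitherWay u v))))))))

-- Random weights in binary and the size of their range

bin : List Bool → ℕ
bin = foldr (λ b a → a + a + (if b then 1 else 0)) 0

double-injective : ∀ a b x y → a + a + (if x then 1 else 0) ≡ b + b + (if y then 1 else 0) → a ≡ b × x ≡ y
double-injective zero zero false false e = refl , refl
double-injective zero zero true true e = refl , refl
double-injective zero (suc b) false y ()
double-injective zero (suc b) true y e rewrite +-suc b b = contradiction (suc-injective e) (λ ())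
double-injective (suc a) zero x false ()
double-injective (suc a) zero x true e rewrite +-suc a a = contradiction (suc-injective e) (λ ())
double-injective (suc a) (suc b) x y e rewrite +-suc a a | +-suc b b =
  let (p , q) = double-injective a b x y (suc-injective (suc-injective e)) in cong suc p , q

bin-injective : ∀ xs ys → length xs ≡ length ys → bin xs ≡ bin ys → xs ≡ ys
bin-injective [] [] l e = refl
bin-injective (x ∷ xs) (y ∷ ys) l e with double-injective (bin xs) (bin ys) x y e
... | p , refl = cong (x ∷_) (bin-injective xs ys (suc-injective l) p)

bin-< : ∀ xs → bin xs < 2 ^ length xs
bin-< [] = ≤-refl
bin-< (x ∷ xs) = ≤-trans (s≤s (+-monoʳ-≤ (bin xs + bin xs) (⌜⌝≤1 x))) (≡≤ (eq) (+-mono-≤ (bin-< xs) (+-mono-≤ (bin-< xs) z≤n)))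
  where
  eq : suc (bin xs + bin xs + 1) ≡ suc (bin xs) + (suc (bin xs) + 0)
  eq = cong suc (trans (+-assoc (bin xs) (bin xs) 1) (cong (bin xs +_) (trans (+-comm (bin xs) 1) (sym (+-identityʳ _)))))

value-bin : ∀ c xs → 2 ^ length xs ≤ c → value c xs ≡ bin xs
value-bin c [] l = refl
value-bin c (x ∷ xs) l rewrite value-bin c xs (≤-trans (m≤m+n _ _) l) = m≥n⇒m⊓n≡n (≤-trans (<⇒≤ (bin-< (x ∷ xs))) l)

lg-spec : ∀ n → n ≤ proj₁ (lg n) × proj₁ (lg n) ≡ 2 ^ proj₂ (lg n)
lg-spec n = let (p , q) = iterate n ≤-refl in ≡≤ ((sym (m≤n⇒m⊓n≡m (n≤1+n n)))) p , q
  where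
  result′ : ℕ → ℕ × ℕ
  result′ j = foldr (λ _ → lgStep n) (1 , 0) (replicate j false)
  iterate : ∀ j → j ≤ n → n ⊓ suc j ≤ proj₁ (result′ j) × proj₁ (result′ j) ≡ 2 ^ proj₂ (result′ j)
  iterate zero l = m⊓n≤n n 1 , refl
  iterate (suc j) l with iterate j (<⇒≤ l)
  ... | le , e = one (result′ j) le e
    where
    one : ∀ pl → n ⊓ suc j ≤ proj₁ pl → proj₁ pl ≡ 2 ^ proj₂ pl →
      n ⊓ suc (suc j) ≤ proj₁ (lgStep n pl) × proj₁ (lgStep n pl) ≡ 2 ^ proj₂ (lgStep n pl)
    one (p , q) le e with p <ᵇ n in eq
    ... | true = ≤-trans (≤-trans (m⊓n≤n n (suc (suc j))) (s≤s j<p)) (≡≤ (+-comm 1 p) (+-monoʳ-≤ p (≤-trans (s≤s z≤n) j<p))) ,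
                  trans (cong₂ _+_ e e) (cong (2 ^ q +_) (sym (+-identityʳ (2 ^ q))))
      where
      j<p : suc j ≤ p
      j<p = ≡≤ (sym (m≥n⇒m⊓n≡n l)) le
    ... | false = ≤-trans (m⊓n≤m n _) (≮⇒≥ (λ l → subst T eq (<⇒<ᵇ l))) , e

boundOf-power : ∀ n → boundOf n ≡ 2 ^ bitsOf n
boundOf-power n = trans (cong (λ x → ((x + x) + (x + x)) * ((x + x) + (x + x))) (proj₂ (lg-spec n))) (power (proj₂ (lg n)))
  where
  power : ∀ l → let x = 2 ^ l in ((x + x) + (x + x)) * ((x + x) + (x + x)) ≡ 2 ^ suc (suc (suc (suc (l + l))))
  power l rewrite ^-distribˡ-+-* 2 l l = solve 1 (λ x → ((x :+ x) :+ (x :+ x)) :* ((x :+ x) :+ (x :+ x)) :≡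
    lit 2 :* (lit 2 :* (lit 2 :* (lit 2 :* (x :* x))))) refl (2 ^ l)

few-pairs : ∀ n → 16 * length (allPairs n) ≤ 2 ^ bitsOf n
few-pairs n = ≤-trans (*-monoʳ-≤ 16 (≤-trans (length-allPairs n) (*-mono-≤ (proj₁ (lg-spec n)) (proj₁ (lg-spec n)))))
  (≡≤ ((solve 1 (λ x → lit 16 :* (x :* x) :≡ ((x :+ x) :+ (x :+ x)) :* ((x :+ x) :+ (x :+ x))) refl (proj₁ (lg n))))
    (≤-reflexive (boundOf-power n)))

trues-tab : ∀ {n} (ν : Fin n → Bool) → trues (tab ν) ≡ sumF (λ v → ⌜ ν v ⌝)
trues-tab {zero} ν = refl
trues-tab {suc n} ν with ν zero
... | true = cong suc (trues-tab (ν ∘ suc))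
... | false = trues-tab (ν ∘ suc)

length-prodMsgs : ∀ ks N ms σ → length (prodMsgs ks N ms σ) ≡ length ks
length-prodMsgs ks N [] σ = length-mapL _ ks
length-prodMsgs ks N ((p , t) ∷ ms) σ with p ≡ᵇ N
... | true = length-mapL _ ks
... | false = length-prodMsgs ks N ms σ

anyL-index : ∀ xs → T (anyL id xs) → ∃[ e ] (e < length xs × nth false e xs ≡ true)
anyL-index (true ∷ xs) t = 0 , s≤s z≤n , refl
anyL-index (false ∷ xs) t = let (e , l , p) = anyL-index xs t in suc e , s≤s l , p

nth-anyL : ∀ xs e → nth false e xs ≡ true → T (anyL id xs)
nth-anyL (true ∷ xs) zero p = tt
nth-anyL (x ∷ xs) (suc e) p = T∨₂ {x} (nth-anyL xs e p)

module _ (flag : Bool) (K : ℕ) (P : El par) where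

  open Poly K
  private
    module R = CommutativeSemiring ring
    D = proj₁ (proj₂ P)
    recs = proj₂ (proj₂ (proj₂ (proj₂ P)))

  zero-sum : ∀ g → (∀ b → coef (g b) ≈ (λ _ → false)) → coef (psum ks g bits2) ≈ (λ _ → false)
  zero-sum g h = R.trans (coef-padd (g false) (padd ks (g true) [])) (R.trans (R.+-cong (h false) (R.trans (coef-padd (g true) []) (R.trans (R.+-identityʳ _) (h true)))) (R.+-identityʳ _))

  first-term : ∀ g → coef (g true) ≈ (λ _ → false) → coef (psum ks g bits2) ≈ coef (g false)
  first-term g h = R.trans (coef-padd (g false) (padd ks (g true) [])) (R.trans (R.+-congˡ (R.trans (coef-padd (g true) []) (R.trans (R.+-identityʳ _) h))) (R.+-identityʳ _))

  -- With no arc in either direction only the empty choice is admissible; it is consistent with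
  -- every state and has weight zero.
  trivial-factor : ∀ u v ws σ → at D u v ≡ false → at D v u ≡ false → coef (factor flag ks P ((u , v) , ws) σ) ≈ R.1#
  trivial-factor u v ws σ uv vu =
    R.trans (first-term t₀ (zero-sum (t₁ true) λ a₁ → zero-sum (t₂ true a₁) λ b₀ → zero-sum (t true a₁ b₀) λ b₁ → none true a₁ b₀ b₁ tt))
    (R.trans (first-term (t₁ false) (zero-sum (t₂ false true) λ b₀ → zero-sum (t false true b₀) λ b₁ → none false true b₀ b₁ tt))
    (R.trans (first-term (t₂ false false) (zero-sum (t false false true) λ b₁ → none false false true b₁ tt))
    (R.trans (first-term (t false false false) (none false false false true tt)) (R.trans (R.reflexive (cong coef (empty flag))) (coef-mono 0)))))
    where
    t : Bool → Bool → Bool → Bool → List Bool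
    t = term flag ks P ((u , v) , ws) σ
    t₂ : Bool → Bool → Bool → List Bool
    t₂ a₀ a₁ b₀ = psum ks (t a₀ a₁ b₀) bits2
    t₁ : Bool → Bool → List Bool
    t₁ a₀ a₁ = psum ks (t₂ a₀ a₁) bits2
    t₀ : Bool → List Bool
    t₀ a₀ = psum ks (t₁ a₀) bits2
    inadmissible : ∀ a₀ a₁ b₀ b₁ → T (a₀ ∨ a₁ ∨ b₀ ∨ b₁) → admissible flag D u v a₀ a₁ b₀ b₁ ≡ false
    inadmissible true a₁ b₀ b₁ _ rewrite uv = refl
    inadmissible false true b₀ b₁ _ rewrite uv = refl
    inadmissible false false true b₁ _ rewrite vu = refl
    inadmissible false false false true _ rewrite vu = refl
    none : ∀ a₀ a₁ b₀ b₁ → T (a₀ ∨ a₁ ∨ b₀ ∨ b₁) → coef (t a₀ a₁ b₀ b₁) ≈ (λ _ → false)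
    none a₀ a₁ b₀ b₁ q rewrite inadmissible a₀ a₁ b₀ b₁ q = R.refl
    empty : ∀ f → term f ks P ((u , v) , ws) σ false false false false ≡ mono ks 0
    empty false = refl
    empty true = refl

-- Correctness of the decision procedure

module Solver (flag : Bool) {n : ℕ} {G : Graph n} (TD : TreeDecomposition G)
  (d : Digraph n) (d⊆G : ∀ u v → u ≢ v → T (d u v) → Adj G u v)
  (nonroot : Fin n → Bool) (t cap : ℕ) where

  open TreeDecomposition TD renaming (tree to tree′)

  D A bags : List (List Bool)
  D = rows d
  A = rows (adj tree′)
  bags = rows (λ x → lookup (bag x))

  ν : List Bool
  ν = tab nonroot

  ps : Pairing {n}
  ps = allPairs n

  k c r p : ℕ
  k = bitsOf n
  c = boundOf n
  r = trues ν
  p = length ps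

  K′ : ℕ → ℕ → ℕ
  K′ m l = truncation l (boundOf m) cap r t

  units′ : ℕ → ℕ → ℕ × ℕ × ℕ
  units′ m l = unit₁ l (boundOf m) cap r t , unit₂ l (boundOf m) cap r t , boundOf m

  -- Order, number of nodes and number of records are parameters, because the program measures them
  -- as lengths of lists, which agree with `n`, `nodes` and `p` only up to provable equality.
  computed : ℕ → ℕ → ℕ → List (El rec) → List Bool
  computed m N l rs = Tables.result flag (K′ m l) (m , D , bags , units′ m l , rs) ν N (order A (range N) N)

  computed-run : ∀ prepare M b rs → length rs ≡ p →
    Run.polynomial flag prepare (D , ν , t , cap) (M , b , A , bags) rs ≡ computed n nodes p rs
  computed-run prepare M b rs e = trans (cong₂ (λ m N → computed m N (length rs) rs) (Listₚ.length-tabulate nonroot) (Listₚ.length-tabulate (λ u → tab (adj tree′ u))))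
    (cong (λ l → computed n nodes l rs) {x = length rs} {y = p} e)

  K M₁ M₂ : ℕ
  K = K′ n p
  M₁ = unit₁ p c cap r t
  M₂ = unit₂ p c cap r t

  Ms : ℕ × ℕ × ℕ
  Ms = units′ n p

  open Expansion flag D {n}

  νᵇ : ℕ → Bool
  νᵇ v = nth false v ν

  module C = Core flag D d (at-rows d) νᵇ

  bag-small : ∀ x u → T (at bags x u) → x < nodes × u < n
  bag-small = rows-< (λ x → lookup (bag x))

  vertex-in-bag : ∀ {v x} → v ∈ˢ bag x → T (at bags (toℕ x) (toℕ v))
  vertex-in-bag {v} {x} m = subst T (sym (trans (at-rows (λ x → lookup (bag x)) x v) ([]=⇒lookup m))) tt

  subtree′ : ∀ v x y → T (at bags (toℕ x) v) → T (at bags (toℕ y) v) →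
    Star (λ a b → Adj tree′ a b × T (at bags (toℕ a) v) × T (at bags (toℕ b) v)) x y
  subtree′ v x y bx by = along (fin (proj₂ (bag-small (toℕ x) v bx))) bx by
    where
    from : ∀ v′ a → T (at bags (toℕ a) (toℕ v′)) → v′ ∈ˢ bag a
    from v′ a q = lookup⇒[]= v′ (bag a) (trans (sym (at-rows (λ x → lookup (bag x)) a v′)) (T→true q))
    along : ∀ {v} → (∃[ v′ ] v ≡ toℕ v′) → T (at bags (toℕ x) v) → T (at bags (toℕ y) v) →
      Star (λ a b → Adj tree′ a b × T (at bags (toℕ a) v) × T (at bags (toℕ b) v)) x y
    along (v′ , refl) bx by = Star.map (λ (e , p , q) → e , vertex-in-bag p , vertex-in-bag q) (subtree v′ x y (from v′ x bx) (from v′ y by))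

  module Ord = TreeOrder tree′ isTree A (at-rows (adj tree′)) (λ i j a → proj₂ (rows-< (adj tree′) i j a))
    (at bags) (λ x v b → proj₁ (bag-small x v b)) subtree′

  O : List (ℕ × ℕ)
  O = order A (range nodes) nodes

  module _ (ω : Vec (List Bool) (p * 4)) where

    private
      rs = recsOf ps ω
      module Tb = Tables flag K (n , D , bags , Ms , rs) ν

    private
      open Poly K using (_≈_; coeff; coef)
      module R = CommutativeSemiring (Poly.ring K)

      cover : ∀ v → T (νᵇ v) → T (anyL (λ x → at bags x v) (Ord.V O))
      cover v q = at-fin (fin (subst (v <_) (Listₚ.length-tabulate nonroot) (nth-< v ν q)))
        where
        at-fin : (∃[ v′ ] v ≡ toℕ v′) → T (anyL (λ x → at bags x v) (Ord.V O))
        at-fin (v′ , refl) = let (x , m) = coverVertex v′ in anyL-∈ (λ x → at bags x (toℕ v′)) (Ord.V O) (Ord.order-all x) (vertex-in-bag m)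

      live : ∀ u v → T (at D u v) → T (anyL (λ x → at bags x u ∧ at bags x v) (Ord.V O))
      live u v a = at-fin (fin (proj₁ (rows-< d u v a))) (fin (proj₂ (rows-< d u v a)))
        where
        common : ∀ u v → T (d u v) → ∃[ x ] (u ∈ˢ bag x × v ∈ˢ bag x)
        common u v duv with u ≟ v
        ... | yes refl = let (x , m) = coverVertex u in x , m , m
        ... | no u≢v = coverEdge u v (d⊆G u v u≢v duv)
        at-fin : (∃[ u′ ] u ≡ toℕ u′) → (∃[ v′ ] v ≡ toℕ v′) → T (anyL (λ x → at bags x u ∧ at bags x v) (Ord.V O))
        at-fin (u′ , refl) (v′ , refl) = let (x , m , m′) = common u′ v′ (subst T (at-rows d u′ v′) a) in
          anyL-∈ (λ x → at bags x (toℕ u′) ∧ at bags x (toℕ v′)) (Ord.V O) (Ord.order-all x) (T∧ (vertex-in-bag m) (vertex-in-bag m′))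

      swap-live : ∀ u v B → T (anyL (λ x → at bags x u ∧ at bags x v) B) → T (anyL (λ x → at bags x v ∧ at bags x u) B)
      swap-live u v (x ∷ B) q = T∨-elim {at bags x u ∧ at bags x v} q (λ e → T∨₁ (T∧ (T∧₂ {at bags x u} e) (T∧₁ e)))
        (λ e → T∨₂ {at bags x v ∧ at bags x u} (swap-live u v B e))

    specified : ∀ e → e < K → nth false e (computed n nodes p rs) ≡
      allX (p * 4) (λ x → parity C.vs νᵇ ps x ∧ (e ≡ᵇ weightOf Ms ps ω x))
    specified e l = trans (coeff (Tb.result-spec nodes O (λ x u q → proj₂ (bag-small x u q))
        (λ v → ¬T→false (λ q → <-irrefl refl (proj₁ (bag-small nodes v q)))) Ord.order-good cover
        (λ ((u , v) , ws) dead σ → trivial-factor flag K (n , D , bags , Ms , rs) u v ws σ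
          (¬T→false (λ q → subst T dead (live u v q)))
          (¬T→false (λ q → subst T dead (swap-live v u (Ord.V O) (live v u q)))))) e l)
      (expansion K bags Ms rs νᵇ C.vs ps ω e l)

private
  shuffle : ∀ p q r s a b c d u B R → ((((p + a) + (q + b)) + ((r + c) + (s + d))) + u) + (B + R) ≡
    ((((p + q) + (r + s)) + u) + B) + (a + (b + (c + (d + R))))
  shuffle = solve 11 (λ p q r s a b c d u B R → ((((p :+ a) :+ (q :+ b)) :+ ((r :+ c) :+ (s :+ d))) :+ u) :+ (B :+ R) :≡
    ((((p :+ q) :+ (r :+ s)) :+ u) :+ B) :+ (a :+ (b :+ (c :+ (d :+ R))))) refl

  -- The bound from `l * 4` coordinates with a range of at least `16 * l` values. The case without
  -- pairs is separate, since the general one cancels the factor `suc l * 4`.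
  quarter : ∀ k l {s q} → 16 * l ≤ 2 ^ k → 2 ^ k * s ≤ (l * 4) * q → 4 * s ≤ q
  quarter k zero {s} {q} h le = ≡≤ ((cong (4 *_) (zero-s s (≤-trans (*-monoˡ-≤ s (m^n>0 2 k)) le)))) z≤n
    where
    zero-s : ∀ s → s + 0 ≤ 0 → s ≡ 0
    zero-s zero _ = refl
  quarter k (suc l) {s} {q} h le = *-cancelˡ-≤ (suc l * 4) (≡≤ ((solve 2 (λ l s → (l :* lit 4) :* (lit 4 :* s) :≡ (lit 16 :* l) :* s) refl (suc l) s))
    (≤-trans (*-monoˡ-≤ s h) le))

module Answers (flag : Bool) (D : El mat) {n : ℕ} (d : Digraph n)
  (at-d : ∀ u v → at D (toℕ u) (toℕ v) ≡ d u v) (νᵇ : ℕ → Bool)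
  (ps : Pairing {n}) (simple : Simple ps) (complete : Complete ps)
  (k c r t cap : ℕ) (few : 16 * length ps ≤ 2 ^ k) (c≡ : c ≡ 2 ^ k) where

  private
    module C = Core flag D d at-d νᵇ
    p = length ps

  open Expansion flag D {n}

  M₁ M₂ K : ℕ
  M₁ = unit₁ p c cap r t
  M₂ = unit₂ p c cap r t
  K = truncation p c cap r t

  module _ (r≡ : r ≡ C.nonroots) (poly′ : Vec (List Bool) (p * 4) → List Bool) (length-poly : ∀ ω → length (poly′ ω) ≡ K)
    (specified : ∀ ω e → e < K → nth false e (poly′ ω) ≡
      allX (p * 4) (λ x → parity C.vs νᵇ ps x ∧ (e ≡ᵇ weightOf (M₁ , M₂ , c) ps ω x))) where

    Ms : ℕ × ℕ × ℕ
    Ms = M₁ , M₂ , c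

    accepts : Vec (List Bool) (p * 4) → Bool
    accepts ω = anyL id (poly′ ω)

    accepts-odd : ∀ ω → T (accepts ω) → ∃[ x ] (C.odd ps x × weightOf Ms ps ω x < K)
    accepts-odd ω q = at-index (anyL-index (poly′ ω) q)
      where
      f : ℕ → Vec Bool (p * 4) → Bool
      f e x = parity C.vs νᵇ ps x ∧ (e ≡ᵇ weightOf Ms ps ω x)
      chosen-by : ∀ e → e < K → (∃[ x ] T (f e x)) → ∃[ x ] (C.odd ps x × weightOf Ms ps ω x < K)
      chosen-by e l (x , both) = x , T→true (T∧₁ both) ,
        ≤-trans (s≤s (≤-reflexive (sym (≡ᵇ⇒≡ e (weightOf Ms ps ω x) (T∧₂ {parity C.vs νᵇ ps x} both))))) l
      at-index : (∃[ e ] (e < length (poly′ ω) × nth false e (poly′ ω) ≡ true)) →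
        ∃[ x ] (C.odd ps x × weightOf Ms ps ω x < K)
      at-index (e , l , eq) = chosen-by e l′ (allX-∃ (p * 4) (f e) (trans (sym (specified ω e l′)) eq))
        where
        l′ : e < K
        l′ = ≤≡ l (length-poly ω)

    rejects-even : ∀ ω → T (not (accepts ω)) → ∀ e → e < K → allX (p * 4) (λ x → parity C.vs νᵇ ps x ∧ (e ≡ᵇ weightOf Ms ps ω x)) ≡ false
    rejects-even ω q e l = ¬T→false (λ odd → not-T q (nth-anyL (poly′ ω) e (trans (specified ω e l) (T→true odd))))

    -- Some odd choice has weight below `K`. Its forests have at least `r + r` arcs in total; one
    -- more would cost `M₁`, which is `M₂ * cap` and so at least the allowance `M₂ * t` of the
    -- union. With exactly `r + r` arcs the remaining price shows that the union has fewer than `t`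
    -- arcs.
    accepts-sound : t ≤ cap → ∀ ω → T (accepts ω) → CoreYes flag d C.ν t
    accepts-sound t≤cap ω q = light-sound (accepts-odd ω q)
      where
      light-sound : (∃[ x ] (C.odd ps x × weightOf Ms ps ω x < K)) → CoreYes flag d C.ν t
      light-sound (x , odd , l) = S.sound simple few′ small
       where
        module S = C.Sound ps x odd
        j a : ℕ
        j = length S.outs + length S.ins
        a = length (chosen any ps x)
        heavy : M₁ * j + M₂ * a < M₁ * (r + r) + M₂ * t
        heavy = ≤-trans (s≤s (weightOf-≥ M₁ M₂ c flag D ps ω x)) l
        low : r + r ≤ j
        low = ≡≤ (cong₂ _+_ r≡ r≡) (+-mono-≤ S.outs-low S.ins-low)
        few′ : j ≤ C.nonroots + C.nonroots
        few′ = ≤≡ (≮⇒≥ (λ more → <⇒≱ heavy (≤-trans (+-monoʳ-≤ (M₁ * (r + r)) (*-monoʳ-≤ M₂ t≤cap))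
          (≡≤ ((trans (+-comm (M₁ * (r + r)) M₁) (sym (*-suc M₁ (r + r))))) (≤-trans (*-monoʳ-≤ M₁ more) (m≤m+n _ _))))))
          (cong₂ _+_ r≡ r≡)
        small : a < t
        small = *-cancelˡ-< M₂ a t (+-cancelˡ-< (M₁ * (r + r)) _ _ (≤-<-trans (+-monoˡ-≤ (M₂ * a) (*-monoʳ-≤ M₁ low)) heavy))

    module _ (toL : Vec Bool k → List Bool) (toL-length : ∀ w → length (toL w) ≡ k) (toL-injective : ∀ {a b} → toL a ≡ toL b → a ≡ b) where

      open Isolation {k} using (Ω; sumΩ; dot; isolation)

      private
        val : Vec Bool k → ℕ
        val w = value c (toL w)

        val-injective : ∀ {a b} → val a ≡ val b → a ≡ b
        val-injective {a} {b} e = toL-injective (bin-injective (toL a) (toL b) (trans (toL-length a) (sym (toL-length b)))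
          (trans (sym (vb a)) (trans e (vb b))))
          where
          vb : ∀ w → val w ≡ bin (toL w)
          vb w = value-bin c (toL w) (≤-reflexive (trans (cong (2 ^_) (toL-length w)) (sym c≡)))

        base : ∀ (qs : Pairing {n}) → Vec Bool (length qs * 4) → ℕ
        base [] [] = 0
        base (_ ∷ qs) (a₀ ∷ a₁ ∷ b₀ ∷ b₁ ∷ x) =
          ((weigh M₁ a₀ + weigh M₁ a₁) + (weigh M₁ b₀ + weigh M₁ b₁) + (weigh M₂ (a₀ ∨ a₁) + weigh M₂ (b₀ ∨ b₁))) + base qs x

        weigh-+ : ∀ m w b → weigh (m + w) b ≡ weigh m b + weigh w b
        weigh-+ m w false = refl
        weigh-+ m w true = refl

        weight-dot : ∀ qs (ω : Ω (length qs * 4)) x → weightOf Ms qs (Vec.map toL ω) x ≡ base qs x + dot val val-injective ω x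
        weight-dot [] [] [] = refl
        weight-dot (_ ∷ qs) (w₀ ∷ w₁ ∷ w₂ ∷ w₃ ∷ ω) (a₀ ∷ a₁ ∷ b₀ ∷ b₁ ∷ x)
          rewrite weight-dot qs ω x | weigh-+ M₁ (val w₀) a₀ | weigh-+ M₁ (val w₁) a₁ | weigh-+ M₁ (val w₂) b₀ | weigh-+ M₁ (val w₃) b₁ =
          shuffle
            (weigh M₁ a₀) (weigh M₁ a₁) (weigh M₁ b₀) (weigh M₁ b₁) (weigh (val w₀) a₀) (weigh (val w₁) a₁) (weigh (val w₂) b₀) (weigh (val w₃) b₁)
            (weigh M₂ (a₀ ∨ a₁) + weigh M₂ (b₀ ∨ b₁)) (base qs x) (dot val val-injective ω x)

      rejected : Ω (p * 4) → Bool
      rejected ω = not (accepts (Vec.map toL ω))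

      -- Isolation is applied to the family of choices with an odd number of states. The two
      -- breadth-first forests of a solution form a member whose weight is below `K` for all random
      -- weights.
      rarely-rejected : CoreYes flag d C.ν t → 4 * sumΩ (p * 4) (⌜_⌝ ∘ rejected) ≤ (2 ^ k) ^ (p * 4)
      rarely-rejected yes′ = quarter k p few
          (isolation val val-injective (parity C.vs νᵇ ps) (base ps) K rejected
            (λ ω q e l → trans (allX-cong (p * 4) (λ x → cong (λ y → parity C.vs νᵇ ps x ∧ (e ≡ᵇ y)) (sym (weight-dot ps ω x)))) (rejects-even (Vec.map toL ω) q e l))
            (CC.c {t} yes′ ps complete) (true→T (CC.choice-odd {t} yes′ ps complete)) (λ ω → ≤-trans (s≤s (≤-reflexive (sym (weight-dot ps ω (CC.c {t} yes′ ps complete))))) (light ω)))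
        where
        module CC = CompleteCore flag D d at-d νᵇ
        -- The union has at most `t` less one arcs, and all random parts together stay below the one
        -- `M₂` that is left; `M₂` was chosen as the successor of their maximal sum.
        light : ∀ ω → weightOf Ms ps (Vec.map toL ω) (CC.c {t} yes′ ps complete) < K
        light ω = ≤-trans (s≤s (weightOf-≤ M₁ M₂ c flag D ps (Vec.map toL ω) (CC.c {t} yes′ ps complete)))
          (≡≤ ((cong suc (cong (λ z → M₁ * z + M₂ * a + p * ((c + c) + (c + c))) (cong₂ _+_ (trans (CC.outs-count {t} yes′ ps complete) (sym r≡)) (trans (CC.ins-count {t} yes′ ps complete) (sym r≡))))))
            (≡≤ ((trans (cong suc (+-assoc (M₁ * (r + r)) (M₂ * a) _)) (sym (+-suc (M₁ * (r + r)) _))))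
              (+-monoʳ-≤ (M₁ * (r + r)) (≡≤ ((trans (sym (+-suc (M₂ * a) _)) (trans (+-comm (M₂ * a) M₂) (sym (*-suc M₂ a)))))
                (*-monoʳ-≤ M₂ (CC.any-count {t} yes′ ps complete))))))
          where
          a = length (chosen any ps (CC.c {t} yes′ ps complete))

change-roots : ∀ {flag n t} {d : Digraph n} {ν ν′ : Fin n → Bool} → (∀ v → ν v ≡ ν′ v) → CoreYes flag d ν t → CoreYes flag d ν′ t
change-roots e y = record
  { pick = pick ; pick⊆ = pick⊆ ; oriented = oriented ; small = small
  ; from-roots = λ v → let (r , nr , s) = from-roots v in r , (λ q → nr (subst T (sym (e r)) q)) , s
  ; to-roots = λ v → let (r , nr , s) = to-roots v in r , (λ q → nr (subst T (sym (e r)) q)) , s }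
  where open CoreYes y

module Decision (flag : Bool) {n : ℕ} {G : Graph n} (TD : TreeDecomposition G)
  (d : Digraph n) (d⊆G : ∀ u v → u ≢ v → T (d u v) → Adj G u v)
  (nonroot : Fin n → Bool) (t cap : ℕ) where

  private
    module V = Solver flag TD d d⊆G nonroot t cap
    module E = Expansion flag V.D {n}
    module A = Answers flag V.D d (at-rows d) V.νᵇ V.ps (simple-pairs n) (complete-pairs n)
      V.k V.c V.r t cap (few-pairs n) (boundOf-power n)

    marked : ∀ v → V.νᵇ (toℕ v) ≡ nonroot v
    marked = nth-tabulate false nonroot

    r≡ : V.r ≡ sumF {n} (λ v → ⌜ V.νᵇ (toℕ v) ⌝)
    r≡ = trans (trues-tab nonroot) (sumF-cong (λ v → cong ⌜_⌝ (sym (marked v))))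

    polynomial : Vec (List Bool) (V.p * 4) → List Bool
    polynomial ω = V.computed n (TreeDecomposition.nodes TD) V.p (E.recsOf V.ps ω)

    length-polynomial : ∀ ω → length (polynomial ω) ≡ V.K
    length-polynomial ω = trans (length-prodMsgs (range V.K) (TreeDecomposition.nodes TD)
      (Tables.messages flag V.K (n , V.D , V.bags , V.Ms , E.recsOf V.ps ω) V.ν (order V.A (range (TreeDecomposition.nodes TD)) (TreeDecomposition.nodes TD)))
      (Tables.zeros flag V.K (n , V.D , V.bags , V.Ms , E.recsOf V.ps ω) V.ν)) (length-range V.K)

  length-recsOf : ∀ (qs : Pairing {n}) (ω : Vec (List Bool) (length qs * 4)) → length (E.recsOf qs ω) ≡ length qs
  length-recsOf [] [] = refl
  length-recsOf (_ ∷ qs) (_ ∷ _ ∷ _ ∷ _ ∷ ω) = cong suc (length-recsOf qs ω)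

  opaque
    accepts : Vec (List Bool) (V.p * 4) → Bool
    accepts = A.accepts r≡ polynomial length-polynomial V.specified

    verdict-accepts : ∀ prepare M b ω →
      verdict flag prepare (rows d , tab nonroot , t , cap) (M , b , rows (adj (TreeDecomposition.tree TD)) , rows (λ x → lookup (TreeDecomposition.bag TD x))) (E.recsOf V.ps ω) ≡ accepts ω
    verdict-accepts prepare M b ω = trans (verdict-def flag prepare (V.D , V.ν , t , cap) (M , b , V.A , V.bags) (E.recsOf V.ps ω))
      (cong (anyL id) (V.computed-run prepare M b (E.recsOf V.ps ω) (length-recsOf V.ps ω)))

    accepts-sound : t ≤ cap → ∀ ω → T (accepts ω) → CoreYes flag d nonroot t
    accepts-sound t≤cap ω q = change-roots marked (A.accepts-sound r≡ polynomial length-polynomial V.specified t≤cap ω q)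

  module _ (toL : Vec Bool (bitsOf n) → List Bool) (toL-length : ∀ w → length (toL w) ≡ bitsOf n) (toL-injective : ∀ {a b} → toL a ≡ toL b → a ≡ b) where

    open Isolation {bitsOf n} using (sumΩ)

    opaque
      unfolding accepts
      rarely-rejected : CoreYes flag d nonroot t →
        4 * sumΩ (V.p * 4) (λ ω → ⌜ not (accepts (Vec.map toL ω)) ⌝) ≤ (2 ^ bitsOf n) ^ (V.p * 4)
      rarely-rejected yes′ = A.rarely-rejected r≡ polynomial length-polynomial V.specified toL toL-length toL-injective (change-roots (sym ∘ marked) yes′)

-- Random executions

-- In t steps every coin sequence leads to an end, and S sums over these,
-- each being reached by w sequences.
record Phase {k} (t w : ℕ) (γ : Config k) (S : (Config k → ℕ) → ℕ) : Set where
  constructor phase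
  field sums : ∀ f → sumV t (λ b → f (steps b γ)) ≡ w * S f
open Phase

sumV-++ : ∀ i j (f : Vec Bool (i + j) → ℕ) → sumV (i + j) f ≡ sumV i (λ a → sumV j (λ b → f (a Vec.++ b)))
sumV-++ zero j f = refl
sumV-++ (suc i) j f = cong₂ _+_ (sumV-++ i j _) (sumV-++ i j _)

module _ {k : ℕ} where

  private
    variable
      γ γ₀ γ₁ : Config k
      S S₀ S₁ : (Config k → ℕ) → ℕ
      t t′ w w′ : ℕ

  finished : Phase 0 1 γ (λ f → f γ)
  finished = phase λ f → sym (+-identityʳ _)

  flipped : (∀ b → step b γ ≡ (if b then γ₁ else γ₀)) → Phase t w γ₀ S₀ → Phase t w γ₁ S₁ → Phase (suc t) w γ (λ f → S₀ f + S₁ f)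
  flipped {t = t} {w} e p q = phase λ f → trans (cong₂ _+_
      (trans (sumV-cong t (λ b → cong (λ δ → f (steps b δ)) (e false))) (sums p f))
      (trans (sumV-cong t (λ b → cong (λ δ → f (steps b δ)) (e true))) (sums q f)))
    (sym (*-distribˡ-+ w _ _))

  -- A coin is supplied at every step, so each step that ignores it doubles the number of coin
  -- sequences leading to the same end.
  determined-by : γ ⟶[ t ] γ₁ → Phase t′ w γ₁ S → Phase (t + t′) (2 ^ t * w) γ S
  determined-by {t′ = t′} {w} done p = phase λ f → trans (sums p f) (cong (_* _) (sym (+-identityʳ w)))
  determined-by {t = suc t} {t′ = t′} {w} {S} (next e r) p = phase λ f → trans (cong₂ _+_
      (trans (sumV-cong (t + t′) (λ b → cong (λ δ → f (steps b δ)) (e false))) (sums (determined-by r p) f))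
      (trans (sumV-cong (t + t′) (λ b → cong (λ δ → f (steps b δ)) (e true))) (sums (determined-by r p) f)))
    (trans (sym (*-distribʳ-+ (S f) (2 ^ t * w) (2 ^ t * w))) (cong (_* S f) (trans (sym (*-distribʳ-+ w (2 ^ t) (2 ^ t)))
      (cong (λ z → (2 ^ t + z) * w) (sym (+-identityʳ (2 ^ t)))))))

  steps-++ : ∀ {i j} (a : Vec Bool i) (b : Vec Bool j) γ → steps (a Vec.++ b) γ ≡ steps {k} b (steps a γ)
  steps-++ [] b γ = refl
  steps-++ (x ∷ a) b γ = steps-++ a b (step x γ)

  phase-++ : ∀ {S′} → Phase t w γ S → (∀ f → S (λ δ → sumV t′ (λ b → f (steps b δ))) ≡ w′ * S′ f) → Phase (t + t′) (w * w′) γ S′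
  phase-++ {t} {w} {t′ = t′} {w′} {S′} p h = phase λ f → trans (sumV-++ t t′ _) (trans (sumV-cong t (λ a → sumV-cong t′ (λ b → cong f (steps-++ a b _))))
    (trans (sums p (λ δ → sumV t′ (λ b → f (steps b δ)))) (trans (cong (w *_) (h f)) (sym (*-assoc w w′ (S′ f))))))

  phase-cong : (∀ f → S f ≡ S₁ f) → Phase t w γ S → Phase t w γ S₁
  phase-cong {w = w} e p = phase λ f → trans (sums p f) (cong (w *_) (e f))

sumV-* : ∀ k c f → sumV k (λ v → c * f v) ≡ c * sumV k f
sumV-* zero c f = refl
sumV-* (suc k) c f = trans (cong₂ _+_ (sumV-* k c _) (sumV-* k c _)) (sym (*-distribˡ-+ c _ _))

-- The program: coins are tossed for all weights, the rest is deterministic.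

-- The tossing loop puts each new bit in front, so the coins arrive in reverse.
toL : ∀ {k} → Vec Bool k → List Bool
toL w = Vec.toList w ʳ++ []

pair : Ty
pair = nat ⊗ nat

spread : ℕ → List (El pair) → List (El rec) → (List (El rec) → ℕ) → ℕ
spread j [] acc f = f acc
spread j (p ∷ L) acc f = sumV j λ w₃ → sumV j λ w₂ → sumV j λ w₁ → sumV j λ w₀ →
  spread j L ((p , toL w₀ , toL w₁ , toL w₂ , toL w₃) ∷ acc) f

module Wrapper (coins : Tm poly (input ∷ []) (list pair ⊗ list bool)) (main : Tm free (input ∷ list rec ∷ []) bool) where

  Dv : ∀ {m} → Fin (4 + m)
  Dv = suc (suc (suc zero))
  PL : ∀ {m} → Fin (5 + m)
  PL = suc Dv
  KL : ∀ {m} → Fin (6 + m)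
  KL = suc PL
  X : ∀ {m} → Fin (7 + m)
  X = suc KL
  Tv : ∀ {m} → Fin (8 + m)
  Tv = suc X
  Cv : ∀ {m} → Fin (9 + m)
  Cv = suc Tv
  OUT : ∀ {m} → Fin (10 + m)
  OUT = suc Cv
  B : Fin 11
  B = suc OUT

  tossBody tossLoop chunk pairBody pairLoop start whole : Command 11
  tossBody = toss B ⨾ (X := cons (var B) (var X)) ⨾ (Tv := tl (var Tv)) ⨾ (B := nil)
  tossLoop = while (var Tv) tossBody
  chunk = (X := nil) ⨾ (Tv := var KL) ⨾ tossLoop
  pairBody = chunk ⨾ (Cv := var X) ⨾ chunk ⨾ (Cv := cons (var X) (var Cv)) ⨾ chunk ⨾ (Cv := cons (var X) (var Cv)) ⨾
    chunk ⨾ (Cv := cons (var X) (var Cv)) ⨾ (OUT := cons (cons (hd (var PL)) (var Cv)) (var OUT)) ⨾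
    (PL := tl (var PL)) ⨾ (X := nil) ⨾ (Cv := nil)
  pairLoop = while (var PL) pairBody
  start = (env := cons (var Dv) (cons (var OUT) nil)) ⨾ comp main
  whole = (Dv := var res) ⨾ (env := cons (var res) nil) ⨾ comp coins ⨾ (PL := hd (var res)) ⨾ (KL := tl (var res)) ⨾ pairLoop ⨾ start

  program : Program
  program = record { auxiliaries = 10 ; body = whole }

  module _ (r e s d : 𝔻) where

    conf : List (Command 11) → 𝔻 → 𝔻 → 𝔻 → 𝔻 → 𝔻 → 𝔻 → 𝔻 → Config 11
    conf cs pl kl x t c o b = cs , r ∷ e ∷ s ∷ d ∷ pl ∷ kl ∷ x ∷ t ∷ c ∷ o ∷ b ∷ []

    ticks′ : ℕ → 𝔻
    ticks′ j = enc (list bool) (replicate j false)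

    -- The counts are multiplicities: how many coin sequences lead to each outcome. They are the
    -- same for all outcomes, so the weights drawn are uniformly distributed, and they cancel in the
    -- probability.
    loopTime loopCount chunkTime chunkCount : ℕ → ℕ
    loopTime zero = 1
    loopTime (suc j) = 2 + suc (5 + loopTime j)
    loopCount zero = 2
    loopCount (suc j) = 2 ^ 2 * (2 ^ 5 * loopCount j)
    chunkTime j = 4 + loopTime j
    chunkCount j = 2 ^ 4 * loopCount j

    toss-phase : ∀ j {cs pl kl c o} xs → Phase (loopTime j) (loopCount j)
      (conf (tossLoop ∷ cs) pl kl (enc (list bool) xs) (ticks′ j) c o nil)
      (λ f → sumV j (λ w → f (conf cs pl kl (enc (list bool) (Vec.toList w ʳ++ xs)) nil c o nil)))
    toss-phase zero xs = determined-by (go done) finished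
    toss-phase (suc j) xs = determined-by (go (go done))
      (flipped {t = 5 + loopTime j} {w = 2 ^ 5 * loopCount j} (λ { false → refl ; true → refl })
        (determined-by (go (go (go (go (go done))))) (toss-phase j (false ∷ xs)))
        (determined-by (go (go (go (go (go done))))) (toss-phase j (true ∷ xs))))

    chunk-phase : ∀ {t′ w′} j {cs pl x t c o} {S : Vec Bool j → (Config 11 → ℕ) → ℕ} →
      (∀ w → Phase t′ w′ (conf cs pl (ticks′ j) (enc (list bool) (toL w)) nil c o nil) (S w)) →
      Phase (chunkTime j + t′) (chunkCount j * w′) (conf (chunk ∷ cs) pl (ticks′ j) x t c o nil) (λ f → sumV j (λ w → S w f))
    chunk-phase {t′} {w′} j {S = S} p = phase-++ {w = chunkCount j}
      (determined-by (go (go (go (go done)))) (toss-phase j []))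
      (λ f → trans (sumV-cong j (λ w → sums (p w) f)) (sumV-* j w′ (λ w → S w f)))

    pairsTime pairsCount : ℕ → ℕ → ℕ
    pairsTime j zero = 1
    pairsTime j (suc l) = 2 + (chunkTime j + (3 + (chunkTime j + (3 + (chunkTime j + (3 + (chunkTime j + (9 + pairsTime j l))))))))
    pairsCount j zero = 2
    pairsCount j (suc l) = 2 ^ 2 * (chunkCount j * (2 ^ 3 * (chunkCount j * (2 ^ 3 * (chunkCount j * (2 ^ 3 * (chunkCount j * (2 ^ 9 * pairsCount j l))))))))

    pairs-phase : ∀ j L acc {cs} → Phase (pairsTime j (length L)) (pairsCount j (length L))
      (conf (pairLoop ∷ cs) (enc (list pair) L) (ticks′ j) nil nil nil (enc (list rec) acc) nil)
      (λ f → spread j L acc (λ rs → f (conf cs nil (ticks′ j) nil nil nil (enc (list rec) rs) nil)))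
    pairs-phase j [] acc = determined-by (go done) finished
    pairs-phase j (p ∷ L) acc = determined-by (go (go done))
      (chunk-phase j λ w₃ → determined-by (go (go (go done)))
      (chunk-phase j λ w₂ → determined-by (go (go (go done)))
      (chunk-phase j λ w₁ → determined-by (go (go (go done)))
      (chunk-phase j λ w₀ → determined-by (go (go (go (go (go (go (go (go (go done)))))))))
      (pairs-phase j L ((p , toL w₀ , toL w₁ , toL w₂ , toL w₃) ∷ acc))))))

  module _ (i : El input) (j : ℕ) (L : List (El pair)) (tossed : ⟦ coins ⟧ᵗ (i , tt) ≡ (L , replicate j false)) where

    private
      d e : 𝔻
      d = enc input i
      e = encEnv (input ∷ []) (i , tt)

    -- The end of the random part
    drawn : List (El rec) → Config 11
    drawn rs = conf (enc (list pair ⊗ list bool) (L , replicate j false)) e nil d (start ∷ []) nil (ticks′ nil nil nil nil j) nil nil nil (enc (list rec) rs) nil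

    drawTime drawCount : ℕ
    drawTime = 5 + (cost coins (i , tt) + (5 + pairsTime nil nil nil nil j (length L)))
    drawCount = 2 ^ 5 * (2 ^ cost coins (i , tt) * (2 ^ 5 * pairsCount nil nil nil nil j (length L)))

    draw-phase : Phase drawTime drawCount (initial program d) (λ f → spread j L [] (f ∘ drawn))
    draw-phase = determined-by (go (go (go (go (go done)))))
      (determined-by listing (determined-by (go (go (go (go (go done))))) (pairs-phase _ _ _ _ j L [])))
      where
      σ : Vec 𝔻 8
      σ = d ∷ nil ∷ nil ∷ nil ∷ nil ∷ nil ∷ nil ∷ nil ∷ []
      cs : List (Command 11)
      cs = ((PL := hd (var res)) ⨾ (KL := tl (var res)) ⨾ pairLoop ⨾ start) ∷ []
      listing : (comp coins ∷ cs , store d e nil σ) ⟶[ cost coins (i , tt) ] (cs , store (enc (list pair ⊗ list bool) (L , replicate j false)) e nil σ)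
      listing = subst (λ v → (comp coins ∷ cs , store d e nil σ) ⟶[ cost coins (i , tt) ] (cs , store (enc (list pair ⊗ list bool) v) e nil σ))
        tossed (comp-ok coins (i , tt))

    main-run : ∀ rs → drawn rs ⟶[ 2 + cost main (i , rs , tt) ] ([] , bit (⟦ main ⟧ᵗ (i , rs , tt)) ∷ _)
    main-run rs = go (go (comp-ok main (i , rs , tt)))

sumV-swap : ∀ j k (f : Vec Bool j → Vec Bool k → ℕ) → sumV j (λ a → sumV k (f a)) ≡ sumV k (λ b → sumV j (λ a → f a b))
sumV-swap zero k f = refl
sumV-swap (suc j) k f = trans (cong₂ _+_ (sumV-swap j k _) (sumV-swap j k _)) (sym (sumV-+ k _ _))

module _ {j : ℕ} where

  open Isolation {j} using (Ω; sumΩ)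

  private
    Σ₄ : (Vec Bool j → Vec Bool j → Vec Bool j → Vec Bool j → ℕ) → ℕ
    Σ₄ F = sumV j λ w₀ → sumV j λ w₁ → sumV j λ w₂ → sumV j λ w₃ → F w₀ w₁ w₂ w₃

    Σ₄-reverse : ∀ F → (sumV j λ w₃ → sumV j λ w₂ → sumV j λ w₁ → sumV j λ w₀ → F w₀ w₁ w₂ w₃) ≡ Σ₄ F
    Σ₄-reverse F = trans (sumV-cong j λ w₃ → trans (sumV-cong j λ w₂ → sumV-swap j j (λ w₁ w₀ → F w₀ w₁ w₂ w₃))
        (trans (sumV-swap j j _) (sumV-cong j λ w₀ → sumV-swap j j _)))
      (trans (sumV-swap j j _) (sumV-cong j λ w₀ → trans (sumV-swap j j _) (sumV-cong j λ w₁ → sumV-swap j j _)))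

    Σ₄-cong : ∀ {F G} → (∀ a b c d → F a b c d ≡ G a b c d) → Σ₄ F ≡ Σ₄ G
    Σ₄-cong h = sumV-cong j λ a → sumV-cong j λ b → sumV-cong j λ c → sumV-cong j λ d → h a b c d

  weightings : List (El pair) → (List (El rec) → ℕ) → ℕ
  weightings [] g = g []
  weightings (p ∷ P) g = Σ₄ λ w₀ w₁ w₂ w₃ → weightings P (λ rs → g ((p , toL w₀ , toL w₁ , toL w₂ , toL w₃) ∷ rs))

  weightings-sumV : ∀ P (g : Vec Bool j → List (El rec) → ℕ) → weightings P (λ rs → sumV j (λ w → g w rs)) ≡ sumV j (λ w → weightings P (g w))
  weightings-sumV [] g = refl
  weightings-sumV (p ∷ P) g = trans (Σ₄-cong λ a b c d → weightings-sumV P _)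
    (trans (sumV-cong j λ a → trans (sumV-cong j λ b → trans (sumV-cong j λ c → sumV-swap j j _) (sumV-swap j j _)) (sumV-swap j j _)) (sumV-swap j j _))

  weightings-cong : ∀ P {g h} → (∀ rs → g rs ≡ h rs) → weightings P g ≡ weightings P h
  weightings-cong [] e = e []
  weightings-cong (p ∷ P) e = Σ₄-cong λ a b c d → weightings-cong P (λ rs → e _)

  -- The loop runs through the pairs in reverse and draws the four weights of a pair in reverse. As
  -- the sums over the weights commute, this is the uniform sum over all weightings in the natural
  -- order.
  spread-weightings : ∀ L P g → weightings P (λ acc → spread j L acc g) ≡ weightings (L ʳ++ P) g
  spread-weightings [] P g = refl
  spread-weightings (p ∷ L) P g = trans (trans (weightings-cong P (λ acc → Σ₄-reverse _))
      (trans (weightings-sumV P _) (sumV-cong j λ w₀ → trans (weightings-sumV P _) (sumV-cong j λ w₁ →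
        trans (weightings-sumV P _) (sumV-cong j λ w₂ → weightings-sumV P _)))))
    (spread-weightings L (p ∷ P) g)

  module _ (flag : Bool) (D : El mat) {n : ℕ} where

    open Expansion flag D {n} using (recsOf)

    weightings-Ω : ∀ (qs : Pairing {n}) g → weightings (mapL toℕ² qs) g ≡ sumΩ (length qs * 4) (λ ω → g (recsOf qs (Vec.map toL ω)))
    weightings-Ω [] g = refl
    weightings-Ω (q ∷ qs) g = Σ₄-cong λ a b c d → weightings-Ω qs _

    spread-Ω : ∀ (qs : Pairing {n}) g → spread j (reverse (mapL toℕ² qs)) [] g ≡ sumΩ (length qs * 4) (λ ω → g (recsOf qs (Vec.map toL ω)))
    spread-Ω qs g = trans (spread-weightings (reverse (mapL toℕ² qs)) [] g)
      (trans (cong (λ P → weightings P g) (reverse-involutive (mapL toℕ² qs))) (weightings-Ω qs g))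

  sumΩ-cong : ∀ M {f g : Ω M → ℕ} → (∀ ω → f ω ≡ g ω) → sumΩ M f ≡ sumΩ M g
  sumΩ-cong zero h = h []
  sumΩ-cong (suc M) h = sumV-cong j (λ w → sumΩ-cong M (λ ω → h (w ∷ ω)))

-- From sums over coin sequences to probabilities

sumV-0 : ∀ k f → sumV k f ≡ 0 → ∀ v → f v ≡ 0
sumV-0 zero f e [] = e
sumV-0 (suc k) f e (false ∷ v) = sumV-0 k _ (m+n≡0⇒m≡0 _ e) v
sumV-0 (suc k) f e (true ∷ v) = sumV-0 k _ (m+n≡0⇒n≡0 (sumV k (f ∘ (false ∷_))) e) v

count-sumV : ∀ k f → count k f ≡ sumV k (⌜_⌝ ∘ f)
count-sumV zero f with f []
... | true = refl
... | false = refl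
count-sumV (suc k) f = cong₂ _+_ (count-sumV k _) (count-sumV k _)

steps-halted : ∀ {k m} (b : Vec Bool m) (σ : Store k) → steps b ([] , σ) ≡ ([] , σ)
steps-halted [] σ = refl
steps-halted (x ∷ b) σ = steps-halted b σ

steps-⟶ : ∀ {k t m} {γ : Config k} {σ} → γ ⟶[ t ] ([] , σ) → t ≤ m → (b : Vec Bool m) → steps b γ ≡ ([] , σ)
steps-⟶ done l b = steps-halted b _
steps-⟶ (next e r) (s≤s l) (x ∷ b) = trans (cong (steps b) (e x)) (steps-⟶ r l b)

module Counting {j M t₁ w T₂ q : ℕ} {γ : Config (suc q)} (ends : Isolation.Ω {j} M → Config (suc q))
  (drawing : Phase t₁ w γ (λ f → Isolation.sumΩ {j} M (f ∘ ends))) (acc : Isolation.Ω {j} M → Bool)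
  (ending : ∀ ω → ∃[ t ] ∃[ σ ] (ends ω ⟶[ t ] ([] , σ) × t ≤ T₂ × isTrue (lookup σ zero) ≡ acc ω)) where

  open Isolation {j}

  private
    after : (Config (suc q) → ℕ) → Config (suc q) → ℕ
    after f δ = sumV T₂ (λ b → f (steps b δ))

    whole-sum : ∀ f → sumV (t₁ + T₂) (λ b → f (steps b γ)) ≡ w * sumΩ M (λ ω → after f (ends ω))
    whole-sum f = trans (sumV-++ t₁ T₂ (λ b → f (steps b γ))) (trans (sumV-cong t₁ {g = λ a → after f (steps a γ)} (λ a → sumV-cong T₂ (λ b → cong f (steps-++ {i = t₁} {j = T₂} a b γ)))) (sums drawing (after f)))

    unhalted : Config (suc q) → ℕ
    unhalted ([] , _) = 0
    unhalted (_ ∷ _ , _) = 1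

    halted : ∀ γ → unhalted γ ≡ 0 → Halted γ
    halted ([] , _) _ = refl

  -- The indicator of not having halted sums to zero over all coin sequences, and a vanishing sum of
  -- natural numbers has vanishing terms. No tracing of individual sequences is needed.
  halts : ∀ (b : Vec Bool (t₁ + T₂)) → Halted (steps b γ)
  halts b = halted (steps b γ) (sumV-0 (t₁ + T₂) (λ b → unhalted (steps b γ)) (trans (whole-sum unhalted)
    (trans (cong (w *_) (trans (sumΩ-cong M (λ ω → let (t , σ , r , l , _) = ending ω in
        trans (sumV-cong T₂ (λ b → cong unhalted (steps-⟶ r l b))) (trans (sumV-const T₂ 0) (*-zeroʳ (2 ^ T₂)))))
      (trans (sumΩ-const M 0) (*-zeroʳ ((2 ^ j) ^ M))))) (*-zeroʳ w))) b)

  scale : ℕ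
  scale = w * 2 ^ T₂

  counted : ∀ (g : Bool → Bool) → count (t₁ + T₂) (λ b → g (answer (steps b γ))) ≡ scale * sumΩ M (λ ω → ⌜ g (acc ω) ⌝)
  counted g = trans (count-sumV (t₁ + T₂) _) (trans (whole-sum (λ δ → ⌜ g (answer δ) ⌝))
    (trans (cong (w *_) (trans (sumΩ-cong M (λ ω → let (t , σ , r , l , e) = ending ω in
        trans (sumV-cong T₂ (λ b → cong (λ δ → ⌜ g (answer δ) ⌝) (steps-⟶ r l b)))
          (trans (sumV-const T₂ _) (cong (λ x → 2 ^ T₂ * ⌜ g x ⌝) e)))) (sumΩ-scale M (2 ^ T₂) (λ ω → ⌜ g (acc ω) ⌝))))
      (sym (*-assoc w (2 ^ T₂) _))))
    where
    sumΩ-scale : ∀ M c f → sumΩ M (λ ω → c * f ω) ≡ c * sumΩ M f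
    sumΩ-scale zero c f = refl
    sumΩ-scale (suc M) c f = trans (sumV-cong j (λ v → sumΩ-scale M c _)) (sumV-* j c _)

  sequences : 2 ^ (t₁ + T₂) ≡ scale * (2 ^ j) ^ M
  sequences = trans (sym (trans (count-sumV (t₁ + T₂) (λ _ → true)) (trans (sumV-const (t₁ + T₂) 1) (*-identityʳ _))))
    (trans (counted (λ _ → true)) (cong (scale *_) (trans (sumΩ-const M 1) (*-identityʳ _))))

  -- Favourable and unfavourable weightings add up to all of them, so if at most a quarter is
  -- unfavourable, at least three quarters are favourable; the multiplicity `scale` is a common
  -- factor. With `g` the identity or the negation this serves both kinds of instances.
  frequent : ∀ (g : Bool → Bool) → 4 * sumΩ M (λ ω → ⌜ not (g (acc ω)) ⌝) ≤ (2 ^ j) ^ M →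
    3 * 2 ^ (t₁ + T₂) ≤ 4 * count (t₁ + T₂) (λ b → g (answer (steps b γ)))
  frequent g rare = ≡≤ ((trans (cong (3 *_) sequences) (exchange 3 scale N))) (≤≡ (*-monoʳ-≤ scale most)
    (trans (sym (exchange 4 scale good)) (cong (4 *_) (sym (counted g)))))
    where
    N good bad : ℕ
    N = (2 ^ j) ^ M
    good = sumΩ M (λ ω → ⌜ g (acc ω) ⌝)
    bad = sumΩ M (λ ω → ⌜ not (g (acc ω)) ⌝)
    exchange : ∀ a b c → a * (b * c) ≡ b * (a * c)
    exchange a b c = trans (sym (*-assoc a b c)) (trans (cong (_* c) (*-comm a b)) (*-assoc b a c))
    split : good + bad ≡ N
    split = trans (sym (sumΩ-+ M (λ ω → ⌜ g (acc ω) ⌝) (λ ω → ⌜ not (g (acc ω)) ⌝)))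
      (trans (sumΩ-cong M (λ ω → one (g (acc ω)))) (trans (sumΩ-const M 1) (*-identityʳ N)))
      where
      one : ∀ b → ⌜ b ⌝ + ⌜ not b ⌝ ≡ 1
      one false = refl
      one true = refl
    most : 3 * N ≤ 4 * good
    most = +-cancelʳ-≤ N (3 * N) (4 * good) (≡≤ ((trans (+-comm (3 * N) N)
      (trans (cong (4 *_) (sym split)) (*-distribˡ-+ 4 good bad)))) (+-monoʳ-≤ (4 * good) rare))

Pr-≥¾ : ∀ m f → 3 * 2 ^ m ≤ 4 * count m f → (ℤ.+ 3 / 4) ℚ.≤ Pr m f
Pr-≥¾ m f h = at-least (count m f) (2 ^ m) {{m^n≢0 2 m}} h
  where
  at-least : ∀ c d .{{_ : NonZero d}} → 3 * d ≤ 4 * c → (ℤ.+ 3 / 4) ℚ.≤ (ℤ.+ c / d)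
  at-least c d@(suc d-1) h = ℚₚ.toℚᵘ-cancel-≤ (ℚᵘₚ.≤-respˡ-≃ (ℚᵘₚ.≃-sym (ℚₚ.toℚᵘ-fromℚᵘ (ℚᵘ.mkℚᵘ (ℤ.+ 3) 3)))
    (ℚᵘₚ.≤-respʳ-≃ (ℚᵘₚ.≃-sym (ℚₚ.toℚᵘ-fromℚᵘ (ℚᵘ.mkℚᵘ (ℤ.+ c) d-1)))
      (ℚᵘ.*≤* (subst₂ ℤ._≤_ (ℤₚ.pos-* 3 d) (trans (cong ℤ.+_ (*-comm 4 c)) (ℤₚ.pos-* c 4)) (ℤ.+≤+ h)))))

record Execution (P : Program) (Yes : Set) (code : 𝔻) (N : ℕ) : Set where
  open Program P
  field
    j M t₁ T₂ w : ℕ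
  open Isolation {j} using (Ω; sumΩ)
  field
    ends : Ω M → Config (suc auxiliaries)
    drawing : Phase t₁ w (initial P code) (λ f → sumΩ M (f ∘ ends))
    acc : Ω M → Bool
    ending : ∀ ω → ∃[ t ] ∃[ σ ] (ends ω ⟶[ t ] ([] , σ) × t ≤ T₂ × isTrue (lookup σ zero) ≡ acc ω)
    bounded-time : t₁ + T₂ ≤ N
    rare : Yes → 4 * sumΩ M (λ ω → ⌜ not (acc ω) ⌝) ≤ (2 ^ j) ^ M
    sound : ∀ ω → T (acc ω) → Yes

  module Co = Counting {w = w} ends drawing acc ending

  duration : ℕ
  duration = t₁ + T₂

  likely-yes : Yes → (ℤ.+ 3 / 4) ℚ.≤ Pr duration (λ b → answer (run P code b))
  likely-yes yes′ = Pr-≥¾ duration _ (Co.frequent id (rare yes′))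

  likely-no : ¬ Yes → (ℤ.+ 3 / 4) ℚ.≤ Pr duration (λ b → not (answer (run P code b)))
  likely-no no′ = Pr-≥¾ duration _ (Co.frequent not (≡≤ ((cong (4 *_)
    (trans (sumΩ-cong M (λ ω → cong (λ b → ⌜ not (not b) ⌝) (¬T→false (λ a → no′ (sound ω a))))) (trans (Isolation.sumΩ-const M 0) (*-zeroʳ ((2 ^ j) ^ M)))))) z≤n))

monteCarlo : ∀ {I : Set} {Yes : I → Set} {encode : I → 𝔻} {P : Program} {N : I → ℕ} (E : ∀ i → Execution P (Yes i) (encode i) (N i)) →
  IsMonteCarlo Yes encode P (λ i → Execution.duration (E i))
monteCarlo E = record
  { halts = λ i → Execution.Co.halts (E i)
  ; success = ℤ.+ 3 / 4
  ; success>½ = ℚ.*<* (ℤ.+<+ (m≤m+n 5 1))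
  ; correct-yes = λ i → Execution.likely-yes (E i)
  ; correct-no = λ i → Execution.likely-no (E i)
  }

-- Sizes of inputs and the number of states at a node

W-list : ∀ A → (∀ a → W (size (enc A a)) A a) → ∀ xs → W (size (enc (list A) xs)) (list A) xs
W-list A h [] = z≤n , []
W-list A h (x ∷ xs) = let (l , ws) = W-list A h xs ; s = size (enc A x) ; r = size (enc (list A) xs) in
  s≤s (≤-trans l (m≤n+m r s)) , W-mono (≤-trans (m≤m+n s r) (n≤1+n _)) A (h x) ∷ All.map (W-mono (≤-trans (m≤n+m r s) (n≤1+n _)) A) ws

W-pair : ∀ A B {a b} → W (size (enc A a)) A a → W (size (enc B b)) B b → W (size (enc (A ⊗ B) (a , b))) (A ⊗ B) (a , b)
W-pair A B {a} {b} wa wb = let s = size (enc A a) ; r = size (enc B b) in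
  W-mono (≤-trans (m≤m+n s r) (n≤1+n _)) A wa , W-mono (≤-trans (m≤n+m r s) (n≤1+n _)) B wb

W-bits : ∀ bs → W (size (enc (list bool) bs)) (list bool) bs
W-bits = W-list bool (λ _ → tt)

W-input : ∀ i → W (size (enc input i)) input i
W-input (M , (b , bs) , A , B) = W-pair mat ((bool ⊗ list bool) ⊗ mat ⊗ mat) (W-list (list bool) W-bits M)
  (W-pair (bool ⊗ list bool) (mat ⊗ mat) (W-pair bool (list bool) tt (W-bits bs))
    (W-pair mat mat (W-list (list bool) W-bits A) (W-list (list bool) W-bits B)))

bitsOf-≤ : ∀ n → bitsOf n ≤ 4 + (4 * n)
bitsOf-≤ n = +-monoʳ-≤ 4 (≤≡ (+-mono-≤ l l) (solve 1 (λ n → (n :+ n) :+ (n :+ n) :≡ lit 4 :* n) refl n))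
  where
  bounds : ∀ j → let r = foldr (λ _ → lgStep n) (1 , 0) (replicate {A = Bool} j false) in proj₂ r < proj₁ r × proj₁ r ≤ suc (n + n)
  bounds zero = s≤s z≤n , s≤s z≤n
  bounds (suc j) = lgStep-bound n (proj₁ (bounds j)) (proj₂ (bounds j))
  l : proj₂ (lg n) ≤ n + n
  l = ℕ.s≤s⁻¹ (≤-trans (proj₁ (bounds n)) (proj₂ (bounds n)))

toL-length : ∀ {k} (w : Vec Bool k) → length (toL w) ≡ k
toL-length {k} w = trans (Listₚ.length-reverse (Vec.toList w)) (length-toList w)
  where
  length-toList : ∀ {k} (w : Vec Bool k) → length (Vec.toList w) ≡ k
  length-toList [] = refl
  length-toList (b ∷ w) = cong suc (length-toList w)

toL-injective : ∀ {k} {a b : Vec Bool k} → toL a ≡ toL b → a ≡ b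
toL-injective e = toList-injective _ _ (Listₚ.reverse-injective e)
  where
  toList-injective : ∀ {k} (a b : Vec Bool k) → Vec.toList a ≡ Vec.toList b → a ≡ b
  toList-injective [] [] e = refl
  toList-injective (x ∷ a) (y ∷ b) e = cong₂ _∷_ (Listₚ.∷-injectiveˡ e) (toList-injective a b (Listₚ.∷-injectiveʳ e))

module _ {n N : ℕ} (bag : Fin N → Subset n) (m : ℕ) (small : ∀ x → ∣ bag x ∣ ≤ m) where

  private
    B : List (List Bool)
    B = rows (λ x → lookup (bag x))

    inBag : ℕ → ℕ → ℕ
    inBag x v = ⌜ at B x v ⌝

    card : ∀ {n} (s : Subset n) → sumF (λ v → ⌜ lookup s v ⌝) ≡ ∣ s ∣
    card [] = refl
    card (false ∷ s) = card s
    card (true ∷ s) = cong suc (card s)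

    none : ∀ (us : List ℕ) → sumL (λ v → ⌜ nth false v [] ⌝) us ≡ 0
    none [] = refl
    none (u ∷ us) = none us

    block≤ : ∀ x → sumL (inBag x) (range n) ≤ m
    block≤ x with x <? N
    ... | yes l with Fin.fromℕ< l | Finₚ.toℕ-fromℕ< l
    ... | y | refl = ≡≤ ((trans (cong (sumL (inBag (toℕ y))) (range-toℕ n)) (trans (sumL-map (inBag (toℕ y)) toℕ (allFin n))
      (trans (sumL-tabulate {n = n} (inBag (toℕ y) ∘ toℕ) id) (trans (sumF-cong {n} (λ v → cong ⌜_⌝ (at-rows (λ x → lookup (bag x)) y v))) (card (bag y))))))) (small y)
    block≤ x | no ¬l = ≡≤ (sumL-none (range n)) z≤n
      where
      sumL-none : ∀ us → sumL (inBag x) us ≡ 0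
      sumL-none [] = refl
      sumL-none (u ∷ us) = cong₂ _+_ (cong ⌜_⌝ (¬T→false (λ t → ¬l (proj₁ (rows-< (λ x → lookup (bag x)) x u t))))) (sumL-none us)

    bits≤ : ∀ ν x p us → trues (kept us ν B x p) + trues (summed us ν B x p) ≤ sumL (inBag x) us
    bits≤ ν x p [] = z≤n
    bits≤ ν x p (u ∷ us) with nth false u ν | at B x u | at B p u | bits≤ ν x p us
    ... | false | b | c | h = ≤-trans h (m≤n+m _ ⌜ b ⌝)
    ... | true | false | c | h = h
    ... | true | true | false | h = ≡≤ (+-suc _ _) (s≤s h)
    ... | true | true | true | h = s≤s h

  -- A vertex outside the bag contributes nothing. A vertex in the bag has four bits, each of which
  -- is kept or summed but not both, so the two exponents add up to at most `4 * m`.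
  states≤ : ∀ ν x p → 2 ^ trues (kept (vertices4 n) ν B x p) * 2 ^ trues (summed (vertices4 n) ν B x p) ≤ 16 ^ m
  states≤ ν x p = ≡≤ ((sym (^-distribˡ-+-* 2 (trues (kept (vertices4 n) ν B x p)) _)))
    (≤≡ (^-monoʳ-≤ 2 (≤-trans (bits≤ ν x p (vertices4 n)) four)) (sym (^-*-assoc 2 4 m)))
    where
    r = range n
    four : sumL (inBag x) (vertices4 n) ≤ 4 * m
    four = ≡≤ ((trans (sumL-++ (inBag x) r _) (cong (sumL (inBag x) r +_) (trans (sumL-++ (inBag x) r _)
      (cong (sumL (inBag x) r +_) (sumL-++ (inBag x) r r))))))
      (+-mono-≤ (block≤ x) (+-mono-≤ (block≤ x) (+-mono-≤ (block≤ x) (≤≡ (block≤ x) (sym (+-identityʳ m))))))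

-- From a reduction to the core problem to a Monte Carlo algorithm

record Reduction (flag : Bool) (prepare : Fn (input ∷ []) prepared) (Yes : Set) (code : 𝔻) (w : ℕ) : Set where
  field
    {n} : ℕ
    {G} : Graph n
    TD : TreeDecomposition G
    matrix : Digraph n
    integer : El (bool ⊗ list bool)
    d : Digraph n
    d⊆G : ∀ u v → u ≢ v → T (d u v) → Adj G u v
    nonroot : Fin n → Bool
    t cap : ℕ
    t≤cap : t ≤ cap

  open TreeDecomposition TD using (bag; width) renaming (tree to links) public

  instanceOf : El input
  instanceOf = rows matrix , integer , rows (adj links) , rows (λ x → lookup (bag x))

  field
    encoded : code ≡ enc input instanceOf
    w≡ : w ≡ width
    prepares : Fn.sem prepare (instanceOf , tt) ≡ (rows d , tab nonroot , t , cap)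
    forwards : Yes → CoreYes flag d nonroot t
    backwards : CoreYes flag d nonroot t → Yes

opaque
  -- A common bound for all parameters of an input of size `z`: there are at most `z * z` pairs and
  -- at most `4 + 4 * z` bits per weight, and the base of the powers has to be at least 2.
  inflated : ℕ → ℕ
  inflated z = 16 * (z * z)

  inflated-def : ∀ z → inflated z ≡ 16 * (z * z)
  inflated-def z = refl

  inflated-≥ : ∀ {z} → 1 ≤ z → z * z ≤ inflated z × z ≤ inflated z × 2 ≤ inflated z × 4 + 4 * z ≤ inflated z
  inflated-≥ {z} 1≤z = z² , ≤-trans z≤z² z² , ≤-trans (m≤m+n 2 14) (*-monoʳ-≤ 16 (*-mono-≤ 1≤z 1≤z)) ,
    ≤-trans (+-monoˡ-≤ (4 * z) (*-monoʳ-≤ 4 1≤z)) (≡≤ (sym (*-distribʳ-+ z 4 4)) (*-mono-≤ (m≤m+n 8 8) z≤z²))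
    where
    z² : z * z ≤ 16 * (z * z)
    z² = m≤m+n (z * z) _
    z≤z² : z ≤ z * z
    z≤z² = ≡≤ (sym (*-identityʳ z)) (*-monoʳ-≤ z 1≤z)

module Solved (flag : Bool) (prepare : Fn (input ∷ []) prepared) where

  coinsT : Tm poly (input ∷ []) (list pair ⊗ list bool)
  coinsT = sealed (Fn.term coinsF)

  mainT : Tm free (input ∷ list rec ∷ []) bool
  mainT = sealed! (solveX flag prepare)

  module Wr = Wrapper coinsT mainT

  deg-main deg-coins : ℕ
  deg-main = proj₁ (solveX-cost flag prepare)
  deg-coins = costDeg (bound coinsT)

  bound-main : ∀ s E i rs → 2 ≤ s → 1 ≤ E → W s input i → W s (list rec) rs →
    (∀ x p → nodeStates flag prepare i rs (x , p) ≤ E) → cost mainT (i , rs , tt) ≤ s ^ deg-main * E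
  bound-main s E i rs h 1≤E wi wrs le = ≡≤ (sealed!-cost (solveX flag prepare) (i , rs , tt))
    (unE (proj₂ (solveX-cost flag prepare) s E i rs h 1≤E wi wrs (All.universal (λ (x , p) → le x p) _)))

  firstTime : ℕ → ℕ
  firstTime s = 5 + (s ^ deg-coins + (5 + (1 + s * (20 + 4 * (4 + (1 + 8 * s))))))

  lastTime : ℕ → ℕ → ℕ
  lastTime s w = 2 + s ^ deg-main * 16 ^ suc w

  firstTime-≥ : ∀ {s c l j} → c ≤ s ^ deg-coins → l ≤ s → j ≤ s → 5 + (c + (5 + (1 + l * (20 + 4 * (4 + (1 + 8 * j)))))) ≤ firstTime s
  firstTime-≥ p q r = +-monoʳ-≤ 5 (+-mono-≤ p (+-monoʳ-≤ 5 (+-monoʳ-≤ 1 (*-mono-≤ q (+-monoʳ-≤ 20 (*-monoʳ-≤ 4 (+-monoʳ-≤ 5 (*-monoʳ-≤ 8 r))))))))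

  lastTime-≥ : ∀ {s c w} → c ≤ s ^ deg-main * 16 ^ suc w → 2 + c ≤ lastTime s w
  lastTime-≥ = +-monoʳ-≤ 2

  loopTime≡ : ∀ j → Wr.loopTime nil nil nil nil j ≡ 1 + 8 * j
  loopTime≡ zero = refl
  loopTime≡ (suc j) = trans (cong (8 +_) (loopTime≡ j)) (cong suc (sym (*-suc 8 j)))

  pairsTime≡ : ∀ j l → Wr.pairsTime nil nil nil nil j l ≡ 1 + l * (20 + 4 * (4 + (1 + 8 * j)))
  pairsTime≡ j l = trans (chunks l) (cong (λ c → 1 + l * (20 + 4 * (4 + c))) (loopTime≡ j))
    where
    c : ℕ
    c = Wr.chunkTime nil nil nil nil j
    around : ℕ → ℕ → ℕ
    around c t = 2 + (c + (3 + (c + (3 + (c + (3 + (c + (9 + t))))))))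
    around≡ : ∀ c t l → t ≡ 1 + l * (20 + 4 * c) → around c t ≡ 1 + suc l * (20 + 4 * c)
    around≡ c .(1 + l * (20 + 4 * c)) l refl = solve 2 (λ c x →
      lit 2 :+ (c :+ (lit 3 :+ (c :+ (lit 3 :+ (c :+ (lit 3 :+ (c :+ (lit 9 :+ (lit 1 :+ x))))))))) :≡ lit 1 :+ ((lit 20 :+ lit 4 :* c) :+ x)) refl c (l * (20 + 4 * c))
    chunks : ∀ l → Wr.pairsTime nil nil nil nil j l ≡ 1 + l * (20 + 4 * c)
    chunks zero = refl
    chunks (suc l) = around≡ c (Wr.pairsTime nil nil nil nil j l) l (chunks l)

  module _ {Yes code w} (R : Reduction flag prepare Yes code w) where

    open Reduction R

    module Dc = Decision flag TD d d⊆G nonroot t cap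
    module E = Expansion flag (rows d) {n}
    j M : ℕ
    j = bitsOf n
    M = length (allPairs n) * 4
    s : ℕ
    s = inflated (size code)
    open Isolation {j} using (Ω; sumΩ)

    L : List (El pair)
    L = reverse (mapL toℕ² (allPairs n))

    length-L : length L ≡ length (allPairs n)
    length-L = trans (Listₚ.length-reverse (mapL toℕ² (allPairs n))) (length-mapL toℕ² (allPairs n))

    recsAt : Ω M → List (El rec)
    recsAt ω = E.recsOf (allPairs n) (Vec.map toL ω)

    n≡ : length (rows matrix) ≡ n
    n≡ = Listₚ.length-tabulate (λ u → tab (matrix u))

    tossed : ⟦ coinsT ⟧ᵗ (instanceOf , tt) ≡ (L , replicate j false)
    tossed = trans (sealed-sem (Fn.term coinsF) (instanceOf , tt)) (trans (Fn.correct coinsF (instanceOf , tt))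
      (trans (cong (λ m → reverse (pairsFrom (range m) (range m)) , replicate (bitsOf m) false) n≡)
        (cong (λ P → reverse P , replicate j false) (pairsFrom-allPairs n))))

    sz : ℕ
    sz = size code
    W-code : W sz input instanceOf
    W-code = subst (λ c → W (size c) input instanceOf) (sym encoded) (W-input instanceOf)
    n≤sz : n ≤ sz
    n≤sz = ≡≤ (sym n≡) (proj₁ (proj₁ W-code))
    size≥1 : ∀ c → 1 ≤ size c
    size≥1 nil = s≤s z≤n
    size≥1 (_ ∙ _) = s≤s z≤n
    sz² : sz * sz ≤ s
    sz² = proj₁ (inflated-≥ (size≥1 code))
    sz≤s : sz ≤ s
    sz≤s = proj₁ (proj₂ (inflated-≥ (size≥1 code)))
    h : 2 ≤ s
    h = proj₁ (proj₂ (proj₂ (inflated-≥ (size≥1 code))))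
    j≤s : j ≤ s
    j≤s = ≤-trans (bitsOf-≤ n) (≤-trans (+-monoʳ-≤ 4 (*-monoʳ-≤ 4 n≤sz)) (proj₂ (proj₂ (proj₂ (inflated-≥ (size≥1 code))))))
    p≤s : length (allPairs n) ≤ s
    p≤s = ≤-trans (length-allPairs n) (≤-trans (*-mono-≤ n≤sz n≤sz) sz²)

    W-recs : ∀ (qs : Pairing {n}) (ω : Ω (length qs * 4)) → length qs ≤ s → W s (list rec) (E.recsOf qs (Vec.map toL ω))
    W-recs qs ω l = ≡≤ (Dc.length-recsOf qs (Vec.map toL ω)) l , go′ qs ω
      where
      fine : (w : Vec Bool j) → W s (list bool) (toL w)
      fine w = list-W (toL w) (≡≤ (toL-length w) j≤s)
      vertex : (v : Fin n) → toℕ v ≤ s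
      vertex v = ≤-trans (<⇒≤ (toℕ<n v)) (≤-trans n≤sz sz≤s)
      go′ : ∀ (qs : Pairing {n}) (ω : Ω (length qs * 4)) → All (W s rec) (E.recsOf qs (Vec.map toL ω))
      go′ [] [] = []
      go′ ((u , v) ∷ qs) (w₀ ∷ w₁ ∷ w₂ ∷ w₃ ∷ ω) = ((vertex u , vertex v) , fine w₀ , fine w₁ , fine w₂ , fine w₃) ∷ go′ qs ω

    accepts : Ω M → Bool
    accepts ω = Dc.accepts (Vec.map toL ω)

    main-sem : ∀ ω → ⟦ mainT ⟧ᵗ (instanceOf , recsAt ω , tt) ≡ accepts ω
    main-sem ω = trans (sealed!-sem (solveX flag prepare) (instanceOf , recsAt ω , tt)) (trans (solveX-sem flag prepare instanceOf (recsAt ω))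
      (trans (cong (λ q → verdict flag prepare q instanceOf (recsAt ω)) prepares)
        (Dc.verdict-accepts prepare (rows matrix) integer (Vec.map toL ω))))

    bag-size : ∀ x → ∣ bag x ∣ ≤ suc w
    bag-size x = ≤-trans (below-max (λ x → ∣ bag x ∣) x) (≤≡ (pred≤ _) (cong suc (sym w≡)))
      where
      below-max : ∀ {N} (f : Fin N → ℕ) x → f x ≤ Vecᶠ.foldr _⊔_ 0 f
      below-max f zero = m≤m⊔n (f zero) _
      below-max f (suc x) = ≤-trans (below-max (f ∘ suc) x) (m≤n⊔m (f zero) _)
      pred≤ : ∀ m → m ≤ suc (m ∸ 1)
      pred≤ zero = z≤n
      pred≤ (suc m) = ≤-refl

    states-bound : ∀ rs x p → nodeStates flag prepare instanceOf rs (x , p) ≤ 16 ^ suc w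
    states-bound rs x p = subst (λ q → let ν = proj₁ (proj₂ q) in
        2 ^ trues (kept (vertices4 (length ν)) ν (rows (λ x → lookup (bag x))) x p) * 2 ^ trues (summed (vertices4 (length ν)) ν (rows (λ x → lookup (bag x))) x p) ≤ 16 ^ suc w)
      (sym prepares) (subst (λ m → 2 ^ trues (kept (vertices4 m) (tab nonroot) (rows (λ x → lookup (bag x))) x p) *
          2 ^ trues (summed (vertices4 m) (tab nonroot) (rows (λ x → lookup (bag x))) x p) ≤ 16 ^ suc w)
        (sym (Listₚ.length-tabulate nonroot)) (states≤ bag (suc w) bag-size (tab nonroot) x p))

    main-cost : ∀ ω → 2 + cost mainT (instanceOf , recsAt ω , tt) ≤ lastTime s w
    main-cost ω = lastTime-≥ {s} {cost mainT (instanceOf , recsAt ω , tt)} {w} (bound-main s (16 ^ suc w) instanceOf (recsAt ω) h (m^n>0 16 (suc w))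
      (W-mono sz≤s input {instanceOf} W-code) (W-recs (allPairs n) ω p≤s) (states-bound (recsAt ω)))

    drawTime≤ : Wr.drawTime instanceOf j L tossed ≤ firstTime s
    drawTime≤ = ≡≤ ((cong (λ x → 5 + (cost coinsT (instanceOf , tt) + (5 + x)))
        (trans (cong (Wr.pairsTime nil nil nil nil j) length-L) (pairsTime≡ j (length (allPairs n))))))
      (firstTime-≥ {s} {cost coinsT (instanceOf , tt)} {length (allPairs n)} {j} (un (costB (bound coinsT) s (instanceOf , tt) h (W-mono sz≤s input {instanceOf} W-code , tt))) p≤s j≤s)

    rarely : CoreYes flag d nonroot t → 4 * sumΩ M (λ ω → ⌜ not (accepts ω) ⌝) ≤ (2 ^ j) ^ M
    rarely = Dc.rarely-rejected toL toL-length toL-injective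

    sound : ∀ ω → T (accepts ω) → CoreYes flag d nonroot t
    sound ω = Dc.accepts-sound t≤cap (Vec.map toL ω)

isTrue-bit : ∀ b → isTrue (bit b) ≡ b
isTrue-bit false = refl
isTrue-bit true = refl

module _ (flag : Bool) (prepare : Fn (input ∷ []) prepared) where

  open Solved flag prepare

  private
    module _ {Yes code w} (R : Reduction flag prepare Yes code w) where

      open Reduction R
      open Isolation {bitsOf n} using (sumΩ)

      opaque
        execution : Execution Wr.program Yes code (firstTime (inflated (size code)) + lastTime (inflated (size code)) w)
        execution = record
          { ends = λ ω → Wr.drawn instanceOf (bitsOf n) (L R) (tossed R) (recsAt R ω)
          ; drawing = subst (λ c → Phase (Wr.drawTime instanceOf (bitsOf n) (L R) (tossed R)) (Wr.drawCount instanceOf (bitsOf n) (L R) (tossed R))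
                (initial Wr.program c) (λ f → sumΩ (M R) (λ ω → f (Wr.drawn instanceOf (bitsOf n) (L R) (tossed R) (recsAt R ω))))) (sym encoded)
              (phase-cong (λ f → spread-Ω flag (rows d) (allPairs n) (f ∘ Wr.drawn instanceOf (bitsOf n) (L R) (tossed R)))
                (Wr.draw-phase instanceOf (bitsOf n) (L R) (tossed R)))
          ; acc = accepts R
          ; ending = λ ω → _ , _ , Wr.main-run instanceOf (bitsOf n) (L R) (tossed R) (recsAt R ω) , main-cost R ω ,
              trans (isTrue-bit (⟦ mainT ⟧ᵗ (instanceOf , recsAt R ω , tt))) (main-sem R ω)
          ; bounded-time = +-monoˡ-≤ (lastTime (inflated (size code)) w) (drawTime≤ R)
          ; rare = λ y → rarely R (forwards y)
          ; sound = λ ω a → backwards (sound R ω a)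
          }

    ^-distribʳ-* : ∀ D a b → (a * b) ^ D ≡ a ^ D * b ^ D
    ^-distribʳ-* zero a b = refl
    ^-distribʳ-* (suc D) a b = trans (cong (a * b *_) (^-distribʳ-* D a b))
      (solve 4 (λ a b x y → (a :* b) :* (x :* y) :≡ (a :* x) :* (b :* y)) refl a b (a ^ D) (b ^ D))

    opaque
      degree : ∃[ D ] ∀ s E → 2 ≤ s → 1 ≤ E → DegE s D E ((5 + (s ^ deg-coins + (5 + (1 + s * (20 + 4 * (4 + (1 + 8 * s))))))) + (2 + s ^ deg-main * E))
      degree = _ , λ s E h 1≤E → let k = λ n → const≤ h n 1≤E ; id′ = sub h (≤-reflexive (sym (*-identityʳ s))) (pw s 1) in
        _⊞_ h (_⊞_ h (k 5) (_⊞_ h (fromDeg h 1≤E (pw s deg-coins)) (_⊞_ h (k 5) (_⊞_ h (k 1)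
          (fromDeg h 1≤E (_⊛_ h id′ (plus h 20 (_⊛_ h (con h 4) (plus h 4 (plus h 1 (_⊛_ h (con h 8) id′)))))))))))
          (_⊞_ h (k 2) (pwE s deg-main E))

    -- A bag may exceed the width by one vertex; the resulting factor 16 goes into the constant, and
    -- `16 ^ w` is relaxed to `17 ^ w`.
    time-bound : ∀ D z w a → 1 ≤ z → DegE (inflated z) D (16 ^ suc w) a → a ≤ 16 ^ D * 16 * z ^ (D + D) * 17 ^ w
    time-bound D z w a 1≤z (degE le) = ≤-trans le
        (≡≤ ((cong (_* (16 ^ suc w)) (trans (cong (_^ D) (inflated-def z)) (trans (^-distribʳ-* D 16 (z * z)) (cong (16 ^ D *_) (trans (^-distribʳ-* D z z) (sym (^-distribˡ-+-* z D D))))))))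
          (≡≤ ((solve 3 (λ a b c → (a :* b) :* (lit 16 :* c) :≡ ((a :* lit 16) :* b) :* c) refl (16 ^ D) (z ^ (D + D)) (16 ^ w)))
            (*-monoʳ-≤ (16 ^ D * 16 * z ^ (D + D)) (^-monoˡ-≤ w (m≤m+n 16 1)))))

  solvable : {I : Set} (Yes : I → Set) (encode : I → 𝔻) (width : I → ℕ) →
    (∀ i → Reduction flag prepare (Yes i) (encode i) (width i)) → MonteCarloSolvable Yes encode (λ i → 17 ^ width i)
  solvable Yes encode width R = Wr.program , (λ i → Execution.duration (execution (R i))) , monteCarlo (λ i → execution (R i)) ,
    16 ^ D * 16 , D + D , λ i → ≤-trans (Execution.bounded-time (execution (R i))) (time-bound D (size (encode i)) (width i) _ (size≥1 (R i) (encode i))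
      (proj₂ degree (inflated (size (encode i))) (16 ^ suc (width i)) (proj₁ (proj₂ (proj₂ (inflated-≥ (size≥1 (R i) (encode i)))))) (m^n>0 16 (suc (width i)))))
    where
    D : ℕ
    D = proj₁ degree

-- Numbers of arcs and the encoded budget

length-filter : ∀ {A : Set} {P : A → Set} (P? : Decidable P) xs → length (List.filter P? xs) ≡ sumL (λ x → ⌜ ⌊ P? x ⌋ ⌝) xs
length-filter P? [] = refl
length-filter P? (x ∷ xs) with P? x
... | yes _ = cong suc (length-filter P? xs)
... | no _ = length-filter P? xs

sumL-product : ∀ {A B : Set} (g : A × B → ℕ) xs ys → sumL g (List.cartesianProduct xs ys) ≡ sumL (λ x → sumL (λ y → g (x , y)) ys) xs
sumL-product g [] ys = refl
sumL-product g (x ∷ xs) ys = trans (sumL-++ g (List.map (x ,_) ys) (List.cartesianProduct xs ys)) (cong₂ _+_ (each ys) (sumL-product g xs ys))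
  where
  each : ∀ ys → sumL g (List.map (x ,_) ys) ≡ sumL (λ y → g (x , y)) ys
  each [] = refl
  each (y ∷ ys) = cong (g (x , y) +_) (each ys)

sumL-square : ∀ {n} (g : Fin n × Fin n → ℕ) → sumL g (List.cartesianProduct (allFin n) (allFin n)) ≡ sumF (λ u → sumF (λ v → g (u , v)))
sumL-square {n} g = trans (sumL-product g (allFin n) (allFin n)) (trans (sumL-tabulate {n = n} (λ u → sumL (λ v → g (u , v)) (allFin n)) id)
  (sumF-cong {n} (λ u → sumL-tabulate {n = n} (λ v → g (u , v)) id)))

length-arcs : ∀ {n} (X : Digraph n) → length (arcs X) ≡ arcCount X
length-arcs {n} X = trans (length-filter (λ (u , v) → T? (X u v)) (List.cartesianProduct (allFin n) (allFin n)))
  (trans (sumL-square (λ (u , v) → ⌜ ⌊ T? (X u v) ⌋ ⌝)) (sumF-cong {n} (λ u → sumF-cong {n} (λ v → cong ⌜_⌝ (same (X u v))))))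
  where
  same : ∀ b → ⌊ T? b ⌋ ≡ b
  same false = refl
  same true = refl

square-≤ : ∀ {n} (X : Digraph n) → arcCount X ≤ n * n
square-≤ {n} X = ≤≡ (sumF-mono {n} (λ u → ≤≡ (sumF-mono {n} {h = λ _ → 1} (λ v → ⌜⌝≤1 (X u v))) (trans (sumF-const n 1) (*-identityʳ n))))
  (sumF-const n n)

-- Bijective binary with the least significant digit first: `true` is the digit 1 and `false` the
-- digit 2. The cap is needed because the budget may be exponential in the length of its code.
budgetValue : ℕ → List Bool → ℕ
budgetValue cap = foldr (λ b a → cap ⊓ (if b then suc (a + a) else suc (suc (a + a)))) 0

-- m < limit exactly if m is at most the budget, for m < cap
limit : ℕ → Bool × List Bool → ℕ
limit cap (neg , bits) = if neg then 0 else cap ⊓ suc (budgetValue cap bits)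

limitF : Fn (nat ∷ bool ⊗ list bool ∷ []) nat
limitF = fn
  (ite (π₁ v1) zer (minF $$ ⟪ v0 ⨟ suk (fold (π₂ v1) zer
    (minF $$ ⟪ v2 ⨟ ite v0 (suk (v1 +′ v1)) (suk (suk (v1 +′ v1))) ⟫)
    (keepBound 1 (λ s ρ 2≤s w → z≤n) (λ s (c , _) x a 2≤s (w , _) p q → ≤-trans (m⊓n≤m c _) (loose nat 2≤s w)))) ⟫))
  (λ (c , b , _) → limit c b) (λ _ → refl)

digits : ℕᵇ → List Bool
digits 0ᵇ = []
digits 2[1+ x ] = false ∷ digits x
digits 1+[2 x ] = true ∷ digits x

enc-digits : ∀ x → encodeℕᵇ x ≡ enc (list bool) (digits x)
enc-digits 0ᵇ = refl
enc-digits 2[1+ x ] = cong (bit false ∙_) (enc-digits x)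
enc-digits 1+[2 x ] = cong (bit true ∙_) (enc-digits x)

signed : ℤ → Bool × List Bool
signed (ℤ.+ n) = false , digits (toBinary n)
signed -[1+ n ] = true , digits (toBinary n)

enc-signed : ∀ z → encodeℤ z ≡ enc (bool ⊗ list bool) (signed z)
enc-signed (ℤ.+ n) = cong (bit false ∙_) (enc-digits (toBinary n))
enc-signed -[1+ n ] = cong (bit true ∙_) (enc-digits (toBinary n))

budgetValue-digits : ∀ cap x → budgetValue cap (digits x) ≡ cap ⊓ fromBinary x
budgetValue-digits cap 0ᵇ = sym (m≥n⇒m⊓n≡n z≤n)
budgetValue-digits cap 2[1+ x ] rewrite budgetValue-digits cap x = clamp (fromBinary x)
  where
  clamp : ∀ v → cap ⊓ suc (suc (cap ⊓ v + cap ⊓ v)) ≡ cap ⊓ (2 * suc v)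
  clamp v with ≤-total cap v
  ... | inj₁ l rewrite m≤n⇒m⊓n≡m l = trans (m≤n⇒m⊓n≡m (≤-trans (m≤m+n cap cap) (≤-trans (n≤1+n _) (n≤1+n _)))) (sym (m≤n⇒m⊓n≡m (≤-trans l (≤-trans (n≤1+n v) (m≤m+n (suc v) _)))))
  ... | inj₂ l rewrite m≥n⇒m⊓n≡n l = cong (cap ⊓_) (cong suc (trans (sym (+-suc v v)) (cong (v +_) (sym (+-identityʳ (suc v))))))
budgetValue-digits cap 1+[2 x ] rewrite budgetValue-digits cap x = clamp (fromBinary x)
  where
  clamp : ∀ v → cap ⊓ suc (cap ⊓ v + cap ⊓ v) ≡ cap ⊓ suc (2 * v)
  clamp v with ≤-total cap v
  ... | inj₁ l rewrite m≤n⇒m⊓n≡m l = trans (m≤n⇒m⊓n≡m (≤-trans (m≤m+n cap cap) (n≤1+n _))) (sym (m≤n⇒m⊓n≡m (≤-trans l (≤-trans (m≤m+n v _) (n≤1+n _)))))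
  ... | inj₂ l rewrite m≥n⇒m⊓n≡n l = cong (λ z → cap ⊓ suc (v + z)) (sym (+-identityʳ v))

limit-≤ : ∀ cap z → limit cap (signed z) ≤ cap
limit-≤ cap (ℤ.+ n) = m⊓n≤m cap _
limit-≤ cap -[1+ n ] = z≤n

limit-sound : ∀ {cap m} z → m < limit cap (signed z) → ℤ.+ m ℤ.≤ z
limit-sound {cap} {m} (ℤ.+ n) l = ℤ.+≤+ (≤-trans (ℕ.s≤s⁻¹ (≤-trans l (m⊓n≤n cap _)))
  (≡≤ ((trans (budgetValue-digits cap (toBinary n)) (cong (cap ⊓_) (fromBinary-toBinary n)))) (m⊓n≤n cap n)))

limit-complete : ∀ {cap m} z → m < cap → ℤ.+ m ℤ.≤ z → m < limit cap (signed z)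
limit-complete {cap} {m} (ℤ.+ n) l (ℤ.+≤+ le) = ⊓-glb l (s≤s (≤≡ (⊓-glb (<⇒≤ l) le)
  (sym (trans (budgetValue-digits cap (toBinary n)) (cong (cap ⊓_) (fromBinary-toBinary n))))))

encodeList-map : ∀ {A B : Set} (f : B → 𝔻) (g : A → B) xs → encodeList f (List.map g xs) ≡ encodeList (f ∘ g) xs
encodeList-map f g [] = refl
encodeList-map f g (x ∷ xs) = cong (f (g x) ∙_) (encodeList-map f g xs)

encodeList-cong : ∀ {A : Set} {f g : A → 𝔻} xs → (∀ x → f x ≡ g x) → encodeList f xs ≡ encodeList g xs
encodeList-cong [] e = refl
encodeList-cong (x ∷ xs) e = cong₂ _∙_ (e x) (encodeList-cong xs e)

encodeList-tabulate : ∀ {A : Set} {n} (f : A → 𝔻) (g : Fin n → A) → encodeList (f ∘ g) (allFin n) ≡ encodeList f (List.tabulate g)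
encodeList-tabulate {n = n} f g = trans (sym (encodeList-map f g (allFin n))) (cong (encodeList f) (Listₚ.map-tabulate id g))

enc-rows : ∀ {m n} (M : Fin m → Fin n → Bool) →
  encodeList (λ u → encodeList (λ v → bit (M u v)) (allFin n)) (allFin m) ≡ enc mat (rows M)
enc-rows {m} M = trans (encodeList-cong (allFin m) (λ u → encodeList-tabulate bit (M u))) (encodeList-tabulate (encodeList bit) (λ u → tab (M u)))

enc-bags : ∀ {N n} (bag : Fin N → Subset n) → encodeList (λ x → encodeSubset (bag x)) (allFin N) ≡ enc mat (rows (λ x → lookup (bag x)))
enc-bags {N} bag = trans (encodeList-cong (allFin N) (λ x → cong (encodeList bit) (toList-tab (bag x)))) (encodeList-tabulate (encodeList bit) (λ x → tab (lookup (bag x))))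
  where
  toList-tab : ∀ {n} (s : Subset n) → Vec.toList s ≡ tab (lookup s)
  toList-tab [] = refl
  toList-tab (b ∷ s) = cong (b ∷_) (toList-tab s)

enc-instance : ∀ {n} {G : Graph n} (M : Digraph n) z (TD : TreeDecomposition G) →
  encodeMatrix M ∙ encodeℤ z ∙ encodeDecomposition TD ≡
  enc input (rows M , signed z , rows (adj (TreeDecomposition.tree TD)) , rows (λ x → lookup (TreeDecomposition.bag TD x)))
enc-instance M z TD = cong₂ _∙_ (enc-rows M) (cong₂ _∙_ (enc-signed z) (cong₂ _∙_ (enc-rows (adj (TreeDecomposition.tree TD))) (enc-bags (TreeDecomposition.bag TD))))

-- The preparation for spanning subgraphs: the root is the vertex 0.

prepareF : Fn (input ∷ []) prepared
prepareF = fn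
  (letin (lenF $$ ⟪ π₁ v0 ⟫) (letin (suk (v0 *′ v0))
    (π₁ v2 ، mapT (rangeF $$ ⟪ v1 ⟫) (¬′ (eqF $$ ⟪ v0 ⨟ zer ⟫)) ، (limitF $$ ⟪ v0 ⨟ π₁ (π₂ v2) ⟫) ، v0)))
  (λ ((M , b , _) , _) → let n = length M ; cap = suc (n * n) in
    M , mapL (λ v → not (v ≡ᵇ 0)) (range n) , limit cap b , cap) (λ _ → refl)

isNonzero : ∀ {n} → Fin n → Bool
isNonzero v = not (toℕ v ≡ᵇ 0)

mapL-range : ∀ {A : Set} n (g : ℕ → A) → mapL g (range n) ≡ List.tabulate {n = n} (g ∘ toℕ)
mapL-range n g = trans (cong (mapL g) (trans (range-toℕ n) (mapL-tabulate {n = n} toℕ id))) (mapL-tabulate {n = n} g toℕ)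

prepareF-spec : ∀ {n} (M : Digraph n) b A B →
  Fn.sem prepareF ((rows M , b , A , B) , tt) ≡ (rows M , tab isNonzero , limit (suc (n * n)) b , suc (n * n))
prepareF-spec {n} M b A B = trans (cong (λ m → rows M , mapL (λ v → not (v ≡ᵇ 0)) (range m) , limit (suc (m * m)) b , suc (m * m)) (Listₚ.length-tabulate (λ u → tab (M u))))
  (cong (λ ν → rows M , ν , limit (suc (n * n)) b , suc (n * n)) (mapL-range n (λ v → not (v ≡ᵇ 0))))

is-zero : ∀ {n} {r : Fin n} → ¬ T (isNonzero r) → toℕ r ≡ 0
is-zero {r = zero} h = refl
is-zero {r = suc r} h = contradiction tt h

zero-root : ∀ {n} (v : Fin n) → ∃[ r ] (toℕ {n} r ≡ 0 × ¬ T (isNonzero r))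
zero-root {suc n} v = zero , refl , λ ()

join-roots : ∀ {n} {R : Fin n → Fin n → Set} (ν : Fin n → Bool) → (∀ {r r′} → ¬ T (ν r) → ¬ T (ν r′) → r ≡ r′) →
  (∀ v → ∃[ r ] (¬ T (ν r) × Star R r v)) → (∀ v → ∃[ r ] (¬ T (ν r) × Star R v r)) → Connected R
join-roots ν one from to u v with to u | from v
... | r , nr , p | r′ , nr′ , q with one nr nr′
... | refl = p ◅◅ q

one-zero : ∀ {n} {r r′ : Fin n} → ¬ T (isNonzero r) → ¬ T (isNonzero r′) → r ≡ r′
one-zero {r = r} {r′} p q = toℕ-injective (trans (is-zero {r = r} p) (sym (is-zero {r = r′} q)))

underlying-adj : ∀ {n} (D : Digraph n) u v → u ≢ v → T (D u v) → Adj (underlying D) u v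
underlying-adj D u v u≢v t with u ≟ v
... | yes e = contradiction e u≢v
... | no _ = T∧ (T∨₁ t) tt

reduceSCSpS : ∀ I → Reduction false prepareF (SCSpS I) (encodeDirected I) (directedWidth I)
reduceSCSpS I = record
  { TD = decomposition ; matrix = digraph ; integer = signed budget
  ; d = digraph ; d⊆G = underlying-adj digraph ; nonroot = isNonzero
  ; t = limit cap (signed budget) ; cap = cap ; t≤cap = limit-≤ cap budget
  ; encoded = enc-instance digraph budget decomposition ; w≡ = refl
  ; prepares = prepareF-spec digraph (signed budget) (rows (adj (TreeDecomposition.tree decomposition))) (rows (λ x → lookup (TreeDecomposition.bag decomposition x)))
  ; forwards = λ (X , X⊆ , l , c) → record
      { pick = X ; pick⊆ = X⊆ ; oriented = λ ()
      ; small = limit-complete budget (s≤s (square-≤ X)) (subst (λ m → ℤ.+ m ℤ.≤ budget) (length-arcs X) l)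
      ; from-roots = λ v → let (r , _ , nr) = zero-root v in r , nr , c r v
      ; to-roots = λ v → let (r , _ , nr) = zero-root v in r , nr , c v r }
  ; backwards = λ y → let open CoreYes y in pick , pick⊆ , subst (λ m → ℤ.+ m ℤ.≤ budget) (sym (length-arcs pick)) (limit-sound budget small) ,
      join-roots isNonzero one-zero from-roots to-roots
  }
  where
  open DirectedInput I renaming (order to m)
  cap : ℕ
  -- More than any possible number of arcs, so capping the budget changes no answer.
  cap = suc (m * m)

-- Strong orientations

ArcOf : ∀ {n} → Digraph n → Fin n → Fin n → Set
ArcOf P u v = T (P u v)

crossing : ∀ {A : Set} {R : A → A → Set} (S : A → Bool) {x y} → Star R x y → T (S x) → ¬ T (S y) → ∃[ s ] ∃[ w ] (R s w × T (S s) × ¬ T (S w))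
crossing S ε p q = contradiction p q
crossing S {x} (_◅_ {j = y} r rs) p q with T? (S y)
... | yes t = crossing S rs t q
... | no ¬t = x , y , r , p , ¬t

sumF-strict : ∀ {n} {S S′ : Fin n → Bool} → (∀ v → T (S v) → T (S′ v)) → ∀ w → ¬ T (S w) → T (S′ w) → sumF (λ v → ⌜ S v ⌝) < sumF (λ v → ⌜ S′ v ⌝)
sumF-strict {n} {S} {S′} sub′ w ¬s s′ = ≰⇒> (λ le → contradiction
  (trans (sym (cong ⌜_⌝ (¬T→false ¬s))) (trans (sumF-tight {n} (λ v → ⌜⌝-mono (sub′ v)) le w) (cong ⌜_⌝ (T→true s′)))) (λ ()))

-- A path that leaves the complement of S, oriented towards S
record Ear {n : ℕ} (R : Fin n → Fin n → Set) (S : Fin n → Bool) (x : Fin n) (ys : List (Fin n)) : Set where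
  field
    Mid : Fin n → Bool
    Q : Digraph n
    fresh : ∀ v → T (Mid v) → v ∈ ys × ¬ T (S v)
    arc : ∀ u v → T (Q u v) → T (Mid u) × (T (Mid v) ⊎ T (S v)) × R u v
    asym : Symmetric⁻ Q
    start : T (Mid x) ⊎ T (S x)
    reach : ∀ v → T (Mid v) → Star (ArcOf Q) x v
    exit : ∀ v → T (Mid v) → ∃[ s ] (T (S s) × Star (ArcOf Q) v s)

-- Follows the walk up to its first vertex in `S`. Because the walk is simple, its first vertex does
-- not recur, which rules out opposite arcs.
ear : ∀ {n} {R : Fin n → Fin n → Set} (S : Fin n → Bool) {x z ys} → Walk R x z ys → Distinct ys → T (S z) → Ear R S x ys
ear S {x} walk dis sz with T? (S x)
... | yes sx = record { Mid = λ _ → false ; Q = λ _ _ → false ; fresh = λ _ () ; arc = λ _ _ () ; asym = λ _ _ () ; start = inj₂ sx ; reach = λ _ () ; exit = λ _ () }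
ear S here! dis sz | no ¬sx = contradiction sz ¬sx
ear {n} {R} S {x} (_∷_ {y = y} {ys = ys} r walk) (x∉ , dis) sz | no ¬sx = record
  { Mid = Mid′ ; Q = Q′
  ; fresh = λ v t → T∨-elim {x == v} t (λ e → here (sym (==-true e)) , subst (λ z → ¬ T (S z)) (==-true e) ¬sx) (λ q → there (proj₁ (fresh v q)) , proj₂ (fresh v q))
  ; arc = λ u v t → arc′ u v (split u v t)
  ; asym = λ u v p q → asym′ u v (split u v p) (split v u q)
  ; start = inj₁ x∈
  ; reach = λ v t → T∨-elim {x == v} t (λ e → subst (Star (ArcOf Q′) x) (==-true e) ε) (λ q → first′ ◅ Star.map (old _ _) (reach v q))
  ; exit = λ v t → T∨-elim {x == v} t
      (λ e → subst (λ z → ∃[ s ] (T (S s) × Star (ArcOf Q′) z s)) (==-true e) (onward start))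
      (λ q → let (s , ss , p) = exit v q in s , ss , Star.map (old _ _) p)
  }
  where
  open Ear (ear {R = R} S walk dis sz)
  Mid′ : Fin n → Bool
  Mid′ v = (x == v) ∨ Mid v
  Q′ : Digraph n
  Q′ u v = ((x == u) ∧ (y == v)) ∨ Q u v
  x∈ : T (Mid′ x)
  x∈ = T∨₁ (true→T (==-refl x))
  first′ : T (Q′ x y)
  first′ = T∨₁ (T∧ (true→T (==-refl x)) (true→T (==-refl y)))
  old : ∀ u v → T (Q u v) → T (Q′ u v)
  old u v t = T∨₂ {(x == u) ∧ (y == v)} t
  split : ∀ u v → T (Q′ u v) → (x ≡ u × y ≡ v) ⊎ T (Q u v)
  split u v t = T∨-elim {(x == u) ∧ (y == v)} t (λ e → inj₁ (==-true (T∧₁ e) , ==-true (T∧₂ {x == u} e))) inj₂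
  wider : ∀ v → T (Mid v) ⊎ T (S v) → T (Mid′ v) ⊎ T (S v)
  wider v (inj₁ t) = inj₁ (T∨₂ {x == v} t)
  wider v (inj₂ t) = inj₂ t
  ¬Midx : ¬ (T (Mid x) ⊎ T (S x))
  ¬Midx (inj₁ t) = x∉ (proj₁ (fresh x t))
  ¬Midx (inj₂ t) = ¬sx t
  arc′ : ∀ u v → (x ≡ u × y ≡ v) ⊎ T (Q u v) → T (Mid′ u) × (T (Mid′ v) ⊎ T (S v)) × R u v
  arc′ u v (inj₁ (refl , refl)) = x∈ , wider y start , r
  arc′ u v (inj₂ q) = let (a , b , c) = arc u v q in T∨₂ {x == u} a , wider v b , c
  head-∈ : ∀ {y z ys} → Walk R y z ys → y ∈ ys
  head-∈ here! = here refl
  head-∈ (_ ∷ _) = here refl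
  asym′ : ∀ u v → (x ≡ u × y ≡ v) ⊎ T (Q u v) → (x ≡ v × y ≡ u) ⊎ T (Q v u) → ⊥
  asym′ u v (inj₁ (refl , refl)) (inj₁ (e , _)) = x∉ (subst (_∈ ys) (sym e) (head-∈ walk))
  asym′ u v (inj₁ (refl , refl)) (inj₂ q) = ¬Midx (proj₁ (proj₂ (arc v u q)))
  asym′ u v (inj₂ p) (inj₁ (refl , refl)) = ¬Midx (proj₁ (proj₂ (arc u v p)))
  asym′ u v (inj₂ p) (inj₂ q) = asym u v p q
  onward : T (Mid y) ⊎ T (S y) → ∃[ s ] (T (S s) × Star (ArcOf Q′) x s)
  onward (inj₁ t) = let (s , ss , p) = exit y t in s , ss , first′ ◅ Star.map (old _ _) p
  onward (inj₂ t) = y , t , first′ ◅ ε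

module Robbins {n : ℕ} (X : Graph n) (tec : TwoEdgeConnected X) (r : Fin n) where

  record Partial : Set where
    field
      S : Fin n → Bool
      P : Digraph n
      root∈ : T (S r)
      within : ∀ u v → T (P u v) → T (S u) × T (S v) × Adj X u v
      asym : Symmetric⁻ P
      from : ∀ v → T (S v) → Star (ArcOf P) r v
      to : ∀ v → T (S v) → Star (ArcOf P) v r

  initially : Partial
  initially = record { S = r ==_ ; P = λ _ _ → false ; root∈ = true→T (==-refl r) ; within = λ _ _ () ; asym = λ _ _ ()
    ; from = λ v t → subst (Star _ r) (==-true t) ε ; to = λ v t → subst (λ z → Star _ z r) (==-true t) ε }

  -- By connectedness an edge leads from some `s` in `S` to some `w` outside. Without this edge `w`
  -- is still joined to `s`, and a simple path of that kind gives an ear from `w` back to `S`.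
  -- Orienting the edge towards `w` makes all vertices of the ear reachable from the root and able
  -- to reach it.
  extend : (A : Partial) → ∀ v → ¬ T (Partial.S A v) → ∃[ B ] (sumF (λ v → ⌜ Partial.S A v ⌝) < sumF (λ v → ⌜ Partial.S B v ⌝))
  extend A v ¬sv with crossing (Partial.S A) (proj₁ tec r v) (Partial.root∈ A) ¬sv
  ... | s , w , sw , ss , ¬w with simple _∈?_ (proj₂ tec s w sw w s)
  ... | ys , walk , dis = record
    { S = S′ ; P = P′ ; root∈ = T∨₁ root∈
    ; within = λ u v t → within′ u v (split u v t)
    ; asym = λ u v p q → asym′ u v (split u v p) (split v u q)
    ; from = λ v t → T∨-elim {S v} t (λ a → Star.map (oldP _ _) (from v a))
        (λ b → Star.map (oldP _ _) (from s ss) ◅◅ (bridge ◅ Star.map (oldQ _ _) (E.reach v b)))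
    ; to = λ v t → T∨-elim {S v} t (λ a → Star.map (oldP _ _) (to v a))
        (λ b → let (s′ , ss′ , p) = E.exit v b in Star.map (oldQ _ _) p ◅◅ Star.map (oldP _ _) (to s′ ss′)) } ,
    sumF-strict {S = S} {S′} (λ v → T∨₁) w ¬w (T∨₂ {S w} w∈)
    where
    open Partial A
    module E = Ear (ear {R = AdjWithout X s w} S walk dis ss)
    S′ : Fin n → Bool
    S′ v = S v ∨ E.Mid v
    P′ : Digraph n
    P′ u v = P u v ∨ (E.Q u v ∨ ((s == u) ∧ (w == v)))
    oldP : ∀ u v → T (P u v) → T (P′ u v)
    oldP u v = T∨₁
    oldQ : ∀ u v → T (E.Q u v) → T (P′ u v)
    oldQ u v t = T∨₂ {P u v} (T∨₁ t)
    bridge : T (P′ s w)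
    bridge = T∨₂ {P s w} (T∨₂ {E.Q s w} (T∧ (true→T (==-refl s)) (true→T (==-refl w))))
    w∈ : T (E.Mid w)
    w∈ with E.start
    ... | inj₁ t = t
    ... | inj₂ t = contradiction t ¬w
    Kind : Fin n → Fin n → Set
    Kind u v = T (P u v) ⊎ T (E.Q u v) ⊎ (s ≡ u × w ≡ v)
    split : ∀ u v → T (P′ u v) → Kind u v
    split u v t = T∨-elim {P u v} t inj₁ (λ t → T∨-elim {E.Q u v} t (inj₂ ∘ inj₁)
      (λ e → inj₂ (inj₂ (==-true (T∧₁ e) , ==-true (T∧₂ {s == u} e)))))
    within′ : ∀ u v → Kind u v → T (S′ u) × T (S′ v) × Adj X u v
    within′ u v (inj₁ p) = let (a , b , c) = within u v p in T∨₁ a , T∨₁ b , c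
    within′ u v (inj₂ (inj₁ q)) = let (a , b , c) = E.arc u v q in T∨₂ {S u} a , either b , proj₁ c
      where
      either : T (E.Mid v) ⊎ T (S v) → T (S′ v)
      either (inj₁ t) = T∨₂ {S v} t
      either (inj₂ t) = T∨₁ t
    within′ u v (inj₂ (inj₂ (refl , refl))) = T∨₁ ss , T∨₂ {S w} w∈ , sw
    apart : ∀ u v → T (P u v) → T (E.Q v u) → ⊥
    apart u v p q = proj₂ (E.fresh v (proj₁ (E.arc v u q))) (proj₁ (proj₂ (within u v p)))
    asym′ : ∀ u v → Kind u v → Kind v u → ⊥
    asym′ u v (inj₁ p) (inj₁ q) = asym u v p q
    asym′ u v (inj₁ p) (inj₂ (inj₁ q)) = apart u v p q
    asym′ u v (inj₂ (inj₁ p)) (inj₁ q) = apart v u q p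
    asym′ u v (inj₁ p) (inj₂ (inj₂ (_ , refl))) = ¬w (proj₁ (within u v p))
    asym′ u v (inj₂ (inj₂ (_ , refl))) (inj₁ q) = ¬w (proj₁ (within v u q))
    asym′ u v (inj₂ (inj₁ p)) (inj₂ (inj₁ q)) = E.asym u v p q
    -- The ear was taken in the graph without the edge between `s` and `w`, so it does not run back
    -- along the bridge.
    asym′ u v (inj₂ (inj₁ p)) (inj₂ (inj₂ (refl , refl))) = proj₂ (proj₂ (proj₂ (E.arc u v p))) (inj₂ (refl , refl))
    asym′ u v (inj₂ (inj₂ (refl , refl))) (inj₂ (inj₁ q)) = proj₂ (proj₂ (proj₂ (E.arc v u q))) (inj₂ (refl , refl))
    asym′ u v (inj₂ (inj₂ (refl , refl))) (inj₂ (inj₂ (e , _))) = ¬w (subst (T ∘ S) e ss)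

  -- `k` bounds the number of vertices still missing; each extension adds at least one.
  total : ∀ k (A : Partial) → n ≤ k + sumF (λ v → ⌜ Partial.S A v ⌝) → ∃[ B ] (∀ v → T (Partial.S B v))
  total zero A le = A , λ v → one (sumF-tight {n} {h = λ _ → 1} (λ v → ⌜⌝≤1 (Partial.S A v)) (≡≤ (trans (sumF-const n 1) (*-identityʳ n)) le) v)
    where
    one : ∀ {b} → ⌜ b ⌝ ≡ 1 → T b
    one {true} _ = tt
  total (suc k) A le with Finₚ.all? (λ v → T? (Partial.S A v))
  ... | yes all = A , all
  ... | no ¬all with Finₚ.¬∀⟶∃¬ n (λ v → T (Partial.S A v)) (λ v → T? (Partial.S A v)) ¬all
  ... | v , ¬sv = let (B , lt) = extend A v ¬sv in total k B (≤-trans le (≡≤ (sym (+-suc k _)) (+-monoʳ-≤ k lt)))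

robbins : ∀ {n} (X : Graph n) → TwoEdgeConnected X →
  ∃[ P ] ((∀ u v → T (P u v) → Adj X u v) × Symmetric⁻ P × Connected (ArcOf P))
robbins {zero} X tec = (λ _ _ → false) , (λ _ _ ()) , (λ _ _ ()) , λ ()
robbins {suc n} X tec = P , (λ u v t → proj₂ (proj₂ (within u v t))) , asym , λ u v → to u (all u) ◅◅ from v (all v)
  where
  open Robbins X tec zero
  whole : ∃[ A ] (∀ v → T (Partial.S A v))
  whole = total (suc n) initially (m≤m+n (suc n) _)
  all : ∀ v → T (Partial.S (proj₁ whole) v)
  all = proj₂ whole
  open Partial (proj₁ whole)

module _ {n : ℕ} (P : Digraph n) (asym : Symmetric⁻ P) where

  symmetrized : Graph n
  symmetrized = record
    { adj = λ u v → P u v ∨ P v u ; symmetric = λ u v → Boolₚ.∨-comm (P u v) (P v u)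
    ; loopless = λ v → ¬T→false (λ t → T∨-elim {P v v} t (λ p → asym v v p p) (λ p → asym v v p p)) }

  -- A path to a need not use an arc that leaves a.
  avoid : ∀ a b {x} → Star (ArcOf P) x a → Star (λ u v → T (P u v) × ¬ (u ≡ a × v ≡ b)) x a
  avoid a b ε = ε
  avoid a b (_◅_ {i = x} {j = y} p ps) with x ≟ a
  ... | yes refl = ε
  ... | no x≢a = (p , x≢a ∘ proj₁) ◅ avoid a b ps

  -- When the edge of an arc from `a` to `b` is deleted, a directed path from `b` to `a`, stopped at
  -- its first arrival in `a`, survives. Traversed backwards it replaces the arc in every path.
  symmetrized-2ec : Connected (ArcOf P) → TwoEdgeConnected symmetrized
  symmetrized-2ec strong = (λ u v → Star.map T∨₁ (strong u v)) ,
    λ a b ab → T∨-elim {P a b} ab (without a b) (λ ba → λ u v → Star.map (λ (e , h) → e , h ∘ swap⊎) (without b a ba u v))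
    where
    swap⊎ : ∀ {a b u v : Fin n} → (u ≡ a × v ≡ b) ⊎ (u ≡ b × v ≡ a) → (u ≡ b × v ≡ a) ⊎ (u ≡ a × v ≡ b)
    swap⊎ (inj₁ x) = inj₂ x
    swap⊎ (inj₂ x) = inj₁ x
    without : ∀ a b → T (P a b) → Connected (AdjWithout symmetrized a b)
    without a b ab u v = detour (strong u v)
      where
      keeps : ∀ {x y} → T (P x y) → ¬ (x ≡ a × y ≡ b) → AdjWithout symmetrized a b x y
      keeps {x} {y} p h = T∨₁ p , λ { (inj₁ e) → h e ; (inj₂ (refl , refl)) → asym a b ab p }
      turn : ∀ {x y} → AdjWithout symmetrized a b x y → AdjWithout symmetrized a b y x
      turn {x} {y} (e , h) = subst T (Boolₚ.∨-comm (P x y) (P y x)) e , λ { (inj₁ (p , q)) → h (inj₂ (q , p)) ; (inj₂ (p , q)) → h (inj₁ (q , p)) }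
      around : Star (AdjWithout symmetrized a b) b a
      around = Star.map (λ (p , h) → keeps p h) (avoid a b (strong b a))
      detour : ∀ {x y} → Star (ArcOf P) x y → Star (AdjWithout symmetrized a b) x y
      detour ε = ε
      detour (_◅_ {i = x} {j = y} p ps) with x ≟ a | y ≟ b
      ... | yes refl | yes refl = reverse-star (Star.map turn around) ◅◅ detour ps
      ... | no h | _ = keeps p (h ∘ proj₁) ◅ detour ps
      ... | yes _ | no h = keeps p (h ∘ proj₂) ◅ detour ps

length-edges : ∀ {n} (X : Graph n) → length (edges X) ≡ sumL (λ (u , v) → ⌜ adj X u v ⌝) (allPairs n)
length-edges {n} X = trans (length-filter (λ (u , v) → (u Finₚ.<? v) ×-dec T? (adj X u v)) (List.cartesianProduct (allFin n) (allFin n)))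
  (trans (sumL-square (λ (u , v) → ⌜ ⌊ (u Finₚ.<? v) ×-dec T? (adj X u v) ⌋ ⌝)) (trans (sumF-cong {n} (λ u → sumF-cong {n} (λ v → same u v)))
    (sym (sum-allPairs n (λ (u , v) → ⌜ adj X u v ⌝)))))
  where
  same : ∀ u v → ⌜ ⌊ (u Finₚ.<? v) ×-dec T? (adj X u v) ⌋ ⌝ ≡ (if u ≺ v then ⌜ adj X u v ⌝ else 0)
  same u v with u Finₚ.<? v | adj X u v
  ... | yes l | true rewrite T→true (<⇒<ᵇ l) = refl
  ... | yes l | false rewrite T→true (<⇒<ᵇ l) = refl
  ... | no ¬l | a rewrite ¬T→false (λ t → ¬l (<ᵇ⇒< (toℕ u) (toℕ v) t)) = refl

module _ {n : ℕ} (P : Digraph n) (asym : Symmetric⁻ P) (X : Graph n) where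

  private
    arcs≡ : arcCount P ≡ sumL (λ p → ⌜ P (proj₁ p) (proj₂ p) ⌝ + ⌜ P (proj₂ p) (proj₁ p) ⌝) (allPairs n)
    arcs≡ = sym (Complete.total (complete-pairs n) P (λ u → ¬T→false (λ t → asym u u t t)))

    sumL-mono : ∀ {A : Set} {g h : A → ℕ} xs → (∀ x → g x ≤ h x) → sumL g xs ≤ sumL h xs
    sumL-mono [] e = z≤n
    sumL-mono (x ∷ xs) e = +-mono-≤ (e x) (sumL-mono xs e)

  orientation-≤ : (∀ u v → T (P u v) → Adj X u v) → arcCount P ≤ length (edges X)
  orientation-≤ P⊆ = ≡≤ (arcs≡) (≤≡ (sumL-mono (allPairs n) (λ (u , v) → one (P u v) (P v u) (adj X u v) (P⊆ u v) (λ t → subst T (symmetric X v u) (P⊆ v u t)) (asym u v)))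
    (sym (length-edges X)))
    where
    one : ∀ a b c → (T a → T c) → (T b → T c) → (T a → ¬ T b) → ⌜ a ⌝ + ⌜ b ⌝ ≤ ⌜ c ⌝
    one false false c f g h = z≤n
    one false true true f g h = ≤-refl
    one true false true f g h = ≤-refl
    one true true c f g h = contradiction tt (h tt)
    one false true false f g h = contradiction (g tt) (λ ())
    one true false false f g h = contradiction (f tt) (λ ())

  edges-≤ : (∀ u v → adj X u v ≡ P u v ∨ P v u) → length (edges X) ≤ arcCount P
  edges-≤ e = ≡≤ (length-edges X) (≤≡ (sumL-mono (allPairs n) (λ (u , v) → ≡≤ (cong ⌜_⌝ (e u v)) (⌜∨⌝-≤ (P u v) (P v u))))
    (sym arcs≡))

reduce2ECSS : ∀ I → Reduction true prepareF (2-ECSS I) (encodeUndirected I) (undirectedWidth I)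
reduce2ECSS I = record
  { TD = decomposition ; matrix = adj graph ; integer = signed budget
  ; d = adj graph ; d⊆G = λ u v _ t → t ; nonroot = isNonzero
  ; t = limit cap (signed budget) ; cap = cap ; t≤cap = limit-≤ cap budget
  ; encoded = enc-instance (adj graph) budget decomposition ; w≡ = refl
  ; prepares = prepareF-spec (adj graph) (signed budget) (rows (adj (TreeDecomposition.tree decomposition))) (rows (λ x → lookup (TreeDecomposition.bag decomposition x)))
  ; forwards = λ (X , X⊆ , l , tec) → let (P , P⊆ , asym , strong) = robbins X tec in record
      { pick = P ; pick⊆ = λ u v t → X⊆ u v (P⊆ u v t) ; oriented = λ _ → asym
      ; small = limit-complete budget (s≤s (square-≤ P)) (ℤₚ.≤-trans (ℤ.+≤+ (orientation-≤ P asym X P⊆)) l)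
      ; from-roots = λ v → let (r , _ , nr) = zero-root v in r , nr , strong r v
      ; to-roots = λ v → let (r , _ , nr) = zero-root v in r , nr , strong v r }
  ; backwards = λ y → let open CoreYes y ; asym = oriented tt ; X = symmetrized pick asym in
      X , (λ u v t → T∨-elim {pick u v} t (pick⊆ u v) (λ p → subst T (symmetric graph v u) (pick⊆ v u p))) ,
      ℤₚ.≤-trans (ℤ.+≤+ (edges-≤ pick asym X (λ u v → refl))) (limit-sound budget small) ,
      symmetrized-2ec pick asym (join-roots isNonzero one-zero from-roots to-roots)
  }
  where
  open UndirectedInput I renaming (order to m)
  cap : ℕ
  cap = suc (m * m)

-- Strong components and the arcs between them

-- The arcs of `A` are counted by their images under `φ` and `ψ`; every arc of `C` is such an image.
image-≤ : ∀ {n} (C A : Digraph n) (φ ψ : Fin n → Fin n → Fin n) →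
  (∀ a b → T (C a b) → ∃[ u ] ∃[ v ] (T (A u v) × φ u v ≡ a × ψ u v ≡ b)) →
  arcCount C ≤ arcCount A
image-≤ {n} C A φ ψ h = ≤-trans (sumF-mono {n} λ a → sumF-mono {n} λ b → counted a b (C a b) refl) (≤-trans (≤-reflexive
    (trans (sumF-cong {n} λ a → sumF-swap (λ b u → sumF (λ v → g a b u v)))
    (trans (sumF-swap (λ a u → sumF (λ b → sumF (λ v → g a b u v))))
    (sumF-cong {n} λ u → trans (sumF-cong {n} λ a → sumF-swap (λ b v → g a b u v)) (sumF-swap (λ a v → sumF (λ b → g a b u v)))))))
  (sumF-mono {n} λ u → sumF-mono {n} λ v → source (A u v) (φ u v) (ψ u v)))
  where
  g : Fin n → Fin n → Fin n → Fin n → ℕ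
  g a b u v = ⌜ A u v ∧ ((φ u v == a) ∧ (ψ u v == b)) ⌝
  counted : ∀ a b c → C a b ≡ c → ⌜ c ⌝ ≤ sumF (λ u → sumF (λ v → g a b u v))
  counted a b false e = z≤n
  counted a b true e with h a b (true→T e)
  ... | u , v , t , refl , refl = ≡≤ ((sym (cong ⌜_⌝ (T→true (T∧ t (T∧ (true→T (==-refl (φ u v))) (true→T (==-refl (ψ u v)))))))))
    (≤-trans (sumF-term (λ v → g (φ u _) (ψ u _) u v) v) (sumF-term (λ u → sumF (λ v → g _ _ u v)) u))
  source : ∀ c x y → sumF (λ a → sumF (λ b → ⌜ c ∧ ((x == a) ∧ (y == b)) ⌝)) ≤ ⌜ c ⌝
  source false x y = ≤-reflexive (trans (sumF-cong {n} λ a → sumF-0 {n}) (sumF-0 {n}))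
  source true x y = ≤-reflexive (trans (sumF-cong {n} λ a → row (x == a)) (sumF-point x))
    where
    row : ∀ b → sumF (λ v → ⌜ b ∧ (y == v) ⌝) ≡ ⌜ b ⌝
    row true = sumF-point y
    row false = sumF-0 {n}

module Components {n : ℕ} (D : Digraph n) where

  R : Digraph n
  R = closure D

  ν : Fin n → Bool
  ν v = anyL (λ w → (w ≺ v) ∧ (R w v ∧ R v w)) (allFin n)

  within : Digraph n
  within u v = D u v ∧ R v u

  between : Fin n → Digraph n
  between a b c = (not (ν c) ∧ not (c == a)) ∧ (not (c == b) ∧ (R a c ∧ R c b))

  -- Consecutive components, given by their roots
  cover : Digraph n
  cover a b = (not (ν a) ∧ not (ν b)) ∧ (not (a == b) ∧ (R a b ∧ not (anyL (between a b) (allFin n))))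

  covers : ℕ
  covers = arcCount cover

  refl′ : ∀ u → T (R u u)
  refl′ = closure-refl D

  tr : ∀ {u w v} → T (R u w) → T (R w v) → T (R u v)
  tr {u} {w} {v} = closure-trans D u w v

  arc→R : ∀ {u v} → T (D u v) → T (R u v)
  arc→R t = closure-complete D (t ◅ ε)

  find-root : ∀ k v → toℕ v < k → ∃[ r ] (¬ T (ν r) × T (R v r) × T (R r v))
  find-root (suc k) v (s≤s l) with T? (ν v)
  ... | no ¬ν = v , ¬ν , refl′ v , refl′ v
  ... | yes t = let (w , p) = anyL-∃ _ (allFin n) t ; q = T∧₂ {w ≺ v} p
                    (r , nr , wr , rw) = find-root k w (≤-trans (<ᵇ⇒< (toℕ w) (toℕ v) (T∧₁ p)) l)
                in r , nr , tr (T∧₂ {R w v} q) wr , tr rw (T∧₁ q)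

  rt : Fin n → Fin n
  rt v = proj₁ (find-root n v (toℕ<n v))

  rt-root : ∀ v → ¬ T (ν (rt v))
  rt-root v = proj₁ (proj₂ (find-root n v (toℕ<n v)))

  to-rt : ∀ v → T (R v (rt v))
  to-rt v = proj₁ (proj₂ (proj₂ (find-root n v (toℕ<n v))))

  from-rt : ∀ v → T (R (rt v) v)
  from-rt v = proj₂ (proj₂ (proj₂ (find-root n v (toℕ<n v))))

  lower : ∀ {a b} → ¬ T (ν b) → T (R a b) → T (R b a) → ¬ (toℕ a < toℕ b)
  lower {a} {b} nb ab ba l = nb (anyL-intro (λ w → (w ≺ b) ∧ (R w b ∧ R b w)) (allFin n) (∈-allFin a) (T∧ (<⇒<ᵇ l) (T∧ ab ba)))

  one-root : ∀ {a b} → ¬ T (ν a) → ¬ T (ν b) → T (R a b) → T (R b a) → a ≡ b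
  one-root na nb ab ba = toℕ-injective (≤-antisym (≮⇒≥ (lower na ba ab)) (≮⇒≥ (lower nb ab ba)))

  rt-own : ∀ {b} → ¬ T (ν b) → rt b ≡ b
  rt-own {b} nb = one-root (rt-root b) nb (from-rt b) (to-rt b)

  rt-≡ : ∀ {u v} → T (R u v) → T (R v u) → rt u ≡ rt v
  rt-≡ {u} {v} uv vu = one-root (rt-root u) (rt-root v) (tr (from-rt u) (tr uv (to-rt v))) (tr (from-rt v) (tr vu (to-rt u)))

  cover-parts : ∀ {a b} → T (cover a b) → ¬ T (ν a) × ¬ T (ν b) × a ≢ b × T (R a b) × (∀ c → ¬ T (between a b c))
  cover-parts {a} {b} t = not-T (T∧₁ p) , not-T (T∧₂ {not (ν a)} p) , (λ { refl → not-T (T∧₁ q) (true→T (==-refl a)) }) , T∧₁ s ,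
    λ c bt → not-T (T∧₂ {R a b} s) (anyL-intro (between a b) (allFin n) (∈-allFin c) bt)
    where
    p = T∧₁ t
    q = T∧₂ {not (ν a) ∧ not (ν b)} t
    s = T∧₂ {not (a == b)} q

  cross : (Digraph n) → Digraph n
  cross X u v = X u v ∧ not (R v u)

  between-intro : ∀ {a b c} → ¬ T (ν c) → c ≢ a → c ≢ b → T (R a c) → T (R c b) → T (between a b c)
  between-intro nc ca cb ac cb′ = T∧ (T∧ (T-not nc) (T-not (ca ∘ ==-true))) (T∧ (T-not (cb ∘ ==-true)) (T∧ ac cb′))

  module _ (X : Digraph n) (X⊆ : ∀ u v → T (X u v) → T (D u v)) where

    path→R : ∀ {u v} → Star (ArcOf X) u v → T (R u v)
    path→R s = closure-complete D (Star.map (X⊆ _ _) s)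

    -- Consider the arc by which the path first leaves the component of `a`. The component of its
    -- head lies after that of `a` and not after that of `b`, so for consecutive components it is
    -- that of `b`.
    crossing-arc : ∀ {a b} → T (cover a b) → ∀ {x} → Star (ArcOf X) x b → rt x ≡ a →
      ∃[ u ] ∃[ v ] (T (cross X u v) × rt u ≡ a × rt v ≡ b)
    crossing-arc {a} {b} cov ε e = let (_ , nb , a≢b , _) = cover-parts {a} {b} cov in contradiction (trans (sym e) (rt-own nb)) a≢b
    crossing-arc {a} {b} cov {x} (_◅_ {j = z} xz zs) e with rt z ≟ a | rt z ≟ b
    ... | yes e′ | _ = crossing-arc {a} {b} cov zs e′
    ... | no z≢a | yes e″ = x , z , T∧ xz (T-not (λ zx → z≢a (trans (rt-≡ zx (arc→R (X⊆ x z xz))) e))) , e , e″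
    ... | no z≢a | no z≢b = let (_ , _ , _ , _ , none) = cover-parts {a} {b} cov in
      ⊥-elim (none (rt z) (between-intro (rt-root z) z≢a z≢b
        (subst (λ c → T (R c (rt z))) e (tr (from-rt x) (tr (arc→R (X⊆ x z xz)) (to-rt z)))) (tr (from-rt z) (path→R zs))))

  module Restrict (X : Digraph n) (X⊆ : ∀ u v → T (X u v) → T (D u v))
    (equivalent : ∀ u v → Star (ArcOf D) u v → Star (ArcOf X) u v) where

    part : Digraph n
    part u v = X u v ∧ R v u

    part⊆ : ∀ u v → T (part u v) → T (within u v)
    part⊆ u v t = T∧ (X⊆ u v (T∧₁ t)) (T∧₂ {X u v} t)

    X-path : ∀ {u v} → T (R u v) → Star (ArcOf X) u v
    X-path {u} {v} t = equivalent u v (closure-sound D u v t)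

    -- A path between vertices of one strong component stays inside it: each vertex on it reaches
    -- `y` and hence returns to `x`.
    inside : ∀ {x y} → Star (ArcOf X) x y → T (R y x) → Star (ArcOf part) x y
    inside ε h = ε
    inside {x} {y} (xz ◅ zs) h = T∧ xz (tr (path→R X X⊆ zs) h) ◅ inside zs (tr h (arc→R (X⊆ _ _ xz)))

    -- Arcs inside components and arcs between them are disjoint. Each pair of consecutive
    -- components needs an arc between them, and the components of its ends tell which pair it
    -- serves.
    part-size : arcCount part + covers ≤ arcCount X
    part-size = ≤≡ (+-monoʳ-≤ (arcCount part) (image-≤ cover (cross X) (λ u v → rt u) (λ u v → rt v)
        (λ a b cov → let (na , nb , _ , ab , _) = cover-parts {a} {b} cov in crossing-arc X X⊆ {a} {b} cov (X-path ab) (rt-own na))))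
      (trans (sym (sumF-+ (λ u → sumF (λ v → ⌜ part u v ⌝)) _)) (sumF-cong {n} λ u → trans (sym (sumF-+ (λ v → ⌜ part u v ⌝) _))
        (sumF-cong {n} λ v → split (X u v) (R v u))))
      where
      split : ∀ a b → ⌜ a ∧ b ⌝ + ⌜ a ∧ not b ⌝ ≡ ⌜ a ⌝
      split false b = refl
      split true false = refl
      split true true = refl

  module Enlarge (P : Digraph n) (P⊆ : ∀ u v → T (P u v) → T (within u v))
    (from-roots : ∀ v → ∃[ r ] (¬ T (ν r) × Star (ArcOf P) r v)) (to-roots : ∀ v → ∃[ r ] (¬ T (ν r) × Star (ArcOf P) v r)) where

    select : ∀ a b → T (cover a b) → ∃[ u ] ∃[ v ] (T (cross D u v) × rt u ≡ a × rt v ≡ b)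
    select a b cov = let (na , nb , _ , ab , _) = cover-parts {a} {b} cov in crossing-arc D (λ u v t → t) {a} {b} cov (closure-sound D a b ab) (rt-own na)

    selected : Fin n → Fin n → Fin n × Fin n
    selected a b = choose (cover a b) (λ t → let (u , v , _) = select a b t in u , v) (a , b)

    extra : Digraph n
    extra u v = anyL (λ a → anyL (λ b → cover a b ∧ ((proj₁ (selected a b) == u) ∧ (proj₂ (selected a b) == v))) (allFin n)) (allFin n)

    extra-elim : ∀ {u v} → T (extra u v) → ∃[ a ] ∃[ b ] (T (cover a b) × proj₁ (selected a b) ≡ u × proj₂ (selected a b) ≡ v)
    extra-elim t = let (a , p) = anyL-∃ _ (allFin n) t ; (b , q) = anyL-∃ _ (allFin n) p ; e = T∧₂ {cover a b} q in
      a , b , T∧₁ q , ==-true (T∧₁ e) , ==-true (T∧₂ {proj₁ (selected a b) == _} e)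

    extra-intro : ∀ {a b} → T (cover a b) → T (extra (proj₁ (selected a b)) (proj₂ (selected a b)))
    extra-intro {a} {b} cov = anyL-intro _ (allFin n) (∈-allFin a) (anyL-intro _ (allFin n) (∈-allFin b)
      (T∧ cov (T∧ (true→T (==-refl (proj₁ (selected a b)))) (true→T (==-refl (proj₂ (selected a b)))))))

    selected-spec : ∀ {a b} → T (cover a b) → let (u , v) = selected a b in T (D u v) × rt u ≡ a × rt v ≡ b
    selected-spec {a} {b} cov = subst (λ (u , v) → T (D u v) × rt u ≡ a × rt v ≡ b)
      (sym (choose-true (cover a b) (λ t → let (u , v , _) = select a b t in u , v) (a , b) cov))
      (let (u , v , t , e , e′) = select a b cov in T∧₁ t , e , e′)

    X : Digraph n
    X u v = P u v ∨ extra u v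

    X⊆ : ∀ u v → T (X u v) → T (D u v)
    X⊆ u v t = T∨-elim {P u v} t (λ p → T∧₁ (P⊆ u v p)) (λ q → let (a , b , cov , e , e′) = extra-elim q in
      subst₂ (λ u v → T (D u v)) e e′ (proj₁ (selected-spec {a} {b} cov)))

    X-size : arcCount X ≤ arcCount P + covers
    X-size = ≤-trans (sumF-mono {n} λ u → ≤≡ (sumF-mono {n} λ v → ⌜∨⌝-≤ (P u v) (extra u v)) (sumF-+ (λ v → ⌜ P u v ⌝) _))
      (≡≤ ((sumF-+ (λ u → sumF (λ v → ⌜ P u v ⌝)) _))
        (+-monoʳ-≤ (arcCount P) (image-≤ extra cover (λ a b → proj₁ (selected a b)) (λ a b → proj₂ (selected a b)) (λ u v t → extra-elim t))))

    P→R : ∀ {x y} → Star (ArcOf P) x y → T (R x y) × T (R y x)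
    P→R ε = refl′ _ , refl′ _
    P→R {x} (_◅_ {j = z} p ps) = let q = P⊆ x z p ; (zy , yz) = P→R ps in tr (arc→R (T∧₁ q)) zy , tr yz (T∧₂ {D x z} q)

    X-to-rt : ∀ v → Star (ArcOf X) v (rt v)
    X-to-rt v = let (r , nr , s) = to-roots v ; (vr , rv) = P→R s in
      subst (Star (ArcOf X) v) (one-root nr (rt-root v) (tr rv (to-rt v)) (tr (from-rt v) vr)) (Star.map T∨₁ s)

    X-from-rt : ∀ v → Star (ArcOf X) (rt v) v
    X-from-rt v = let (r , nr , s) = from-roots v ; (rv , vr) = P→R s in
      subst (λ z → Star (ArcOf X) z v) (one-root nr (rt-root v) (tr rv (to-rt v)) (tr (from-rt v) vr)) (Star.map T∨₁ s)

    interval : Fin n → Digraph n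
    interval a b c = R a c ∧ R c b

    -- Induction on the number of vertices lying between `a` and `b` in the reachability order.
    -- Consecutive components are joined by their selected arc; otherwise some root lies strictly
    -- between, and both intervals at it are smaller, as each loses one of the ends.
    connect : ∀ k a b → sumF (λ c → ⌜ interval a b c ⌝) < k → ¬ T (ν a) → ¬ T (ν b) → T (R a b) → Star (ArcOf X) a b
    connect (suc k) a b (s≤s l) na nb ab = by (a ≟ b) (T? (cover a b)) (T? (anyL (between a b) (allFin n)))
      where
      through : ∀ c → T (between a b c) → Star (ArcOf X) a b
      through c t = connect k a c (≤-trans (sumF-strict {n} (λ x s → T∧ (T∧₁ s) (tr (T∧₂ {R a x} s) cb)) b
            (λ s → c≢b (one-root nc nb cb (T∧₂ {R a b} s))) (T∧ ab (refl′ b))) l) na nc ac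
          ◅◅ connect k c b (≤-trans (sumF-strict {n} (λ x s → T∧ (tr ac (T∧₁ s)) (T∧₂ {R c x} s)) a
            (λ s → c≢a (one-root nc na (T∧₁ s) ac)) (T∧ (refl′ a) ab)) l) nc nb cb
        where
        p = T∧₁ t
        q = T∧₂ {not (ν c) ∧ not (c == a)} t
        nc = not-T (T∧₁ p)
        c≢a : c ≢ a
        c≢a refl = not-T (T∧₂ {not (ν c)} p) (true→T (==-refl c))
        c≢b : c ≢ b
        c≢b refl = not-T (T∧₁ q) (true→T (==-refl c))
        ac = T∧₁ (T∧₂ {not (c == b)} q)
        cb = T∧₂ {R a c} (T∧₂ {not (c == b)} q)
      by : Dec (a ≡ b) → Dec (T (cover a b)) → Dec (T (anyL (between a b) (allFin n))) → Star (ArcOf X) a b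
      by (yes refl) _ _ = ε
      by (no a≢b) (yes cov) _ = let (u , v) = selected a b ; (_ , e , e′) = selected-spec {a} {b} cov in
        subst (λ z → Star (ArcOf X) z u) e (X-from-rt u) ◅◅ (T∨₂ {P u v} (extra-intro {a} {b} cov) ◅ subst (Star (ArcOf X) v) e′ (X-to-rt v))
      by (no a≢b) (no ¬cov) (no none) = contradiction (T∧ (T∧ (T-not na) (T-not nb)) (T∧ (T-not (a≢b ∘ ==-true)) (T∧ ab (T-not none)))) ¬cov
      by (no a≢b) (no ¬cov) (yes some) = let (c , t) = anyL-∃ (between a b) (allFin n) some in through c t

    equivalent : ∀ u v → Star (ArcOf D) u v → Star (ArcOf X) u v
    equivalent u v s = X-to-rt u ◅◅ (connect (suc (sumF (λ c → ⌜ interval (rt u) (rt v) c ⌝))) (rt u) (rt v) ≤-refl (rt-root u) (rt-root v)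
      (tr (from-rt u) (tr (closure-complete D s) (to-rt v))) ◅◅ X-from-rt v)

-- The preparation for equivalent subgraphs, computed on lists

grid : List ℕ → (ℕ → ℕ → Bool) → List (List Bool)
grid is g = mapL (λ u → mapL (g u) is) is

grid-W : ∀ {s} is g → length is ≤ s → W s mat (grid is g)
grid-W {s} is g l = ≡≤ (length-mapL _ is) l , each is
  where
  each : ∀ us → All (W s (list bool)) (mapL (λ u → mapL (g u) is) us)
  each [] = []
  each (u ∷ us) = list-W (mapL (g u) is) (≡≤ (length-mapL (g u) is) l) ∷ each us

roundL : List ℕ → ℕ → List (List Bool) → List (List Bool)
roundL is w ρ = grid is (λ u v → at ρ u v ∨ (at ρ u w ∧ at ρ w v))

reachL : List (List Bool) → List ℕ → List (List Bool)
reachL M is = foldr (roundL is) (grid is (λ u v → at M u v ∨ (u ≡ᵇ v))) is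

reachF : Fn (mat ∷ list nat ∷ []) mat
reachF = fn
  (fold v1 (mapT v1 (mapT v2 ((atF $$ ⟪ v2 ⨟ v1 ⨟ v0 ⟫) ∨′ (eqF $$ ⟪ v1 ⨟ v0 ⟫))))
    (mapT v3 (mapT v4 ((atF $$ ⟪ v3 ⨟ v1 ⨟ v0 ⟫) ∨′ ((atF $$ ⟪ v3 ⨟ v1 ⨟ v2 ⟫) ∧′ (atF $$ ⟪ v3 ⨟ v2 ⨟ v0 ⟫)))))
    (keepBound 1 (λ s (M , is , _) h (_ , w , _) → loose mat h (grid-W is (λ u v → at M u v ∨ (u ≡ᵇ v)) (proj₁ w)))
      (λ s (_ , is , _) w ρ h (_ , wis , _) p q → loose mat h (grid-W is (λ u v → at ρ u v ∨ (at ρ u w ∧ at ρ w v)) (proj₁ wis)))))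
  (λ (M , is , _) → reachL M is) (λ _ → refl)

nonrootsL : List (List Bool) → List ℕ → List Bool
nonrootsL R is = mapL (λ u → anyL (λ w → (w <ᵇ u) ∧ (at R w u ∧ at R u w)) is) is

nonrootsF : Fn (mat ∷ list nat ∷ []) (list bool)
nonrootsF = fn (mapT v1 (anyT v2 ((ltF $$ ⟪ v0 ⨟ v1 ⟫) ∧′ ((atF $$ ⟪ v2 ⨟ v0 ⨟ v1 ⟫) ∧′ (atF $$ ⟪ v2 ⨟ v1 ⨟ v0 ⟫)))))
  (λ (R , is , _) → nonrootsL R is) (λ _ → refl)

withinF : Fn (mat ∷ mat ∷ list nat ∷ []) mat
withinF = fn (mapT v2 (mapT v3 ((atF $$ ⟪ v2 ⨟ v1 ⨟ v0 ⟫) ∧′ (atF $$ ⟪ v3 ⨟ v0 ⨟ v1 ⟫))))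
  (λ (M , R , is , _) → grid is (λ u v → at M u v ∧ at R v u)) (λ _ → refl)

coverL : List (List Bool) → List Bool → List ℕ → ℕ → ℕ → Bool
coverL R ν is a b = (not (nth false a ν) ∧ not (nth false b ν)) ∧ (not (a ≡ᵇ b) ∧ (at R a b ∧ not (anyL (λ c →
  (not (nth false c ν) ∧ not (c ≡ᵇ a)) ∧ (not (c ≡ᵇ b) ∧ (at R a c ∧ at R c b))) is)))

coverF : Fn (mat ∷ list bool ∷ list nat ∷ nat ∷ nat ∷ []) bool
coverF = fn
  ((¬′ (nthB′ v3 v1) ∧′ ¬′ (nthB′ v4 v1)) ∧′ (¬′ (eqF $$ ⟪ v3 ⨟ v4 ⟫) ∧′ ((atF $$ ⟪ v0 ⨟ v3 ⨟ v4 ⟫) ∧′ ¬′ (anyT v2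
    ((¬′ (nthB′ v0 v2) ∧′ ¬′ (eqF $$ ⟪ v0 ⨟ v4 ⟫)) ∧′ (¬′ (eqF $$ ⟪ v0 ⨟ v5 ⟫) ∧′ ((atF $$ ⟪ v1 ⨟ v4 ⨟ v0 ⟫) ∧′ (atF $$ ⟪ v1 ⨟ v0 ⨟ v5 ⟫))))))))
  (λ (R , ν , is , a , b , _) → coverL R ν is a b) (λ _ → refl)

coversL : List (List Bool) → List Bool → List ℕ → ℕ
coversL R ν is = sumL (λ a → trues (mapL (coverL R ν is a) is)) is

trues-≤ : ∀ bs → trues bs ≤ length bs
trues-≤ [] = z≤n
trues-≤ (false ∷ bs) = ≤-trans (trues-≤ bs) (n≤1+n _)
trues-≤ (true ∷ bs) = s≤s (trues-≤ bs)

coversF : Fn (mat ∷ list bool ∷ list nat ∷ []) nat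
coversF = fn
  (fold v2 zer ((truesF $$ ⟪ mapT v4 (coverF $$ (v3 ∷ v4 ∷ v5 ∷ v1 ∷ v0 ∷ [])) ⟫) +′ v1)
    (natBound 1 (λ s ρ h w → z≤n) (λ s (R , ν , is , _) a acc h (_ , _ , w , _) p →
      +-monoˡ-≤ acc (≤-trans (trues-≤ (mapL (coverL R ν is a) is)) (≡≤ (length-mapL (coverL R ν is a) is) (≤-trans (proj₁ w) (≤pow h 0)))))))
  (λ (R , ν , is , _) → coversL R ν is) (λ _ → refl)

-- The one arc needed between each two consecutive components is paid for in advance by lowering the
-- limit; the core problem then concerns only arcs inside components. If the budget cannot pay for
-- these arcs, the truncated difference is zero and no subgraph has fewer than zero arcs.
prepareMEG : List (List Bool) → Bool × List Bool → ℕ → El prepared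
prepareMEG M b n = let is = range n ; R = reachL M is ; ν = nonrootsL R is ; cap = suc (n * n) in
  grid is (λ u v → at M u v ∧ at R v u) , ν , limit cap b ∸ coversL R ν is , cap

prepareMEGF : Fn (input ∷ []) prepared
prepareMEGF = fn
  (letin (lenF $$ ⟪ π₁ v0 ⟫) (letin (rangeF $$ ⟪ v0 ⟫) (letin (reachF $$ ⟪ π₁ v2 ⨟ v0 ⟫) (letin (nonrootsF $$ ⟪ v0 ⨟ v1 ⟫) (letin (suk (v3 *′ v3))
    ((withinF $$ ⟪ π₁ v5 ⨟ v2 ⨟ v3 ⟫) ، v1 ، (monusF $$ ⟪ limitF $$ ⟪ v0 ⨟ π₁ (π₂ v5) ⟫ ⨟ coversF $$ ⟪ v2 ⨟ v1 ⨟ v3 ⟫ ⟫) ، v0))))))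
  (λ ((M , b , _) , _) → prepareMEG M b (length M)) (λ _ → refl)

anyL-cong : ∀ {A : Set} {g h : A → Bool} xs → (∀ x → g x ≡ h x) → anyL g xs ≡ anyL h xs
anyL-cong [] e = refl
anyL-cong (x ∷ xs) e = cong₂ _∨_ (e x) (anyL-cong xs e)

anyL-range : ∀ n (g : ℕ → Bool) {h : Fin n → Bool} → (∀ v → g (toℕ v) ≡ h v) → anyL g (range n) ≡ anyL h (allFin n)
anyL-range n g {h} e = trans (cong (anyL g) (range-toℕ n)) (trans (anyL-mapL (allFin n)) (anyL-cong (allFin n) e))
  where
  anyL-mapL : ∀ (xs : List (Fin n)) → anyL g (mapL toℕ xs) ≡ anyL (g ∘ toℕ) xs
  anyL-mapL [] = refl
  anyL-mapL (x ∷ xs) = cong (g (toℕ x) ∨_) (anyL-mapL xs)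

mapL-tab : ∀ n (g : ℕ → Bool) (h : Fin n → Bool) → (∀ v → g (toℕ v) ≡ h v) → mapL g (range n) ≡ tab h
mapL-tab n g h e = trans (mapL-range n g) (Listₚ.tabulate-cong e)

grid-rows : ∀ n g (M : Digraph n) → (∀ u v → g (toℕ u) (toℕ v) ≡ M u v) → grid (range n) g ≡ rows M
grid-rows n g M e = trans (mapL-range n (λ u → mapL (g u) (range n))) (Listₚ.tabulate-cong (λ u → mapL-tab n (g (toℕ u)) (M u) (e u)))

≡ᵇ-== : ∀ {n} (u v : Fin n) → (toℕ u ≡ᵇ toℕ v) ≡ (u == v)
≡ᵇ-== u v = T-ext (λ t → subst (λ w → T (u == w)) (toℕ-injective (≡ᵇ⇒≡ (toℕ u) (toℕ v) t)) (true→T (==-refl u)))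
  (λ t → subst (λ w → T (toℕ u ≡ᵇ toℕ w)) (==-true t) (≡ᵇ-refl (toℕ u)))

module _ {n : ℕ} (D : Digraph n) where

  private module C = Components D

  reachL-closure : reachL (rows D) (range n) ≡ rows C.R
  reachL-closure = trans (cong (foldr (roundL (range n)) (grid (range n) (λ u v → at (rows D) u v ∨ (u ≡ᵇ v)))) (range-toℕ n)) (rounds (allFin n))
    where
    rounds : ∀ (ws : List (Fin n)) → foldr (roundL (range n)) (grid (range n) (λ u v → at (rows D) u v ∨ (u ≡ᵇ v))) (mapL toℕ ws) ≡
      rows (foldr round (λ u v → D u v ∨ (u == v)) ws)
    rounds [] = grid-rows n (λ u v → at (rows D) u v ∨ (u ≡ᵇ v)) _ (λ u v → cong₂ _∨_ (at-rows D u v) (≡ᵇ-== u v))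
    rounds (w ∷ ws) = trans (cong (roundL (range n) (toℕ w)) (rounds ws)) (grid-rows n (λ u v → at (rows ρ) u v ∨ (at (rows ρ) u (toℕ w) ∧ at (rows ρ) (toℕ w) v)) (round w ρ)
      (λ u v → cong₂ _∨_ (at-rows ρ u v) (cong₂ _∧_ (at-rows ρ u w) (at-rows ρ w v))))
      where
      ρ : Digraph n
      ρ = foldr round (λ u v → D u v ∨ (u == v)) ws

  nonrootsL-ν : nonrootsL (rows C.R) (range n) ≡ tab C.ν
  nonrootsL-ν = mapL-tab n _ C.ν (λ u → anyL-range n _ (λ w → cong ((w ≺ u) ∧_) (cong₂ _∧_ (at-rows C.R w u) (at-rows C.R u w))))

  coverL-cover : ∀ a b → coverL (rows C.R) (tab C.ν) (range n) (toℕ a) (toℕ b) ≡ C.cover a b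
  coverL-cover a b = cong₂ _∧_ (cong₂ (λ x y → not x ∧ not y) (nth-tabulate false C.ν a) (nth-tabulate false C.ν b))
    (cong₂ (λ x y → not x ∧ y) (≡ᵇ-== a b) (cong₂ (λ x y → x ∧ not y) (at-rows C.R a b) (anyL-range n _ (λ c →
      cong₂ _∧_ (cong₂ (λ x y → not x ∧ not y) (nth-tabulate false C.ν c) (≡ᵇ-== c a))
        (cong₂ (λ x y → not x ∧ y) (≡ᵇ-== c b) (cong₂ _∧_ (at-rows C.R a c) (at-rows C.R c b)))))))

  coversL-covers : coversL (rows C.R) (tab C.ν) (range n) ≡ C.covers
  coversL-covers = trans (cong (sumL (λ a → trues (mapL (coverL (rows C.R) (tab C.ν) (range n) a) (range n)))) (range-toℕ n))
    (trans (sumL-map (λ a → trues (mapL (coverL (rows C.R) (tab C.ν) (range n) a) (range n))) toℕ (allFin n))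
      (trans (sumL-tabulate {n = n} (λ a → trues (mapL (coverL (rows C.R) (tab C.ν) (range n) (toℕ a)) (range n))) id)
        (sumF-cong {n} (λ a → trans (cong trues (mapL-tab n (coverL (rows C.R) (tab C.ν) (range n) (toℕ a)) (C.cover a) (coverL-cover a))) (trues-tab (C.cover a))))))

  prepareMEG-spec : ∀ b A B → Fn.sem prepareMEGF ((rows D , b , A , B) , tt) ≡
    (rows C.within , tab C.ν , limit (suc (n * n)) b ∸ C.covers , suc (n * n))
  prepareMEG-spec b A B = trans (cong (prepareMEG (rows D) b) (Listₚ.length-tabulate (λ u → tab (D u)))) (trans
    (cong (λ R → given R (nonrootsL R (range n))) reachL-closure) (trans (cong (given (rows C.R)) nonrootsL-ν)
      (cong₂ (λ E k → E , tab C.ν , limit (suc (n * n)) b ∸ k , suc (n * n))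
        (grid-rows n (λ u v → at (rows D) u v ∧ at (rows C.R) v u) C.within (λ u v → cong₂ _∧_ (at-rows D u v) (at-rows C.R v u))) coversL-covers)))
    where
    given : List (List Bool) → List Bool → El prepared
    given R ν = grid (range n) (λ u v → at (rows D) u v ∧ at R v u) , ν , limit (suc (n * n)) b ∸ coversL R ν (range n) , suc (n * n)

+-<⇒<-∸ : ∀ m k l → m + k < l → m < l ∸ k
+-<⇒<-∸ m k l h = m+n≤o⇒m≤o∸n (suc m) h

<-∸⇒+-< : ∀ m k l → m < l ∸ k → m + k < l
<-∸⇒+-< m zero l h = ≡≤ (cong suc (+-identityʳ m)) h
<-∸⇒+-< m (suc k) (suc l) h = s≤s (≡≤ (+-suc m k) (<-∸⇒+-< m k l h))

reduceMEG : ∀ I → Reduction false prepareMEGF (MEG I) (encodeDirected I) (directedWidth I)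
reduceMEG I = record
  { TD = decomposition ; matrix = digraph ; integer = signed budget
  ; d = C.within ; d⊆G = λ u v u≢v t → underlying-adj digraph u v u≢v (T∧₁ t) ; nonroot = C.ν
  ; t = limit cap (signed budget) ∸ C.covers ; cap = cap ; t≤cap = ≤-trans (m∸n≤m (limit cap (signed budget)) C.covers) (limit-≤ cap budget)
  ; encoded = enc-instance digraph budget decomposition ; w≡ = refl
  ; prepares = prepareMEG-spec digraph (signed budget) (rows (adj (TreeDecomposition.tree decomposition))) (rows (λ x → lookup (TreeDecomposition.bag decomposition x)))
  ; forwards = forwards ; backwards = backwards
  }
  where
  open DirectedInput I renaming (order to m)
  module C = Components digraph
  cap : ℕ
  cap = suc (m * m)
  forwards : MEG I → CoreYes false C.within C.ν (limit cap (signed budget) ∸ C.covers)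
  forwards (X , X⊆ , l , eq) = record
    { pick = Rs.part ; pick⊆ = Rs.part⊆ ; oriented = λ ()
    ; small = +-<⇒<-∸ _ C.covers _ (≤-trans (s≤s Rs.part-size) (limit-complete budget (s≤s (square-≤ X)) (subst (λ k → ℤ.+ k ℤ.≤ budget) (length-arcs X) l)))
    ; from-roots = λ v → C.rt v , C.rt-root v , Rs.inside (Rs.X-path (C.from-rt v)) (C.to-rt v)
    ; to-roots = λ v → C.rt v , C.rt-root v , Rs.inside (Rs.X-path (C.to-rt v)) (C.from-rt v) }
    where
    module Rs = C.Restrict X X⊆ eq
  backwards : CoreYes false C.within C.ν (limit cap (signed budget) ∸ C.covers) → MEG I
  backwards y = En.X , En.X⊆ , subst (λ k → ℤ.+ k ℤ.≤ budget) (sym (length-arcs En.X))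
      (limit-sound budget (≤-trans (s≤s En.X-size) (<-∸⇒+-< _ C.covers _ small))) , En.equivalent
    where
    open CoreYes y
    module En = C.Enlarge pick pick⊆ from-roots to-roots

corollary1 :
    MonteCarloSolvable SCSpS encodeDirected (λ i → 17 ^ directedWidth i)
  × MonteCarloSolvable MEG encodeDirected (λ i → 17 ^ directedWidth i)
  × MonteCarloSolvable 2-ECSS encodeUndirected (λ i → 17 ^ undirectedWidth i)
corollary1 = solvable false prepareF SCSpS encodeDirected directedWidth reduceSCSpS
  , solvable false prepareMEGF MEG encodeDirected directedWidth reduceMEG
  , solvable true prepareF 2-ECSS encodeUndirected undirectedWidth reduce2ECSS
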